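{- The scheduling problem $P \mid\mid \Sigma w_j C_j$ (minimizing the total weighted completion time of $n$ jobs on $m$ identical parallel machines, with $m$ part of the input) can be solved in time $O(2.755^n)$, where $n$ is the number of jobs.
   Context: Problem $P \mid\mid \Sigma w_j C_j$. Input: $n$ jobs, where job $j \in \{1,\dots,n\}$ has a processing time $p_j \in \mathbb{N}$ and a weight $w_j \in \mathbb{N}$; a number of machines $m \in \mathbb{N}$ with $m \ge 1$. Here $\mathbb{N}$ contains $0$. A schedule assigns each job to a machine and a starting time (at least $0$) such that no two jobs are processed at the same time by the same machine; once started, job $j$ runs for $p_j$ time units, and $C_j$ denotes its completion time. Task: compute the minimum of $\sum_{j=1}^n w_j C_j$ over all schedules of the $n$ jobs on the $m$ identical parallel machines. Computation model: unit-cost RAM with word size $\Theta(L)$ bits, where $L$ is the encoding length of the input, so arithmetic operations on integers with $O(L)$ bits take constant time. -}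

module Defs where

open import Data.Bool.Base using (if_then_else_)
open import Data.Fin.Base using (Fin)
open import Data.Integer.Base using (+_)
open import Data.List.Base using (List; []; _∷_; _++_; drop; head; map; tabulate)
open import Data.Maybe.Base using (Maybe; just; nothing; fromMaybe)
open import Data.Nat.Base as ℕ using (ℕ; zero; suc; _^_; _≡ᵇ_)
open import Data.Nat.ListAction using (sum)
open import Data.Nat.DivMod using (_%_)
open import Data.Nat.Logarithm using (⌊log₂_⌋)
open import Data.Nat.Properties using (m^n≢0)
open import Data.Product using (_×_; ∃-syntax)
open import Data.Rational.Base as ℚ using (ℚ; 0ℚ)
open import Data.Vec.Functional using (Vector)
open import Relation.Binary.PropositionalEquality using (_≡_; _≢_)
open import Relation.Nullary using (¬_)
import Algebra.Definitions.RawMonoid as RawMonoidDefs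

------------------------------------------------------------------------
-- The problem P || Σ wⱼCⱼ

record Instance : Set where
  field
    jobs        : ℕ
    machines    : ℕ
    machines≥1  : 1 ℕ.≤ machines
    processing  : Vector ℕ jobs
    weight      : Vector ℕ jobs

fromℕ : ℕ → ℚ
fromℕ a = + a ℚ./ 1

-- Time is rational: starting times are not assumed to be integral, although
-- the processing times are.
module _ (I : Instance) where
  open Instance I

  record Assignment : Set where
    field
      machine : Fin jobs → Fin machines
      start   : Fin jobs → ℚ

    completion : Fin jobs → ℚ
    completion j = start j ℚ.+ fromℕ (processing j)

    -- Half-open intervals, so that a job may start exactly when its
    -- predecessor on the machine completes.
    ProcessedAt : Fin jobs → ℚ → Set
    ProcessedAt j t = start j ℚ.≤ t × t ℚ.< completion j

    totalWeightedCompletion : ℚ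
    totalWeightedCompletion =
      RawMonoidDefs.sum ℚ.+-0-rawMonoid (λ j → fromℕ (weight j) ℚ.* completion j)

  record Schedule : Set where
    field
      assignment : Assignment
    open Assignment assignment public
    field
      start≥0    : ∀ j → 0ℚ ℚ.≤ start j
      no-overlap : ∀ {i j} → i ≢ j → machine i ≡ machine j →
                   ∀ t → ¬ (ProcessedAt i t × ProcessedAt j t)

  IsOptimalValue : ℕ → Set
  IsOptimalValue v =
    (∃[ σ ] Schedule.totalWeightedCompletion σ ≡ fromℕ v) ×
    (∀ σ → fromℕ v ℚ.≤ Schedule.totalWeightedCompletion σ)

  -- The input, as a sequence of numbers: n, m, p₁, …, pₙ, w₁, …, wₙ.
  encode : List ℕ
  encode = jobs ∷ machines ∷ tabulate processing ++ tabulate weight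

-- Number of binary digits; 0 has one digit, as ⌊log₂ 0 ⌋ = 0.
bits : ℕ → ℕ
bits a = suc ⌊log₂ a ⌋

encodingLength : Instance → ℕ
encodingLength I = sum (map bits (encode I))

------------------------------------------------------------------------
-- Unit-cost word RAM

Register Label : Set
Register = ℕ
Label    = ℕ

data Op : Set where
  add sub mul div : Op

data Instruction : Set where
  const    : Register → ℕ → Instruction
  arith    : Op → Register → Register → Register → Instruction
  load     : Register → Register → Instruction
  store    : Register → Register → Instruction
  jump     : Label → Instruction
  jumpZero : Register → Label → Instruction

-- A label is the position of an instruction, counted from 0. The machine halts
-- when the program counter leaves the program.
Program : Set
Program = List Instruction

-- A program mentions only finitely many registers. Memory can be accessed only
-- at an address held in a register.
record State : Set where
  constructor ⟨_,_,_⟩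
  field
    pc        : ℕ
    registers : ℕ → ℕ
    memory    : ℕ → ℕ

_[_≔_] : (ℕ → ℕ) → ℕ → ℕ → (ℕ → ℕ)
(f [ a ≔ v ]) b = if a ≡ᵇ b then v else f b

-- Subtraction is truncated at 0; division rounds down, and division by 0 gives 0.
⟦_⟧ : Op → ℕ → ℕ → ℕ
⟦ add ⟧ x y       = x ℕ.+ y
⟦ sub ⟧ x y       = x ℕ.∸ y
⟦ mul ⟧ x y       = x ℕ.* y
⟦ div ⟧ x zero    = 0
⟦ div ⟧ x (suc y) = x ℕ./ suc y

-- The parameter W is the word size in bits.
module _ (W : ℕ) where

  truncate : ℕ → ℕ
  truncate x = _%_ x (2 ^ W) {{m^n≢0 2 W}}

  execute : Instruction → State → State
  execute (const r x)     ⟨ pc , R , M ⟩ = ⟨ suc pc , R [ r ≔ truncate x ] , M ⟩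
  execute (arith o r a b) ⟨ pc , R , M ⟩ = ⟨ suc pc , R [ r ≔ truncate (⟦ o ⟧ (R a) (R b)) ] , M ⟩
  execute (load r a)      ⟨ pc , R , M ⟩ = ⟨ suc pc , R [ r ≔ M (R a) ] , M ⟩
  execute (store a r)     ⟨ pc , R , M ⟩ = ⟨ suc pc , R , M [ R a ≔ R r ] ⟩
  execute (jump l)        ⟨ pc , R , M ⟩ = ⟨ l , R , M ⟩
  execute (jumpZero r l)  ⟨ pc , R , M ⟩ = ⟨ (if R r ≡ᵇ 0 then l else suc pc) , R , M ⟩

  fetch : Program → State → Maybe Instruction
  fetch P s = head (drop (State.pc s) P)

  data _⊢_⇓[_]_ (P : Program) : State → ℕ → State → Set where
    halted : ∀ {s} → fetch P s ≡ nothing → P ⊢ s ⇓[ 0 ] s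
    next   : ∀ {s i t s′} → fetch P s ≡ just i →
             P ⊢ execute i s ⇓[ t ] s′ → P ⊢ s ⇓[ suc t ] s′

  initial : List ℕ → State
  initial xs = ⟨ 0 , (λ _ → 0) , (λ a → fromMaybe 0 (head (drop a xs))) ⟩

  -- The output is the content of register 0.
  OutputsAfter : Program → List ℕ → ℕ → ℕ → Set
  OutputsAfter P xs v t =
    ∃[ s ] (P ⊢ initial xs ⇓[ t ] s) × State.registers s 0 ≡ v

{-# OPTIONS --safe #-}
module Submission where

-- By Smith's rule the jobs of a machine may be processed by increasing p / w, so
-- a schedule is a partition of the jobs into m sets t, each with a cost depending
-- on t only. Cut the sorted jobs into f = ⌊n / 2⌋ early and l = n − f late ones.
-- A set with early part t₁ and late part t₂ costs
--   cost t₁ + p(t₁) w(t₂) + cost t₂.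
-- Machines are added one at a time. Fix the set u of early jobs to be scheduled
-- and the set x₂ of late jobs that the previous machines process. Each t₁ ⊆ u
-- then gives a line of slope p(t₁), and for each t₂ disjoint from x₂ the minimum
-- of these lines at w(t₂) is needed. With lines and queries sorted, the best line
-- is monotone in the query; handling the 2^b queries in blocks of about √2^b
-- takes O(2^|u| √2^b + 2^b) steps, where b = l − |x₂|. Summed over u and x₂ this
-- is O(3^f (1 + √2)^l + 2^f 3^l), and since 1 + √2 < 5/2 and
-- 3 · 5/2 < 2.755², this remains below 2.755^n after multiplication by n.
-- The algorithm is written in a while language, which is compiled to the RAM.

open import Data.Nat.Base using (ℕ; _*_; _^_; _≤_)
open import Data.Product using (_×_; Σ-syntax)
open import Defs

open import Data.Bool.Base using (Bool; true; false; if_then_else_; T; not; _∨_)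
open import Data.Empty using (⊥; ⊥-elim)
open import Data.Fin using (#_)
open import Data.Fin.Base using (Fin; zero; suc; toℕ; fromℕ<)
open import Data.Fin.Properties as Finₚ using (toℕ<n; toℕ-injective; toℕ-fromℕ<)
import Data.Integer.Base as ℤ
import Data.Integer.Properties as ℤ
open import Data.List.Base as List using (List; []; _∷_; _++_; length; head; drop; merge; tabulate; applyDownFrom)
open import Data.List.Properties using (length-++; length-map; length-tabulate; map-tabulate; ++-assoc; ∷-injective)
open import Data.List.Membership.Propositional using (_∈_)
open import Data.List.Membership.Propositional.Properties using (∈-map⁺; ∈-map⁻; ∈-++⁻; ∈-++⁺ˡ; ∈-++⁺ʳ)
open import Data.List.Relation.Binary.Permutation.Propositional as Perm
  using (_↭_; ↭-refl; ↭-sym; ↭-trans; ↭-prep; ↭-swap; ↭-reflexive; ↭⇒↭ₛ)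
open import Data.List.Relation.Binary.Permutation.Propositional.Properties
  using (merge-↭; ↭-length; ↭-map-inv; ∈-resp-↭; All-resp-↭) renaming (map⁺ to ↭-map⁺)
import Data.List.Relation.Binary.Permutation.Setoid.Properties as PermS
open import Data.List.Relation.Unary.All as LAll using (All; []; _∷_)
open import Data.List.Relation.Unary.All.Properties as LAllP using (++⁺)
open import Data.List.Relation.Unary.AllPairs as AllPairs using (AllPairs; []; _∷_)
import Data.List.Relation.Unary.AllPairs.Properties as APP
open import Data.List.Relation.Unary.Any using (here; there)
open import Data.Maybe.Base using (just; nothing; fromMaybe)
open import Data.Nat.Base hiding (ℕ; _*_; _^_; _≤_)
open import Data.Nat.DivMod using (m<n⇒m%n≡m; m/n≤m; [m+kn]%n≡m%n; m≡m%n+[m/n]*n; m%n<n)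
open import Data.Nat.ListAction using (sum)
open import Data.Nat.ListAction.Properties using (sum-++; sum-↭)
open import Data.Nat.Logarithm using (⌊log₂_⌋; ⌊log₂⌋-mono-≤; ⌊log₂[2^n]⌋≡n)
open import Data.Nat.Properties
open import Data.Nat.Tactic.RingSolver using (solve-∀)
open import Data.Product using (∃-syntax; ∃₂; _,_; proj₁; proj₂)
import Data.Rational.Base as ℚ
open ℚ using (ℚ; 0ℚ)
import Data.Rational.Properties as ℚ
import Data.Rational.Unnormalised.Base as ℚᵘ
import Data.Rational.Unnormalised.Properties as ℚᵘ
open import Data.Sum.Base as ⊎ using (_⊎_; inj₁; inj₂; [_,_]′)
open import Data.Unit.Base using (⊤; tt)
open import Data.Vec.Base as Vec using (Vec; []; _∷_; map; replicate; splitAt) renaming (_++_ to _⧺_)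
import Data.Vec.Relation.Unary.All as VAll
open VAll using ([]; _∷_) renaming (All to AllV)
open import Function.Base using (_∘_)
open import Relation.Binary.PropositionalEquality hiding (J; [_])
open import Relation.Nullary using (yes; no; Dec; does)
import Algebra.Definitions.RawMonoid as RawMonoidDefs

-- Adding a machine by trying every set together with every subset takes 3^n steps. The saving is
-- possible because `t₁` and `t₂` interact only through the product p(t₁) w(t₂). The square root
-- comes from scans that merely evaluate and compare lines: one long scan per block, and for each
-- query of the block a scan of the window between the best lines of two consecutive blocks. The
-- windows of all blocks together pass over the lines about once for each query of a single block.
-- For n = 2f the base is √(3 · 5/2) = √7.5 < 2.739; the gap to 2.755 pays for the up to n machines.
-- Their number may be exponential in the input length, but no more than n of them are useful, so
-- min(n, m) tables suffice. Schedules have rational starting times and may contain idle time.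
-- Instead of exchanging jobs, the lower bound estimates each completion time by the total length of
-- the jobs that the same machine has completed by then, and counts every pair of jobs on a machine
-- in its cheaper order. Smith's order attains the cheaper order for all pairs at once.

≡ᵇ-refl : ∀ a → (a ≡ᵇ a) ≡ true
≡ᵇ-refl zero    = refl
≡ᵇ-refl (suc a) = ≡ᵇ-refl a

≢⇒≡ᵇ : ∀ {a b} → a ≢ b → (a ≡ᵇ b) ≡ false
≢⇒≡ᵇ {a} {b} a≢b with a ≡ᵇ b in eq
... | true  = ⊥-elim (a≢b (≡ᵇ⇒≡ a b (subst T (sym eq) tt)))
... | false = refl

≔-same : ∀ f a v {b} → a ≡ b → (f [ a ≔ v ]) b ≡ v
≔-same f a v refl rewrite ≡ᵇ-refl a = refl

≔-other : ∀ f a v {b} → a ≢ b → (f [ a ≔ v ]) b ≡ f b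
≔-other f a v a≢b rewrite ≢⇒≡ᵇ a≢b = refl

-- A while language and its compilation to the RAM

Array : Set
Array = Fin 16

data Expr : Set where
  var  : ℕ → Expr
  lit  : ℕ → Expr
  op   : Op → Expr → Expr → Expr
  _at_ : Array → Expr → Expr

infixl 6 _⊕_ _⊖_
infixl 7 _⊗_ _⊘_
infix  8 _at_

pattern _⊕_ a b = op add a b
pattern _⊖_ a b = op sub a b
pattern _⊗_ a b = op mul a b
pattern _⊘_ a b = op div a b

infix  4 _:=_ _⟦_⟧:=_
infixr 3 _⨾_

data Cmd : Set where
  skip    : Cmd
  _:=_    : ℕ → Expr → Cmd
  _⟦_⟧:=_ : Array → Expr → Expr → Cmd
  read    : ℕ → Expr → Cmd
  _⨾_     : Cmd → Cmd → Cmd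
  cond    : Expr → Cmd → Cmd → Cmd
  while   : Expr → Cmd → Cmd

record Store : Set where
  constructor store
  field
    reg : ℕ → ℕ
    arr : Array → ℕ → ℕ
open Store public

setReg : Store → ℕ → ℕ → Store
setReg s x v = store (reg s [ x ≔ v ]) (arr s)

setArr : Store → Array → ℕ → ℕ → Store
setArr s A i v =
  store (reg s) (λ B → if toℕ A ≡ᵇ toℕ B then arr s B [ i ≔ v ] else arr s B)

eval : Expr → Store → ℕ
eval (var x)    s = reg s x
eval (lit c)    s = c
eval (op o a b) s = ⟦ o ⟧ (eval a s) (eval b s)
eval (A at e)   s = arr s A (eval e s)

-- Register 0 holds the address of the arrays; odd registers are variables,
-- the other even ones form the evaluation stack.
varReg stackReg : ℕ → Register
varReg x   = suc (x * 2)
stackReg d = suc (suc (d * 2))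

addressCode : Array → ℕ → List Instruction
addressCode A d =
  const (stackReg (suc d)) 16 ∷
  arith mul (stackReg d) (stackReg d) (stackReg (suc d)) ∷
  arith add (stackReg d) (stackReg d) 0 ∷
  const (stackReg (suc d)) (toℕ A) ∷
  arith add (stackReg d) (stackReg d) (stackReg (suc d)) ∷ []

-- The value is left in stack slot `d`; slots below `d` hold pending operands and must survive. The
-- RAM has no move between registers, so a variable is copied by adding 0.
compileExpr : Expr → ℕ → List Instruction
compileExpr (var x) d    = const (stackReg d) 0 ∷ arith add (stackReg d) (varReg x) (stackReg d) ∷ []
compileExpr (lit c) d    = const (stackReg d) c ∷ []
compileExpr (op o a b) d =
  compileExpr a d ++ compileExpr b (suc d) ++ arith o (stackReg d) (stackReg d) (stackReg (suc d)) ∷ []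
compileExpr (A at e) d   = compileExpr e d ++ addressCode A d ++ load (stackReg d) (stackReg d) ∷ []

moveCode : Register → List Instruction
moveCode r = const (stackReg 1) 0 ∷ arith add r (stackReg 0) (stackReg 1) ∷ []

-- Jump targets depend on the length of code that is still to be generated. This length does not
-- depend on the position of the code and is therefore computed separately.
size : Cmd → ℕ
size skip            = 0
size (x := e)        = length (compileExpr e 0 ++ moveCode (varReg x))
size (A ⟦ i ⟧:= e)   = length (compileExpr e 0 ++ compileExpr i 1 ++ addressCode A 1 ++ store (stackReg 1) (stackReg 0) ∷ [])
size (read x e)      = length (compileExpr e 0 ++ load (varReg x) (stackReg 0) ∷ [])
size (c ⨾ c′)        = size c + size c′
size (cond e c c′)   = length (compileExpr e 0) + suc (size c + suc (size c′))
size (while e c)     = length (compileExpr e 0) + suc (size c + 1)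

compile : ℕ → Cmd → List Instruction
compile pc skip          = []
compile pc (x := e)      = compileExpr e 0 ++ moveCode (varReg x)
compile pc (A ⟦ i ⟧:= e) = compileExpr e 0 ++ compileExpr i 1 ++ addressCode A 1 ++ store (stackReg 1) (stackReg 0) ∷ []
compile pc (read x e)    = compileExpr e 0 ++ load (varReg x) (stackReg 0) ∷ []
compile pc (c ⨾ c′)      = compile pc c ++ compile (pc + size c) c′
compile pc (cond e c c′) =
  compileExpr e 0 ++ jumpZero (stackReg 0) (suc (suc pc₁ + size c)) ∷
  compile (suc pc₁) c ++ jump (suc (suc pc₁ + size c) + size c′) ∷
  compile (suc (suc pc₁ + size c)) c′
  where pc₁ = pc + length (compileExpr e 0)
compile pc (while e c) =
  compileExpr e 0 ++ jumpZero (stackReg 0) (suc (suc pc₁ + size c)) ∷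
  compile (suc pc₁) c ++ jump pc ∷ []
  where pc₁ = pc + length (compileExpr e 0)

length-compile : ∀ pc c → length (compile pc c) ≡ size c
length-compile pc skip = refl
length-compile pc (x := e) = refl
length-compile pc (A ⟦ i ⟧:= e) = refl
length-compile pc (read x e) = refl
length-compile pc (c ⨾ c′)
  rewrite length-++ (compile pc c) {compile (pc + size c) c′}
        | length-compile pc c | length-compile (pc + size c) c′ = refl
length-compile pc (cond e c c′)
  rewrite length-++ (compileExpr e 0) {jumpZero (stackReg 0) (suc (suc (pc + length (compileExpr e 0)) + size c)) ∷
            compile (suc (pc + length (compileExpr e 0))) c ++
            jump (suc (suc (pc + length (compileExpr e 0)) + size c) + size c′) ∷
            compile (suc (suc (pc + length (compileExpr e 0)) + size c)) c′}
        | length-++ (compile (suc (pc + length (compileExpr e 0))) c)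
            {jump (suc (suc (pc + length (compileExpr e 0)) + size c) + size c′) ∷
            compile (suc (suc (pc + length (compileExpr e 0)) + size c)) c′}
        | length-compile (suc (pc + length (compileExpr e 0))) c
        | length-compile (suc (suc (pc + length (compileExpr e 0)) + size c)) c′ = refl
length-compile pc (while e c)
  rewrite length-++ (compileExpr e 0) {jumpZero (stackReg 0) (suc (suc (pc + length (compileExpr e 0)) + size c)) ∷
            compile (suc (pc + length (compileExpr e 0))) c ++ jump pc ∷ []}
        | length-++ (compile (suc (pc + length (compileExpr e 0))) c) {jump pc ∷ []}
        | length-compile (suc (pc + length (compileExpr e 0))) c = refl

-- If all variables and array entries are at most V ≥ 16, then all
-- values arising in the evaluation of e are at most V ^ degree e.
degree : Expr → ℕ
degree (var x)    = 1
degree (lit c)    = suc c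
degree (op o a b) = degree a + degree b
degree (A at e)   = 3 + degree e

degreeᶜ : Cmd → ℕ
degreeᶜ skip          = 1
degreeᶜ (x := e)      = degree e
degreeᶜ (A ⟦ i ⟧:= e) = degree e ⊔ degree (A at i)
degreeᶜ (read x e)    = degree e
degreeᶜ (c ⨾ c′)      = degreeᶜ c ⊔ degreeᶜ c′
degreeᶜ (cond e c c′) = degree e ⊔ (degreeᶜ c ⊔ degreeᶜ c′)
degreeᶜ (while e c)   = degree e ⊔ degreeᶜ c

data Straight : Instruction → Set where
  const : ∀ {r c} → Straight (const r c)
  arith : ∀ {o r a b} → Straight (arith o r a b)
  load  : ∀ {r a} → Straight (load r a)
  store : ∀ {a r} → Straight (store a r)

straight-compileExpr : ∀ e d → All Straight (compileExpr e d)
straight-compileExpr (var x) d = const ∷ arith ∷ []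
straight-compileExpr (lit c) d = const ∷ []
straight-compileExpr (op o a b) d =
  ++⁺ (straight-compileExpr a d) (++⁺ (straight-compileExpr b (suc d)) (arith ∷ []))
straight-compileExpr (A at e) d =
  ++⁺ (straight-compileExpr e d) (const ∷ arith ∷ arith ∷ const ∷ arith ∷ load ∷ [])

stackReg≢varReg : ∀ d x → varReg x ≢ stackReg d
stackReg≢varReg zero    zero    ()
stackReg≢varReg zero    (suc x) ()
stackReg≢varReg (suc d) zero    ()
stackReg≢varReg (suc d) (suc x) eq = stackReg≢varReg d x (suc-injective (suc-injective eq))

stackReg-injective : ∀ {d e} → stackReg d ≡ stackReg e → d ≡ e
stackReg-injective {d} {e} eq = *-cancelʳ-≡ d e 2 (suc-injective (suc-injective eq))

varReg-injective : ∀ {d e} → varReg d ≡ varReg e → d ≡ e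
varReg-injective {d} {e} eq = *-cancelʳ-≡ d e 2 (suc-injective eq)

-- Semantics of the while language, with ticks

module Machine (B V : ℕ) (input : ℕ → ℕ) where

  -- A tick is charged for each elementary command and each test; `simulate` turns ticks into
  -- instructions at a constant rate. The premises `≤ V` keep all stored values small enough for
  -- truncation to have no effect.
  data Exec : Cmd → Store → ℕ → Store → Set where
    skip   : ∀ {s} → Exec skip s 0 s
    assign : ∀ {x e s} → eval e s ≤ V → Exec (x := e) s 1 (setReg s x (eval e s))
    put    : ∀ {A i e s} → eval e s ≤ V → Exec (A ⟦ i ⟧:= e) s 1 (setArr s A (eval i s) (eval e s))
    read   : ∀ {x e s} → eval e s < B → Exec (read x e) s 1 (setReg s x (input (eval e s)))
    seq    : ∀ {c c′ s d s₁ d′ s₂} → Exec c s d s₁ → Exec c′ s₁ d′ s₂ → Exec (c ⨾ c′) s (d + d′) s₂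
    cond≢0 : ∀ {e c c′ s d s₁} → eval e s ≢ 0 → Exec c s d s₁ → Exec (cond e c c′) s (suc d) s₁
    cond≡0 : ∀ {e c c′ s d s₁} → eval e s ≡ 0 → Exec c′ s d s₁ → Exec (cond e c c′) s (suc d) s₁
    loop   : ∀ {e c s d s₁ d′ s₂} → eval e s ≢ 0 → Exec c s d s₁ → Exec (while e c) s₁ d′ s₂ →
             Exec (while e c) s (suc (d + d′)) s₂
    stop   : ∀ {e c s} → eval e s ≡ 0 → Exec (while e c) s 1 s

  record Bounded (s : Store) : Set where
    constructor bounded
    field
      reg≤ : ∀ x → reg s x ≤ V
      arr≤ : ∀ A i → arr s A i ≤ V
  open Bounded

  ≔-≤ : ∀ f a {v} → (∀ b → f b ≤ V) → v ≤ V → ∀ b → (f [ a ≔ v ]) b ≤ V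
  ≔-≤ f a f≤ v≤ b with a ≡ᵇ b
  ... | true  = v≤
  ... | false = f≤ b

  bounded-setReg : ∀ {s} x {v} → Bounded s → v ≤ V → Bounded (setReg s x v)
  bounded-setReg {s} x b v≤ = bounded (≔-≤ (reg s) x (reg≤ b) v≤) (arr≤ b)

  bounded-setArr : ∀ {s} A i {v} → Bounded s → v ≤ V → Bounded (setArr s A i v)
  bounded-setArr {s} A i {v} b v≤ = bounded (reg≤ b) arr≤′
    where
    arr≤′ : ∀ C j → arr (setArr s A i v) C j ≤ V
    arr≤′ C j with toℕ A ≡ᵇ toℕ C
    ... | true  = ≔-≤ (arr s C) i (arr≤ b C) v≤ j
    ... | false = arr≤ b C j

-- Correctness of the compiler

module Correctness (W B V : ℕ) (input : ℕ → ℕ) (V≥16 : 16 ≤ V) (B≤V : B ≤ V) (input≤V : ∀ a → input a ≤ V) where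
  open Machine B V input
  open Bounded

  Regs Mem : Set
  Regs = ℕ → ℕ
  Mem  = ℕ → ℕ

  -- The sixteen arrays are interleaved above the input, which occupies the cells below `B`. So no
  -- array needs a length fixed in advance.
  address : Array → ℕ → ℕ
  address A i = i * 16 + B + toℕ A

  -- After `B` is cancelled, the array is the residue modulo 16 and the index is the quotient.
  address-injective : ∀ {A A′ i i′} → address A i ≡ address A′ i′ → A ≡ A′ × i ≡ i′
  address-injective {A} {A′} {i} {i′} eq = toℕ-injective A≡ , *-cancelʳ-≡ i i′ 16 i≡
    where
    move : ∀ a x b → a + x + b ≡ x + (b + a)
    move = solve-∀
    eq′ : toℕ A + i * 16 ≡ toℕ A′ + i′ * 16
    eq′ = +-cancelˡ-≡ B _ _ (trans (sym (move (i * 16) B (toℕ A))) (trans eq (move (i′ * 16) B (toℕ A′))))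
    A≡ : toℕ A ≡ toℕ A′
    A≡ = trans (sym (trans ([m+kn]%n≡m%n (toℕ A) i 16) (m<n⇒m%n≡m (toℕ<n A))))
         (trans (cong (_% 16) eq′) (trans ([m+kn]%n≡m%n (toℕ A′) i′ 16) (m<n⇒m%n≡m (toℕ<n A′))))
    i≡ : i * 16 ≡ i′ * 16
    i≡ = +-cancelˡ-≡ (toℕ A) _ _ (trans eq′ (cong (_+ i′ * 16) (sym A≡)))

  address≥ : ∀ A i → B ≤ address A i
  address≥ A i = ≤-trans (m≤n+m B (i * 16)) (m≤m+n _ (toℕ A))

  record Represents (R : Regs) (M : Mem) (s : Store) : Set where
    constructor represents
    field
      base≡  : R 0 ≡ B
      vars≡  : ∀ x → R (varReg x) ≡ reg s x
      arr≡   : ∀ A i → M (address A i) ≡ arr s A i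
      input≡ : ∀ a → a < B → M a ≡ input a
  open Represents

  -- The slots from `d` on are scratch space for an evaluation at depth `d`; every other register
  -- has to survive.
  record Agree (d : ℕ) (R R′ : Regs) : Set where
    constructor agree
    field
      agrees : ∀ r → (∀ e → d ≤ e → r ≢ stackReg e) → R′ r ≡ R r
  open Agree

  represents-agree : ∀ {d R R′ M s} → Represents R M s → Agree d R R′ → Represents R′ M s
  represents-agree rep ag = represents
    (trans (agrees ag 0 (λ _ _ ())) (base≡ rep))
    (λ x → trans (agrees ag (varReg x) (λ e _ → stackReg≢varReg e x)) (vars≡ rep x))
    (arr≡ rep) (input≡ rep)

  agree-trans : ∀ {d e R R′ R″} → d ≤ e → Agree d R R′ → Agree e R′ R″ → Agree d R R″
  agree-trans d≤e a b = agree λ r h → trans (agrees b r (λ k e≤k → h k (≤-trans d≤e e≤k))) (agrees a r h)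

  agree-set : ∀ {d} e R v → d ≤ e → Agree d R (R [ stackReg e ≔ v ])
  agree-set e R v d≤e = agree λ r h → ≔-other R (stackReg e) v (λ eq → h e d≤e (sym eq))

  step : Instruction → Regs × Mem → Regs × Mem
  step i (R , M) = State.registers s′ , State.memory s′
    where s′ = execute W i ⟨ 0 , R , M ⟩

  line : List Instruction → Regs × Mem → Regs × Mem
  line []       s = s
  line (i ∷ is) s = line is (step i s)

  line-++ : ∀ xs ys s → line (xs ++ ys) s ≡ line ys (line xs s)
  line-++ []       ys s = refl
  line-++ (x ∷ xs) ys s = line-++ xs ys (step x s)

  truncate≡ : ∀ {x} → x < 2 ^ W → truncate W x ≡ x
  truncate≡ x< = m<n⇒m%n≡m {{m^n≢0 2 W}} x<

  instance
    V≢0 : NonZero V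
    V≢0 = >-nonZero (≤-trans (s≤s z≤n) V≥16)

  degree≥1 : ∀ e → 1 ≤ degree e
  degree≥1 (var x)    = s≤s z≤n
  degree≥1 (lit c)    = s≤s z≤n
  degree≥1 (op o a b) = ≤-trans (degree≥1 a) (m≤m+n _ _)
  degree≥1 (A at e)   = s≤s z≤n

  V≤V^ : ∀ a → 1 ≤ a → V ≤ V ^ a
  V≤V^ a 1≤a = subst (_≤ V ^ a) (^-identityʳ V) (^-monoʳ-≤ V 1≤a)

  sum≤product : ∀ {a b} → 2 ≤ a → 2 ≤ b → a + b ≤ a * b
  sum≤product {suc (suc a)} {suc (suc b)} _ _ = subst (suc (suc a) + suc (suc b) ≤_) (eq a b) (m≤m+n _ _)
    where
    eq : ∀ a b → (2 + a) + (2 + b) + (a * b + a + b) ≡ (2 + a) * (2 + b)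
    eq = solve-∀
  sum≤product {suc zero} (s≤s ())
  sum≤product {suc (suc a)} {suc zero} _ (s≤s ())

  sum≤V^ : ∀ {x y} a b → 1 ≤ a → 1 ≤ b → x ≤ V ^ a → y ≤ V ^ b → x + y ≤ V ^ (a + b)
  sum≤V^ {x} {y} a b 1≤a 1≤b x≤ y≤ = begin
    x + y         ≤⟨ +-mono-≤ x≤ y≤ ⟩
    V ^ a + V ^ b ≤⟨ sum≤product (2≤ 1≤a) (2≤ 1≤b) ⟩
    V ^ a * V ^ b ≡⟨ ^-distribˡ-+-* V a b ⟨
    V ^ (a + b)   ∎
    where
    open ≤-Reasoning
    2≤ : ∀ {c} → 1 ≤ c → 2 ≤ V ^ c
    2≤ {c} 1≤c = ≤-trans (≤-trans (s≤s (s≤s z≤n)) V≥16) (V≤V^ c 1≤c)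

  -- A sum is estimated by a product, as both bounds are at least 2. Thus degrees add up for every
  -- operation, and one exponent serves the whole expression.
  op≤ : ∀ o {x y a b} → 1 ≤ a → 1 ≤ b → x ≤ V ^ a → y ≤ V ^ b → ⟦ o ⟧ x y ≤ V ^ (a + b)
  op≤ add {a = a} {b} = sum≤V^ a b
  op≤ sub {x} {y} {a} {b} _ _ x≤ _ = ≤-trans (m∸n≤m x y) (≤-trans x≤ (^-monoʳ-≤ V (m≤m+n a b)))
  op≤ mul {a = a} {b} _ _ x≤ y≤ = ≤-trans (*-mono-≤ x≤ y≤) (≤-reflexive (sym (^-distribˡ-+-* V a b)))
  op≤ div {x} {zero} _ _ x≤ _ = z≤n
  op≤ div {x} {suc y} {a} {b} _ _ x≤ _ = ≤-trans (m/n≤m x (suc y)) (≤-trans x≤ (^-monoʳ-≤ V (m≤m+n a b)))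

  eval≤ : ∀ {s} → Bounded s → ∀ e → eval e s ≤ V ^ degree e
  eval≤ b (var x)    = ≤-trans (reg≤ b x) (≤-reflexive (sym (^-identityʳ V)))
  -- A literal satisfies `c < 2 ^ c ≤ V ^ c`; its degree is `suc c` so that degrees are always
  -- positive.
  eval≤ b (lit c)    = ≤-trans (<⇒≤ (n<2^n c)) (≤-trans (^-monoˡ-≤ c (≤-trans (s≤s (s≤s z≤n)) V≥16)) (^-monoʳ-≤ V (n≤1+n c)))
    where
    n<2^n : ∀ n → n < 2 ^ n
    n<2^n zero    = s≤s z≤n
    n<2^n (suc n) = begin-strict
      suc n           <⟨ s≤s (n<2^n n) ⟩
      suc (2 ^ n)     ≤⟨ +-monoˡ-≤ (2 ^ n) (>-nonZero⁻¹ (2 ^ n) {{m^n≢0 2 n}}) ⟩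
      2 ^ n + 2 ^ n   ≡⟨ cong (2 ^ n +_) (+-identityʳ _) ⟨
      2 ^ suc n       ∎
      where open ≤-Reasoning
  eval≤ b (op o x y) = op≤ o (degree≥1 x) (degree≥1 y) (eval≤ b x) (eval≤ b y)
  eval≤ b (A at e)   = ≤-trans (arr≤ b A _) (V≤V^ (degree (A at e)) (s≤s z≤n))

  -- The three extra degrees are for the factor 16, the offset `B` and the number of the array. The
  -- intermediate results are included, since each of them is truncated.
  address≤ : ∀ {i a} → 1 ≤ a → i ≤ V ^ a → ∀ A →
    i * 16 ≤ V ^ (3 + a) × i * 16 + B ≤ V ^ (3 + a) × address A i ≤ V ^ (3 + a)
  address≤ {i} {a} 1≤a i≤ A =
    ≤-trans p₁ (^-monoʳ-≤ V (m≤n+m (1 + a) 2)) ,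
    ≤-trans p₂ (^-monoʳ-≤ V (m≤n+m (2 + a) 1)) ,
    subst (address A i ≤_) (cong (V ^_) (+-comm (2 + a) 1)) p₃
    where
    V¹ : ∀ {x} → x ≤ V → x ≤ V ^ 1
    V¹ x≤ = ≤-trans x≤ (≤-reflexive (sym (^-identityʳ V)))
    p₁ : i * 16 ≤ V ^ (1 + a)
    p₁ = ≤-trans (*-mono-≤ i≤ V≥16) (≤-reflexive (*-comm (V ^ a) V))
    p₂ : i * 16 + B ≤ V ^ (2 + a)
    p₂ = subst (i * 16 + B ≤_) (cong (V ^_) (+-comm (1 + a) 1)) (sum≤V^ (1 + a) 1 (s≤s z≤n) (s≤s z≤n) p₁ (V¹ B≤V))
    p₃ : address A i ≤ V ^ ((2 + a) + 1)
    p₃ = sum≤V^ (2 + a) 1 (s≤s z≤n) (s≤s z≤n) p₂ (V¹ (≤-trans (<⇒≤ (toℕ<n A)) V≥16))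

  record Fits (k : ℕ) : Set where
    constructor fits
    field
      V^<2^W : V ^ k < 2 ^ W
  open Fits

  fits-≤ : ∀ {a b} → a ≤ b → Fits b → Fits a
  fits-≤ a≤b f = fits (≤-<-trans (^-monoʳ-≤ V a≤b) (V^<2^W f))

  truncate-eval : ∀ {s} → Bounded s → ∀ e → Fits (degree e) → truncate W (eval e s) ≡ eval e s
  truncate-eval b e fit = truncate≡ (≤-<-trans (eval≤ b e) (V^<2^W fit))

  truncate-0 : ∀ {k} → Fits k → truncate W 0 ≡ 0
  truncate-0 fit = truncate≡ (≤-<-trans z≤n (V^<2^W fit))

  line-address : ∀ A d R M v rest → 1 ≤ degree rest → v ≤ V ^ degree rest → Fits (3 + degree rest) →
    R 0 ≡ B → R (stackReg d) ≡ v →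
    Σ[ R′ ∈ Regs ] line (addressCode A d) (R , M) ≡ (R′ , M) × R′ (stackReg d) ≡ address A v × Agree d R R′
  line-address A d R M v rest 1≤ v≤ fit b≡ v≡ = R₅ , refl , r₅ ,
    agree-trans ≤-refl (agree-trans ≤-refl (agree-trans ≤-refl (agree-trans ≤-refl
      (agree-set (suc d) R v₁ (n≤1+n d)) (agree-set d R₁ v₂ ≤-refl)) (agree-set d R₂ v₃ ≤-refl))
      (agree-set (suc d) R₃ v₄ (n≤1+n d))) (agree-set d R₄ v₅ ≤-refl)
    where
    s s′ : ℕ
    s  = stackReg d
    s′ = stackReg (suc d)
    v₁ v₂ v₃ v₄ v₅ : ℕ
    R₁ R₂ R₃ R₄ R₅ : Regs
    v₁ = truncate W 16
    R₁ = R [ s′ ≔ v₁ ]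
    v₂ = truncate W (R₁ s * R₁ s′)
    R₂ = R₁ [ s ≔ v₂ ]
    v₃ = truncate W (R₂ s + R₂ 0)
    R₃ = R₂ [ s ≔ v₃ ]
    v₄ = truncate W (toℕ A)
    R₄ = R₃ [ s′ ≔ v₄ ]
    v₅ = truncate W (R₄ s + R₄ s′)
    R₅ = R₄ [ s ≔ v₅ ]
    bs = address≤ 1≤ v≤ A
    s′≢s : s′ ≢ s
    s′≢s eq = 1+n≢n {d} (stackReg-injective {suc d} {d} eq)
    small : ∀ {x} → x ≤ 16 → truncate W x ≡ x
    small x≤ = truncate≡ (≤-<-trans x≤ (≤-<-trans V≥16 (≤-<-trans (V≤V^ (3 + degree rest) (s≤s z≤n)) (V^<2^W fit))))
    fit′ : ∀ {x} → x ≤ V ^ (3 + degree rest) → truncate W x ≡ x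
    fit′ x≤ = truncate≡ (≤-<-trans x≤ (V^<2^W fit))
    r₂ : R₂ s ≡ v * 16
    r₂ = trans (≔-same R₁ s v₂ refl) (trans (cong (truncate W)
           (cong₂ _*_ (trans (≔-other R s′ v₁ s′≢s) v≡) (trans (≔-same R s′ v₁ refl) (small ≤-refl)))) (fit′ (proj₁ bs)))
    r₃ : R₃ s ≡ v * 16 + B
    r₃ = trans (≔-same R₂ s v₃ refl) (trans (cong (truncate W) (cong₂ _+_ r₂
           (trans (≔-other R₁ s v₂ {0} λ ()) (trans (≔-other R s′ v₁ {0} λ ()) b≡)))) (fit′ (proj₁ (proj₂ bs))))
    r₅ : R₅ s ≡ address A v
    r₅ = trans (≔-same R₄ s v₅ refl) (trans (cong (truncate W) (cong₂ _+_ (trans (≔-other R₃ s′ v₄ s′≢s) r₃)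
           (trans (≔-same R₃ s′ v₄ refl) (small (<⇒≤ (toℕ<n A)))))) (fit′ (proj₂ (proj₂ bs))))

  line-expr : ∀ e d {R M s} → Bounded s → Represents R M s → Fits (degree e) →
    Σ[ R′ ∈ Regs ] line (compileExpr e d) (R , M) ≡ (R′ , M) × R′ (stackReg d) ≡ eval e s × Agree d R R′
  line-expr (var x) d {R} {M} {s} b rep fit =
    R₂ , refl , trans (≔-same R₁ sd v₂ refl) (trans (cong (truncate W) (trans (cong₂ _+_
      (trans (≔-other R sd v₁ (λ eq → stackReg≢varReg d x (sym eq))) (vars≡ rep x))
      (trans (≔-same R sd v₁ refl) (truncate-0 fit))) (+-identityʳ _)))
      (truncate-eval b (var x) fit)) ,
    agree-trans ≤-refl (agree-set d R v₁ ≤-refl) (agree-set d R₁ v₂ ≤-refl)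
    where
    sd = stackReg d
    v₁ = truncate W 0
    R₁ = R [ sd ≔ v₁ ]
    v₂ = truncate W (R₁ (varReg x) + R₁ sd)
    R₂ = R₁ [ sd ≔ v₂ ]
  line-expr (lit c) d {R} {M} {s} b rep fit =
    R [ stackReg d ≔ truncate W c ] , refl ,
    trans (≔-same R (stackReg d) _ refl) (truncate-eval b (lit c) fit) , agree-set d R (truncate W c) ≤-refl
  line-expr (op o x y) d {R} {M} {s} b rep fit
    with line-expr x d b rep (fits-≤ (m≤m+n _ _) fit)
  ... | R₁ , l₁ , v₁ , a₁
    with line-expr y (suc d) b (represents-agree rep a₁) (fits-≤ (m≤n+m _ (degree x)) fit)
  ... | R₂ , l₂ , v₂ , a₂ =
    R₂ [ stackReg d ≔ truncate W v ] ,
    trans (line-++ (compileExpr x d) (compileExpr y (suc d) ++ last) (R , M))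
      (trans (cong (line (compileExpr y (suc d) ++ last)) l₁)
          (trans (line-++ (compileExpr y (suc d)) last (R₁ , M)) (cong (line last) l₂))) ,
    trans (≔-same R₂ (stackReg d) (truncate W v) refl) (trans (cong (truncate W) (cong₂ ⟦ o ⟧
      -- The first operand waits in slot `d`, outside the scratch space of the second one, which
      -- starts at `suc d`.
      (trans (agrees a₂ (stackReg d) (λ e d<e eq → <⇒≢ d<e (stackReg-injective eq))) v₁) v₂))
      (truncate-eval b (op o x y) fit)) ,
    agree-trans ≤-refl (agree-trans (n≤1+n d) a₁ a₂) (agree-set d R₂ (truncate W v) ≤-refl)
    where
    last = arith o (stackReg d) (stackReg d) (stackReg (suc d)) ∷ []
    v    = ⟦ o ⟧ (R₂ (stackReg d)) (R₂ (stackReg (suc d)))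
  line-expr (A at e) d {R} {M} {s} b rep fit
    with line-expr e d b rep (fits-≤ (m≤n+m _ 3) fit)
  ... | R₁ , l₁ , v₁ , a₁
    with line-address A d R₁ M (eval e s) e (degree≥1 e) (eval≤ b e) fit (base≡ (represents-agree rep a₁)) v₁
  ... | R₂ , l₂ , v₂ , a₂ =
    R₂ [ stackReg d ≔ M (R₂ (stackReg d)) ] ,
    trans (line-++ (compileExpr e d) (addressCode A d ++ last) (R , M))
      (trans (cong (line (addressCode A d ++ last)) l₁)
          (trans (line-++ (addressCode A d) last (R₁ , M)) (cong (line last) l₂))) ,
    trans (≔-same R₂ (stackReg d) _ refl) (trans (cong M v₂) (arr≡ rep A (eval e s))) ,
    agree-trans ≤-refl (agree-trans ≤-refl a₁ a₂) (agree-set d R₂ (M (R₂ (stackReg d))) ≤-refl)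
    where
    last = load (stackReg d) (stackReg d) ∷ []

  module Simulation (Pg : Program) where

    infix 4 _⟶⟨_⟩_

    record _⟶⟨_⟩_ (s : State) (b : ℕ) (s′ : State) : Set where
      constructor reach
      field
        time   : ℕ
        time≤  : time ≤ b
        extend : ∀ {t s″} → _⊢_⇓[_]_ W Pg s′ t s″ → _⊢_⇓[_]_ W Pg s (time + t) s″

    reach-refl : ∀ {s} → s ⟶⟨ 0 ⟩ s
    reach-refl = reach 0 z≤n (λ r → r)

    reach-trans : ∀ {s s′ s″ a b} → s ⟶⟨ a ⟩ s′ → s′ ⟶⟨ b ⟩ s″ → s ⟶⟨ a + b ⟩ s″
    reach-trans {s} (reach t t≤ f) (reach t′ t′≤ g) = reach (t + t′) (+-mono-≤ t≤ t′≤)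
      λ {u} {s‴} r → subst (λ x → _⊢_⇓[_]_ W Pg s x s‴) (sym (+-assoc t t′ u)) (f (g r))

    reach-≤ : ∀ {s s′ a b} → a ≤ b → s ⟶⟨ a ⟩ s′ → s ⟶⟨ b ⟩ s′
    reach-≤ a≤b (reach t t≤ f) = reach t (≤-trans t≤ a≤b) f

    reach-pc : ∀ {s a p q R M} → p ≡ q → s ⟶⟨ a ⟩ ⟨ p , R , M ⟩ → s ⟶⟨ a ⟩ ⟨ q , R , M ⟩
    reach-pc refl r = r

    reach-next : ∀ {s i} → fetch W Pg s ≡ just i → s ⟶⟨ 1 ⟩ execute W i s
    reach-next eq = reach 1 ≤-refl (next eq)

    At : ℕ → List Instruction → Set
    At pc []       = ⊤
    At pc (i ∷ is) = head (drop pc Pg) ≡ just i × At (suc pc) is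

    at-++ : ∀ {pc} xs {ys} → At pc (xs ++ ys) → At pc xs × At (pc + length xs) ys
    at-++ {pc} [] {ys} h = tt , subst (λ p → At p ys) (sym (+-identityʳ pc)) h
    at-++ {pc} (x ∷ xs) {ys} (h , hs) with at-++ xs hs
    ... | p , q = (h , p) , subst (λ p → At p ys) (sym (+-suc pc (length xs))) q

    at-≡ : ∀ {p q xs} → p ≡ q → At p xs → At q xs
    at-≡ refl h = h

    reach-line : ∀ {pc xs R M R′ M′} → At pc xs → All Straight xs → line xs (R , M) ≡ (R′ , M′) →
      ⟨ pc , R , M ⟩ ⟶⟨ length xs ⟩ ⟨ pc + length xs , R′ , M′ ⟩
    reach-line {pc} {[]} h [] refl = reach-pc (sym (+-identityʳ pc)) reach-refl
    reach-line {pc} {i ∷ xs} {R} {M} (h , hs) (st ∷ sts) eq =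
      reach-pc (sym (+-suc pc (length xs))) (reach-trans (one st) (reach-line hs sts eq))
      where
      one : Straight i → ⟨ pc , R , M ⟩ ⟶⟨ 1 ⟩ ⟨ suc pc , proj₁ (step i (R , M)) , proj₂ (step i (R , M)) ⟩
      one const = reach-next h
      one arith = reach-next h
      one load  = reach-next h
      one store = reach-next h

    record Simulates (pc b end : ℕ) (R : Regs) (M : Mem) (s′ : Store) : Set where
      constructor simulates
      field
        {R′}  : Regs
        {M′}  : Mem
        run   : ⟨ pc , R , M ⟩ ⟶⟨ b ⟩ ⟨ end , R′ , M′ ⟩
        rep   : Represents R′ M′ s′
        bnd   : Bounded s′

    represents-setReg : ∀ {R M s} x v → Represents R M s → Represents (R [ varReg x ≔ v ]) M (setReg s x v)
    represents-setReg {R} {M} {s} x v rep = represents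
      (trans (≔-other R (varReg x) v (λ ())) (base≡ rep)) vars (arr≡ rep) (input≡ rep)
      where
      vars : ∀ y → (R [ varReg x ≔ v ]) (varReg y) ≡ (reg s [ x ≔ v ]) y
      vars y with x ≟ y
      ... | yes refl = trans (≔-same R (varReg x) v refl) (sym (≔-same (reg s) x v refl))
      ... | no x≢y   = trans (≔-other R (varReg x) v (λ eq → x≢y (varReg-injective eq)))
                         (trans (vars≡ rep y) (sym (≔-other (reg s) x v x≢y)))

    represents-setArr : ∀ {R M s} A i v → Represents R M s → Represents R (M [ address A i ≔ v ]) (setArr s A i v)
    represents-setArr {R} {M} {s} A i v rep = represents (base≡ rep) (vars≡ rep) arrs
      (λ a a< → trans (≔-other M (address A i) v (λ eq → <⇒≱ a< (subst (B ≤_) eq (address≥ A i)))) (input≡ rep a a<))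
      where
      arrs : ∀ C j → (M [ address A i ≔ v ]) (address C j) ≡ arr (setArr s A i v) C j
      arrs C j with toℕ A ≟ toℕ C
      ... | no A≢C rewrite ≢⇒≡ᵇ A≢C =
        trans (≔-other M (address A i) v (λ eq → A≢C (cong toℕ (proj₁ (address-injective {A} {C} {i} {j} eq))))) (arr≡ rep C j)
      ... | yes A≡C with toℕ-injective A≡C
      ... | refl rewrite ≡ᵇ-refl (toℕ A) with i ≟ j
      ...   | yes refl = trans (≔-same M (address A i) v refl) (sym (≔-same (arr s A) i v refl))
      ...   | no i≢j   = trans (≔-other M (address A i) v (λ eq → i≢j (proj₂ (address-injective {A} {A} {i} {j} eq))))
                           (trans (arr≡ rep A j) (sym (≔-other (arr s A) i v i≢j)))

    test : ∀ {pc rest R M s} e l → Bounded s → Represents R M s → Fits (degree e) →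
      At pc (compileExpr e 0 ++ jumpZero (stackReg 0) l ∷ rest) →
      Σ[ R₁ ∈ Regs ] Represents R₁ M s × At (suc (pc + length (compileExpr e 0))) rest ×
        (⟨ pc , R , M ⟩ ⟶⟨ length (compileExpr e 0) + 1 ⟩
          ⟨ (if eval e s ≡ᵇ 0 then l else suc (pc + length (compileExpr e 0))) , R₁ , M ⟩)
    test {pc} {M = M} e l b rep fit code
      with line-expr e 0 b rep fit | at-++ (compileExpr e 0) code
    ... | R₁ , l₁ , v₁ , a₁ | at₁ , jz , at₂ = R₁ , represents-agree rep a₁ , at₂ ,
      reach-trans (reach-line at₁ (straight-compileExpr e 0) l₁)
        (reach-pc (cong (λ v → if v ≡ᵇ 0 then l else suc (pc + length (compileExpr e 0))) v₁) (reach-next jz))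

    if-false : ∀ {b} {l m : ℕ} → b ≡ false → (if b then l else m) ≡ m
    if-false refl = refl

    if-true : ∀ {v} {l m : ℕ} → v ≡ 0 → (if v ≡ᵇ 0 then l else m) ≡ l
    if-true refl = refl

    -- By induction on the execution. The rate `K` is fixed by the whole command and inherited by
    -- its parts, so that sequences and repeated loop bodies just add their ticks; the tick of a
    -- test also pays for the jumps around the branch.
    simulate : ∀ {K c s d s′} → size c ≤ K → Fits (degreeᶜ c) → Exec c s d s′ →
      ∀ {pc R M} → Bounded s → Represents R M s → At pc (compile pc c) →
      Simulates pc (K * d) (pc + size c) R M s′
    simulate _ _ skip {pc} b rep code =
      simulates (reach-pc (sym (+-identityʳ pc)) (reach-≤ z≤n reach-refl)) rep b
    simulate {K} sz fit (assign {x} {e} {s} v≤) {pc} {R} {M} b rep code with line-expr e 0 b rep fit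
    ... | R₁ , l₁ , v₁ , a₁ = simulates
      (reach-≤ (≤-trans sz (m≤m*n K 1)) (reach-line code (++⁺ (straight-compileExpr e 0) (const ∷ arith ∷ []))
        (trans (line-++ (compileExpr e 0) (moveCode (varReg x)) (R , M)) (cong (line (moveCode (varReg x))) l₁))))
      (subst (λ v → Represents (R₂ [ varReg x ≔ v ]) M (setReg s x (eval e s))) (sym v₂)
        (represents-setReg x (eval e s) (represents-agree (represents-agree rep a₁) (agree-set 1 R₁ (truncate W 0) (z≤n {1})))))
      (bounded-setReg x b v≤)
      where
      R₂ = R₁ [ stackReg 1 ≔ truncate W 0 ]
      v₂ : truncate W (R₂ (stackReg 0) + R₂ (stackReg 1)) ≡ eval e s
      v₂ = trans (cong (truncate W) (trans (cong₂ _+_ v₁ (truncate-0 fit)) (+-identityʳ _)))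
             (truncate-eval b e fit)
    simulate {K} sz fit (put {A} {i} {e} {s} v≤) {pc} {R} {M} b rep code
      with line-expr e 0 b rep (fits-≤ (m≤m⊔n _ _) fit)
    ... | R₁ , l₁ , v₁ , a₁
      with line-expr i 1 b (represents-agree rep a₁) (fits-≤ (≤-trans (m≤n+m _ 3) (m≤n⊔m (degree e) _)) fit)
    ... | R₂ , l₂ , v₂ , a₂
      with line-address A 1 R₂ M (eval i s) i (degree≥1 i) (eval≤ b i) (fits-≤ (m≤n⊔m (degree e) _) fit)
             (base≡ (represents-agree (represents-agree rep a₁) a₂)) v₂
    ... | R₃ , l₃ , v₃ , a₃ = simulates
      (reach-≤ (≤-trans sz (m≤m*n K 1)) (reach-line code
        (++⁺ (straight-compileExpr e 0) (++⁺ (straight-compileExpr i 1) (const ∷ arith ∷ arith ∷ const ∷ arith ∷ store ∷ [])))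
        (trans (line-++ (compileExpr e 0) (compileExpr i 1 ++ addressCode A 1 ++ last) (R , M))
          (trans (cong (line (compileExpr i 1 ++ addressCode A 1 ++ last)) l₁)
          (trans (line-++ (compileExpr i 1) (addressCode A 1 ++ last) (R₁ , M))
            (trans (cong (line (addressCode A 1 ++ last)) l₂)
            (trans (line-++ (addressCode A 1) last (R₂ , M)) (cong (line last) l₃))))))))
      (subst₂ (λ a v → Represents R₃ (M [ a ≔ v ]) (setArr s A (eval i s) (eval e s)))
        (sym v₃) (sym v₀)
        (represents-setArr A (eval i s) (eval e s)
          (represents-agree (represents-agree (represents-agree rep a₁) a₂) a₃)))
      (bounded-setArr A (eval i s) b v≤)
      where
      last = store (stackReg 1) (stackReg 0) ∷ []
      ≢stack : ∀ k → 1 ≤ k → stackReg 0 ≢ stackReg k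
      ≢stack k 1≤k eq = <⇒≢ 1≤k (stackReg-injective {0} {k} eq)
      v₀ : R₃ (stackReg 0) ≡ eval e s
      v₀ = trans (agrees a₃ (stackReg 0) ≢stack) (trans (agrees a₂ (stackReg 0) ≢stack) v₁)
    simulate {K} sz fit (read {x} {e} {s} a<) {pc} {R} {M} b rep code with line-expr e 0 b rep fit
    ... | R₁ , l₁ , v₁ , a₁ = simulates
      (reach-≤ (≤-trans sz (m≤m*n K 1)) (reach-line code (++⁺ (straight-compileExpr e 0) (load ∷ []))
        (trans (line-++ (compileExpr e 0) last (R , M)) (cong (line last) l₁))))
      (subst (λ v → Represents (R₁ [ varReg x ≔ v ]) M (setReg s x (input (eval e s))))
        (sym (trans (cong M v₁) (input≡ rep _ a<)))
        (represents-setReg x (input (eval e s)) (represents-agree rep a₁)))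
      (bounded-setReg x b (input≤V _))
      where last = load (varReg x) (stackReg 0) ∷ []
    simulate {K} sz fit (seq {c} {c′} {d = d} {d′ = d′} p q) {pc} b rep code
      with at-++ (compile pc c) code
    ... | at₁ , at₂
      with simulate (≤-trans (m≤m+n _ _) sz) (fits-≤ (m≤m⊔n _ _) fit) p b rep at₁
    ... | simulates r₁ rep₁ b₁
      with simulate (≤-trans (m≤n+m _ (size c)) sz) (fits-≤ (m≤n⊔m (degreeᶜ c) _) fit) q b₁ rep₁
             (at-≡ (cong (pc +_) (length-compile pc c)) at₂)
    ... | simulates r₂ rep₂ b₂ = simulates
      (reach-≤ (≤-reflexive (sym (*-distribˡ-+ K d d′)))
        (reach-pc (+-assoc pc (size c) (size c′)) (reach-trans r₁ r₂)))
      rep₂ b₂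
    simulate {K} sz fit (cond≢0 {e} {c} {c′} {s} {d} e≢0 p) {pc} b rep code
      with test e (suc (suc (pc + length (compileExpr e 0)) + size c)) b rep (fits-≤ (m≤m⊔n _ _) fit) code
    ... | R₁ , rep₁ , at₂ , r₀ with at-++ (compile (suc (pc + length (compileExpr e 0))) c) at₂
    ... | at₃ , j , at₄
      with simulate (≤-trans (m≤m+n _ _) (≤-trans (n≤1+n _) (≤-trans (m≤n+m _ (length (compileExpr e 0))) sz)))
             (fits-≤ (≤-trans (m≤m⊔n (degreeᶜ c) _) (m≤n⊔m (degree e) _)) fit) p b rep₁ at₃
    ... | simulates r₂ rep₂ b₂ = simulates
      (reach-pc end (reach-≤ time (reach-trans (reach-trans (reach-pc (if-false (≢⇒≡ᵇ e≢0)) r₀) r₂)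
        (reach-trans (reach-pc (cong (suc (pc + E) +_) (sym (length-compile (suc (pc + E)) c))) reach-refl) (reach-next j)))))
      rep₂ b₂
      where
      E = length (compileExpr e 0)
      end : suc (suc (pc + E) + size c) + size c′ ≡ pc + size (cond e c c′)
      end = eq pc E (size c) (size c′)
        where
        eq : ∀ a b x y → suc (suc (a + b) + x) + y ≡ a + (b + suc (x + suc y))
        eq = solve-∀
      time : E + 1 + K * d + 1 ≤ K * suc d
      time = begin
        E + 1 + K * d + 1 ≡⟨ eq E (K * d) ⟩
        E + 2 + K * d     ≤⟨ +-monoˡ-≤ (K * d) (≤-trans (+-monoʳ-≤ E (s≤s (≤-trans (s≤s z≤n) (m≤n+m (suc (size c′)) (size c))))) sz) ⟩
        K + K * d         ≡⟨ *-suc K d ⟨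
        K * suc d         ∎
        where
        open ≤-Reasoning
        eq : ∀ a b → a + 1 + b + 1 ≡ a + 2 + b
        eq = solve-∀
    simulate {K} sz fit (cond≡0 {e} {c} {c′} {s} {d} e≡0 p) {pc} b rep code
      with test e (suc (suc (pc + length (compileExpr e 0)) + size c)) b rep (fits-≤ (m≤m⊔n _ _) fit) code
    ... | R₁ , rep₁ , at₂ , r₀ with at-++ (compile (suc (pc + length (compileExpr e 0))) c) at₂
    ... | at₃ , j , at₄
      with simulate (≤-trans (≤-trans (n≤1+n _) (m≤n+m _ (size c))) (≤-trans (n≤1+n _) (≤-trans (m≤n+m _ (length (compileExpr e 0))) sz)))
             (fits-≤ (≤-trans (m≤n⊔m (degreeᶜ c) _) (m≤n⊔m (degree e) _)) fit) p b rep₁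
             (at-≡ (cong (λ l → suc (suc (pc + length (compileExpr e 0)) + l))
               (length-compile (suc (pc + length (compileExpr e 0))) c)) at₄)
    ... | simulates r₂ rep₂ b₂ = simulates
      (reach-pc end (reach-≤ time (reach-trans (reach-pc (if-true e≡0) r₀) r₂)))
      rep₂ b₂
      where
      E = length (compileExpr e 0)
      end : suc (suc (pc + E) + size c) + size c′ ≡ pc + size (cond e c c′)
      end = eq pc E (size c) (size c′)
        where
        eq : ∀ a b x y → suc (suc (a + b) + x) + y ≡ a + (b + suc (x + suc y))
        eq = solve-∀
      time : E + 1 + K * d ≤ K * suc d
      time = begin
        E + 1 + K * d     ≤⟨ +-monoˡ-≤ (K * d) (≤-trans (+-monoʳ-≤ E (s≤s z≤n)) sz) ⟩
        K + K * d         ≡⟨ *-suc K d ⟨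
        K * suc d         ∎
        where open ≤-Reasoning
    simulate {K} sz fit (loop {e} {c} {s} {d} {s₁} {d′} e≢0 p q) {pc} b rep code
      with test e (suc (suc (pc + length (compileExpr e 0)) + size c)) b rep (fits-≤ (m≤m⊔n _ _) fit) code
    ... | R₁ , rep₁ , at₂ , r₀ with at-++ (compile (suc (pc + length (compileExpr e 0))) c) at₂
    ... | at₃ , j , at₄
      with simulate (≤-trans (m≤m+n _ _) (≤-trans (n≤1+n _) (≤-trans (m≤n+m _ (length (compileExpr e 0))) sz)))
             (fits-≤ (m≤n⊔m (degree e) _) fit) p b rep₁ at₃
    ... | simulates r₂ rep₂ b₂ with simulate sz fit q b₂ rep₂ code
    ... | simulates r₃ rep₃ b₃ = simulates
      (reach-≤ time (reach-trans (reach-trans (reach-trans (reach-pc (if-false (≢⇒≡ᵇ e≢0)) r₀) r₂)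
        (reach-trans (reach-pc (cong (suc (pc + E) +_) (sym (length-compile (suc (pc + E)) c))) reach-refl) (reach-next j))) r₃))
      rep₃ b₃
      where
      E = length (compileExpr e 0)
      time : E + 1 + K * d + 1 + K * d′ ≤ K * suc (d + d′)
      time = begin
        E + 1 + K * d + 1 + K * d′ ≡⟨ eq E (K * d) (K * d′) ⟩
        E + 2 + (K * d + K * d′)   ≤⟨ +-mono-≤ (≤-trans (+-monoʳ-≤ E (s≤s (m≤n+m 1 (size c)))) sz) (≤-reflexive (sym (*-distribˡ-+ K d d′))) ⟩
        K + K * (d + d′)           ≡⟨ *-suc K (d + d′) ⟨
        K * suc (d + d′)           ∎
        where
        open ≤-Reasoning
        eq : ∀ a b c → a + 1 + b + 1 + c ≡ a + 2 + (b + c)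
        eq = solve-∀
    simulate {K} sz fit (stop {e} {c} {s} e≡0) {pc} b rep code
      with test e (suc (suc (pc + length (compileExpr e 0)) + size c)) b rep (fits-≤ (m≤m⊔n _ _) fit) code
    ... | R₁ , rep₁ , at₂ , r₀ = simulates
      (reach-pc end (reach-≤ time (reach-pc (if-true e≡0) r₀))) rep₁ b
      where
      E = length (compileExpr e 0)
      end : suc (suc (pc + E) + size c) ≡ pc + size (while e c)
      end = eq pc E (size c)
        where
        eq : ∀ a b x → suc (suc (a + b) + x) ≡ a + (b + suc (x + 1))
        eq = solve-∀
      time : E + 1 ≤ K * 1
      time = ≤-trans (+-monoʳ-≤ E (s≤s z≤n)) (≤-trans sz (≤-reflexive (sym (*-identityʳ K))))

-- Program logic

-- A syntactic frame condition: for the concrete commands below, `writes x c` computes to `false`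
-- whenever `x` is left alone, so framing is discharged by `refl`.
writes : ℕ → Cmd → Bool
writes x skip           = false
writes x (y := _)       = y ≡ᵇ x
writes x (_ ⟦ _ ⟧:= _)  = false
writes x (read y _)     = y ≡ᵇ x
writes x (c ⨾ c′)       = writes x c ∨ writes x c′
writes x (cond _ c c′)  = writes x c ∨ writes x c′
writes x (while _ c)    = writes x c

writesArr : Array → Cmd → Bool
writesArr A skip           = false
writesArr A (_ := _)       = false
writesArr A (C ⟦ _ ⟧:= _)  = toℕ C ≡ᵇ toℕ A
writesArr A (read _ _)     = false
writesArr A (c ⨾ c′)       = writesArr A c ∨ writesArr A c′
writesArr A (cond _ c c′)  = writesArr A c ∨ writesArr A c′
writesArr A (while _ c)    = writesArr A c

∨-falseˡ : ∀ {a b} → (a ∨ b) ≡ false → a ≡ false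
∨-falseˡ {false} _ = refl

∨-falseʳ : ∀ {a b} → (a ∨ b) ≡ false → b ≡ false
∨-falseʳ {false} h = h

-- The body of an inner loop is verified against its own frame. Weakening this frame to that of an
-- enclosing command makes the facts known on entry to the latter available again.
data _⊑_ : Cmd → Cmd → Set where
  self   : ∀ {c} → c ⊑ c
  inFirst  : ∀ {c a b} → c ⊑ a → c ⊑ (a ⨾ b)
  inSecond : ∀ {c a b} → c ⊑ b → c ⊑ (a ⨾ b)
  inThen   : ∀ {c e a b} → c ⊑ a → c ⊑ cond e a b
  inElse   : ∀ {c e a b} → c ⊑ b → c ⊑ cond e a b
  inLoop : ∀ {c e a} → c ⊑ a → c ⊑ while e a

writes-⊑ : ∀ {c c′} → c ⊑ c′ → ∀ x → writes x c′ ≡ false → writes x c ≡ false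
writes-⊑ self x h = h
writes-⊑ (inFirst {a = a} p) x h  = writes-⊑ p x (∨-falseˡ {writes x a} h)
writes-⊑ (inSecond {a = a} p) x h = writes-⊑ p x (∨-falseʳ {writes x a} h)
writes-⊑ (inThen {a = a} p) x h   = writes-⊑ p x (∨-falseˡ {writes x a} h)
writes-⊑ (inElse {a = a} p) x h   = writes-⊑ p x (∨-falseʳ {writes x a} h)
writes-⊑ (inLoop p) x h         = writes-⊑ p x h

writesArr-⊑ : ∀ {c c′} → c ⊑ c′ → ∀ A → writesArr A c′ ≡ false → writesArr A c ≡ false
writesArr-⊑ self A h = h
writesArr-⊑ (inFirst {a = a} p) A h  = writesArr-⊑ p A (∨-falseˡ {writesArr A a} h)
writesArr-⊑ (inSecond {a = a} p) A h = writesArr-⊑ p A (∨-falseʳ {writesArr A a} h)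
writesArr-⊑ (inThen {a = a} p) A h   = writesArr-⊑ p A (∨-falseˡ {writesArr A a} h)
writesArr-⊑ (inElse {a = a} p) A h   = writesArr-⊑ p A (∨-falseʳ {writesArr A a} h)
writesArr-⊑ (inLoop p) A h         = writesArr-⊑ p A h

module Logic (B V : ℕ) (input : ℕ → ℕ) (input≤V : ∀ a → input a ≤ V) where

  open Machine B V input public

  record Keeps (c : Cmd) (s s′ : Store) : Set where
    constructor keeps
    field
      kept    : ∀ x → writes x c ≡ false → reg s′ x ≡ reg s x
      keptArr : ∀ A → writesArr A c ≡ false → ∀ i → arr s′ A i ≡ arr s A i
      isBounded : Bounded s′
  open Keeps public

  exec-bounded : ∀ {c s d s′} → Exec c s d s′ → Bounded s → Bounded s′
  exec-bounded skip b          = b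
  exec-bounded (assign {x} v≤) b = bounded-setReg x b v≤
  exec-bounded (put {A} {i} {s = s} v≤) b = bounded-setArr A (eval i s) b v≤
  exec-bounded (read {x} {e} {s} _) b = bounded-setReg x b (input≤V (eval e s))
  exec-bounded (seq p q) b     = exec-bounded q (exec-bounded p b)
  exec-bounded (cond≢0 _ p) b  = exec-bounded p b
  exec-bounded (cond≡0 _ p) b  = exec-bounded p b
  exec-bounded (loop _ p q) b  = exec-bounded q (exec-bounded p b)
  exec-bounded (stop _) b      = b

  exec-kept : ∀ {c s d s′} → Exec c s d s′ → ∀ x → writes x c ≡ false → reg s′ x ≡ reg s x
  exec-kept skip x h           = refl
  exec-kept (assign {y} {e} {s} _) x h = cong (λ b → if b then eval e s else reg s x) h
  exec-kept (put _) x h        = refl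
  exec-kept (read {y} {e} {s} _) x h = cong (λ b → if b then input (eval e s) else reg s x) h
  exec-kept (seq {c} {c′} p q) x h =
    trans (exec-kept q x (∨-falseʳ {writes x c} h)) (exec-kept p x (∨-falseˡ {writes x c} h))
  exec-kept (cond≢0 {c = c} _ p) x h = exec-kept p x (∨-falseˡ {writes x c} h)
  exec-kept (cond≡0 {c = c} _ p) x h = exec-kept p x (∨-falseʳ {writes x c} h)
  exec-kept (loop _ p q) x h   = trans (exec-kept q x h) (exec-kept p x h)
  exec-kept (stop _) x h       = refl

  exec-keptArr : ∀ {c s d s′} → Exec c s d s′ → ∀ A → writesArr A c ≡ false → ∀ i → arr s′ A i ≡ arr s A i
  exec-keptArr skip A h i       = refl
  exec-keptArr (assign _) A h i = refl
  exec-keptArr (put {C} {j} {e} {s} _) A h i =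
    cong (λ b → (if b then arr s A [ eval j s ≔ eval e s ] else arr s A) i) h
  exec-keptArr (read _) A h i   = refl
  exec-keptArr (seq {c} {c′} p q) A h i =
    trans (exec-keptArr q A (∨-falseʳ {writesArr A c} h) i) (exec-keptArr p A (∨-falseˡ {writesArr A c} h) i)
  exec-keptArr (cond≢0 {c = c} _ p) A h i = exec-keptArr p A (∨-falseˡ {writesArr A c} h) i
  exec-keptArr (cond≡0 {c = c} _ p) A h i = exec-keptArr p A (∨-falseʳ {writesArr A c} h) i
  exec-keptArr (loop _ p q) A h i = trans (exec-keptArr q A h i) (exec-keptArr p A h i)
  exec-keptArr (stop _) A h i   = refl

  exec-keeps : ∀ {c s d s′} → Exec c s d s′ → Bounded s → Keeps c s s′
  exec-keeps p b = keeps (exec-kept p) (exec-keptArr p) (exec-bounded p b)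

  -- Total correctness, with a postcondition that sees the number of ticks. In `run-⨾` the
  -- postcondition of the first command is a `Run` of the second, so proofs follow the program by
  -- symbolic execution.
  record Run (c : Cmd) (s : Store) (Q : ℕ → Store → Set) : Set where
    constructor run
    field
      {ticks} : ℕ
      {final} : Store
      exec    : Exec c s ticks final
      post    : Q ticks final

  run-skip : ∀ {s Q} → Q 0 s → Run skip s Q
  run-skip q = run skip q

  run-:= : ∀ {x e s Q} → eval e s ≤ V → Q 1 (setReg s x (eval e s)) → Run (x := e) s Q
  run-:= v≤ q = run (assign v≤) q

  run-put : ∀ {A i e s Q} → eval e s ≤ V → Q 1 (setArr s A (eval i s) (eval e s)) → Run (A ⟦ i ⟧:= e) s Q
  run-put v≤ q = run (put v≤) q

  run-read : ∀ {x e s Q} → eval e s < B → Q 1 (setReg s x (input (eval e s))) → Run (read x e) s Q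
  run-read a< q = run (read a<) q

  run-⨾ : ∀ {c c′ s Q} → Run c s (λ d s₁ → Run c′ s₁ (λ d′ → Q (d + d′))) → Run (c ⨾ c′) s Q
  run-⨾ (run p (run q r)) = run (seq p q) r

  run-cond : ∀ {e c c′ s Q} → (eval e s ≢ 0 → Run c s (λ d → Q (suc d))) →
    (eval e s ≡ 0 → Run c′ s (λ d → Q (suc d))) → Run (cond e c c′) s Q
  run-cond {e} {s = s} f g with eval e s ≟ 0
  ... | yes e≡0 = let run p q = g e≡0 in run (cond≡0 e≡0 p) q
  ... | no e≢0 = let run p q = f e≢0 in run (cond≢0 e≢0 p) q

  run-mono : ∀ {c s Q Q′} → (∀ {d s′} → Q d s′ → Q′ d s′) → Run c s Q → Run c s Q′
  run-mono f (run p q) = run p (f q)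

  run-keeps : ∀ {c s Q Q′} → Bounded s → Run c s Q → (∀ {d s′} → Keeps c s s′ → Q d s′ → Q′ d s′) → Run c s Q′
  run-keeps b (run p q) f = run p (f (exec-keeps p b) q)

  -- The number `n` of rounds of every loop is known on entry; the invariant is indexed by the
  -- rounds and the ticks so far. A round costs one tick more than its body, for the test, and the
  -- failing test costs the last one.
  run-while : ∀ {e c s Q} (I : ℕ → ℕ → Store → Set) n → Bounded s → I 0 0 s →
    (∀ {i d s′} → Keeps c s s′ → i < n → I i d s′ →
      eval e s′ ≢ 0 × Run c s′ (λ d′ → I (suc i) (d + suc d′))) →
    (∀ {d s′} → Keeps c s s′ → I n d s′ → eval e s′ ≡ 0 × Q (d + 1) s′) →
    Run (while e c) s Q
  run-while {e} {c} {s} {Q} I n b init body end = go n 0 0 s (+-identityʳ n) (keeps (λ _ _ → refl) (λ _ _ _ → refl) b) init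
    where
    go : ∀ k i d s′ → k + i ≡ n → Keeps c s s′ → I i d s′ → Run (while e c) s′ (λ d′ → Q (d + d′))
    go zero i d s′ refl ks inv with end ks inv
    ... | e≡0 , q = run (stop e≡0) q
    go (suc k) i d s′ eq ks inv with body ks (subst (suc i ≤_) eq (s≤s (m≤n+m i k))) inv
    ... | e≢0 , run {d₁} {s₁} p inv′ with exec-keeps p (isBounded ks)
    ... | keeps k₁ a₁ b₁ with go k (suc i) (d + suc d₁) s₁ (trans (+-suc k i) eq)
                            (keeps (λ x h → trans (k₁ x h) (kept ks x h))
                                   (λ A h i → trans (a₁ A h i) (keptArr ks A h i)) b₁) inv′
    ... | run {d₂} {s₂} q r = run (loop e≢0 p q) (subst (λ d → Q d s₂) (+-assoc d (suc d₁) d₂) r)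

  keeps-trans : ∀ {c s s′ s″} → Keeps c s s′ → Keeps c s′ s″ → Keeps c s s″
  keeps-trans k k′ = keeps (λ x h → trans (kept k′ x h) (kept k x h))
    (λ A h i → trans (keptArr k′ A h i) (keptArr k A h i)) (isBounded k′)

  keeps-setReg : ∀ {c s} x v → writes x c ≡ true → Bounded s → v ≤ V → Keeps c s (setReg s x v)
  keeps-setReg {c} {s} x v w b v≤ = keeps unchanged (λ _ _ _ → refl) (bounded-setReg x b v≤)
    where
    unchanged : ∀ y → writes y c ≡ false → (reg s [ x ≔ v ]) y ≡ reg s y
    unchanged y h = ≔-other (reg s) x v λ { refl → case (trans (sym w) h) }
      where
      case : true ≡ false → ⊥
      case ()

  keeps-⊑ : ∀ {c c′ s s′} → c ⊑ c′ → Keeps c s s′ → Keeps c′ s s′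
  keeps-⊑ p k = keeps (λ x h → kept k x (writes-⊑ p x h)) (λ A h → keptArr k A (writesArr-⊑ p A h)) (isBounded k)

-- Sets of jobs as bit vectors and as numbers

-- Sets of jobs; the head of a mask is its most significant bit.
Mask : ℕ → Set
Mask = Vec Bool

∅ : ∀ {b} → Mask b
∅ {b} = replicate b false

val : ∀ {b} → Mask b → ℕ
val []                  = 0
val {suc b} (true  ∷ v) = 2 ^ b + val v
val {suc b} (false ∷ v) = val v

count : ∀ {b} → Mask b → ℕ
count []          = 0
count (true  ∷ v) = suc (count v)
count (false ∷ v) = count v

toMask : ∀ b → ℕ → Mask b
toMask zero    y = []
toMask (suc b) y = if 2 ^ b ≤ᵇ y then true ∷ toMask b (y ∸ 2 ^ b) else false ∷ toMask b y

2^suc : ∀ b → 2 ^ suc b ≡ 2 ^ b + 2 ^ b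
2^suc b = cong (2 ^ b +_) (+-identityʳ (2 ^ b))

1≤2^ : ∀ b → 1 ≤ 2 ^ b
1≤2^ b = m^n>0 2 b

val<2^ : ∀ {b} (v : Mask b) → val v < 2 ^ b
val<2^ []                  = s≤s z≤n
val<2^ {suc b} (true  ∷ v) = subst (2 ^ b + val v <_) (sym (2^suc b)) (+-monoʳ-< (2 ^ b) (val<2^ v))
val<2^ {suc b} (false ∷ v) = <-≤-trans (val<2^ v) (m≤m+n (2 ^ b) _)

≤ᵇ-true : ∀ {a b} → a ≤ b → (a ≤ᵇ b) ≡ true
≤ᵇ-true {a} {b} a≤b with a ≤ᵇ b in eq
... | true  = refl
... | false = ⊥-elim (subst T eq (≤⇒≤ᵇ a≤b))

≤ᵇ-false : ∀ {a b} → b < a → (a ≤ᵇ b) ≡ false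
≤ᵇ-false {a} {b} b<a with a ≤ᵇ b in eq
... | false = refl
... | true  = ⊥-elim (<⇒≱ b<a (≤ᵇ⇒≤ a b (subst T (sym eq) _)))

toMask-val : ∀ {b} (v : Mask b) → toMask b (val v) ≡ v
toMask-val [] = refl
toMask-val {suc b} (true ∷ v)
  rewrite ≤ᵇ-true (m≤m+n (2 ^ b) (val v)) | m+n∸m≡n (2 ^ b) (val v) = cong (true ∷_) (toMask-val v)
toMask-val {suc b} (false ∷ v) rewrite ≤ᵇ-false (val<2^ v) = cong (false ∷_) (toMask-val v)

val-toMask : ∀ b y → y < 2 ^ b → val (toMask b y) ≡ y
val-toMask zero zero _ = refl
val-toMask zero (suc y) (s≤s ())
val-toMask (suc b) y y< with 2 ^ b ≤? y
... | yes h rewrite ≤ᵇ-true h =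
  trans (cong (2 ^ b +_) (val-toMask b (y ∸ 2 ^ b) (+-cancelˡ-< (2 ^ b) _ _ (subst₂ _<_ (sym (m+[n∸m]≡n h)) (2^suc b) y<))))
    (m+[n∸m]≡n h)
... | no h rewrite ≤ᵇ-false (≰⇒> h) = val-toMask b y (≰⇒> h)

val-injective : ∀ {b} {v v′ : Mask b} → val v ≡ val v′ → v ≡ v′
val-injective {b} {v} {v′} eq = trans (sym (toMask-val v)) (trans (cong (toMask b) eq) (toMask-val v′))

val-∅ : ∀ b → val (∅ {b}) ≡ 0
val-∅ zero    = refl
val-∅ (suc b) = val-∅ b

val-++ : ∀ {l f} (h : Mask l) (v : Mask f) → val (h ⧺ v) ≡ val h * 2 ^ f + val v
val-++ [] v = refl
val-++ {suc l} {f} (true ∷ h) v = begin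
  2 ^ (l + f) + val (h ⧺ v)               ≡⟨ cong₂ _+_ (^-distribˡ-+-* 2 l f) (val-++ h v) ⟩
  2 ^ l * 2 ^ f + (val h * 2 ^ f + val v)  ≡⟨ eq (2 ^ l) (2 ^ f) (val h) (val v) ⟩
  (2 ^ l + val h) * 2 ^ f + val v          ∎
  where
  open ≡-Reasoning
  eq : ∀ a b c d → a * b + (c * b + d) ≡ (a + c) * b + d
  eq = solve-∀
val-++ (false ∷ h) v = val-++ h v

complement : ∀ {b} → Mask b → Mask b
complement = map not

val-complement : ∀ {b} (v : Mask b) → val v + val (complement v) + 1 ≡ 2 ^ b
val-complement [] = refl
val-complement {suc b} (true ∷ v) = trans (eq (2 ^ b) (val v) (val (complement v)))
  (trans (cong (2 ^ b +_) (val-complement v)) (sym (2^suc b)))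
  where
  eq : ∀ a b c → a + b + c + 1 ≡ a + (b + c + 1)
  eq = solve-∀
val-complement {suc b} (false ∷ v) = trans (eq (2 ^ b) (val v) (val (complement v)))
  (trans (cong (2 ^ b +_) (val-complement v)) (sym (2^suc b)))
  where
  eq : ∀ a b c → b + (a + c) + 1 ≡ a + (b + c + 1)
  eq = solve-∀

data Split : ∀ {b} → Mask b → Mask b → Mask b → Set where
  []   : Split [] [] []
  out  : ∀ {b} {v t x : Mask b} → Split v t x → Split (false ∷ v) (false ∷ t) (false ∷ x)
  inT  : ∀ {b} {v t x : Mask b} → Split v t x → Split (true ∷ v) (true ∷ t) (false ∷ x)
  inX  : ∀ {b} {v t x : Mask b} → Split v t x → Split (true ∷ v) (false ∷ t) (true ∷ x)

-- Disjoint bits produce no carry. This is why the program may form disjoint unions by `⊕` and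
-- differences from a superset by `⊖`.
split-val : ∀ {b} {v t x : Mask b} → Split v t x → val v ≡ val t + val x
split-val [] = refl
split-val (out s) = split-val s
split-val {suc b} (inT {t = t} {x} s) = trans (cong (2 ^ b +_) (split-val s)) (sym (+-assoc (2 ^ b) (val t) (val x)))
split-val {suc b} (inX {t = t} {x} s) = trans (cong (2 ^ b +_) (split-val s)) (eq (2 ^ b) (val t) (val x))
  where
  eq : ∀ a b c → a + (b + c) ≡ b + (a + c)
  eq = solve-∀

split-val∸ : ∀ {b} {v t x : Mask b} → Split v t x → val v ∸ val t ≡ val x
split-val∸ {t = t} {x} s = trans (cong (_∸ val t) (split-val s)) (m+n∸m≡n (val t) (val x))

split-sym : ∀ {b} {v t x : Mask b} → Split v t x → Split v x t
split-sym []      = []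
split-sym (out s) = out (split-sym s)
split-sym (inT s) = inX (split-sym s)
split-sym (inX s) = inT (split-sym s)

split-∅ : ∀ {b} (v : Mask b) → Split v v ∅
split-∅ []          = []
split-∅ (true ∷ v)  = inT (split-∅ v)
split-∅ (false ∷ v) = out (split-∅ v)

split-by-∅ : ∀ {b} {v t : Mask b} → Split v t ∅ → t ≡ v
split-by-∅ []      = refl
split-by-∅ (out s) = cong (false ∷_) (split-by-∅ s)
split-by-∅ (inT s) = cong (true ∷_) (split-by-∅ s)

split-count : ∀ {b} {v t x : Mask b} → Split v t x → count v ≡ count t + count x
split-count []      = refl
split-count (out s) = split-count s
split-count (inT s) = cong suc (split-count s)
split-count (inX {t = t} s) = trans (cong suc (split-count s)) (sym (+-suc (count t) _))

split-++ : ∀ {l f} {v₂ t₂ x₂ : Mask l} {v₁ t₁ x₁ : Mask f} →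
  Split v₂ t₂ x₂ → Split v₁ t₁ x₁ → Split (v₂ ⧺ v₁) (t₂ ⧺ t₁) (x₂ ⧺ x₁)
split-++ []      s′ = s′
split-++ (out s) s′ = out (split-++ s s′)
split-++ (inT s) s′ = inT (split-++ s s′)
split-++ (inX s) s′ = inX (split-++ s s′)

record SplitParts {l f} (v₂ : Mask l) (v₁ : Mask f) (t x : Mask (l + f)) : Set where
  constructor splitParts
  field
    t₂ x₂ : Mask l
    t₁ x₁ : Mask f
    t≡ : t ≡ t₂ ⧺ t₁
    x≡ : x ≡ x₂ ⧺ x₁
    split₂ : Split v₂ t₂ x₂
    split₁ : Split v₁ t₁ x₁

split-++⁻ : ∀ {l f} (v₂ : Mask l) (v₁ : Mask f) {t x} → Split (v₂ ⧺ v₁) t x → SplitParts v₂ v₁ t x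
split-++⁻ [] v₁ s = splitParts [] [] _ _ refl refl [] s
split-++⁻ (false ∷ v₂) v₁ (out s) with split-++⁻ v₂ v₁ s
... | splitParts _ _ _ _ p q s₂ s₁ = splitParts _ _ _ _ (cong (false ∷_) p) (cong (false ∷_) q) (out s₂) s₁
split-++⁻ (true ∷ v₂) v₁ (inT s) with split-++⁻ v₂ v₁ s
... | splitParts _ _ _ _ p q s₂ s₁ = splitParts _ _ _ _ (cong (true ∷_) p) (cong (false ∷_) q) (inT s₂) s₁
split-++⁻ (true ∷ v₂) v₁ (inX s) with split-++⁻ v₂ v₁ s
... | splitParts _ _ _ _ p q s₂ s₁ = splitParts _ _ _ _ (cong (false ∷_) p) (cong (true ∷_) q) (inX s₂) s₁

-- The program enumerates the subsets `t` of the complement of `x`, whereas the recurrence speaks of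
-- the sets `v` composed of `t` and `x`. This lemma and `split-complement` pass between the two
-- views.
union : ∀ {b} {t d : Mask b} x → complement x ≡ d → ∀ {y} → Split d t y → ∃[ v ] Split v t x
union [] refl [] = [] , []
union (true ∷ x) refl (out s) with union x refl s
... | v , s′ = true ∷ v , inX s′
union (false ∷ x) refl (inT s) with union x refl s
... | v , s′ = true ∷ v , inT s′
union (false ∷ x) refl (inX s) with union x refl s
... | v , s′ = false ∷ v , out s′

split-complement : ∀ {b} {v t x : Mask b} → Split v t x → ∃[ y ] Split (complement x) t y
split-complement [] = [] , []
split-complement (out s) with split-complement s
... | y , s′ = true ∷ y , inX s′
split-complement (inT s) with split-complement s
... | y , s′ = false ∷ y , inT s′
split-complement (inX s) with split-complement s
... | y , s′ = false ∷ y , out s′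

-- The head of a mask of length `suc b` stands for job `b`; the position of a job is thus
-- independent of the length of the mask.
weigh : (ℕ → ℕ) → ∀ {b} → Mask b → ℕ
weigh κ []                  = 0
weigh κ {suc b} (true  ∷ v) = κ b + weigh κ v
weigh κ {suc b} (false ∷ v) = weigh κ v

weigh-∅ : ∀ κ b → weigh κ (∅ {b}) ≡ 0
weigh-∅ κ zero    = refl
weigh-∅ κ (suc b) = weigh-∅ κ b

weigh-++ : ∀ κ {l f} (h : Mask l) (v : Mask f) → weigh κ (h ⧺ v) ≡ weigh κ (h ⧺ ∅ {f}) + weigh κ v
weigh-++ κ {f = f} [] v = cong (_+ weigh κ v) (sym (weigh-∅ κ f))
weigh-++ κ {suc l} {f} (true ∷ h) v =
  trans (cong (κ (l + f) +_) (weigh-++ κ h v)) (sym (+-assoc (κ (l + f)) _ _))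
weigh-++ κ (false ∷ h) v = weigh-++ κ h v

weigh-high : ∀ κ {l f} (h : Mask l) → weigh κ (h ⧺ ∅ {f}) ≡ weigh (λ i → κ (i + f)) h
weigh-high κ {f = f} [] = weigh-∅ κ f
weigh-high κ {suc l} {f} (true ∷ h) = cong (κ (l + f) +_) (weigh-high κ h)
weigh-high κ (false ∷ h) = weigh-high κ h

weigh-low : ∀ κ l {f} (v : Mask f) → weigh κ (∅ {l} ⧺ v) ≡ weigh κ v
weigh-low κ zero v    = refl
weigh-low κ (suc l) v = weigh-low κ l v

sumBelow : ℕ → (ℕ → ℕ) → ℕ
sumBelow zero    κ = 0
sumBelow (suc b) κ = sumBelow b κ + κ b

weigh≤ : ∀ κ {b} (v : Mask b) → weigh κ v ≤ sumBelow b κ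
weigh≤ κ [] = z≤n
weigh≤ κ {suc b} (true ∷ v)  = ≤-trans (+-monoʳ-≤ (κ b) (weigh≤ κ v)) (≤-reflexive (+-comm (κ b) _))
weigh≤ κ {suc b} (false ∷ v) = ≤-trans (weigh≤ κ v) (m≤m+n _ _)

nth : ∀ {b} → List (Mask b) → ℕ → Mask b
nth []       k       = ∅
nth (x ∷ xs) zero    = x
nth (x ∷ xs) (suc k) = nth xs k

nth-∈ : ∀ {b} (xs : List (Mask b)) {k} → k < length xs → nth xs k ∈ xs
nth-∈ (x ∷ xs) {zero}  _        = here refl
nth-∈ (x ∷ xs) {suc k} (s≤s k<) = there (nth-∈ xs k<)

∈-nth : ∀ {b} {xs : List (Mask b)} {x} → x ∈ xs → ∃[ k ] (k < length xs × nth xs k ≡ x)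
∈-nth (here refl) = 0 , s≤s z≤n , refl
∈-nth (there x∈) with ∈-nth x∈
... | k , k< , eq = suc k , s≤s k< , eq

nth-map : ∀ {b c} (g : Mask b → Mask c) xs {k} → k < length xs → nth (List.map g xs) k ≡ g (nth xs k)
nth-map g (x ∷ xs) {zero}  _        = refl
nth-map g (x ∷ xs) {suc k} (s≤s k<) = nth-map g xs k<

drop-nth : ∀ {b} (xs : List (Mask b)) {k} → k < length xs → drop k xs ≡ nth xs k ∷ drop (suc k) xs
drop-nth (x ∷ xs) {zero}  _        = refl
drop-nth (x ∷ xs) {suc k} (s≤s k<) = drop-nth xs k<

drop-all : ∀ {b} (xs : List (Mask b)) {k} → length xs ≤ k → drop k xs ≡ []
drop-all [] {zero}  _ = refl
drop-all [] {suc k} _ = refl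
drop-all (x ∷ xs) {suc k} (s≤s h) = drop-all xs h

drop-head : ∀ {b} (xs : List (Mask b)) {k y ys} → drop k xs ≡ y ∷ ys → nth xs k ≡ y × drop (suc k) xs ≡ ys
drop-head (x ∷ xs) {zero}  refl = refl , refl
drop-head (x ∷ xs) {suc k} eq   = drop-head xs eq

-- Subsets sorted by weight

module Submasks (κ : ℕ → ℕ) where

  _≤κ?_ : ∀ {b} (x y : Mask b) → Dec (weigh κ x ≤ weigh κ y)
  x ≤κ? y = weigh κ x ≤? weigh κ y

  -- Adding the same job to all sets of a sorted list keeps it sorted. One merge per job therefore
  -- replaces sorting, and a list costs time linear in its length.
  submasks : ∀ {b} → Mask b → List (Mask b)
  submasks []          = [] ∷ []
  submasks (false ∷ u) = List.map (false ∷_) (submasks u)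
  submasks (true  ∷ u) = merge _≤κ?_ (List.map (false ∷_) (submasks u)) (List.map (true ∷_) (submasks u))

  length-submasks : ∀ {b} (u : Mask b) → length (submasks u) ≡ 2 ^ count u
  length-submasks [] = refl
  length-submasks (false ∷ u) = trans (length-map (false ∷_) (submasks u)) (length-submasks u)
  length-submasks (true ∷ u) = begin
    length (merge _≤κ?_ fs ts)                  ≡⟨ ↭-length (merge-↭ _≤κ?_ fs ts) ⟩
    length (fs List.++ ts)                      ≡⟨ length-++ fs ⟩
    length fs + length ts                       ≡⟨ cong₂ _+_ (length-map (false ∷_) (submasks u)) (length-map (true ∷_) (submasks u)) ⟩
    length (submasks u) + length (submasks u)   ≡⟨ cong₂ _+_ (length-submasks u) (length-submasks u) ⟩
    2 ^ count u + 2 ^ count u                   ≡⟨ 2^suc (count u) ⟨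
    2 ^ suc (count u)                           ∎
    where
    open ≡-Reasoning
    fs = List.map (false ∷_) (submasks u)
    ts = List.map (true ∷_) (submasks u)

  split-∈ : ∀ {b} {u t x : Mask b} → Split u t x → t ∈ submasks u
  split-∈ []      = here refl
  split-∈ (out s) = ∈-map⁺ (false ∷_) (split-∈ s)
  split-∈ {u = true ∷ u} (inT s) = ∈-resp-↭ (↭-sym (merge-↭ _≤κ?_ (List.map (false ∷_) (submasks u)) _))
    (∈-++⁺ʳ (List.map (false ∷_) (submasks u)) (∈-map⁺ (true ∷_) (split-∈ s)))
  split-∈ {u = true ∷ u} (inX s) = ∈-resp-↭ (↭-sym (merge-↭ _≤κ?_ (List.map (false ∷_) (submasks u)) _))
    (∈-++⁺ˡ (∈-map⁺ (false ∷_) (split-∈ s)))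

  ∈-split : ∀ {b} (u : Mask b) {t} → t ∈ submasks u → ∃[ x ] Split u t x
  ∈-split [] (here refl) = [] , []
  ∈-split (false ∷ u) t∈ with ∈-map⁻ (false ∷_) t∈
  ... | t′ , t′∈ , refl with ∈-split u t′∈
  ... | x , s = false ∷ x , out s
  ∈-split (true ∷ u) t∈
    with ∈-++⁻ (List.map (false ∷_) (submasks u)) (∈-resp-↭ (merge-↭ _≤κ?_ (List.map (false ∷_) (submasks u)) _) t∈)
  ... | inj₁ t∈′ with ∈-map⁻ (false ∷_) t∈′
  ...   | t′ , t′∈ , refl with ∈-split u t′∈
  ...   | x , s = true ∷ x , inX s
  ∈-split (true ∷ u) t∈ | inj₂ t∈′ with ∈-map⁻ (true ∷_) t∈′
  ...   | t′ , t′∈ , refl with ∈-split u t′∈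
  ...   | x , s = false ∷ x , inT s

  Ordered : ∀ {b} → List (Mask b) → Set
  Ordered = AllPairs (λ x y → weigh κ x ≤ weigh κ y)

  ordered-merge : ∀ {b} (xs ys : List (Mask b)) → Ordered xs → Ordered ys → Ordered (merge _≤κ?_ xs ys)
  ordered-merge [] ys oxs oys = oys
  ordered-merge (x ∷ xs) [] oxs oys = oxs
  ordered-merge (x ∷ xs) (y ∷ ys) (x≤ ∷ oxs) (y≤ ∷ oys)
    with x ≤κ? y | ordered-merge xs (y ∷ ys) oxs (y≤ ∷ oys) | ordered-merge (x ∷ xs) ys (x≤ ∷ oxs) oys
  ... | yes x≤y | rec | _ rewrite ≤ᵇ-true x≤y = All-resp-↭ (↭-sym (merge-↭ _≤κ?_ xs (y ∷ ys)))
          (LAllP.++⁺ x≤ (x≤y ∷ LAll.map (≤-trans x≤y) y≤)) ∷ rec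
  ... | no x≰y | _ | rec rewrite ≤ᵇ-false (≰⇒> x≰y) = All-resp-↭ (↭-sym (merge-↭ _≤κ?_ (x ∷ xs) ys))
          (LAllP.++⁺ (<⇒≤ (≰⇒> x≰y) ∷ LAll.map (≤-trans (<⇒≤ (≰⇒> x≰y))) x≤) y≤) ∷ rec

  ordered-submasks : ∀ {b} (u : Mask b) → Ordered (submasks u)
  ordered-submasks [] = [] ∷ []
  ordered-submasks (false ∷ u) = APP.map⁺ (ordered-submasks u)
  ordered-submasks {suc b} (true ∷ u) = ordered-merge _ _ (APP.map⁺ (ordered-submasks u))
    (APP.map⁺ (AllPairs.map (+-monoʳ-≤ (κ b)) (ordered-submasks u)))

  nth-ordered : ∀ {b} {xs : List (Mask b)} → Ordered xs → ∀ {i j} → i ≤ j → j < length xs →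
    weigh κ (nth xs i) ≤ weigh κ (nth xs j)
  nth-ordered (x≤ ∷ o) {zero}  {zero}  _ _ = ≤-refl
  nth-ordered {xs = x ∷ xs} (x≤ ∷ o) {zero} {suc j} _ (s≤s j<) = LAll.lookup x≤ (nth-∈ xs j<)
  nth-ordered (x≤ ∷ o) {suc i} {suc j} (s≤s i≤j) (s≤s j<) = nth-ordered o i≤j j<

  -- one step of merging the remainders drop a xs and drop c ys
  module MergeStep {b} (xs ys : List (Mask b)) {a c k : ℕ}
    (inv : drop k (merge _≤κ?_ xs ys) ≡ merge _≤κ?_ (drop a xs) (drop c ys)) where

    Next : ℕ → ℕ → Mask b → Set
    Next a′ c′ x = nth (merge _≤κ?_ xs ys) k ≡ x ×
      drop (suc k) (merge _≤κ?_ xs ys) ≡ merge _≤κ?_ (drop a′ xs) (drop c′ ys)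

    merge-[] : ∀ (zs : List (Mask b)) → merge _≤κ?_ zs [] ≡ zs
    merge-[] []       = refl
    merge-[] (z ∷ zs) = refl

    takeˡ : a < length xs → (c < length ys → weigh κ (nth xs a) ≤ weigh κ (nth ys c)) → Next (suc a) c (nth xs a)
    takeˡ a< le with c <? length ys
    ... | no c≮ = drop-head (merge _≤κ?_ xs ys) (trans inv (trans (cong₂ (merge _≤κ?_) (drop-nth xs a<) ys≡[])
          (cong (nth xs a ∷_) (sym (trans (cong (merge _≤κ?_ (drop (suc a) xs)) ys≡[]) (merge-[] _))))))
      where ys≡[] = drop-all ys (≮⇒≥ c≮)
    ... | yes c< = drop-head (merge _≤κ?_ xs ys) (trans inv (trans (cong₂ (merge _≤κ?_) (drop-nth xs a<) (drop-nth ys c<))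
          (trans step (cong (λ z → nth xs a ∷ merge _≤κ?_ (drop (suc a) xs) z) (sym (drop-nth ys c<))))))
      where
      step : merge _≤κ?_ (nth xs a ∷ drop (suc a) xs) (nth ys c ∷ drop (suc c) ys) ≡
             nth xs a ∷ merge _≤κ?_ (drop (suc a) xs) (nth ys c ∷ drop (suc c) ys)
      step rewrite ≤ᵇ-true (le c<) = refl

    takeʳ : c < length ys → (a < length xs → weigh κ (nth ys c) < weigh κ (nth xs a)) → Next a (suc c) (nth ys c)
    takeʳ c< lt with a <? length xs
    ... | no a≮ = drop-head (merge _≤κ?_ xs ys) (trans inv (trans (cong₂ (merge _≤κ?_) xs≡[] (drop-nth ys c<))
          (cong (nth ys c ∷_) (sym (cong (λ z → merge _≤κ?_ z (drop (suc c) ys)) xs≡[])))))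
      where xs≡[] = drop-all xs (≮⇒≥ a≮)
    ... | yes a< = drop-head (merge _≤κ?_ xs ys) (trans inv (trans (cong₂ (merge _≤κ?_) (drop-nth xs a<) (drop-nth ys c<))
          (trans step (cong (λ z → nth ys c ∷ merge _≤κ?_ z (drop (suc c) ys)) (sym (drop-nth xs a<))))))
      where
      step : merge _≤κ?_ (nth xs a ∷ drop (suc a) xs) (nth ys c ∷ drop (suc c) ys) ≡
             nth ys c ∷ merge _≤κ?_ (nth xs a ∷ drop (suc a) xs) (drop (suc c) ys)
      step rewrite ≤ᵇ-false (lt a<) = refl

-- Costs of sets and of partitions

module Costs (p w : ℕ → ℕ) where

  -- The cost of processing the jobs of a mask in increasing order on one machine.
  cost : ∀ {b} → Mask b → ℕ
  cost []                  = 0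
  cost {suc b} (true  ∷ v) = cost v + w b * (weigh p v + p b)
  cost {suc b} (false ∷ v) = cost v

  cost-∅ : ∀ b → cost (∅ {b}) ≡ 0
  cost-∅ zero    = refl
  cost-∅ (suc b) = cost-∅ b

  cost-low : ∀ l {f} (v : Mask f) → cost (∅ {l} ⧺ v) ≡ cost v
  cost-low zero v    = refl
  cost-low (suc l) v = cost-low l v

  -- The jobs of `h` have the larger indices and run after those of `v`; each is delayed by the
  -- total length `weigh p v` of the latter.
  cost-++ : ∀ {l f} (h : Mask l) (v : Mask f) →
    cost (h ⧺ v) ≡ cost v + weigh p v * weigh w (h ⧺ ∅ {f}) + cost (h ⧺ ∅ {f})
  cost-++ {f = f} [] v rewrite weigh-∅ w f | cost-∅ f | *-zeroʳ (weigh p v) | +-identityʳ (cost v) | +-identityʳ (cost v) = refl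
  cost-++ {suc l} {f} (true ∷ h) v = trans
    (cong₂ (λ c s → c + w (l + f) * (s + p (l + f))) (cost-++ h v) (weigh-++ p h v))
    (eq (cost v) (weigh p v) (weigh w (h ⧺ ∅ {f})) (cost (h ⧺ ∅ {f})) (w (l + f)) (weigh p (h ⧺ ∅ {f})) (p (l + f)))
    where
    eq : ∀ c s t d x y z → c + s * t + d + x * (y + s + z) ≡ c + s * (x + t) + (d + x * (y + z))
    eq = solve-∀
  cost-++ (false ∷ h) v = cost-++ h v

  -- Without idle time, no completion time on a machine exceeds the total processing time.
  cost≤ : ∀ {b} (v : Mask b) → cost v ≤ sumBelow b p * sumBelow b w
  cost≤ [] = z≤n
  cost≤ {suc b} (true ∷ v) = begin
    cost v + w b * (weigh p v + p b)                    ≤⟨ +-mono-≤ (cost≤ v) (*-monoʳ-≤ (w b) (+-monoˡ-≤ (p b) (weigh≤ p v))) ⟩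
    sumBelow b p * sumBelow b w + w b * (sumBelow b p + p b) ≤⟨ m≤m+n _ (p b * sumBelow b w) ⟩
    sumBelow b p * sumBelow b w + w b * (sumBelow b p + p b) + p b * sumBelow b w
      ≡⟨ eq (sumBelow b p) (sumBelow b w) (p b) (w b) ⟩
    (sumBelow b p + p b) * (sumBelow b w + w b)         ∎
    where
    open ≤-Reasoning
    eq : ∀ s t x y → s * t + y * (s + x) + x * t ≡ (s + x) * (t + y)
    eq = solve-∀
  cost≤ {suc b} (false ∷ v) = ≤-trans (cost≤ v) (*-mono-≤ (m≤m+n (sumBelow b p) (p b)) (m≤m+n (sumBelow b w) (w b)))

  -- Part k v a: the jobs of v can be distributed to k machines at total cost a.
  data Part : ℕ → ∀ {b} → Mask b → ℕ → Set where
    nil  : ∀ {b} → Part 0 (∅ {b}) 0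
    cons : ∀ {k b} {v t x : Mask b} {a} → Split v t x → Part k x a → Part (suc k) v (cost t + a)

  Best : ℕ → ∀ {b} → Mask b → ℕ → Set
  Best k v a = Part k v a × (∀ {a′} → Part k v a′ → a ≤ a′)

  best-1 : ∀ {b} (v : Mask b) → Best 1 v (cost v)
  best-1 {b} v = subst (Part 1 v) (+-identityʳ (cost v)) (cons (split-∅ v) nil) , least
    where
    least : ∀ {a′} → Part 1 v a′ → cost v ≤ a′
    least (cons {t = t} s nil) = ≤-reflexive (trans (cong cost (sym (split-by-∅ s))) (sym (+-identityʳ (cost t))))

  best-suc : ∀ {k b} {h : Mask b → ℕ} → (∀ x → Best k x (h x)) → ∀ {v t x a} →
    Split v t x → a ≡ cost t + h x → (∀ {t x} → Split v t x → a ≤ cost t + h x) → Best (suc k) v a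
  best-suc {k} {h = h} best {v} {t} {x} s refl least = cons s (proj₁ (best x)) , least′
    where
    least′ : ∀ {a′} → Part (suc k) v a′ → cost t + h x ≤ a′
    least′ (cons {t = t′} s′ q) = ≤-trans (least s′) (+-monoʳ-≤ (cost t′) (proj₂ (best _) q))

  -- All jobs may go to one machine, the others staying empty. So the tables for several machines
  -- obey the same size bound as the costs of single sets.
  best≤cost : ∀ {k b} {v : Mask b} {a} → Best (suc k) v a → a ≤ cost v
  best≤cost {k} {b} {v} (_ , least) = ≤-trans (least (cons (split-∅ v) (empties k))) (≤-reflexive (+-identityʳ _))
    where
    empties : ∀ k → Part k (∅ {b}) 0
    empties zero    = nil
    empties (suc k) = subst (Part (suc k) ∅) (cong (_+ 0) (cost-∅ b)) (cons (split-∅ ∅) (empties k))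

  -- Labels are machines, numbered from 1; label 0 marks an absent job.
  Labels : ℕ → Set
  Labels = Vec ℕ

  having : ℕ → ∀ {b} → Labels b → Mask b
  having c = map (c ≡ᵇ_)

  support : ∀ {b} → Labels b → Mask b
  support = map (λ c → not (c ≡ᵇ 0))

  clear : ℕ → ∀ {b} → Labels b → Labels b
  clear c = map (λ d → if c ≡ᵇ d then 0 else d)

  labelCost : ∀ {b} → Labels b → ℕ
  labelCost []                  = 0
  labelCost (zero ∷ g)          = labelCost g
  labelCost {suc b} (suc c ∷ g) = labelCost g + w b * (weigh p (having (suc c) g) + p b)

  having-clear : ∀ {c d} → c ≢ d → 1 ≤ d → ∀ {b} (g : Labels b) → having d (clear c g) ≡ having d g
  having-clear c≢d 1≤d [] = refl
  having-clear {c} {d} c≢d 1≤d (e ∷ g) = cong₂ _∷_ same (having-clear c≢d 1≤d g)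
    where
    same : (d ≡ᵇ (if c ≡ᵇ e then 0 else e)) ≡ (d ≡ᵇ e)
    same with c ≟ e
    ... | yes refl rewrite ≡ᵇ-refl c | ≢⇒≡ᵇ (λ d≡c → c≢d (sym d≡c)) = ≢⇒≡ᵇ {d} {0} λ { refl → <⇒≱ 1≤d z≤n }
    ... | no c≢e rewrite ≢⇒≡ᵇ c≢e = refl

  -- Jobs on different machines do not delay each other, so one machine can be split off.
  labelCost-clear : ∀ c {b} (g : Labels b) → labelCost g ≡ cost (having (suc c) g) + labelCost (clear (suc c) g)
  labelCost-clear c [] = refl
  labelCost-clear c (zero ∷ g) = labelCost-clear c g
  labelCost-clear c {suc b} (suc d ∷ g) with c ≟ d
  ... | yes refl rewrite ≡ᵇ-refl c | labelCost-clear c g =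
    eq (cost (having (suc c) g)) (labelCost (clear (suc c) g)) (w b * (weigh p (having (suc c) g) + p b))
    where
    eq : ∀ x y z → x + y + z ≡ x + z + y
    eq = solve-∀
  ... | no c≢d rewrite ≢⇒≡ᵇ c≢d | having-clear {suc c} {suc d} (λ e → c≢d (suc-injective e)) (s≤s z≤n) g | labelCost-clear c g =
    +-assoc (cost (having (suc c) g)) _ _

  split-clear : ∀ c {b} (g : Labels b) → Split (support g) (having (suc c) g) (support (clear (suc c) g))
  split-clear c [] = []
  split-clear c (zero ∷ g) = out (split-clear c g)
  split-clear c (suc d ∷ g) with c ≟ d
  ... | yes refl rewrite ≡ᵇ-refl c = inT (split-clear c g)
  ... | no c≢d rewrite ≢⇒≡ᵇ c≢d = inX (split-clear c g)

  part-clear : ∀ c {k b} (g : Labels b) → Part k (support (clear (suc c) g)) (labelCost (clear (suc c) g)) →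
    Part (suc k) (support g) (labelCost g)
  part-clear c g q = subst (Part _ (support g)) (sym (labelCost-clear c g)) (cons (split-clear c g) q)

  part-absent : ∀ {b} (g : Labels b) → AllV (_≤ 0) g → Part 0 (support g) (labelCost g)
  part-absent g h = subst₂ (Part 0) (sym (proj₁ (absent g h))) (sym (proj₂ (absent g h))) nil
    where
    absent : ∀ {b} (g : Labels b) → AllV (_≤ 0) g → support g ≡ ∅ × labelCost g ≡ 0
    absent [] [] = refl , refl
    absent (zero ∷ g) (_ ∷ h) = cong (false ∷_) (proj₁ (absent g h)) , proj₂ (absent g h)

  clear-≤ : ∀ {k b} (g : Labels b) → AllV (_≤ suc k) g → AllV (_≤ k) (clear (suc k) g)
  clear-≤ [] [] = []
  clear-≤ {k} (d ∷ g) (d≤ ∷ h) = le ∷ clear-≤ g h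
    where
    le : (if suc k ≡ᵇ d then 0 else d) ≤ k
    le with suc k ≟ d
    ... | yes refl rewrite ≡ᵇ-refl k = z≤n
    ... | no k≢d rewrite ≢⇒≡ᵇ k≢d = ≤-pred (≤∧≢⇒< d≤ (λ eq → k≢d (sym eq)))

  -- The machine with the largest label is removed in each step and becomes one `cons`.
  part-labels : ∀ k {b} (g : Labels b) → AllV (_≤ k) g → Part k (support g) (labelCost g)
  part-labels zero g h    = part-absent g h
  part-labels (suc k) g h = part-clear k g (part-labels k (clear (suc k) g) (clear-≤ g h))

  some-label : ∀ {b} (g : Labels b) → AllV (_≤ 0) g ⊎ ∃[ c ] 1 ≤ count (having (suc c) g)
  some-label [] = inj₁ []
  some-label (suc c ∷ g) = inj₂ (c , pos)
    where
    pos : 1 ≤ count (having (suc c) (suc c ∷ g))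
    pos rewrite ≡ᵇ-refl c = s≤s z≤n
  some-label (zero ∷ g) with some-label g
  ... | inj₁ h       = inj₁ (z≤n ∷ h)
  ... | inj₂ (c , h) = inj₂ (c , h)

  -- Empty machines are not needed, so as many machines as jobs suffice.
  part-count : ∀ k {b} (g : Labels b) → count (support g) ≤ k → Part k (support g) (labelCost g)
  part-count k g h with some-label g
  part-count zero g h | inj₁ absent = part-absent g absent
  part-count (suc k) g h | inj₁ absent =
    part-labels (suc k) g (VAll.map (λ c≤0 → ≤-trans c≤0 z≤n) absent)
  part-count zero g h | inj₂ (c , pos) =
    ⊥-elim (<⇒≱ pos (≤-trans (m≤m+n _ _) (≤-trans (≤-reflexive (sym (split-count (split-clear c g)))) h)))
  part-count (suc k) g h | inj₂ (c , pos) = part-clear c g (part-count k (clear (suc c) g) (≤-pred (begin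
    suc (count (support (clear (suc c) g)))                      ≤⟨ +-monoˡ-≤ _ pos ⟩
    count (having (suc c) g) + count (support (clear (suc c) g)) ≡⟨ split-count (split-clear c g) ⟨
    count (support g)                                            ≤⟨ h ⟩
    suc k                                                        ∎)))
    where open ≤-Reasoning

  record Labelling (k : ℕ) {b} (v : Mask b) (a : ℕ) : Set where
    constructor labelling
    field
      labels   : Labels b
      labels≤  : AllV (_≤ k) labels
      support≡ : support labels ≡ v
      cost≡    : labelCost labels ≡ a

  overlay : ∀ {b} → ℕ → Mask b → Labels b → Labels b
  overlay c [] [] = []
  overlay c (t ∷ ts) (d ∷ g) = (if t then c else d) ∷ overlay c ts g

  overlay-≤ : ∀ {k b} (t : Mask b) {g : Labels b} → AllV (_≤ k) g → AllV (_≤ suc k) (overlay (suc k) t g)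
  overlay-≤ [] [] = []
  overlay-≤ (true ∷ t)  (_ ∷ h)  = ≤-refl ∷ overlay-≤ t h
  overlay-≤ (false ∷ t) (d≤ ∷ h) = m≤n⇒m≤1+n d≤ ∷ overlay-≤ t h

  -- The labels of `g` are at most `k`, so `suc k` is fresh: the jobs of the new machine can be
  -- recovered from their label, and clearing it gives back `g`.
  overlay-parts : ∀ {k b} {v t x : Mask b} {g : Labels b} → Split v t x → AllV (_≤ k) g → support g ≡ x →
    support (overlay (suc k) t g) ≡ v × having (suc k) (overlay (suc k) t g) ≡ t × clear (suc k) (overlay (suc k) t g) ≡ g
  overlay-parts [] [] refl = refl , refl , refl
  overlay-parts {g = zero ∷ g} (out s) (_ ∷ h) refl with overlay-parts s h refl
  ... | p , q , r = cong (false ∷_) p , cong (false ∷_) q , cong (0 ∷_) r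
  overlay-parts {k} {g = zero ∷ g} (inT s) (_ ∷ h) refl with overlay-parts s h refl
  ... | p , q , r rewrite ≡ᵇ-refl k = cong (true ∷_) p , cong (true ∷_) q , cong (0 ∷_) r
  overlay-parts {k} {g = suc d ∷ g} (inX s) (d≤ ∷ h) refl with overlay-parts s h refl
  ... | p , q , r rewrite ≢⇒≡ᵇ {k} {d} (λ { refl → <⇒≱ d≤ ≤-refl }) = cong (true ∷_) p , cong (false ∷_) q , cong (suc d ∷_) r
  overlay-parts {g = suc d ∷ g} (out s) (_ ∷ h) ()
  overlay-parts {g = suc d ∷ g} (inT s) (_ ∷ h) ()
  overlay-parts {g = zero ∷ g} (inX s) (_ ∷ h) ()

  label-part : ∀ {k b} {v : Mask b} {a} → Part k v a → Labelling k v a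
  label-part {b = b} nil = labelling (replicate b 0) (absent b) (support-absent b) (cost-absent b)
    where
    absent : ∀ b → AllV (_≤ 0) (replicate b 0)
    absent zero    = []
    absent (suc b) = z≤n ∷ absent b
    support-absent : ∀ b → support (replicate b 0) ≡ ∅
    support-absent zero    = refl
    support-absent (suc b) = cong (false ∷_) (support-absent b)
    cost-absent : ∀ b → labelCost (replicate b 0) ≡ 0
    cost-absent zero    = refl
    cost-absent (suc b) = cost-absent b
  label-part (cons {k} {t = t} s q) with label-part q
  ... | labelling g g≤ g≡ refl with overlay-parts s g≤ g≡
  ... | p , q′ , r = labelling (overlay (suc k) t g) (overlay-≤ t g≤) p
    (trans (labelCost-clear k (overlay (suc k) t g)) (cong₂ _+_ (cong cost q′) (cong labelCost r)))

-- Rational schedules and partitions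

toℚᵘ-fromℕ : ∀ a → ℚ.toℚᵘ (fromℕ a) ℚᵘ.≃ ℚᵘ.mkℚᵘ (ℤ.+ a) 0
toℚᵘ-fromℕ a = ℚ.toℚᵘ-fromℚᵘ (ℚᵘ.mkℚᵘ (ℤ.+ a) 0)

-- Shown for unnormalised rationals, where the sum of two fractions with denominator 1 is an
-- identity between integers.
fromℕ-+ : ∀ a b → fromℕ (a + b) ≡ fromℕ a ℚ.+ fromℕ b
fromℕ-+ a b = ℚ.toℚᵘ-injective (begin-equality
  ℚ.toℚᵘ (fromℕ (a + b))                          ≃⟨ toℚᵘ-fromℕ (a + b) ⟩
  ℚᵘ.mkℚᵘ (ℤ.+ (a + b)) 0                          ≃⟨ ℚᵘ.*≡* (cong (ℤ._* ℤ.1ℤ) (cong₂ ℤ._+_ (sym (ℤ.*-identityʳ (ℤ.+ a))) (sym (ℤ.*-identityʳ (ℤ.+ b))))) ⟩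
  ℚᵘ.mkℚᵘ (ℤ.+ a) 0 ℚᵘ.+ ℚᵘ.mkℚᵘ (ℤ.+ b) 0          ≃⟨ ℚᵘ.+-cong (toℚᵘ-fromℕ a) (toℚᵘ-fromℕ b) ⟨
  ℚ.toℚᵘ (fromℕ a) ℚᵘ.+ ℚ.toℚᵘ (fromℕ b)           ≃⟨ ℚ.toℚᵘ-homo-+ (fromℕ a) (fromℕ b) ⟨
  ℚ.toℚᵘ (fromℕ a ℚ.+ fromℕ b)                    ∎)
  where open ℚᵘ.≤-Reasoning

fromℕ-* : ∀ a b → fromℕ (a * b) ≡ fromℕ a ℚ.* fromℕ b
fromℕ-* a b = ℚ.toℚᵘ-injective (begin-equality
  ℚ.toℚᵘ (fromℕ (a * b))                          ≃⟨ toℚᵘ-fromℕ (a * b) ⟩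
  ℚᵘ.mkℚᵘ (ℤ.+ (a * b)) 0                          ≃⟨ ℚᵘ.*≡* (cong (ℤ._* ℤ.1ℤ) (ℤ.pos-* a b)) ⟩
  ℚᵘ.mkℚᵘ (ℤ.+ a) 0 ℚᵘ.* ℚᵘ.mkℚᵘ (ℤ.+ b) 0          ≃⟨ ℚᵘ.*-cong (toℚᵘ-fromℕ a) (toℚᵘ-fromℕ b) ⟨
  ℚ.toℚᵘ (fromℕ a) ℚᵘ.* ℚ.toℚᵘ (fromℕ b)           ≃⟨ ℚ.toℚᵘ-homo-* (fromℕ a) (fromℕ b) ⟨
  ℚ.toℚᵘ (fromℕ a ℚ.* fromℕ b)                    ∎)
  where open ℚᵘ.≤-Reasoning

fromℕ-≤ : ∀ {a b} → a ≤ b → fromℕ a ℚ.≤ fromℕ b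
fromℕ-≤ {a} {b} a≤b = ℚ.toℚᵘ-cancel-≤ (begin
  ℚ.toℚᵘ (fromℕ a)    ≃⟨ toℚᵘ-fromℕ a ⟩
  ℚᵘ.mkℚᵘ (ℤ.+ a) 0    ≤⟨ ℚᵘ.*≤* (ℤ.*-monoʳ-≤-nonNeg ℤ.1ℤ (ℤ.+≤+ a≤b)) ⟩
  ℚᵘ.mkℚᵘ (ℤ.+ b) 0    ≃⟨ toℚᵘ-fromℕ b ⟨
  ℚ.toℚᵘ (fromℕ b)    ∎)
  where open ℚᵘ.≤-Reasoning

fromℕ-< : ∀ {a b} → a < b → fromℕ a ℚ.< fromℕ b
fromℕ-< {a} {b} a<b = ℚ.toℚᵘ-cancel-< (begin-strict
  ℚ.toℚᵘ (fromℕ a)    ≃⟨ toℚᵘ-fromℕ a ⟩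
  ℚᵘ.mkℚᵘ (ℤ.+ a) 0    <⟨ ℚᵘ.*<* (ℤ.*-monoʳ-<-pos ℤ.1ℤ (ℤ.+<+ a<b)) ⟩
  ℚᵘ.mkℚᵘ (ℤ.+ b) 0    ≃⟨ toℚᵘ-fromℕ b ⟨
  ℚ.toℚᵘ (fromℕ b)    ∎)
  where open ℚᵘ.≤-Reasoning

∑ : ∀ {n} → (Fin n → ℕ) → ℕ
∑ {zero}  f = 0
∑ {suc n} f = f zero + ∑ (f ∘ suc)

∑ℚ : ∀ {n} → (Fin n → ℚ) → ℚ
∑ℚ = RawMonoidDefs.sum ℚ.+-0-rawMonoid

∑-+ : ∀ {n} (f g : Fin n → ℕ) → ∑ (λ i → f i + g i) ≡ ∑ f + ∑ g
∑-+ {zero} f g  = refl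
∑-+ {suc n} f g rewrite ∑-+ (f ∘ suc) (g ∘ suc) = eq (f zero) (g zero) _ _
  where
  eq : ∀ a b c d → a + b + (c + d) ≡ a + c + (b + d)
  eq = solve-∀

∑-≤ : ∀ {n} {f g : Fin n → ℕ} → (∀ i → f i ≤ g i) → ∑ f ≤ ∑ g
∑-≤ {zero} h  = z≤n
∑-≤ {suc n} h = +-mono-≤ (h zero) (∑-≤ (h ∘ suc))

∑-* : ∀ {n} c (f : Fin n → ℕ) → ∑ (λ i → c * f i) ≡ c * ∑ f
∑-* {zero} c f  = sym (*-zeroʳ c)
∑-* {suc n} c f rewrite ∑-* c (f ∘ suc) = sym (*-distribˡ-+ c (f zero) _)

fromℕ-∑ : ∀ {n} (f : Fin n → ℕ) (g : Fin n → ℚ) → (∀ i → fromℕ (f i) ℚ.≤ g i) → fromℕ (∑ f) ℚ.≤ ∑ℚ g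
fromℕ-∑ {zero} f g h  = ℚ.≤-refl
fromℕ-∑ {suc n} f g h = subst (ℚ._≤ ∑ℚ g) (sym (fromℕ-+ (f zero) _)) (ℚ.+-mono-≤ (h zero) (fromℕ-∑ (f ∘ suc) (g ∘ suc) (h ∘ suc)))

∑ℚ-fromℕ : ∀ {n} (f : Fin n → ℕ) (g : Fin n → ℚ) → (∀ i → g i ≡ fromℕ (f i)) → ∑ℚ g ≡ fromℕ (∑ f)
∑ℚ-fromℕ {zero} f g h  = refl
∑ℚ-fromℕ {suc n} f g h = trans (cong₂ ℚ._+_ (h zero) (∑ℚ-fromℕ (f ∘ suc) (g ∘ suc) (h ∘ suc))) (sym (fromℕ-+ (f zero) _))

∑-tabulate : ∀ {n} {A : Set} (g : A → ℕ) (f : Fin n → A) → sum (List.map g (tabulate f)) ≡ ∑ (g ∘ f)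
∑-tabulate {zero} g f  = refl
∑-tabulate {suc n} g f = cong (g (f zero) +_) (∑-tabulate g (f ∘ suc))

-- The embedding ι is fromℕ, kept abstract so that sums in ℚ are not normalised.
module Packing (ι : ℕ → ℚ) (ι-0 : ι 0 ≡ 0ℚ) (ι-+ : ∀ a b → ι (a + b) ≡ ι a ℚ.+ ι b)
               (ι-≤ : ∀ {a b} → a ≤ b → ι a ℚ.≤ ι b) where

  Within : ℚ → ℚ → ℚ → ℕ → Set
  Within lo hi s ℓ = lo ℚ.≤ s × s ℚ.+ ι ℓ ℚ.≤ hi

  within? : ∀ lo hi s ℓ → Dec (Within lo hi s ℓ)
  within? lo hi s ℓ with lo ℚ.≤? s | s ℚ.+ ι ℓ ℚ.≤? hi
  ... | yes p | yes q = yes (p , q)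
  ... | no ¬p | _     = no (¬p ∘ proj₁)
  ... | yes _ | no ¬q = no (¬q ∘ proj₂)

  within : ℚ → ℚ → ℚ → ℕ → ℕ
  within lo hi s ℓ = if does (within? lo hi s ℓ) then ℓ else 0

  within-inside : ∀ {lo hi s ℓ} → Within lo hi s ℓ → within lo hi s ℓ ≡ ℓ
  within-inside {lo} {hi} {s} {ℓ} h with within? lo hi s ℓ
  ... | yes _ = refl
  ... | no ¬h = ⊥-elim (¬h h)

  -- Intervals of length 0 are exempt. A job with processing time 0 is never `ProcessedAt` any time,
  -- so a schedule may start it in the middle of another job on the same machine.
  Disjoint : ∀ {n} → (Fin n → ℚ) → (Fin n → ℕ) → Set
  Disjoint S ℓ = ∀ {i j} → i ≢ j → ℓ i ≡ 0 ⊎ ℓ j ≡ 0 ⊎ S i ℚ.+ ι (ℓ i) ℚ.≤ S j ⊎ S j ℚ.+ ι (ℓ j) ℚ.≤ S i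

  -- If the first interval lies within [lo , hi], then the others within
  -- [lo , hi] lie to its left or to its right.
  packing : ∀ {n} (S : Fin n → ℚ) (ℓ : Fin n → ℕ) → Disjoint S ℓ → ∀ {lo hi} → lo ℚ.≤ hi →
    lo ℚ.+ ι (∑ (λ i → within lo hi (S i) (ℓ i))) ℚ.≤ hi
  packing {zero} S ℓ dis {lo} {hi} lo≤hi = subst (ℚ._≤ hi) (sym (trans (cong (lo ℚ.+_) ι-0) (ℚ.+-identityʳ lo))) lo≤hi
  packing {suc n} S ℓ dis {lo} {hi} lo≤hi with within? lo hi (S zero) (ℓ zero) | ℓ zero ≟ 0
  ... | no _ | _ = packing (S ∘ suc) (ℓ ∘ suc) (λ i≢j → dis (i≢j ∘ Finₚ.suc-injective)) lo≤hi
  -- An empty interval cannot serve as a cut, as another interval may contain it; it adds nothing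
  -- and is dropped.
  ... | yes _ | yes ℓ≡0 rewrite ℓ≡0 = packing (S ∘ suc) (ℓ ∘ suc) (λ i≢j → dis (i≢j ∘ Finₚ.suc-injective)) lo≤hi
  ... | yes (lo≤s , c≤hi) | no ℓ≢0 = begin
    lo ℚ.+ ι (ℓ zero + ∑ all)                                   ≤⟨ ℚ.+-monoʳ-≤ lo (ι-≤ (+-monoʳ-≤ (ℓ zero) (∑-≤ sides))) ⟩
    lo ℚ.+ ι (ℓ zero + ∑ (λ i → left i + right i))              ≡⟨ cong (λ x → lo ℚ.+ ι (ℓ zero + x)) (∑-+ left right) ⟩
    lo ℚ.+ ι (ℓ zero + (∑ left + ∑ right))                      ≡⟨ cong (λ x → lo ℚ.+ ι x) (eq (ℓ zero) (∑ left) (∑ right)) ⟩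
    lo ℚ.+ ι (∑ left + (ℓ zero + ∑ right))                      ≡⟨ cong (lo ℚ.+_) (ι-+ (∑ left) (ℓ zero + ∑ right)) ⟩
    lo ℚ.+ (ι (∑ left) ℚ.+ ι (ℓ zero + ∑ right))            ≡⟨ ℚ.+-assoc lo (ι (∑ left)) (ι (ℓ zero + ∑ right)) ⟨
    lo ℚ.+ ι (∑ left) ℚ.+ ι (ℓ zero + ∑ right)              ≤⟨ ℚ.+-monoˡ-≤ (ι (ℓ zero + ∑ right)) (packing (S ∘ suc) (ℓ ∘ suc) dis′ lo≤s) ⟩
    S zero ℚ.+ ι (ℓ zero + ∑ right)                             ≡⟨ cong (S zero ℚ.+_) (ι-+ (ℓ zero) (∑ right)) ⟩
    S zero ℚ.+ (ι (ℓ zero) ℚ.+ ι (∑ right))                 ≡⟨ ℚ.+-assoc (S zero) (ι (ℓ zero)) (ι (∑ right)) ⟨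
    S zero ℚ.+ ι (ℓ zero) ℚ.+ ι (∑ right)                   ≤⟨ packing (S ∘ suc) (ℓ ∘ suc) dis′ c≤hi ⟩
    hi                                                              ∎
    where
    open ℚ.≤-Reasoning
    dis′ : Disjoint (S ∘ suc) (ℓ ∘ suc)
    dis′ i≢j = dis (i≢j ∘ Finₚ.suc-injective)
    all left right : Fin n → ℕ
    all i   = within lo hi (S (suc i)) (ℓ (suc i))
    left i  = within lo (S zero) (S (suc i)) (ℓ (suc i))
    right i = within (S zero ℚ.+ ι (ℓ zero)) hi (S (suc i)) (ℓ (suc i))
    eq : ∀ a b c → a + (b + c) ≡ b + (a + c)
    eq = solve-∀
    sides : ∀ i → all i ≤ left i + right i
    sides i with within? lo hi (S (suc i)) (ℓ (suc i))
    ... | no _ = z≤n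
    ... | yes (lo≤ , ≤hi) with dis {zero} {suc i} (λ ())
    ...   | inj₁ ℓ≡0               = ⊥-elim (ℓ≢0 ℓ≡0)
    ...   | inj₂ (inj₁ ℓ≡0)        = subst (_≤ left i + right i) (sym ℓ≡0) z≤n
    ...   | inj₂ (inj₂ (inj₁ c≤))  = ≤-trans (≤-reflexive (sym (within-inside (c≤ , ≤hi)))) (m≤n+m _ (left i))
    ...   | inj₂ (inj₂ (inj₂ ≤s))  = ≤-trans (≤-reflexive (sym (within-inside (lo≤ , ≤s)))) (m≤m+n _ (right i))

open Packing fromℕ refl fromℕ-+ fromℕ-≤

-- ((p , w) , c) is a job on machine c
Labelled : Set
Labelled = (ℕ × ℕ) × ℕ

pairCost : Labelled → Labelled → ℕ
pairCost ((p , w) , c) ((p′ , w′) , c′) = if c ≡ᵇ c′ then (p * w′) ⊓ (p′ * w) else 0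

-- In an optimal order each pair of jobs on the same machine contributes
-- the smaller one of its two possible contributions.
pairsCost : List Labelled → ℕ
pairsCost []       = 0
pairsCost (x ∷ xs) = pairCost x x + sum (List.map (pairCost x) xs) + pairsCost xs

pairCost-comm : ∀ x y → pairCost x y ≡ pairCost y x
pairCost-comm ((p , w) , c) ((p′ , w′) , c′) with c ≟ c′
... | yes refl rewrite ≡ᵇ-refl c = ⊓-comm (p * w′) (p′ * w)
... | no c≢c′ rewrite ≢⇒≡ᵇ c≢c′ | ≢⇒≡ᵇ (≢-sym c≢c′) = refl

-- Holds because `pairCost` is symmetric. It relates the jobs in the order of the instance, in which
-- schedules are given, to the sorted order, in which partitions are evaluated.
pairsCost-↭ : ∀ {xs ys} → xs ↭ ys → pairsCost xs ≡ pairsCost ys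
pairsCost-↭ Perm.refl = refl
pairsCost-↭ (Perm.prep x p) = cong₂ (λ a b → pairCost x x + a + b) (sum-↭ (↭-map⁺ (pairCost x) p)) (pairsCost-↭ p)
pairsCost-↭ (Perm.swap x y p)
  rewrite sum-↭ (↭-map⁺ (pairCost x) p) | sum-↭ (↭-map⁺ (pairCost y) p) | pairsCost-↭ p | pairCost-comm x y =
  eq (pairCost x x) (pairCost y x) _ (pairCost y y) _ _
  where
  eq : ∀ a b c d e f → a + (b + c) + (d + e + f) ≡ d + (b + e) + (a + c + f)
  eq = solve-∀
pairsCost-↭ (Perm.trans p q) = trans (pairsCost-↭ p) (pairsCost-↭ q)

pairsCost-tabulate : ∀ {n} (J : Fin n → Labelled) (a : Fin n → Fin n → ℕ) →
  (∀ i → pairCost (J i) (J i) ≤ a i i) → (∀ {i j} → i ≢ j → pairCost (J i) (J j) ≤ a i j + a j i) →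
  pairsCost (tabulate J) ≤ ∑ (λ i → ∑ (a i))
pairsCost-tabulate {zero} J a h h′ = z≤n
pairsCost-tabulate {suc n} J a h h′ = begin
  pairCost (J zero) (J zero) + sum (List.map (pairCost (J zero)) (tabulate (J ∘ suc))) + pairsCost (tabulate (J ∘ suc))
    ≤⟨ +-mono-≤ (+-mono-≤ (h zero) (≤-trans (≤-reflexive (∑-tabulate (pairCost (J zero)) (J ∘ suc))) (∑-≤ λ i → h′ {zero} {suc i} λ ())))
         (pairsCost-tabulate (J ∘ suc) (λ i j → a (suc i) (suc j)) (h ∘ suc) (λ {i} {j} i≢j → h′ {suc i} {suc j} (i≢j ∘ Finₚ.suc-injective))) ⟩
  a zero zero + ∑ (λ i → a zero (suc i) + a (suc i) zero) + rest
    ≡⟨ cong (λ x → a zero zero + x + rest) (∑-+ (a zero ∘ suc) (λ i → a (suc i) zero)) ⟩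
  a zero zero + (∑ (a zero ∘ suc) + ∑ (λ i → a (suc i) zero)) + rest
    ≡⟨ eq (a zero zero) _ _ _ ⟩
  a zero zero + ∑ (a zero ∘ suc) + (∑ (λ i → a (suc i) zero) + rest)
    ≡⟨ cong (a zero zero + ∑ (a zero ∘ suc) +_) (∑-+ (λ i → a (suc i) zero) (λ i → ∑ (a (suc i) ∘ suc))) ⟨
  ∑ (λ i → ∑ (a i))  ∎
  where
  open ≤-Reasoning
  rest = ∑ (λ i → ∑ (λ j → a (suc i) (suc j)))
  eq : ∀ a b c d → a + (b + c) + d ≡ a + b + (c + d)
  eq = solve-∀

pairCost-same : ∀ p w c p′ w′ c′ → c ≡ c′ → pairCost ((p , w) , c) ((p′ , w′) , c′) ≡ (p * w′) ⊓ (p′ * w)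
pairCost-same p w c p′ w′ c′ refl rewrite ≡ᵇ-refl c = refl

pairCost-other : ∀ p w c p′ w′ c′ → c ≢ c′ → pairCost ((p , w) , c) ((p′ , w′) , c′) ≡ 0
pairCost-other p w c p′ w′ c′ c≢c′ rewrite ≢⇒≡ᵇ c≢c′ = refl

-- `b j i` is the amount of job `i` that counts towards the completion time of `j`. Of two jobs on a
-- machine, the one that is `Before` counts fully towards the other, and this contribution alone is
-- at least the minimum in `pairCost`.
pairsCost-order : ∀ {n} (p w c : Fin n → ℕ) (Before : Fin n → Fin n → Set) (b : Fin n → Fin n → ℕ) →
  (∀ i j → Before i j ⊎ Before j i) → (∀ {i j} → c i ≡ c j → Before i j → b j i ≡ p i) →
  pairsCost (tabulate (λ j → (p j , w j) , c j)) ≤ ∑ (λ j → ∑ (λ i → w j * b j i))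
pairsCost-order {n} p w c Before b total b-before =
  pairsCost-tabulate (λ j → (p j , w j) , c j) (λ j i → w j * b j i) diagonal pairs
  where
  term : ∀ {i j} → c i ≡ c j → Before i j → p i * w j ≡ w j * b j i
  term {i} {j} same before = trans (*-comm (p i) (w j)) (cong (w j *_) (sym (b-before same before)))
  diagonal : ∀ i → pairCost ((p i , w i) , c i) ((p i , w i) , c i) ≤ w i * b i i
  diagonal i = ≤-trans (≤-reflexive (pairCost-same (p i) (w i) (c i) (p i) (w i) (c i) refl))
    (≤-trans (m⊓n≤m (p i * w i) _) (≤-reflexive (term {i} {i} refl ([ (λ x → x) , (λ x → x) ]′ (total i i)))))
  pairs : ∀ {i j} → i ≢ j → pairCost ((p i , w i) , c i) ((p j , w j) , c j) ≤ w i * b i j + w j * b j i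
  pairs {i} {j} _ with c i ≟ c j
  ... | no neq   = subst (_≤ w i * b i j + w j * b j i) (sym (pairCost-other (p i) (w i) (c i) (p j) (w j) (c j) neq)) z≤n
  ... | yes same with total i j
  ...   | inj₁ before = ≤-trans (≤-reflexive (pairCost-same (p i) (w i) (c i) (p j) (w j) (c j) same)) (≤-trans (m⊓n≤m (p i * w j) _)
            (≤-trans (≤-reflexive (term {i} {j} same before)) (m≤n+m _ (w i * b i j))))
  ...   | inj₂ before = ≤-trans (≤-reflexive (pairCost-same (p i) (w i) (c i) (p j) (w j) (c j) same)) (≤-trans (m⊓n≤n (p i * w j) _)
            (≤-trans (≤-reflexive (term {j} {i} (sym same) before)) (m≤m+n _ (w j * b j i))))

-- If neither interval ended before the other began, the later one of the two starting times would
-- lie in both.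
separate : ∀ {s c s′ c′} → s ℚ.< c → s′ ℚ.< c′ →
  (∀ t → (s ℚ.≤ t × t ℚ.< c) × (s′ ℚ.≤ t × t ℚ.< c′) → ⊥) → c ℚ.≤ s′ ⊎ c′ ℚ.≤ s
separate {s} {c} {s′} {c′} s<c s′<c′ disjoint with ℚ.≤-total s s′ | c ℚ.≤? s′ | c′ ℚ.≤? s
... | _       | yes c≤ | _      = inj₁ c≤
... | _       | _      | yes c≤ = inj₂ c≤
... | inj₁ s≤ | no c≰  | _      = ⊥-elim (disjoint s′ ((s≤ , ℚ.≰⇒> c≰) , (ℚ.≤-refl , s′<c′)))
... | inj₂ s≤ | _      | no c≰  = ⊥-elim (disjoint s ((ℚ.≤-refl , s<c) , (s≤ , ℚ.≰⇒> c≰)))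

-- Optimal schedules as optimal partitions

module Scheduling (I : Instance) where
  open Instance I

  jobLabel : (Fin jobs → ℕ) → Fin jobs → Labelled
  jobLabel c j = (processing j , weight j) , c j

  -- By `packing` into the time from 0 to the completion of `j`, that completion time is at least
  -- the total length of the jobs lying there on the same machine. Ordering the jobs by completion
  -- time, `pairsCost-order` applies.
  schedule≥pairsCost : (σ : Schedule I) → let open Schedule σ in
    fromℕ (pairsCost (tabulate (jobLabel (λ j → suc (toℕ (machine j)))))) ℚ.≤ totalWeightedCompletion
  schedule≥pairsCost σ = ℚ.≤-trans (fromℕ-≤ (pairsCost-order processing weight (λ j → suc (toℕ (machine j)))
      (λ i j → completion i ℚ.≤ completion j) b (λ i j → ℚ.≤-total (completion i) (completion j))
      (λ {i} {j} → b-before {i} {j})))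
    (fromℕ-∑ (λ j → ∑ (λ i → weight j * b j i)) (λ j → fromℕ (weight j) ℚ.* completion j) each)
    where
    open Schedule σ
    ℓ b : Fin jobs → Fin jobs → ℕ
    ℓ j i = if suc (toℕ (machine i)) ≡ᵇ suc (toℕ (machine j)) then processing i else 0
    b j i = within 0ℚ (completion j) (start i) (ℓ j i)
    ℓ-same : ∀ {i j} → toℕ (machine i) ≡ toℕ (machine j) → ℓ j i ≡ processing i
    ℓ-same {i} {j} eq = cong (if_then processing i else 0)
      (trans (cong (_≡ᵇ toℕ (machine j)) eq) (≡ᵇ-refl (toℕ (machine j))))
    ℓ-other : ∀ {i j} → machine i ≢ machine j → ℓ j i ≡ 0
    ℓ-other {i} {j} neq = cong (if_then processing i else 0) (≢⇒≡ᵇ (neq ∘ toℕ-injective))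
    b-before : ∀ {i j} → suc (toℕ (machine i)) ≡ suc (toℕ (machine j)) → completion i ℚ.≤ completion j → b j i ≡ processing i
    b-before {i} {j} same c≤ = trans (within-inside (start≥0 i ,
        subst (λ x → start i ℚ.+ fromℕ x ℚ.≤ completion j) (sym (ℓ-same {i} {j} (suc-injective same))) c≤))
      (ℓ-same {i} {j} (suc-injective same))
    after-start : ∀ i → processing i ≢ 0 → start i ℚ.< completion i
    after-start i p≢0 = subst (ℚ._< completion i) (ℚ.+-identityʳ (start i)) (ℚ.+-monoʳ-< (start i) (fromℕ-< (n≢0⇒n>0 p≢0)))
    apart : ∀ {i k} → i ≢ k → machine i ≡ machine k → processing i ≢ 0 → processing k ≢ 0 →
      completion i ℚ.≤ start k ⊎ completion k ℚ.≤ start i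
    apart {i} {k} i≢k same pi pk = separate (after-start i pi) (after-start k pk) (no-overlap i≢k same)
    disjoint : ∀ j → Disjoint start (ℓ j)
    disjoint j {i} {k} i≢k = dispatch (machine i Finₚ.≟ machine j) (machine k Finₚ.≟ machine j) (processing i ≟ 0) (processing k ≟ 0)
      where
      dispatch : Dec (machine i ≡ machine j) → Dec (machine k ≡ machine j) → Dec (processing i ≡ 0) → Dec (processing k ≡ 0) →
        ℓ j i ≡ 0 ⊎ ℓ j k ≡ 0 ⊎ start i ℚ.+ fromℕ (ℓ j i) ℚ.≤ start k ⊎ start k ℚ.+ fromℕ (ℓ j k) ℚ.≤ start i
      dispatch (no neq) _ _ _              = inj₁ (ℓ-other neq)
      dispatch (yes _) (no neq) _ _        = inj₂ (inj₁ (ℓ-other neq))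
      dispatch (yes si) (yes _) (yes pi) _ = inj₁ (trans (ℓ-same (cong toℕ si)) pi)
      dispatch (yes _) (yes sk) _ (yes pk) = inj₂ (inj₁ (trans (ℓ-same (cong toℕ sk)) pk))
      dispatch (yes si) (yes sk) (no pi) (no pk) =
        inj₂ (inj₂ (subst₂ (λ x y → start i ℚ.+ fromℕ x ℚ.≤ start k ⊎ start k ℚ.+ fromℕ y ℚ.≤ start i)
          (sym (ℓ-same (cong toℕ si))) (sym (ℓ-same (cong toℕ sk))) (apart i≢k (trans si (sym sk)) pi pk)))
    completion≥ : ∀ j → fromℕ (∑ (b j)) ℚ.≤ completion j
    completion≥ j = subst (ℚ._≤ completion j) (ℚ.+-identityˡ _) (packing start (ℓ j) (disjoint j)
      (ℚ.≤-trans (start≥0 j) (subst (ℚ._≤ completion j) (ℚ.+-identityʳ (start j)) (ℚ.+-monoʳ-≤ (start j) (fromℕ-≤ {0} {processing j} z≤n)))))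
    each : ∀ j → fromℕ (∑ (λ i → weight j * b j i)) ℚ.≤ fromℕ (weight j) ℚ.* completion j
    each j = subst (ℚ._≤ fromℕ (weight j) ℚ.* completion j)
      (sym (trans (cong fromℕ (∑-* (weight j) (b j))) (fromℕ-* (weight j) _)))
      (ℚ.*-monoˡ-≤-nonNeg (fromℕ (weight j)) {{ℚ.nonNegative (fromℕ-≤ {0} {weight j} z≤n)}} (completion≥ j))

  Placed : Set
  Placed = (ℕ × ℕ) × (ℕ × ℕ)

  -- ((p , w) , (c , s)) is a job that starts on machine c at time s
  end : Placed → ℕ
  end ((p , w) , (c , s)) = s + p

  Compatible : Placed → Placed → Set
  Compatible x@(_ , (c , s)) y@(_ , (c′ , s′)) = c ≡ c′ → end x ≤ s′ ⊎ end y ≤ s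

  compatible-sym : ∀ {x y} → Compatible x y → Compatible y x
  compatible-sym h eq = ⊎.swap (h (sym eq))

  placedCost : Placed → ℕ
  placedCost x@((p , w) , _) = w * end x

  tabulated : ∀ {A B : Set} {n} (f : Fin n → A) (xs : List (A × B)) → List.map proj₁ xs ≡ tabulate f →
    Σ[ g ∈ (Fin n → B) ] xs ≡ tabulate (λ j → f j , g j)
  tabulated {n = zero} f [] eq = (λ ()) , refl
  tabulated {n = suc n} f ((a , b) ∷ xs) eq with ∷-injective eq
  ... | refl , eq′ with tabulated (f ∘ suc) xs eq′
  ... | g , refl = (λ { zero → b ; (suc i) → g i }) , refl

  all-tabulate⁻ : ∀ {A : Set} {n} {P : A → Set} {f : Fin n → A} → All P (tabulate f) → ∀ i → P (f i)
  all-tabulate⁻ (p ∷ ps) zero    = p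
  all-tabulate⁻ (p ∷ ps) (suc i) = all-tabulate⁻ ps i

  all-tabulate⁺ : ∀ {A : Set} {n} {P : A → Set} {f : Fin n → A} → (∀ i → P (f i)) → All P (tabulate f)
  all-tabulate⁺ {n = zero} h  = []
  all-tabulate⁺ {n = suc n} h = h zero ∷ all-tabulate⁺ (h ∘ suc)

  allPairs-tabulate⁻ : ∀ {A : Set} {n} {R : A → A → Set} {f : Fin n → A} → (∀ {x y} → R x y → R y x) →
    AllPairs R (tabulate f) → ∀ {i j} → i ≢ j → R (f i) (f j)
  allPairs-tabulate⁻ R-sym (r ∷ rs) {zero}  {zero}  i≢j = ⊥-elim (i≢j refl)
  allPairs-tabulate⁻ R-sym (r ∷ rs) {zero}  {suc j} i≢j = all-tabulate⁻ r j
  allPairs-tabulate⁻ R-sym (r ∷ rs) {suc i} {zero}  i≢j = R-sym (all-tabulate⁻ r i)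
  allPairs-tabulate⁻ R-sym (r ∷ rs) {suc i} {suc j} i≢j = allPairs-tabulate⁻ R-sym rs (i≢j ∘ cong suc)

  InRange : ℕ → Set
  InRange c = 1 ≤ c × c ≤ machines

  realise : ∀ (c s : Fin jobs → ℕ) → let x = λ j → (processing j , weight j) , (c j , s j) in
    (∀ j → InRange (c j)) → (∀ {i j} → i ≢ j → Compatible (x i) (x j)) →
    Σ[ σ ∈ Schedule I ] Schedule.totalWeightedCompletion σ ≡ fromℕ (∑ (placedCost ∘ x))
  realise c s range compatible = σ , ∑ℚ-fromℕ _ _ λ j →
      trans (cong (fromℕ (weight j) ℚ.*_) (sym (fromℕ-+ (s j) (processing j)))) (sym (fromℕ-* (weight j) _))
    where
    predecessor< : ∀ {c} → InRange c → pred c < machines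
    predecessor< {suc c} (_ , c<) = c<
    machineOf : Fin jobs → Fin machines
    machineOf j = fromℕ< (predecessor< (range j))
    pred-cancel : ∀ {a b} → 1 ≤ a → 1 ≤ b → pred a ≡ pred b → a ≡ b
    pred-cancel {suc a} {suc b} _ _ eq = cong suc eq
    same-label : ∀ {i j} → machineOf i ≡ machineOf j → c i ≡ c j
    same-label {i} {j} eq = pred-cancel (proj₁ (range i)) (proj₁ (range j))
      (trans (sym (toℕ-fromℕ< (predecessor< (range i)))) (trans (cong toℕ eq) (toℕ-fromℕ< (predecessor< (range j)))))
    σ : Schedule I
    σ = record
      { assignment = record { machine = machineOf ; start = λ j → fromℕ (s j) }
      ; start≥0    = λ j → fromℕ-≤ {0} {s j} z≤n
      ; no-overlap = λ {i} {j} i≢j same t → λ ((si≤ , <ci) , (sj≤ , <cj)) →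
          [ (λ c≤ → ℚ.<-irrefl refl (ℚ.<-≤-trans <ci (ℚ.≤-trans (done i j c≤) sj≤)))
          , (λ c≤ → ℚ.<-irrefl refl (ℚ.<-≤-trans <cj (ℚ.≤-trans (done j i c≤) si≤))) ]′
          (compatible i≢j (same-label same)) }
      where
      done : ∀ i j → s i + processing i ≤ s j → fromℕ (s i) ℚ.+ fromℕ (processing i) ℚ.≤ fromℕ (s j)
      done i j c≤ = subst (ℚ._≤ fromℕ (s j)) (fromℕ-+ (s i) (processing i)) (fromℕ-≤ c≤)

  module _ (p w : ℕ → ℕ) where
    open Costs p w

    pairsBelow : ℕ → List (ℕ × ℕ)
    pairsBelow = applyDownFrom (λ k → p k , w k)

    Smith : ℕ → Set
    Smith n = ∀ {i j} → i < j → j < n → p i * w j ≤ p j * w i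

    labelled : ∀ {b} → Labels b → List Labelled
    labelled []              = []
    labelled {suc b} (c ∷ g) = ((p b , w b) , c) ∷ labelled g

    labelled⁻ : ∀ b (xs : List Labelled) → List.map proj₁ xs ≡ pairsBelow b → Σ[ g ∈ Labels b ] labelled g ≡ xs
    labelled⁻ zero [] eq = [] , refl
    labelled⁻ (suc b) (((a , v) , c) ∷ xs) eq with ∷-injective eq
    ... | refl , eq′ with labelled⁻ b xs eq′
    ... | g , refl = c ∷ g , refl

    Positive : ∀ {b} → Labels b → Set
    Positive = AllV (1 ≤_)

    -- The jobs of `g` have smaller indices than `b`, so in Smith's order the minimum in `pairCost`
    -- is always the contribution of letting job `b` wait.
    pairs-labelled : ∀ {b} → Smith (suc b) → ∀ {a} c (g : Labels a) → a ≤ b →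
      sum (List.map (pairCost ((p b , w b) , c)) (labelled g)) ≡ w b * weigh p (having c g)
    pairs-labelled {b} sm c [] a≤ = sym (*-zeroʳ (w b))
    pairs-labelled {b} sm {suc a} c (d ∷ g) a≤ with c ≟ d | pairs-labelled sm c g (<⇒≤ a≤)
    ... | yes refl | rec rewrite ≡ᵇ-refl c | rec =
      trans (cong (_+ w b * weigh p (having c g)) (trans (m≥n⇒m⊓n≡n (sm a≤ ≤-refl)) (*-comm (p a) (w b)))) (sym (*-distribˡ-+ (w b) (p a) _))
    ... | no c≢d | rec rewrite ≢⇒≡ᵇ c≢d = rec

    pairsCost-labelled : ∀ {b} → Smith b → (g : Labels b) → Positive g → pairsCost (labelled g) ≡ labelCost g
    pairsCost-labelled sm [] [] = refl
    pairsCost-labelled {suc b} sm (suc c ∷ g) (_ ∷ pos)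
      rewrite ≡ᵇ-refl c | pairs-labelled {b} sm (suc c) g ≤-refl
            | pairsCost-labelled (λ i<j j<b → sm i<j (m<n⇒m<1+n j<b)) g pos | ⊓-idem (p b * w b) =
      eq (p b) (w b) (weigh p (having (suc c) g)) (labelCost g)
      where
      eq : ∀ x y z t → x * y + y * z + t ≡ t + y * (z + x)
      eq = solve-∀

    all-labelled⁻ : ∀ {b} {P : ℕ → Set} (g : Labels b) → All (P ∘ proj₂) (labelled g) → AllV P g
    all-labelled⁻ [] []            = []
    all-labelled⁻ (c ∷ g) (h ∷ hs) = h ∷ all-labelled⁻ g hs

    full-support : ∀ {b} (g : Labels b) → Positive g → support g ≡ replicate b true
    full-support [] []                  = refl
    full-support (suc c ∷ g) (_ ∷ pos)  = cong (true ∷_) (full-support g pos)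

    full-support⁻ : ∀ {b} (g : Labels b) → support g ≡ replicate b true → Positive g
    full-support⁻ [] eq          = []
    full-support⁻ (suc c ∷ g) eq = s≤s z≤n ∷ full-support⁻ g (cong Vec.tail eq)

    -- The schedule of a labelling: every machine runs its jobs by increasing index and without idle
    -- time.
    placed : ∀ {b} → Labels b → List Placed
    placed []              = []
    placed {suc b} (c ∷ g) = ((p b , w b) , (c , weigh p (having c g))) ∷ placed g

    proj-placed : ∀ {b} (g : Labels b) → List.map proj₁ (placed g) ≡ pairsBelow b
    proj-placed []      = refl
    proj-placed (c ∷ g) = cong (_ ∷_) (proj-placed g)

    placedCost-labels : ∀ {b} (g : Labels b) → Positive g → sum (List.map placedCost (placed g)) ≡ labelCost g
    placedCost-labels [] [] = refl
    placedCost-labels {suc b} (suc c ∷ g) (_ ∷ pos) = trans (+-comm _ (sum (List.map placedCost (placed g))))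
      (cong (_+ w b * (weigh p (having (suc c) g) + p b)) (placedCost-labels g pos))

    all-placed : ∀ {b} {P : ℕ → Set} (g : Labels b) → AllV P g → All (λ x → P (proj₁ (proj₂ x))) (placed g)
    all-placed [] []            = []
    all-placed (c ∷ g) (h ∷ hs) = h ∷ all-placed g hs

    ends : ∀ {b} c (g : Labels b) → All (λ x → c ≡ proj₁ (proj₂ x) → end x ≤ weigh p (having c g)) (placed g)
    ends c [] = []
    ends {suc b} c (d ∷ g) = first ∷ LAll.map (λ h eq → ≤-trans (h eq) grow) (ends c g)
      where
      first : c ≡ d → weigh p (having d g) + p b ≤ weigh p (having c (d ∷ g))
      first refl rewrite ≡ᵇ-refl c = ≤-reflexive (+-comm _ (p b))
      grow : weigh p (having c g) ≤ weigh p (having c (d ∷ g))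
      grow with c ≡ᵇ d
      ... | true  = m≤n+m _ (p b)
      ... | false = ≤-refl

    compatible-placed : ∀ {b} (g : Labels b) → AllPairs Compatible (placed g)
    compatible-placed []      = []
    compatible-placed (c ∷ g) = LAll.map (λ h eq → inj₂ (h eq)) (ends c g) ∷ compatible-placed g

    module _ (arranged : pairsBelow jobs ↭ tabulate (λ j → processing j , weight j)) (smith : Smith jobs) where

      jobPair : Fin jobs → ℕ × ℕ
      jobPair j = processing j , weight j

      map-proj₁-tabulate : ∀ {n} {A B : Set} (f : Fin n → A) (g : Fin n → B) →
        List.map proj₁ (tabulate (λ j → f j , g j)) ≡ tabulate f
      map-proj₁-tabulate {zero} f g  = refl
      map-proj₁-tabulate {suc n} f g = cong (f zero ∷_) (map-proj₁-tabulate (f ∘ suc) (g ∘ suc))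

      count-full : ∀ b → count (replicate b true) ≡ b
      count-full zero    = refl
      count-full (suc b) = cong suc (count-full b)

      -- For the lower bound, the machines of a schedule are carried over to the sorted jobs as
      -- labels, and the resulting partition costs exactly the `pairsCost` of the schedule. It uses
      -- at most `K` machines by `part-labels` if `machines ≤ K` and by `part-count` if `jobs ≤ K`.
      -- Conversely, an optimal partition is labelled, placed and carried back.
      best-optimal : ∀ {K a} → (machines ≤ K ⊎ jobs ≤ K) → K ≤ machines → Best K (replicate jobs true) a → IsOptimalValue I a
      best-optimal {K} {a} enough K≤ (part , least) = attained , lower
        where
        lowerLabels : ∀ σ (g : Labels jobs) → tabulate (jobLabel (λ j → suc (toℕ (Schedule.machine σ j)))) ↭ labelled g →
          fromℕ a ℚ.≤ Schedule.totalWeightedCompletion σ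
        lowerLabels σ g perm = ℚ.≤-trans (fromℕ-≤ a≤) (schedule≥pairsCost σ)
          where
          range : AllV InRange g
          range = all-labelled⁻ g (All-resp-↭ perm (all-tabulate⁺ λ j → s≤s z≤n , toℕ<n (Schedule.machine σ j)))
          positive : Positive g
          positive = VAll.map proj₁ range
          partition : Part K (support g) (labelCost g)
          partition = [ (λ m≤K → part-labels K g (VAll.map (λ r → ≤-trans (proj₂ r) m≤K) range))
                      , (λ n≤K → part-count K g (subst (_≤ K)
                          (sym (trans (cong count (full-support g positive)) (count-full jobs))) n≤K)) ]′ enough
          a≤ : a ≤ pairsCost (tabulate (jobLabel (λ j → suc (toℕ (Schedule.machine σ j)))))
          a≤ = subst (a ≤_) (sym (trans (pairsCost-↭ perm) (pairsCost-labelled smith g positive)))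
            (least (subst (λ v → Part K v (labelCost g)) (full-support g positive) partition))

        lower : ∀ σ → fromℕ a ℚ.≤ Schedule.totalWeightedCompletion σ
        lower σ =
          -- The permutation is known only for the pairs of processing time and weight; it lifts to
          -- the labelled jobs, and it does not matter which of several equal jobs receives which
          -- label.
          let ys , eq , perm = ↭-map-inv proj₁ {xs = tabulate (jobLabel (λ j → suc (toℕ (Schedule.machine σ j))))}
                (↭-trans (↭-reflexive (map-proj₁-tabulate jobPair _)) (↭-sym arranged))
              g , g≡ = labelled⁻ jobs ys (sym eq)
          in lowerLabels σ g (subst (tabulate (jobLabel (λ j → suc (toℕ (Schedule.machine σ j)))) ↭_) (sym g≡) perm)

        placedLabels : ∀ (g : Labels jobs) → AllV (_≤ K) g → support g ≡ replicate jobs true → labelCost g ≡ a →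
          ∀ cs → placed g ↭ tabulate (λ j → jobPair j , cs j) →
          Σ[ σ ∈ Schedule I ] Schedule.totalWeightedCompletion σ ≡ fromℕ a
        placedLabels g g≤ sup cost≡ cs perm =
          proj₁ real , trans (proj₂ real) (cong fromℕ (trans (sym (∑-tabulate placedCost (λ j → jobPair j , cs j)))
              (trans (sum-↭ (↭-sym (↭-map⁺ placedCost perm))) (trans (placedCost-labels g (full-support⁻ g sup)) cost≡))))
          where
          range : ∀ j → InRange (proj₁ (cs j))
          range = all-tabulate⁻ {P = λ x → InRange (proj₁ (proj₂ x))} (All-resp-↭ perm (all-placed g
            (VAll.map (λ (q , r) → q , ≤-trans r K≤) (VAll.zip (full-support⁻ g sup , g≤)))))
          compatible : ∀ {i j} → i ≢ j → Compatible (jobPair i , cs i) (jobPair j , cs j)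
          compatible = allPairs-tabulate⁻ {R = Compatible} (λ {x} {y} → compatible-sym {x} {y})
            (PermS.AllPairs-resp-↭ (setoid Placed) (λ {x} {y} → compatible-sym {x} {y})
              ((λ { refl h → h }) , (λ { refl h → h })) (↭⇒↭ₛ perm) (compatible-placed g))
          real = realise (proj₁ ∘ cs) (proj₂ ∘ cs) range compatible

        attained : Σ[ σ ∈ Schedule I ] Schedule.totalWeightedCompletion σ ≡ fromℕ a
        attained =
          let labelling g g≤ sup cost≡ = label-part part
              ys , eq , perm = ↭-map-inv proj₁ {xs = placed g} (↭-trans (↭-reflexive (proj-placed g)) arranged)
              cs , cs≡ = tabulated jobPair ys (sym eq)
          in placedLabels g g≤ sup cost≡ cs (subst (placed g ↭_) cs≡ perm)

-- The program

-- The program keeps the jobs in Smith's order in PA and WA. At index val v, the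
-- arrays PS and WS hold the total processing time and weight of v, GA and HA
-- hold gOf v and hOf v, and LST holds the sorted subsets of v from index
-- val v * NV on. The array HH holds the costs of all sets on one machine, then
-- the optimal costs for 2, 3, … machines; obV and nbV are the positions of the
-- last two of these tables. The lines in COL (intercepts) and SL (slopes) belong
-- to the set uV of early jobs and the set xV of late jobs left to the other
-- machines; dV is the complement of xV among the late jobs.
pattern nV = 0
pattern mV = 1
pattern iV = 2
pattern jV = 3
pattern tV = 4
pattern NV = 5
pattern bV = 6
pattern sV = 7
pattern EV = 8
pattern unitV = 9
pattern cntV = 10
pattern uV = 11
pattern szV = 12
pattern aV = 13
pattern cV = 14
pattern kV = 15
pattern obV = 16
pattern nbV = 17
pattern lyV = 18
pattern xV = 19
pattern dV = 20
pattern loV = 21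
pattern hiV = 22
pattern argV = 23
pattern bestV = 24
pattern vV = 25
pattern qV = 26
pattern rV = 27
pattern gV = 28
pattern sizeV = 29
pattern FV = 30

PS WS LST GA HA HH COL SL PA WA : Array
PA  = # 0
WA  = # 1
PS  = # 2
WS  = # 3
LST = # 4
GA  = # 5
HA  = # 6
HH  = # 7
COL = # 8
SL  = # 9

scanStep : Cmd
scanStep =
  jV := var jV ⊕ lit 1 ⨾
  vV := COL at var jV ⊕ (SL at var jV) ⊗ var qV ⨾
  cond (var bestV ⊖ var vV) (bestV := var vV ⨾ argV := var jV) skip

scan : Cmd
scan =
  argV := var loV ⨾
  bestV := COL at var loV ⊕ (SL at var loV) ⊗ var qV ⨾
  jV := var loV ⨾
  while (var hiV ⊖ var jV) scanStep

-- The early set, the late set of the other machines and the late set of the new machine are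
-- disjoint, so the sum of their numbers is the number of their union.
target : Expr
target = var nbV ⊕ var uV ⊕ var xV ⊕ var tV

row : Cmd
row =
  rV := var rV ⊖ lit 1 ⨾
  tV := LST at (var dV ⊗ var NV ⊕ var rV) ⨾
  qV := WS at var tV ⨾
  scan ⨾
  vV := var bestV ⊕ HH at var tV ⨾
  cond (HH at target ⊖ var vV) (HH ⟦ target ⟧:= var vV) skip

rowStep : Cmd
rowStep = row ⨾ kV := var kV ⊕ lit 1

-- The queries qV of a list decrease from block to block, so the best line moves
-- to the right. The scan for the last query of a block ends the window in which
-- the best lines for the other queries of the block lie.
block : Cmd
block =
  tV := LST at (var dV ⊗ var NV ⊕ (var rV ⊖ var gV)) ⨾
  qV := WS at var tV ⨾
  hiV := var szV ⊖ lit 1 ⨾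
  scan ⨾
  hiV := var argV ⨾
  kV := lit 0 ⨾
  while (var gV ⊖ var kV) rowStep ⨾
  loV := var hiV

rowStep⊑block : rowStep ⊑ block
rowStep⊑block = inSecond (inSecond (inSecond (inSecond (inSecond (inSecond (inFirst (inLoop self)))))))

scan⊑block : scan ⊑ block
scan⊑block = inSecond (inSecond (inSecond (inFirst self)))

-- Lines ordered by slope: the better one of two lines stays better in the
-- direction that its slope favours.
line-right : ∀ {a b x y q q′} → x ≤ y → q ≤ q′ → a + x * q ≤ b + y * q → a + x * q′ ≤ b + y * q′
line-right {a} {b} {x} {y} {q} {q′} x≤y q≤q′ h = begin
  a + x * q′                      ≡⟨ cong (λ z → a + x * z) (m+[n∸m]≡n q≤q′) ⟨
  a + x * (q + (q′ ∸ q))          ≡⟨ eq a x q (q′ ∸ q) ⟩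
  a + x * q + x * (q′ ∸ q)        ≤⟨ +-mono-≤ h (*-monoˡ-≤ (q′ ∸ q) x≤y) ⟩
  b + y * q + y * (q′ ∸ q)        ≡⟨ eq b y q (q′ ∸ q) ⟨
  b + y * (q + (q′ ∸ q))          ≡⟨ cong (λ z → b + y * z) (m+[n∸m]≡n q≤q′) ⟩
  b + y * q′                      ∎
  where
  open ≤-Reasoning
  eq : ∀ a x q r → a + x * (q + r) ≡ a + x * q + x * r
  eq = solve-∀

line-left : ∀ {a b x y q q′} → y ≤ x → q ≤ q′ → a + x * q′ ≤ b + y * q′ → a + x * q ≤ b + y * q
line-left {a} {b} {x} {y} {q} {q′} y≤x q≤q′ h = +-cancelʳ-≤ (x * (q′ ∸ q)) _ _ (begin
  a + x * q + x * (q′ ∸ q)        ≡⟨ eq a x q (q′ ∸ q) ⟨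
  a + x * (q + (q′ ∸ q))          ≡⟨ cong (λ z → a + x * z) (m+[n∸m]≡n q≤q′) ⟩
  a + x * q′                      ≤⟨ h ⟩
  b + y * q′                      ≡⟨ cong (λ z → b + y * z) (m+[n∸m]≡n q≤q′) ⟨
  b + y * (q + (q′ ∸ q))          ≡⟨ eq b y q (q′ ∸ q) ⟩
  b + y * q + y * (q′ ∸ q)        ≤⟨ +-monoʳ-≤ (b + y * q) (*-monoˡ-≤ (q′ ∸ q) y≤x) ⟩
  b + y * q + x * (q′ ∸ q)        ∎)
  where
  open ≤-Reasoning
  eq : ∀ a x q r → a + x * (q + r) ≡ a + x * q + x * r
  eq = solve-∀

-- The line of an early set t₁: its intercept is the cost of t₁ plus the cost of leaving the rest of
-- `uV` together with `xV` to the previous machines, its slope the processing time of t₁.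
columnStep : Cmd
columnStep =
  tV := LST at (var uV ⊗ var NV ⊕ var jV) ⨾
  COL ⟦ var jV ⟧:= HH at (var obV ⊕ (var uV ⊖ var tV ⊕ var xV)) ⊕ HH at var tV ⨾
  SL ⟦ var jV ⟧:= PS at var tV ⨾
  jV := var jV ⊕ lit 1

inner : Cmd
inner =
  szV := GA at var uV ⊗ HA at var uV ⨾
  -- 2^n - 2^f is the number of the set of all late jobs, from which `dV` is removed.
  xV := var NV ⊖ var FV ⊖ var dV ⨾
  jV := lit 0 ⨾
  while (var szV ⊖ var jV) columnStep ⨾
  gV := GA at var dV ⨾
  rV := HA at var dV ⊗ var gV ⨾
  loV := lit 0 ⨾
  while (var rV) block

-- For each set d of late jobs, its 2 ^ count d subsets are queried in hOf d blocks
-- of gOf d queries; both are within a factor of √2 of 2 ^ (count d / 2).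
gOf hOf : ∀ {b} → Mask b → ℕ
gOf []          = 1
gOf (true ∷ u)  = hOf u
gOf (false ∷ u) = gOf u
hOf []          = 1
hOf (true ∷ u)  = 2 * gOf u
hOf (false ∷ u) = hOf u

hOf*gOf : ∀ {b} (u : Mask b) → hOf u * gOf u ≡ 2 ^ count u
hOf*gOf [] = refl
hOf*gOf (true ∷ u) = trans (*-assoc 2 (gOf u) (hOf u)) (cong (2 *_) (trans (*-comm (gOf u) (hOf u)) (hOf*gOf u)))
hOf*gOf (false ∷ u) = hOf*gOf u

gOf≥1 : ∀ {b} (u : Mask b) → 1 ≤ gOf u
hOf≥1 : ∀ {b} (u : Mask b) → 1 ≤ hOf u
gOf≥1 []          = ≤-refl
gOf≥1 (true ∷ u)  = hOf≥1 u
gOf≥1 (false ∷ u) = gOf≥1 u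
hOf≥1 []          = ≤-refl
hOf≥1 (true ∷ u)  = ≤-trans (gOf≥1 u) (m≤m+n _ _)
hOf≥1 (false ∷ u) = hOf≥1 u

2^count≤ : ∀ {b} (u : Mask b) → 2 ^ count u ≤ 2 ^ b
2^count≤ []          = ≤-refl
2^count≤ (true ∷ u)  = *-monoʳ-≤ 2 (2^count≤ u)
2^count≤ (false ∷ u) = ≤-trans (2^count≤ u) (m≤m+n _ _)

complement-involutive : ∀ {b} (v : Mask b) → complement (complement v) ≡ v
complement-involutive []          = refl
complement-involutive (true ∷ v)  = cong (true ∷_) (complement-involutive v)
complement-involutive (false ∷ v) = cong (false ∷_) (complement-involutive v)

-- X bounds 2 ^ n and the total processing time and weight; then every value
-- that the program computes is at most X ^ 8.
module Powers (X V : ℕ) (X≥2 : 2 ≤ X) (X^8≤V : X ^ 8 ≤ V) where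

  instance
    X≢0 : NonZero X
    X≢0 = >-nonZero (≤-trans (s≤s z≤n) X≥2)

  ^-+ : ∀ {a b} k → a ≤ X ^ k → b ≤ X ^ k → a + b ≤ X ^ suc k
  ^-+ {a} {b} k a≤ b≤ = begin
    a + b             ≤⟨ +-mono-≤ a≤ b≤ ⟩
    X ^ k + X ^ k     ≡⟨ cong (X ^ k +_) (+-identityʳ (X ^ k)) ⟨
    2 * X ^ k         ≤⟨ *-monoˡ-≤ (X ^ k) X≥2 ⟩
    X ^ suc k         ∎
    where open ≤-Reasoning

  ^-* : ∀ {a b} j k → a ≤ X ^ j → b ≤ X ^ k → a * b ≤ X ^ (j + k)
  ^-* j k a≤ b≤ = ≤-trans (*-mono-≤ a≤ b≤) (≤-reflexive (sym (^-distribˡ-+-* X j k)))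

  ^-up : ∀ {a} j k → {T (j ≤ᵇ k)} → a ≤ X ^ j → a ≤ X ^ k
  ^-up j k {h} a≤ = ≤-trans a≤ (^-monoʳ-≤ X (≤ᵇ⇒≤ j k h))

  ≤V : ∀ {a} k → {T (k ≤ᵇ 8)} → a ≤ X ^ k → a ≤ V
  ≤V k {h} a≤ = ≤-trans (^-up k 8 {h} a≤) X^8≤V

  ^-1 : ∀ {a} → a ≤ X → a ≤ X ^ 1
  ^-1 a≤ = ≤-trans a≤ (≤-reflexive (sym (^-identityʳ X)))

highStep : Cmd
highStep = inner ⨾ dV := var dV ⊕ var FV

lowStep : Cmd
lowStep = dV := lit 0 ⨾ while (var NV ⊖ var dV) highStep ⨾ uV := var uV ⊕ lit 1

copyStep : Cmd
copyStep = HH ⟦ var nbV ⊕ var sV ⟧:= HH at (var obV ⊕ var sV) ⨾ sV := var sV ⊕ lit 1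

layerStep : Cmd
layerStep =
  nbV := var obV ⊕ var NV ⨾
  sV := lit 0 ⨾
  -- The new table starts as a copy of the old one, which corresponds to an idle new machine; every
  -- further candidate can only lower an entry.
  while (var NV ⊖ var sV) copyStep ⨾
  uV := lit 0 ⨾
  while (var FV ⊖ var uV) lowStep ⨾
  obV := var nbV ⨾
  lyV := var lyV ⊕ lit 1

layers : Cmd
layers =
  obV := lit 0 ⨾
  lyV := lit 0 ⨾
  -- With truncated subtraction, n - (n - m) is the minimum of n and m. One table fewer has to be
  -- built, since the costs of single sets are the table for one machine.
  cntV := var nV ⊖ (var nV ⊖ var mV) ⊖ lit 1 ⨾
  while (var cntV ⊖ var lyV) layerStep ⨾
  rV := HH at (var obV ⊕ (var NV ⊖ lit 1))

lowStep⊑layerStep : lowStep ⊑ layerStep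
lowStep⊑layerStep = inSecond (inSecond (inSecond (inSecond (inFirst (inLoop self)))))

highStep⊑lowStep : highStep ⊑ lowStep
highStep⊑lowStep = inSecond (inFirst (inLoop self))

⊑-trans : ∀ {a b c} → a ⊑ b → b ⊑ c → a ⊑ c
⊑-trans p self       = p
⊑-trans p (inFirst q)  = inFirst (⊑-trans p q)
⊑-trans p (inSecond q) = inSecond (⊑-trans p q)
⊑-trans p (inThen q)   = inThen (⊑-trans p q)
⊑-trans p (inElse q)   = inElse (⊑-trans p q)
⊑-trans p (inLoop q) = inLoop (⊑-trans p q)

applyDownFrom-cong : ∀ {A : Set} {e e′ : ℕ → A} b → (∀ {i} → i < b → e i ≡ e′ i) → applyDownFrom e b ≡ applyDownFrom e′ b
applyDownFrom-cong zero h    = refl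
applyDownFrom-cong (suc b) h = cong₂ _∷_ (h ≤-refl) (applyDownFrom-cong b (λ i< → h (m<n⇒m<1+n i<)))

applyDownFrom-swap : ∀ {A : Set} {e e′ : ℕ → A} j b → suc j < b → e′ j ≡ e (suc j) → e′ (suc j) ≡ e j →
  (∀ {i} → i ≢ j → i ≢ suc j → e′ i ≡ e i) → applyDownFrom e′ b ↭ applyDownFrom e b
applyDownFrom-swap {e = e} {e′} j (suc b) (s≤s j<b) p q h with suc j ≟ b
... | yes refl rewrite p | q = ↭-trans (↭-swap (e j) (e (suc j)) ↭-refl)
        (↭-prep (e (suc j)) (↭-prep (e j) (↭-reflexive (applyDownFrom-cong j λ i< → h (<⇒≢ i<) (<⇒≢ (m<n⇒m<1+n i<))))))
... | no neq rewrite h {b} (λ { refl → n≮n b j<b }) (λ { refl → neq refl }) =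
        ↭-prep (e b) (applyDownFrom-swap j b (≤∧≢⇒< j<b neq) p q h)

key : ℕ × ℕ → ℕ
key (p , w) = p + (1 ∸ w)

-- Smith's order by increasing p / w. Jobs of weight 0 come last; adding 1 to
-- their processing times makes the cross-multiplied comparison transitive.
_≼_ : ℕ × ℕ → ℕ × ℕ → Set
x ≼ y = key x * proj₂ y ≤ key y * proj₂ x

-- A positive weight in the middle can be cancelled. If it is 0, the middle key is positive and the
-- second comparison forces the weight of `z` to be 0 as well, which makes the claim trivial.
≼-trans : ∀ {x y z} → x ≼ y → y ≼ z → x ≼ z
≼-trans {p , u} {q , suc v} {r , w} h k = *-cancelʳ-≤ _ _ (suc v) (begin
  key (p , u) * w * suc v         ≡⟨ eq₁ (key (p , u)) w (suc v) ⟩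
  key (p , u) * suc v * w         ≤⟨ *-monoˡ-≤ w h ⟩
  key (q , suc v) * u * w         ≡⟨ eq₁ (key (q , suc v)) u w ⟩
  key (q , suc v) * w * u         ≤⟨ *-monoˡ-≤ u k ⟩
  key (r , w) * suc v * u         ≡⟨ eq₁ (key (r , w)) (suc v) u ⟩
  key (r , w) * u * suc v         ∎)
  where
  open ≤-Reasoning
  eq₁ : ∀ a b c → a * b * c ≡ a * c * b
  eq₁ = solve-∀
≼-trans {p , u} {q , zero} {r , zero} h k = subst (_≤ key (r , zero) * u) (sym (*-zeroʳ (key (p , u)))) z≤n
≼-trans {p , u} {q , zero} {r , suc w} h k = ⊥-elim (<⇒≱ (*-mono-≤ (m≤n+m 1 q) (s≤s (z≤n {w})))
  (≤-trans k (≤-reflexive (*-zeroʳ (key (r , suc w))))))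

≼⇒smith : ∀ {p w p′ w′} → (p , w) ≼ (p′ , w′) → p * w′ ≤ p′ * w
≼⇒smith {p} {w} {p′} {zero} h = subst (_≤ p′ * w) (sym (*-zeroʳ p)) z≤n
≼⇒smith {p} {zero} {p′} {suc w′} h = ⊥-elim (<⇒≱ (*-mono-≤ (m≤n+m 1 p) (s≤s (z≤n {w′})))
  (≤-trans h (≤-reflexive (*-zeroʳ (key (p′ , suc w′))))))
≼⇒smith {p} {suc w} {p′} {suc w′} h = subst₂ (λ x y → x * suc w′ ≤ y * suc w)
  (trans (cong (p +_) (0∸n≡0 w)) (+-identityʳ p)) (trans (cong (p′ +_) (0∸n≡0 w′)) (+-identityʳ p′)) h

keyExpr : Expr → Expr
keyExpr e = PA at e ⊕ (lit 1 ⊖ WA at e)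

swapCmd : Cmd
swapCmd =
  tV := PA at var jV ⨾
  PA ⟦ var jV ⟧:= PA at (var jV ⊕ lit 1) ⨾
  PA ⟦ var jV ⊕ lit 1 ⟧:= var tV ⨾
  tV := WA at var jV ⨾
  WA ⟦ var jV ⟧:= WA at (var jV ⊕ lit 1) ⨾
  WA ⟦ var jV ⊕ lit 1 ⟧:= var tV

sink : Cmd
sink =
  jV := var jV ⊖ lit 1 ⨾
  cond (keyExpr (var jV) ⊗ WA at (var jV ⊕ lit 1) ⊖ keyExpr (var jV ⊕ lit 1) ⊗ WA at var jV) swapCmd skip

insert : Cmd
insert =
  -- The input is n, m, the processing times and the weights, so those of job i are at 2 + i and 2 +
  -- n + i.
  read tV (lit 2 ⊕ var iV) ⨾
  PA ⟦ var iV ⟧:= var tV ⨾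
  read tV (lit 2 ⊕ var nV ⊕ var iV) ⨾
  WA ⟦ var iV ⟧:= var tV ⨾
  jV := var iV ⨾
  while (var jV) sink ⨾
  iV := var iV ⊕ lit 1

sort : Cmd
sort =
  read nV (lit 0) ⨾
  read mV (lit 1) ⨾
  iV := lit 0 ⨾
  while (var nV ⊖ var iV) insert

-- `NV` is 2^b here, so `NV ⊕ sV` is the number of the set `sV` with job b added. This job is the
-- last one of the set to be processed.
tableStep : Cmd
tableStep =
  HH ⟦ var NV ⊕ var sV ⟧:= HH at var sV ⊕ WA at var bV ⊗ (PS at var sV ⊕ PA at var bV) ⨾
  PS ⟦ var NV ⊕ var sV ⟧:= PA at var bV ⊕ PS at var sV ⨾
  WS ⟦ var NV ⊕ var sV ⟧:= WA at var bV ⊕ WS at var sV ⨾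
  sV := var sV ⊕ lit 1

tableRow : Cmd
tableRow = sV := lit 0 ⨾ while (var NV ⊖ var sV) tableStep ⨾ NV := var NV ⊕ var NV ⨾ bV := var bV ⊕ lit 1

tables : Cmd
tables = NV := lit 1 ⨾ bV := lit 0 ⨾ while (var nV ⊖ var bV) tableRow

sumBelow-mono : ∀ κ {a b} → a ≤ b → sumBelow a κ ≤ sumBelow b κ
sumBelow-mono κ {a} {zero} z≤n = ≤-refl
sumBelow-mono κ {a} {suc b} a≤ with a ≟ suc b
... | yes refl = ≤-refl
... | no neq   = ≤-trans (sumBelow-mono κ (≤-pred (≤∧≢⇒< a≤ neq))) (m≤m+n _ _)

sumMask : ∀ {b} → (Mask b → ℕ) → ℕ
sumMask {zero}  φ = φ []
sumMask {suc b} φ = sumMask (φ ∘ (false ∷_)) + sumMask (φ ∘ (true ∷_))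

sumBelow-cong : ∀ {κ κ′} n → (∀ {i} → i < n → κ i ≡ κ′ i) → sumBelow n κ ≡ sumBelow n κ′
sumBelow-cong zero h    = refl
sumBelow-cong (suc n) h = cong₂ _+_ (sumBelow-cong n (λ i< → h (m<n⇒m<1+n i<))) (h ≤-refl)

sumBelow-+ : ∀ κ m n → sumBelow (m + n) κ ≡ sumBelow m κ + sumBelow n (λ i → κ (m + i))
sumBelow-+ κ m zero    = trans (cong (λ k → sumBelow k κ) (+-identityʳ m)) (sym (+-identityʳ _))
sumBelow-+ κ m (suc n) = trans (cong (λ k → sumBelow k κ) (+-suc m n))
  (trans (cong (_+ κ (m + n)) (sumBelow-+ κ m n)) (+-assoc (sumBelow m κ) _ _))

sumBelow-toMask : ∀ b (φ : Mask b → ℕ) → sumBelow (2 ^ b) (φ ∘ toMask b) ≡ sumMask φ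
sumBelow-toMask zero φ    = refl
sumBelow-toMask (suc b) φ = trans (cong (λ k → sumBelow k (φ ∘ toMask (suc b))) (2^suc b))
  (trans (sumBelow-+ (φ ∘ toMask (suc b)) (2 ^ b) (2 ^ b)) (cong₂ _+_
    (trans (sumBelow-cong (2 ^ b) (λ i< → cong φ (low-toMask i<))) (sumBelow-toMask b (φ ∘ (false ∷_))))
    (trans (sumBelow-cong (2 ^ b) (λ {i} _ → cong φ (high-toMask i))) (sumBelow-toMask b (φ ∘ (true ∷_))))))
  where
  low-toMask : ∀ {i} → i < 2 ^ b → toMask (suc b) i ≡ false ∷ toMask b i
  low-toMask i< rewrite ≤ᵇ-false i< = refl
  high-toMask : ∀ i → toMask (suc b) (2 ^ b + i) ≡ true ∷ toMask b i
  high-toMask i rewrite ≤ᵇ-true (m≤m+n (2 ^ b) i) | m+n∸m≡n (2 ^ b) i = refl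

sumMask-cong : ∀ {b} {φ ψ : Mask b → ℕ} → (∀ v → φ v ≡ ψ v) → sumMask φ ≡ sumMask ψ
sumMask-cong {zero} h  = h []
sumMask-cong {suc b} h = cong₂ _+_ (sumMask-cong (h ∘ (false ∷_))) (sumMask-cong (h ∘ (true ∷_)))

sumMask-* : ∀ {b} c (φ : Mask b → ℕ) → sumMask (λ v → c * φ v) ≡ c * sumMask φ
sumMask-* {zero} c φ  = refl
sumMask-* {suc b} c φ = trans (cong₂ _+_ (sumMask-* c (φ ∘ (false ∷_))) (sumMask-* c (φ ∘ (true ∷_)))) (sym (*-distribˡ-+ c _ _))

sumMask-+ : ∀ {b} (φ ψ : Mask b → ℕ) → sumMask (λ v → φ v + ψ v) ≡ sumMask φ + sumMask ψ
sumMask-+ {zero} φ ψ  = refl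
sumMask-+ {suc b} φ ψ rewrite sumMask-+ (φ ∘ (false ∷_)) (ψ ∘ (false ∷_)) | sumMask-+ (φ ∘ (true ∷_)) (ψ ∘ (true ∷_)) =
  eq (sumMask (φ ∘ (false ∷_))) (sumMask (ψ ∘ (false ∷_))) (sumMask (φ ∘ (true ∷_))) _
  where
  eq : ∀ a b c d → a + b + (c + d) ≡ a + c + (b + d)
  eq = solve-∀

-- The binomial theorem. With `a = 2` it turns work proportional to the number of subsets of each
-- set into a power of 3.
sumMask-^ : ∀ a b → sumMask {b} (λ v → a ^ count v) ≡ (1 + a) ^ b
sumMask-^ a zero    = refl
sumMask-^ a (suc b) = cong₂ _+_ (sumMask-^ a b) (trans (sumMask-* {b} a (λ v → a ^ count v)) (cong (a *_) (sumMask-^ a b)))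

listBase slot : Expr
listBase = var uV ⊗ var NV
slot = (var uV ⊕ var EV) ⊗ var NV ⊕ var kV

mergeStep : Array → Cmd
mergeStep K =
  -- The first summand is nonzero when the list without the new job is exhausted. The second one is
  -- nonzero when the list with the new job is not exhausted and its next set is strictly lighter.
  -- In both cases the latter list is served; on a tie it is the former, as in `merge`.
  cond (lit 1 ⊖ (var szV ⊖ var aV) ⊕
        (var szV ⊖ var cV) ⊗ (K at (LST at (listBase ⊕ var aV)) ⊖ K at (LST at (listBase ⊕ var cV) ⊕ var EV)))
    (LST ⟦ slot ⟧:= LST at (listBase ⊕ var cV) ⊕ var EV ⨾ cV := var cV ⊕ lit 1)
    (LST ⟦ slot ⟧:= LST at (listBase ⊕ var aV) ⨾ aV := var aV ⊕ lit 1) ⨾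
  kV := var kV ⊕ lit 1

listStep : Array → Cmd
listStep K =
  tV := GA at var uV ⨾
  szV := var tV ⊗ HA at var uV ⨾
  GA ⟦ var uV ⊕ var EV ⟧:= HA at var uV ⨾
  HA ⟦ var uV ⊕ var EV ⟧:= lit 2 ⊗ var tV ⨾
  aV := lit 0 ⨾
  cV := lit 0 ⨾
  kV := lit 0 ⨾
  while (var szV ⊕ var szV ⊖ var kV) (mergeStep K) ⨾
  uV := var uV ⊕ var unitV

buildRow : Array → Cmd
buildRow K = uV := lit 0 ⨾ while (var EV ⊖ var uV) (listStep K) ⨾ EV := var EV ⊕ var EV ⨾ bV := var bV ⊕ lit 1

build : Array → Cmd
build K = bV := lit 0 ⨾ while (var cntV ⊖ var bV) (buildRow K)

-- The same code serves both halves: `unitV` is the number of the lowest job, 1 for the early jobs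
-- and 2^f for the late ones. Early sets are sorted by processing time, which gives slopes, and late
-- sets by weight, which gives queries.
sublists : Cmd
sublists =
  LST ⟦ lit 0 ⟧:= lit 0 ⨾
  GA ⟦ lit 0 ⟧:= lit 1 ⨾
  HA ⟦ lit 0 ⟧:= lit 1 ⨾
  unitV := lit 1 ⨾
  EV := lit 1 ⨾
  cntV := var nV ⊘ lit 2 ⨾
  build PS ⨾
  unitV := var EV ⨾
  FV := var EV ⨾
  cntV := var nV ⊖ var cntV ⨾
  build WS

mergeStep⊑ : ∀ {K} → mergeStep K ⊑ buildRow K
mergeStep⊑ = inSecond (inFirst (inLoop (inSecond (inSecond (inSecond (inSecond (inSecond (inSecond (inSecond (inFirst (inLoop self)))))))))))

listStep⊑ : ∀ {K} → listStep K ⊑ buildRow K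
listStep⊑ = inSecond (inFirst (inLoop self))

-- Correctness and running time of the program

module Verification (B V : ℕ) (input : ℕ → ℕ) (input≤V : ∀ a → input a ≤ V) where
  open Logic B V input input≤V
  open Bounded

  lineAt : Store → ℕ → ℕ
  lineAt s j = arr s COL j + arr s SL j * reg s qV

  record Scanned (lo hi : ℕ) (line : ℕ → ℕ) (s′ : Store) : Set where
    constructor scanned
    field
      lo≤arg : lo ≤ reg s′ argV
      arg≤hi : reg s′ argV ≤ hi
      best≡  : reg s′ bestV ≡ line (reg s′ argV)
      least  : ∀ j → lo ≤ j → j ≤ hi → line (reg s′ argV) ≤ line j
  open Scanned public

  scan-correct : ∀ {s} → Bounded s → reg s loV ≤ reg s hiV → (∀ j → j ≤ reg s hiV → lineAt s j ≤ V) →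
    Run scan s (λ d s′ → d ≤ 4 + 6 * (reg s hiV ∸ reg s loV) × Scanned (reg s loV) (reg s hiV) (lineAt s) s′)
  scan-correct {s} bd lo≤hi fit =
    run-⨾ (run-:= (Bounded.reg≤ bd loV) (run-⨾ (run-:= (fit lo lo≤hi)
      (run-⨾ (run-:= (Bounded.reg≤ bd loV) (run-while I (hi ∸ lo)
        (bounded-setReg jV (bounded-setReg bestV (bounded-setReg argV bd (Bounded.reg≤ bd loV)) (fit lo lo≤hi)) (Bounded.reg≤ bd loV))
        (inv z≤n (sym (+-identityʳ lo)) ≤-refl ≤-refl refl
             (λ j l≤j j≤l → ≤-reflexive (cong M (≤-antisym l≤j j≤l))))
        body end))))))
    where
    lo = reg s loV
    hi = reg s hiV
    M  = lineAt s
    s₀ = setReg (setReg (setReg s argV lo) bestV (M lo)) jV lo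
    record I (i d : ℕ) (s′ : Store) : Set where
      pattern
      constructor inv
      field
        time  : d ≤ 6 * i
        j≡    : reg s′ jV ≡ lo + i
        lo≤   : lo ≤ reg s′ argV
        arg≤  : reg s′ argV ≤ reg s′ jV
        best≡ : reg s′ bestV ≡ M (reg s′ argV)
        least : ∀ j → lo ≤ j → j ≤ reg s′ jV → M (reg s′ argV) ≤ M j
    body : ∀ {i d s′} → Keeps scanStep s₀ s′ → i < hi ∸ lo → I i d s′ →
      eval (var hiV ⊖ var jV) s′ ≢ 0 × Run scanStep s′ (λ d′ → I (suc i) (d + suc d′))
    body {i} {d} {s′} ks i< (inv time j≡ lo≤ arg≤ best≡ least) =
      (λ eq → m>n⇒m∸n≢0 j<hi (trans (cong (_∸ j) (sym hi≡)) eq)) ,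
      run-⨾ (run-:= (subst (_≤ V) (+-comm 1 j) (≤-trans (≤-trans j<hi (≤-reflexive (sym hi≡))) (Bounded.reg≤ (isBounded ks) hiV)))
        (run-⨾ (run-:= (subst (_≤ V) (sym v≡) (fit (j + 1) j+1≤hi))
          (run-cond
            (λ gt → run-⨾ (run-:= (subst (_≤ V) (sym v≡) (fit (j + 1) j+1≤hi)) (run-:= (≤-trans j+1≤hi (≤-trans (≤-reflexive (sym hi≡)) (Bounded.reg≤ (isBounded ks) hiV)))
              (inv (tick 5 ≤-refl) j≡′ (≤-trans lo≤j (m≤m+n j 1)) ≤-refl v≡
                 (λ k lo≤k k≤ → below k (M (j + 1)) ≤-refl (λ k≤j → ≤-trans (<⇒≤ (subst₂ _<_ v≡ best≡ (m∸n≢0⇒n<m gt))) (least k lo≤k k≤j)) k≤)))))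
            (λ le → run-skip (inv (tick 3 (s≤s (s≤s (s≤s z≤n)))) j≡′ lo≤ (≤-trans arg≤ (m≤m+n j 1)) best≡
                 (λ k lo≤k k≤ → below k _ (subst₂ _≤_ best≡ v≡ (m∸n≡0⇒m≤n le)) (least k lo≤k) k≤)))))))
      where
      j = reg s′ jV
      hi≡ : reg s′ hiV ≡ hi
      hi≡ = kept ks hiV refl
      j<hi : j < hi
      j<hi = subst₂ _<_ (sym j≡) (m+[n∸m]≡n lo≤hi) (+-monoʳ-< lo i<)
      j+1≤hi : j + 1 ≤ hi
      j+1≤hi = subst (_≤ hi) (+-comm 1 j) j<hi
      lo≤j : lo ≤ j
      lo≤j = ≤-trans (m≤m+n lo i) (≤-reflexive (sym j≡))
      j≡′ : j + 1 ≡ lo + suc i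
      j≡′ = trans (cong (_+ 1) j≡) (trans (+-assoc lo i 1) (cong (lo +_) (+-comm i 1)))
      v≡ : arr s′ COL (j + 1) + arr s′ SL (j + 1) * reg s′ qV ≡ M (j + 1)
      v≡ = cong₂ _+_ (keptArr ks COL refl (j + 1)) (cong₂ _*_ (keptArr ks SL refl (j + 1)) (kept ks qV refl))
      tick : ∀ t → t ≤ 5 → d + suc t ≤ 6 * suc i
      tick t t≤ = ≤-trans (+-mono-≤ time (s≤s t≤)) (≤-reflexive (trans (+-comm (6 * i) 6) (sym (*-suc 6 i))))
      below : ∀ k x → x ≤ M (j + 1) → (k ≤ j → x ≤ M k) → k ≤ j + 1 → x ≤ M k
      below k x x≤ h k≤ with k ≤? j
      ... | yes k≤j = h k≤j
      ... | no k≰j  = subst (λ y → x ≤ M y) (≤-antisym (subst (_≤ k) (+-comm 1 j) (≰⇒> k≰j)) k≤) x≤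
    end : ∀ {d s′} → Keeps scanStep s₀ s′ → I (hi ∸ lo) d s′ → eval (var hiV ⊖ var jV) s′ ≡ 0 ×
      (1 + (1 + (1 + (d + 1))) ≤ 4 + 6 * (hi ∸ lo) × Scanned lo hi M s′)
    end {d} {s′} ks (inv time j≡ lo≤ arg≤ best≡ least) =
      trans (cong₂ _∸_ (kept ks hiV refl) j≡hi) (n∸n≡0 hi) ,
      subst (_≤ 4 + 6 * (hi ∸ lo)) (cong (3 +_) (+-comm 1 d)) (s≤s (s≤s (s≤s (s≤s time)))) ,
      scanned lo≤ (subst (reg s′ argV ≤_) j≡hi arg≤) best≡ (λ j lo≤j j≤hi → least j lo≤j (subst (j ≤_) (sym j≡hi) j≤hi))
      where
      j≡hi : reg s′ jV ≡ hi
      j≡hi = trans j≡ (m+[n∸m]≡n lo≤hi)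

  -- Minima of lines, queried in blocks

  module Rows (s : Store) (bd : Bounded s) where

    sz d g nb : ℕ
    sz = reg s szV
    g  = reg s gV
    nb = reg s nbV
    t q e goal : ℕ → ℕ
    t ρ    = arr s LST (reg s dV * reg s NV + ρ)
    q ρ    = arr s WS (t ρ)
    e ρ    = arr s HH (t ρ)
    goal ρ = nb + reg s uV + reg s xV + t ρ
    M cand : ℕ → ℕ → ℕ
    M ρ j    = arr s COL j + arr s SL j * q ρ
    cand ρ j = M ρ j + e ρ
    d = reg s dV

    module _ (R : ℕ) (sz≥1 : 1 ≤ sz)
             (t< : ∀ {ρ} → ρ < R → t ρ < nb)
             (slopes : ∀ {i j} → i ≤ j → j < sz → arr s SL i ≤ arr s SL j)
             (weights : ∀ {i j} → i ≤ j → j < R → q i ≤ q j)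
             (fit : ∀ {ρ j} → ρ < R → j < sz → cand ρ j ≤ V) where

      -- Rows are handled from the largest query downwards, so those from `r` on are finished.
      -- `done` is completeness, `origin` is soundness, and `decrease` ensures that completeness
      -- reached earlier is not lost.
      record Progress (r : ℕ) (s′ : Store) : Set where
        pattern
        constructor progress
        field
          done     : ∀ {ρ j} → r ≤ ρ → ρ < R → j < sz → arr s′ HH (goal ρ) ≤ cand ρ j
          decrease : ∀ i → arr s′ HH i ≤ arr s HH i
          origin   : ∀ i → arr s′ HH i ≡ arr s HH i ⊎ (∃₂ λ ρ j → ρ < R × j < sz × i ≡ goal ρ × arr s′ HH i ≡ cand ρ j)
      open Progress public

      -- Only cells of the new table are written, and they begin at `nb`. The costs of the late
      -- sets, which are read from the same array, therefore stay valid during the updates.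
      old : ∀ {r s′} → Progress r s′ → ∀ {i} → i < nb → arr s′ HH i ≡ arr s HH i
      old pr {i} i< with origin pr i
      ... | inj₁ eq = eq
      ... | inj₂ (ρ , j , _ , _ , refl , _) =
        ⊥-elim (<⇒≱ i< (≤-trans (m≤m+n nb _) (≤-trans (m≤m+n (nb + reg s uV) _) (m≤m+n _ (t ρ)))))

      progress-same : ∀ {r s′ s″} → (∀ i → arr s″ HH i ≡ arr s′ HH i) → Progress r s′ → Progress r s″
      progress-same same (progress done decrease origin) = progress
        (λ r≤ ρ< j< → ≤-trans (≤-reflexive (same _)) (done r≤ ρ< j<))
        (λ i → ≤-trans (≤-reflexive (same i)) (decrease i))
        (λ i → origin′ i (origin i))
        where
        origin′ : ∀ i → _ → _
        origin′ i (inj₁ eq) = inj₁ (trans (same i) eq)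
        origin′ i (inj₂ (ρ , j , a , b , c , eq)) = inj₂ (ρ , j , a , b , c , trans (same i) eq)

      -- Each line is beaten or equalled from within the window; no particular optimal line is
      -- named, so ties need no convention.
      Window : ℕ → ℕ → ℕ → Set
      Window r lo hi = ∀ {j} → j < sz → ∃[ k ] (lo ≤ k × k ≤ hi × M r k ≤ M r j)

      row-correct : ∀ {s′ r} → Keeps block s s′ → reg s′ rV ≡ suc r → r < R → Progress (suc r) s′ →
        reg s′ loV ≤ reg s′ hiV → reg s′ hiV < sz → Window r (reg s′ loV) (reg s′ hiV) →
        Run row s′ (λ d s″ → d ≤ 10 + 6 * (reg s′ hiV ∸ reg s′ loV) × reg s″ rV ≡ r × Progress r s″)
      row-correct {s′} {r} ks rV≡ r<R pr lo≤hi hi<sz window =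
        run-⨾ (run-:= r≤V (run-⨾ (run-:= t≤V (run-⨾ (run-:= q≤V (run-⨾
          (run-keeps (isBounded k₃) (scan-correct (isBounded k₃) lo≤hi
            (λ j j≤hi → ≤-trans (≤-reflexive (line≡ j)) (≤-trans (m≤m+n _ (e r)) (fit r<R (≤-<-trans j≤hi hi<sz)))))
            (λ {d} {s₄} k₄ (time , sc) → after k₄ time sc))))))))
        where
        bd′ : Bounded s′
        bd′ = isBounded ks
        r′ t′ q′ : ℕ
        r′ = reg s′ rV ∸ 1
        t′ = arr s′ LST (reg s′ dV * reg s′ NV + r′)
        q′ = arr s′ WS t′
        r≤V : r′ ≤ V
        r≤V = ≤-trans (m∸n≤m _ 1) (reg≤ bd′ rV)
        t≤V : t′ ≤ V
        t≤V = arr≤ bd′ LST _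
        q≤V : q′ ≤ V
        q≤V = arr≤ bd′ WS t′
        s₃ : Store
        s₃ = setReg (setReg (setReg s′ rV r′) tV t′) qV q′
        k₃ : Keeps block s s₃
        k₃ = keeps-trans (keeps-trans (keeps-trans ks
               (keeps-setReg rV r′ refl bd′ r≤V)) (keeps-setReg tV t′ refl (bounded-setReg rV bd′ r≤V) t≤V))
               (keeps-setReg qV q′ refl (bounded-setReg tV (bounded-setReg rV bd′ r≤V) t≤V) q≤V)
        r≡ : r′ ≡ r
        r≡ = cong (_∸ 1) rV≡
        t≡ : t′ ≡ t r
        t≡ = trans (keptArr ks LST refl _) (cong (arr s LST) (cong₂ _+_ (cong₂ _*_ (kept ks dV refl) (kept ks NV refl)) r≡))
        q≡ : q′ ≡ q r
        q≡ = trans (keptArr ks WS refl t′) (cong (arr s WS) t≡)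
        line≡ : ∀ j → lineAt s₃ j ≡ M r j
        line≡ j = cong₂ _+_ (keptArr ks COL refl j) (cong₂ _*_ (keptArr ks SL refl j) q≡)
        after : ∀ {d s₄} → Keeps scan s₃ s₄ → d ≤ 4 + 6 * (reg s′ hiV ∸ reg s′ loV) →
          Scanned (reg s′ loV) (reg s′ hiV) (lineAt s₃) s₄ →
          Run (vV := var bestV ⊕ HH at var tV ⨾ cond (HH at target ⊖ var vV) (HH ⟦ target ⟧:= var vV) skip) s₄
            (λ d′ s″ → 1 + (1 + (1 + (d + d′))) ≤ 10 + 6 * (reg s′ hiV ∸ reg s′ loV) × reg s″ rV ≡ r × Progress r s″)
        after {d} {s₄} k₄ time sc = run-⨾ (run-:= v≤V (run-cond
            (λ gt → run-put v≤V (tick ≤-refl , trans (kept k₄ rV refl) r≡ , improve (<⇒≤ (m∸n≢0⇒n<m gt))))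
            (λ le → run-skip (tick (s≤s (s≤s z≤n)) , trans (kept k₄ rV refl) r≡ , stay (m∸n≡0⇒m≤n le)))))
          where
          a v i₀ : ℕ
          a  = reg s₄ argV
          v  = reg s₄ bestV + arr s₄ HH (reg s₄ tV)
          i₀ = reg s₄ nbV + reg s₄ uV + reg s₄ xV + reg s₄ tV
          a<sz : a < sz
          a<sz = ≤-<-trans (arg≤hi sc) hi<sz
          t₄≡ : reg s₄ tV ≡ t r
          t₄≡ = trans (kept k₄ tV refl) t≡
          hh≡ : ∀ i → arr s₄ HH i ≡ arr s′ HH i
          hh≡ = keptArr k₄ HH refl
          v≡ : v ≡ cand r a
          v≡ = cong₂ _+_ (trans (best≡ sc) (line≡ a)) (trans (hh≡ _) (trans (cong (arr s′ HH) t₄≡) (old pr (t< r<R))))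
          v≤V : v ≤ V
          v≤V = ≤-trans (≤-reflexive v≡) (fit r<R a<sz)
          i₀≡ : i₀ ≡ goal r
          i₀≡ = cong₂ _+_ (cong₂ _+_ (cong₂ _+_ (trans (kept k₄ nbV refl) (kept ks nbV refl))
                  (trans (kept k₄ uV refl) (kept ks uV refl))) (trans (kept k₄ xV refl) (kept ks xV refl))) t₄≡
          best : ∀ {j} → j < sz → cand r a ≤ cand r j
          best {j} j< with window j<
          ... | k , lo≤k , k≤hi , k≤j = +-monoˡ-≤ (e r)
            (≤-trans (subst₂ _≤_ (line≡ a) (line≡ k) (least sc k lo≤k k≤hi)) k≤j)
          tick : ∀ {x} → x ≤ 3 → 1 + (1 + (1 + (d + x))) ≤ 10 + 6 * (reg s′ hiV ∸ reg s′ loV)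
          tick {x} x≤ = ≤-trans (+-monoʳ-≤ 3 (+-mono-≤ time x≤)) (≤-reflexive (eq (6 * (reg s′ hiV ∸ reg s′ loV))))
            where
            eq : ∀ z → 3 + (4 + z + 3) ≡ 10 + z
            eq = solve-∀
          case≥ : ∀ {A : Set} {ρ} → r ≤ ρ → (ρ ≡ r → A) → (suc r ≤ ρ → A) → A
          case≥ {ρ = ρ} r≤ρ f g with r ≟ ρ
          ... | yes refl = f refl
          ... | no r≢ρ   = g (≤∧≢⇒< r≤ρ r≢ρ)
          s₅ : Store
          s₅ = setReg s₄ vV v
          pr₅ : Progress (suc r) s₅
          pr₅ = progress-same hh≡ pr
          stay : arr s₄ HH i₀ ≤ v → Progress r s₅
          stay le = progress
            (λ {ρ} {j} r≤ ρ< j< → case≥ r≤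
              (λ { refl → ≤-trans (subst (λ i → arr s₄ HH i ≤ v) i₀≡ le) (≤-trans (≤-reflexive v≡) (best j<)) })
              (λ r< → done pr₅ r< ρ< j<))
            (decrease pr₅) (origin pr₅)
          s₆ : Store
          s₆ = setArr s₅ HH i₀ v
          improve : v ≤ arr s₄ HH i₀ → Progress r s₆
          improve le = progress
            (λ {ρ} {j} r≤ ρ< j< → case≥ r≤
              (λ { refl → ≤-trans (≤-reflexive (≔-same (arr s₄ HH) i₀ v i₀≡)) (≤-trans (≤-reflexive v≡) (best j<)) })
              (λ r< → ≤-trans (lower (goal ρ)) (done pr₅ r< ρ< j<)))
            (λ i → ≤-trans (lower i) (decrease pr₅ i))
            from
            where
            lower : ∀ i → arr s₆ HH i ≤ arr s₅ HH i
            lower i with i₀ ≟ i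
            ... | yes refl = ≤-trans (≤-reflexive (≔-same (arr s₄ HH) i₀ v refl)) le
            ... | no i₀≢i  = ≤-reflexive (≔-other (arr s₄ HH) i₀ v i₀≢i)
            from : ∀ i → arr s₆ HH i ≡ arr s HH i ⊎ (∃₂ λ ρ j → ρ < R × j < sz × i ≡ goal ρ × arr s₆ HH i ≡ cand ρ j)
            from i with i₀ ≟ i
            ... | yes refl = inj₂ (r , a , r<R , a<sz , i₀≡ , trans (≔-same (arr s₄ HH) i₀ v refl) v≡)
            ... | no i₀≢i with origin pr₅ i
            ...   | inj₁ eq = inj₁ (trans (≔-other (arr s₄ HH) i₀ v i₀≢i) eq)
            ...   | inj₂ (ρ , j , x , y , z , eq) = inj₂ (ρ , j , x , y , z , trans (≔-other (arr s₄ HH) i₀ v i₀≢i) eq)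

      -- For all remaining queries, which are smaller than those already handled, the lines to the
      -- left of `loV` can be ignored: a steeper line that wins at some query also wins at every
      -- smaller one.
      record Rest (r : ℕ) (s′ : Store) : Set where
        pattern
        constructor rest
        field
          lo<sz : reg s′ loV < sz
          left  : ∀ {ρ j} → ρ < r → j < reg s′ loV → M ρ (reg s′ loV) ≤ M ρ j
          prog  : Progress r s′

      -- 6 ticks per step of a scan; the window of the block is paid for by the advance of loV
      block-correct : ∀ {s′ r} → Keeps block s s′ → 1 ≤ g → reg s′ rV ≡ r + g → r + g ≤ R → Rest (r + g) s′ →
        Run block s′ (λ d s″ → d + 6 * (g * reg s′ loV) ≤ 12 + 6 * sz + 12 * g + 6 * (g * reg s″ loV) × reg s″ rV ≡ r × Rest r s″)
      block-correct {s′} {r} ks 1≤g rV≡ r+g≤R (rest lo<sz left pr) =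
        run-⨾ (run-:= t≤V (run-⨾ (run-:= q≤V (run-⨾ (run-:= z≤V (run-⨾
          (run-keeps (isBounded k₃) (scan-correct (isBounded k₃) lo≤z
            (λ j j≤ → ≤-trans (≤-reflexive (line≡ j)) (≤-trans (m≤m+n _ (e r)) (fit r<R (≤z⇒<sz j≤)))))
            (λ {d} {s₄} k₄ (time , sc) → after k₄ time sc))))))))
        where
        bd′ : Bounded s′
        bd′ = isBounded ks
        r′ t′ q′ z lo : ℕ
        r′ = reg s′ rV ∸ reg s′ gV
        t′ = arr s′ LST (reg s′ dV * reg s′ NV + r′)
        q′ = arr s′ WS t′
        z  = reg s′ szV ∸ 1
        lo = reg s′ loV
        t≤V : t′ ≤ V
        t≤V = arr≤ bd′ LST _
        q≤V : q′ ≤ V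
        q≤V = arr≤ bd′ WS t′
        z≤V : z ≤ V
        z≤V = ≤-trans (m∸n≤m _ 1) (reg≤ bd′ szV)
        s₃ : Store
        s₃ = setReg (setReg (setReg s′ tV t′) qV q′) hiV z
        k₃ : Keeps block s s₃
        k₃ = keeps-trans (keeps-trans (keeps-trans ks
               (keeps-setReg tV t′ refl bd′ t≤V)) (keeps-setReg qV q′ refl (bounded-setReg tV bd′ t≤V) q≤V))
               (keeps-setReg hiV z refl (bounded-setReg qV (bounded-setReg tV bd′ t≤V) q≤V) z≤V)
        r<R : r < R
        r<R = <-≤-trans (m<m+n r 1≤g) r+g≤R
        r≡ : r′ ≡ r
        r≡ = trans (cong₂ _∸_ rV≡ (kept ks gV refl)) (m+n∸n≡m r g)
        t≡ : t′ ≡ t r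
        t≡ = trans (keptArr ks LST refl _) (cong (arr s LST) (cong₂ _+_ (cong₂ _*_ (kept ks dV refl) (kept ks NV refl)) r≡))
        q≡ : q′ ≡ q r
        q≡ = trans (keptArr ks WS refl t′) (cong (arr s WS) t≡)
        z≡ : z ≡ sz ∸ 1
        z≡ = cong (_∸ 1) (kept ks szV refl)
        suc-z : suc z ≡ sz
        suc-z = trans (cong suc z≡) (m+[n∸m]≡n sz≥1)
        ≤z⇒<sz : ∀ {j} → j ≤ z → j < sz
        ≤z⇒<sz {j} j≤ = subst (suc j ≤_) suc-z (s≤s j≤)
        <sz⇒≤z : ∀ {j} → j < sz → j ≤ z
        <sz⇒≤z {j} j< = ≤-pred (subst (suc j ≤_) (sym suc-z) j<)
        lo≤z : lo ≤ z
        lo≤z = <sz⇒≤z lo<sz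
        line≡ : ∀ j → lineAt s₃ j ≡ M r j
        line≡ j = cong₂ _+_ (keptArr ks COL refl j) (cong₂ _*_ (keptArr ks SL refl j) q≡)
        after : ∀ {d s₄} → Keeps scan s₃ s₄ → d ≤ 4 + 6 * (z ∸ lo) → Scanned lo z (lineAt s₃) s₄ →
          Run (hiV := var argV ⨾ kV := lit 0 ⨾ while (var gV ⊖ var kV) rowStep ⨾ loV := var hiV) s₄
            (λ d′ s″ → 1 + (1 + (1 + (d + d′))) + 6 * (g * lo) ≤ 12 + 6 * sz + 12 * g + 6 * (g * reg s″ loV) × reg s″ rV ≡ r × Rest r s″)
        after {d} {s₄} k₄ time sc =
          run-⨾ (run-:= (reg≤ b₄ argV) (run-⨾ (run-:= z≤n (run-⨾ (run-while I g (isBounded k₆)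
            (inv z≤n (trans (+-identityʳ _) (trans (kept k₄ rV refl) rV≡)) refl
              (subst (λ x → Progress x s₆) (sym (trans (kept k₄ rV refl) rV≡)) (progress-same (keptArr k₄ HH refl) pr)))
            body end)))))
          where
          b₄ = isBounded k₄
          hi : ℕ
          hi = reg s₄ argV
          s₆ : Store
          s₆ = setReg (setReg s₄ hiV hi) kV 0
          k₆ : Keeps block s s₆
          k₆ = keeps-trans (keeps-trans (keeps-trans k₃ (keeps-⊑ scan⊑block k₄))
                 (keeps-setReg hiV hi refl b₄ (reg≤ b₄ argV)))
                 (keeps-setReg kV 0 refl (bounded-setReg hiV b₄ (reg≤ b₄ argV)) z≤n)
          lo₆ : reg s₆ loV ≡ lo
          lo₆ = kept k₄ loV refl
          hi<sz : hi < sz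
          hi<sz = ≤z⇒<sz (arg≤hi sc)
          lo≤hi : lo ≤ hi
          lo≤hi = lo≤arg sc
          hi-best : ∀ {j} → j < sz → M r hi ≤ M r j
          hi-best {j} j< with lo ≤? j
          ... | yes lo≤j = subst₂ _≤_ (line≡ hi) (line≡ j) (least sc j lo≤j (<sz⇒≤z j<))
          ... | no lo≰j  = ≤-trans (subst₂ _≤_ (line≡ hi) (line≡ lo) (least sc lo ≤-refl lo≤z))
                             (left (m<m+n r 1≤g) (≰⇒> lo≰j))
          -- Lines left of `lo` lose by `left`. A line right of `hi` is at least as steep as `hi`
          -- and does not beat it at the smallest query `r` of the block, so by `line-right` it does
          -- not at the larger ones either.
          window : ∀ {ρ} → r ≤ ρ → ρ < r + g → Window ρ lo hi
          window {ρ} r≤ρ ρ< {j} j< with lo ≤? j | j ≤? hi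
          ... | no lo≰j | _ = lo , ≤-refl , lo≤hi , left ρ< (≰⇒> lo≰j)
          ... | yes lo≤j | yes j≤hi = j , lo≤j , j≤hi , ≤-refl
          ... | yes lo≤j | no j≰hi  = hi , lo≤hi , ≤-refl ,
            line-right {arr s COL hi} {arr s COL j} (slopes (<⇒≤ (≰⇒> j≰hi)) j<) (weights r≤ρ (<-≤-trans ρ< r+g≤R)) (hi-best j<)
          record I (k d : ℕ) (s₇ : Store) : Set where
            pattern
            constructor inv
            field
              time′ : d ≤ k * (12 + 6 * (hi ∸ lo))
              r+k≡  : reg s₇ rV + k ≡ r + g
              k≡    : reg s₇ kV ≡ k
              prog′ : Progress (reg s₇ rV) s₇
          body : ∀ {k d s₇} → Keeps rowStep s₆ s₇ → k < g → I k d s₇ →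
            eval (var gV ⊖ var kV) s₇ ≢ 0 × Run rowStep s₇ (λ d′ → I (suc k) (d + suc d′))
          body {k} {d₇} {s₇} k₇ k<g (inv time′ r+k≡ k≡ prog′) =
            (λ eq → m>n⇒m∸n≢0 k<g (trans (sym (cong₂ _∸_ (kept ks₇ gV refl) k≡)) eq)) ,
            run-⨾ (run-keeps (isBounded k₇) (row-correct ks₇ r≡suc (<-≤-trans ρ<r+g r+g≤R)
                (subst (λ x → Progress x s₇) r≡suc prog′)
                (subst₂ _≤_ (sym lo₇) (sym hi₇) lo≤hi) (subst (_< sz) (sym hi₇) hi<sz)
                (subst₂ (Window ρ) (sym lo₇) (sym hi₇) (window r≤ρ ρ<r+g)))
              (λ {d₈} {s₈} k₈ (t₈ , r₈ , p₈) → run-:=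
                (subst (_≤ V) (trans (+-comm 1 k) (cong (_+ 1) (sym (trans (kept k₈ kV refl) k≡))))
                  (≤-trans k<g (reg≤ bd gV)))
                (inv (tick d₈ t₈) (trans (cong (_+ suc k) r₈) (trans (+-suc ρ k) (trans (cong (_+ k) (sym r≡suc)) r+k≡)))
                  (trans (cong (_+ 1) (trans (kept k₈ kV refl) k≡)) (+-comm k 1))
                  (progress-same (λ _ → refl) (subst (λ x → Progress x s₈) (sym r₈) p₈)))))
            where
            ks₇ : Keeps block s s₇
            ks₇ = keeps-trans k₆ (keeps-⊑ rowStep⊑block k₇)
            lo₇ : reg s₇ loV ≡ lo
            lo₇ = trans (kept k₇ loV refl) lo₆
            hi₇ : reg s₇ hiV ≡ hi
            hi₇ = kept k₇ hiV refl
            r<rV : r < reg s₇ rV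
            r<rV = +-cancelʳ-< k r (reg s₇ rV) (subst (r + k <_) (sym r+k≡) (+-monoʳ-< r k<g))
            ρ : ℕ
            ρ = reg s₇ rV ∸ 1
            r≡suc : reg s₇ rV ≡ suc ρ
            r≡suc = sym (m+[n∸m]≡n (≤-trans (s≤s z≤n) r<rV))
            r≤ρ : r ≤ ρ
            r≤ρ = ≤-pred (subst (suc r ≤_) r≡suc r<rV)
            ρ<r+g : ρ < r + g
            ρ<r+g = subst (suc ρ ≤_) r+k≡ (≤-trans (≤-reflexive (sym r≡suc)) (m≤m+n _ k))
            tick : ∀ d₈ → d₈ ≤ 10 + 6 * (reg s₇ hiV ∸ reg s₇ loV) → d₇ + suc (d₈ + 1) ≤ suc k * (12 + 6 * (hi ∸ lo))
            tick d₈ t₈ = begin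
              d₇ + suc (d₈ + 1)                                            ≤⟨ +-mono-≤ time′ (s≤s (+-monoˡ-≤ 1 (subst₂ (λ x y → d₈ ≤ 10 + 6 * (x ∸ y)) hi₇ lo₇ t₈))) ⟩
              k * (12 + 6 * (hi ∸ lo)) + suc (10 + 6 * (hi ∸ lo) + 1)      ≡⟨ eq (k * (12 + 6 * (hi ∸ lo))) (6 * (hi ∸ lo)) ⟩
              suc k * (12 + 6 * (hi ∸ lo))                                 ∎
              where
              open ≤-Reasoning
              eq : ∀ a b → a + suc (10 + b + 1) ≡ (12 + b) + a
              eq = solve-∀
          end : ∀ {d₇ s₇} → Keeps rowStep s₆ s₇ → I g d₇ s₇ → eval (var gV ⊖ var kV) s₇ ≡ 0 ×
            Run (loV := var hiV) s₇ (λ d₈ s″ → 1 + (1 + (1 + (d + (1 + (1 + (d₇ + 1 + d₈)))))) + 6 * (g * lo) ≤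
              12 + 6 * sz + 12 * g + 6 * (g * reg s″ loV) × reg s″ rV ≡ r × Rest r s″)
          end {d₇} {s₇} k₇ (inv time′ r+k≡ k≡ prog′) =
            trans (cong₂ _∸_ (kept ks₇ gV refl) k≡) (n∸n≡0 g) ,
            run-:= (reg≤ (isBounded k₇) hiV) (total , r₇ , rest (subst (_< sz) (sym hi₇) hi<sz)
              (λ {ρ} {j} ρ<r j< → subst (λ x → M ρ x ≤ M ρ j) (sym hi₇)
                (left′ ρ<r (subst (j <_) hi₇ j<)))
              (progress-same (λ _ → refl) (subst (λ x → Progress x s₇) r₇ prog′)))
            where
            ks₇ : Keeps block s s₇
            ks₇ = keeps-trans k₆ (keeps-⊑ rowStep⊑block k₇)
            hi₇ : reg s₇ hiV ≡ hi
            hi₇ = kept k₇ hiV refl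
            r₇ : reg s₇ rV ≡ r
            r₇ = +-cancelʳ-≡ g _ r r+k≡
            left′ : ∀ {ρ j} → ρ < r → j < hi → M ρ hi ≤ M ρ j
            left′ {ρ} {j} ρ<r j<hi = line-left {arr s COL hi} {arr s COL j} (slopes (<⇒≤ j<hi) hi<sz)
              (weights (<⇒≤ ρ<r) r<R) (hi-best (<-trans j<hi hi<sz))
            total : 1 + (1 + (1 + (d + (1 + (1 + (d₇ + 1 + 1)))))) + 6 * (g * lo) ≤ 12 + 6 * sz + 12 * g + 6 * (g * reg s₇ hiV)
            total = begin
              1 + (1 + (1 + (d + (1 + (1 + (d₇ + 1 + 1)))))) + 6 * (g * lo)
                ≤⟨ +-monoˡ-≤ (6 * (g * lo)) (+-monoʳ-≤ 3 (+-mono-≤ time (+-monoʳ-≤ 2 (+-monoˡ-≤ 1 (+-monoˡ-≤ 1 time′))))) ⟩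
              3 + (4 + 6 * (z ∸ lo) + (2 + (g * (12 + 6 * (hi ∸ lo)) + 1 + 1))) + 6 * (g * lo)
                ≡⟨ eq (6 * (z ∸ lo)) g (hi ∸ lo) lo ⟩
              11 + 6 * (z ∸ lo) + 12 * g + 6 * (g * (hi ∸ lo + lo))
                ≡⟨ cong (λ x → 11 + 6 * (z ∸ lo) + 12 * g + 6 * (g * x)) (trans (m∸n+n≡m lo≤hi) (sym hi₇)) ⟩
              11 + 6 * (z ∸ lo) + 12 * g + 6 * (g * reg s₇ hiV)
                ≤⟨ +-monoˡ-≤ (6 * (g * reg s₇ hiV)) (+-monoˡ-≤ (12 * g) (+-mono-≤ (n≤1+n 11) (*-monoʳ-≤ 6
                     (≤-trans (m∸n≤m z lo) (≤-trans (n≤1+n z) (≤-reflexive suc-z)))))) ⟩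
              12 + 6 * sz + 12 * g + 6 * (g * reg s₇ hiV) ∎
              where
              open ≤-Reasoning
              eq : ∀ a g x y → 3 + (4 + a + (2 + (g * (12 + 6 * x) + 1 + 1))) + 6 * (g * y) ≡ 11 + a + 12 * g + 6 * (g * (x + y))
              eq = solve-∀

      -- The advances of `loV` telescope to at most `sz`, so all windows together cost
      -- `6 * (g * sz)`. Besides that, each of the `h` blocks pays for one long scan and for
      -- constant work on each of its `g` queries.
      rows-correct : ∀ h → 1 ≤ g → R ≡ h * g → reg s rV ≡ R → reg s loV ≡ 0 →
        Run (while (var rV) block) s (λ d s″ → d ≤ h * (13 + 6 * sz + 12 * g) + 6 * (g * sz) + 1 × Progress 0 s″)
      rows-correct h 1≤g R≡ rV≡ lo≡ = run-while I h bd
        (inv z≤n (trans (+-identityʳ _) (trans rV≡ R≡))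
          (rest (subst (_< sz) (sym lo≡) sz≥1) (λ {_} {j} _ j< → ⊥-elim (n≮0 (subst (j <_) lo≡ j<)))
            (progress (λ {ρ} r≤ρ ρ<R → ⊥-elim (<⇒≱ ρ<R (subst (_≤ ρ) rV≡ r≤ρ))) (λ _ → ≤-refl) (λ _ → inj₁ refl))))
        body end
        where
        record I (k d : ℕ) (s′ : Store) : Set where
          pattern
          constructor inv
          field
            time : d ≤ k * (13 + 6 * sz + 12 * g) + 6 * (g * reg s′ loV)
            r≡   : reg s′ rV + k * g ≡ h * g
            rst  : Rest (reg s′ rV) s′
        body : ∀ {k d s′} → Keeps block s s′ → k < h → I k d s′ →
          eval (var rV) s′ ≢ 0 × Run block s′ (λ d′ → I (suc k) (d + suc d′))
        body {k} {d} {s′} ks k<h (inv time r≡ rst) =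
          (λ eq → n≮0 (subst (1 ≤_) eq 1≤rV)) ,
          run-mono (λ {d′} {s″} (t″ , r″ , rst″) → inv (tick d′ s″ t″)
              (trans (cong (_+ suc k * g) r″) (trans (sym (+-assoc r g (k * g))) (trans (cong (_+ k * g) (sym rV≡′)) r≡)))
              (subst (λ x → Rest x s″) (sym r″) rst″))
            (block-correct ks 1≤g rV≡′ (subst (_≤ R) rV≡′ (≤-trans (m≤m+n _ (k * g)) (≤-reflexive (trans r≡ (sym R≡)))))
              (subst (λ x → Rest x s′) rV≡′ rst))
          where
          g≤rV : g ≤ reg s′ rV
          g≤rV = +-cancelʳ-≤ (k * g) _ _ (subst (g + k * g ≤_) (sym r≡) (*-monoˡ-≤ g k<h))
          1≤rV : 1 ≤ reg s′ rV
          1≤rV = ≤-trans 1≤g g≤rV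
          r : ℕ
          r = reg s′ rV ∸ g
          rV≡′ : reg s′ rV ≡ r + g
          rV≡′ = sym (m∸n+n≡m g≤rV)
          tick : ∀ d′ s″ → d′ + 6 * (g * reg s′ loV) ≤ 12 + 6 * sz + 12 * g + 6 * (g * reg s″ loV) →
            d + suc d′ ≤ suc k * (13 + 6 * sz + 12 * g) + 6 * (g * reg s″ loV)
          tick d′ s″ t″ = begin
            d + suc d′                                       ≤⟨ +-monoˡ-≤ (suc d′) time ⟩
            K + L + suc d′                                   ≡⟨ eq₁ K L d′ ⟩
            K + 1 + (d′ + L)                                 ≤⟨ +-monoʳ-≤ (K + 1) t″ ⟩
            K + 1 + (12 + 6 * sz + 12 * g + L″)              ≡⟨ eq₂ K (6 * sz) (12 * g) L″ ⟩
            13 + 6 * sz + 12 * g + K + L″                    ∎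
            where
            open ≤-Reasoning
            K = k * (13 + 6 * sz + 12 * g)
            L = 6 * (g * reg s′ loV)
            L″ = 6 * (g * reg s″ loV)
            eq₁ : ∀ a b c → a + b + suc c ≡ a + 1 + (c + b)
            eq₁ = solve-∀
            eq₂ : ∀ a b c d → a + 1 + (12 + b + c + d) ≡ 13 + b + c + a + d
            eq₂ = solve-∀
        end : ∀ {d s′} → Keeps block s s′ → I h d s′ → eval (var rV) s′ ≡ 0 ×
          (d + 1 ≤ h * (13 + 6 * sz + 12 * g) + 6 * (g * sz) + 1 × Progress 0 s′)
        end {d} {s′} ks (inv time r≡ rst@(rest lo<sz _ pr)) =
          r0 , +-monoˡ-≤ 1 (≤-trans time (+-monoʳ-≤ (h * (13 + 6 * sz + 12 * g)) (*-monoʳ-≤ 6 (*-monoʳ-≤ g (<⇒≤ lo<sz))))) ,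
          subst (λ x → Progress x s′) r0 pr
          where
          r0 : reg s′ rV ≡ 0
          r0 = +-cancelʳ-≡ (h * g) _ 0 r≡

  -- Sorting the jobs

  entry : Store → ℕ → ℕ × ℕ
  entry s k = arr s PA k , arr s WA k

  job : ℕ → ℕ × ℕ
  job k = input (2 + k) , input (2 + input 0 + k)

  swap-correct : ∀ {s} → Bounded s → Run swapCmd s (λ τ s′ → τ ≡ 6 × reg s′ jV ≡ reg s jV ×
    entry s′ (reg s jV) ≡ entry s (suc (reg s jV)) × entry s′ (suc (reg s jV)) ≡ entry s (reg s jV) ×
    (∀ {i} → i ≢ reg s jV → i ≢ suc (reg s jV) → entry s′ i ≡ entry s i))
  swap-correct {s} bd =
    run-⨾ (run-:= pj≤ (run-⨾ (run-put pj+1≤ (run-⨾ (run-put pj≤ (run-⨾ (run-:= wj≤ (run-⨾ (run-put wj+1≤ (run-put wj≤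
      (refl , refl , cong₂ _,_ (at-j (arr s PA)) (at-j (arr s WA)) , cong₂ _,_ (at-j+1 (arr s PA)) (at-j+1 (arr s WA)) ,
       λ i≢ i≢′ → cong₂ _,_ (elsewhere (arr s PA) i≢ i≢′) (elsewhere (arr s WA) i≢ i≢′))))))))))))
    where
    j : ℕ
    j = reg s jV
    pj≤ : arr s PA j ≤ V
    pj≤ = arr≤ bd PA j
    wj≤ : arr s WA j ≤ V
    wj≤ = arr≤ bd WA j
    pj+1≤ : arr s PA (j + 1) ≤ V
    pj+1≤ = arr≤ bd PA (j + 1)
    wj+1≤ : arr s WA (j + 1) ≤ V
    wj+1≤ = arr≤ bd WA (j + 1)
    module _ (f : ℕ → ℕ) where
      f₁ f₂ : ℕ → ℕ
      f₁ = f [ j ≔ f (j + 1) ]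
      f₂ = f₁ [ j + 1 ≔ f j ]
      at-j : f₂ j ≡ f (suc j)
      at-j = trans (≔-other f₁ (j + 1) (f j) (λ eq → 1+n≢n (trans (+-comm 1 j) eq)))
        (trans (≔-same f j (f (j + 1)) refl) (cong f (+-comm j 1)))
      at-j+1 : f₂ (suc j) ≡ f j
      at-j+1 = ≔-same f₁ (j + 1) (f j) (+-comm j 1)
      elsewhere : ∀ {i} → i ≢ j → i ≢ suc j → f₂ i ≡ f i
      elsewhere i≢ i≢′ = trans (≔-other f₁ (j + 1) (f j) (λ eq → i≢′ (trans (sym eq) (+-comm j 1))))
        (≔-other f j (f (j + 1)) (λ eq → i≢ (sym eq)))

  -- Entry `j` may be too small for its predecessors, but the entries after `j` are in order with
  -- respect to it.
  SortedExcept : ℕ → ℕ → Store → Set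
  SortedExcept i j s = ∀ {x y} → x < y → y ≤ i → y ≢ j → entry s x ≼ entry s y

  -- The position `j` moves down to 0 even when the new entry has found its place, so that there are
  -- exactly `i` rounds. A round without a swap passes the exception on to `j ∸ 1`, by transitivity.
  sink-correct : ∀ {s i} → Bounded s → reg s jV ≡ i → SortedExcept i i s →
    Run (while (var jV) sink) s (λ τ s′ → τ ≤ 9 * i + 1 ×
      applyDownFrom (entry s′) (suc i) ↭ applyDownFrom (entry s) (suc i) × SortedExcept i 0 s′)
  sink-correct {s} {i} bd j≡ sorted = run-while I i bd
    (inv z≤n (trans (+-identityʳ _) j≡) (subst (λ j → SortedExcept i j s) (sym j≡) sorted) ↭-refl) body end
    where
    record I (k τ : ℕ) (s′ : Store) : Set where
      pattern
      constructor inv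
      field
        time    : τ ≤ 9 * k
        j+k≡    : reg s′ jV + k ≡ i
        sorted′ : SortedExcept i (reg s′ jV) s′
        perm    : applyDownFrom (entry s′) (suc i) ↭ applyDownFrom (entry s) (suc i)
    body : ∀ {k τ s′} → Keeps sink s s′ → k < i → I k τ s′ →
      eval (var jV) s′ ≢ 0 × Run sink s′ (λ τ′ → I (suc k) (τ + suc τ′))
    body {k} {τ} {s′} ks k<i (inv time j+k≡ sorted′ perm) =
      (λ eq → n≮0 (subst (1 ≤_) eq j≥1)) ,
      run-⨾ (run-:= j≤V (run-cond
        (λ gt → run-mono (λ {τ₁} {s₁} (τ≡ , j₁ , at-j , at-j+1 , away) →
            inv (≤-trans (≤-reflexive (cong (λ z → τ + suc (suc (suc z))) τ≡)) tick)
              (trans (cong (_+ suc k) j₁) j+k≡′)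
              (subst (λ z → SortedExcept i z s₁) (sym j₁) (swapped {s₁} (<⇒≤ (m∸n≢0⇒n<m gt)) at-j at-j+1 away))
              (↭-trans (applyDownFrom-swap {e = entry s′} j (suc i) (s≤s suc-j≤i) at-j at-j+1 away) perm))
          (swap-correct (bounded-setReg jV (isBounded ks) j≤V)))
        (λ le → run-skip (inv (≤-trans (+-monoʳ-≤ τ (s≤s (s≤s (s≤s z≤n)))) tick) j+k≡′ (stay (m∸n≡0⇒m≤n le)) perm))))
      where
      j : ℕ
      j = reg s′ jV ∸ 1
      j≤V : j ≤ V
      j≤V = ≤-trans (m∸n≤m _ 1) (reg≤ (isBounded ks) jV)
      j≥1 : 1 ≤ reg s′ jV
      j≥1 = +-cancelʳ-≤ k 1 (reg s′ jV) (subst (suc k ≤_) (sym j+k≡) k<i)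
      suc-j : suc j ≡ reg s′ jV
      suc-j = m+[n∸m]≡n j≥1
      suc-j≤i : suc j ≤ i
      suc-j≤i = subst (suc j ≤_) j+k≡ (subst (_≤ reg s′ jV + k) (sym suc-j) (m≤m+n _ k))
      j+k≡′ : j + suc k ≡ i
      j+k≡′ = trans (+-suc j k) (trans (cong (_+ k) suc-j) j+k≡)
      tick : τ + 9 ≤ 9 * suc k
      tick = ≤-trans (+-monoˡ-≤ 9 time) (≤-reflexive (trans (+-comm (9 * k) 9) (sym (*-suc 9 k))))
      sorted″ : SortedExcept i (suc j) s′
      sorted″ = subst (λ z → SortedExcept i z s′) (sym suc-j) sorted′
      e : ℕ → ℕ × ℕ
      e = entry s′
      stay : key (e j) * arr s′ WA (j + 1) ≤ key (e (j + 1)) * arr s′ WA j → SortedExcept i j s′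
      stay le {x} {y} x<y y≤i y≢j with y ≟ suc j
      ... | no y≢ = sorted″ x<y y≤i y≢
      ... | yes refl with x ≟ j
      ...   | yes refl = subst (λ z → e j ≼ e z) (+-comm j 1) le
      ...   | no x≢j   = ≼-trans {e x} {e j} {e (suc j)} (sorted″ (≤∧≢⇒< (≤-pred x<y) x≢j) (<⇒≤ suc-j≤i) (<⇒≢ ≤-refl))
                           (subst (λ z → e j ≼ e z) (+-comm j 1) le)
      swapped : ∀ {s₁} → key (e (j + 1)) * arr s′ WA j ≤ key (e j) * arr s′ WA (j + 1) →
        entry s₁ j ≡ e (suc j) → entry s₁ (suc j) ≡ e j → (∀ {x} → x ≢ j → x ≢ suc j → entry s₁ x ≡ e x) → SortedExcept i j s₁
      swapped {s₁} ge at-j at-j+1 away {x} {y} x<y y≤i y≢j with y ≟ suc j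
      ... | yes refl with x ≟ j
      ...   | yes refl = subst₂ _≼_ (sym at-j) (sym at-j+1) (subst (λ z → e z ≼ e j) (+-comm j 1) ge)
      ...   | no x≢j   = subst₂ _≼_ (sym (away x≢j (<⇒≢ x<y))) (sym at-j+1)
                           (sorted″ (≤∧≢⇒< (≤-pred x<y) x≢j) (<⇒≤ suc-j≤i) (<⇒≢ ≤-refl))
      swapped {s₁} ge at-j at-j+1 away {x} {y} x<y y≤i y≢j | no y≢ with x ≟ j | x ≟ suc j
      ... | yes refl | _ = subst₂ _≼_ (sym at-j) (sym (away y≢j y≢)) (sorted″ (≤∧≢⇒< x<y (λ eq → y≢ (sym eq))) y≤i y≢)
      ... | no _ | yes refl = subst₂ _≼_ (sym at-j+1) (sym (away y≢j y≢)) (sorted″ (<⇒≤ x<y) y≤i y≢)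
      ... | no x≢ | no x≢′ = subst₂ _≼_ (sym (away x≢ x≢′)) (sym (away y≢j y≢)) (sorted″ x<y y≤i y≢)
    end : ∀ {τ s′} → Keeps sink s s′ → I i τ s′ → eval (var jV) s′ ≡ 0 × (τ + 1 ≤ 9 * i + 1 ×
      applyDownFrom (entry s′) (suc i) ↭ applyDownFrom (entry s) (suc i) × SortedExcept i 0 s′)
    end {s′ = s′} ks (inv time j+k≡ sorted′ perm) = j≡0 , +-monoˡ-≤ 1 time , perm , subst (λ z → SortedExcept i z s′) j≡0 sorted′
      where
      j≡0 : reg s′ jV ≡ 0
      j≡0 = +-cancelʳ-≡ i _ 0 j+k≡

  record Arranged (s : Store) : Set where
    pattern
    constructor arranged
    field
      n≡     : reg s nV ≡ input 0
      m≡     : reg s mV ≡ input 1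
      perm   : applyDownFrom (entry s) (input 0) ↭ applyDownFrom job (input 0)
      sorted : ∀ {x y} → x < y → y < input 0 → entry s x ≼ entry s y

  sort-correct : ∀ {s} → Bounded s → B ≡ 2 + (input 0 + input 0) →
    Run sort s (λ τ s′ → τ ≤ input 0 * (9 * input 0 + 9) + 4 × Arranged s′)
  sort-correct {s} bd B≡ = run-⨾ (run-read (subst (0 <_) (sym B≡) (s≤s z≤n)) (run-⨾ (run-read (subst (1 <_) (sym B≡) (s≤s (s≤s z≤n)))
    (run-⨾ (run-:= z≤n (run-while I n b₁ (inv z≤n refl ↭-refl (λ _ ())) body end))))))
    where
    n : ℕ
    n = input 0
    s₁ : Store
    s₁ = setReg (setReg (setReg s nV (input 0)) mV (input 1)) iV 0
    b₁ : Bounded s₁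
    b₁ = bounded-setReg iV (bounded-setReg mV (bounded-setReg nV bd (input≤V 0)) (input≤V 1)) z≤n
    record I (i τ : ℕ) (s′ : Store) : Set where
      pattern
      constructor inv
      field
        time   : τ ≤ i * (9 * n + 9)
        i≡     : reg s′ iV ≡ i
        perm   : applyDownFrom (entry s′) i ↭ applyDownFrom job i
        sorted : ∀ {x y} → x < y → y < i → entry s′ x ≼ entry s′ y
    body : ∀ {i τ s′} → Keeps insert s₁ s′ → i < n → I i τ s′ →
      eval (var nV ⊖ var iV) s′ ≢ 0 × Run insert s′ (λ τ′ → I (suc i) (τ + suc τ′))
    body {i} {τ} {s′} ks i<n (inv time i≡ perm sorted) =
      (λ eq → m>n⇒m∸n≢0 i<n (trans (sym (cong₂ _∸_ (kept ks nV refl) i≡)) eq)) ,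
      run-⨾ (run-read a< (run-⨾ (run-put p≤V (run-⨾ (run-read a′< (run-⨾ (run-put w≤V (run-⨾ (run-:= i≤V
        (run-⨾ (run-keeps b₂ (sink-correct b₂ i≡ sorted₂) (λ {τ₃} {s₃} k₃ (time₃ , perm₃ , sorted₃) →
          run-:= (≤-trans (≤-reflexive (i+1 k₃)) (≤-trans i<n (input≤V 0)))
            (inv (tick τ₃ time₃) (i+1 k₃) (↭-trans perm₃ perm₂)
              (λ {x} {y} x<y y<i → sorted₃ x<y (≤-pred y<i) (λ { refl → n≮0 x<y })))))))))))))))
      where
      bd′ = isBounded ks
      i₀ : ℕ
      i₀ = reg s′ iV
      a< : 2 + i₀ < B
      a< = subst₂ (λ y z → 2 + y < z) (sym i≡) (sym B≡) (+-monoʳ-< 2 (<-≤-trans i<n (m≤m+n n n)))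
      a′< : 2 + reg s′ nV + i₀ < B
      a′< = subst₂ (λ x y → 2 + x + y < B) (sym (kept ks nV refl)) (sym i≡)
              (subst (2 + n + i <_) (sym B≡) (+-monoʳ-< 2 (+-monoʳ-< n i<n)))
      p₀ w₀ : ℕ
      p₀ = input (2 + i₀)
      w₀ = input (2 + reg s′ nV + i₀)
      p≤V : p₀ ≤ V
      p≤V = input≤V _
      w≤V : w₀ ≤ V
      w≤V = input≤V _
      i≤V : i₀ ≤ V
      i≤V = reg≤ bd′ iV
      s₂ : Store
      s₂ = setReg (setArr (setReg (setArr (setReg s′ tV p₀) PA i₀ p₀) tV w₀) WA i₀ w₀) jV i₀
      b₂ : Bounded s₂
      b₂ = bounded-setReg jV (bounded-setArr WA i₀ (bounded-setReg tV (bounded-setArr PA i₀ (bounded-setReg tV bd′ p≤V) p≤V) w≤V) w≤V) i≤V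
      below₂ : ∀ {x} → x < i → entry s₂ x ≡ entry s′ x
      below₂ {x} x< = cong₂ _,_ (≔-other (arr s′ PA) i₀ p₀ i₀≢x) (≔-other (arr s′ WA) i₀ w₀ i₀≢x)
        where
        i₀≢x : i₀ ≢ x
        i₀≢x eq = <⇒≢ x< (trans (sym eq) i≡)
      at₂ : entry s₂ i ≡ job i
      at₂ = cong₂ _,_ (trans (≔-same (arr s′ PA) i₀ p₀ i≡) (cong (λ y → input (2 + y)) i≡))
        (trans (≔-same (arr s′ WA) i₀ w₀ i≡) (cong₂ (λ x y → input (2 + x + y)) (kept ks nV refl) i≡))
      perm₂ : applyDownFrom (entry s₂) (suc i) ↭ applyDownFrom job (suc i)
      perm₂ = ↭-trans (↭-reflexive (cong₂ _∷_ at₂ (applyDownFrom-cong i below₂))) (↭-prep (job i) perm)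
      sorted₂ : SortedExcept i i s₂
      sorted₂ {x} {y} x<y y≤i y≢i = subst₂ _≼_ (sym (below₂ (<-trans x<y y<i))) (sym (below₂ y<i)) (sorted x<y y<i)
        where
        y<i : y < i
        y<i = ≤∧≢⇒< y≤i y≢i
      i+1 : ∀ {s₃} → Keeps (while (var jV) sink) s₂ s₃ → reg s₃ iV + 1 ≡ suc i
      i+1 k₃ = trans (cong (_+ 1) (trans (kept k₃ iV refl) i≡)) (+-comm i 1)
      tick : ∀ τ₃ → τ₃ ≤ 9 * i + 1 → τ + suc (1 + (1 + (1 + (1 + (1 + (τ₃ + 1)))))) ≤ suc i * (9 * n + 9)
      tick τ₃ time₃ = begin
        τ + (6 + (τ₃ + 1))                      ≤⟨ +-mono-≤ time (+-monoʳ-≤ 6 (+-monoˡ-≤ 1 (≤-trans time₃ (+-monoˡ-≤ 1 (*-monoʳ-≤ 9 (<⇒≤ i<n)))))) ⟩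
        i * (9 * n + 9) + (6 + (9 * n + 1 + 1)) ≤⟨ +-monoʳ-≤ (i * (9 * n + 9)) (≤-trans (≤-reflexive (eq (9 * n))) (+-monoʳ-≤ (9 * n) (n≤1+n 8))) ⟩
        i * (9 * n + 9) + (9 * n + 9)           ≡⟨ +-comm (i * (9 * n + 9)) (9 * n + 9) ⟩
        suc i * (9 * n + 9)                     ∎
        where
        open ≤-Reasoning
        eq : ∀ a → 6 + (a + 1 + 1) ≡ a + 8
        eq = solve-∀
    end : ∀ {τ s′} → Keeps insert s₁ s′ → I n τ s′ → eval (var nV ⊖ var iV) s′ ≡ 0 ×
      (1 + (1 + (1 + (τ + 1))) ≤ n * (9 * n + 9) + 4 × Arranged s′)
    end {τ} ks (inv time i≡ perm sorted) =
      trans (cong₂ _∸_ (kept ks nV refl) i≡) (n∸n≡0 n) ,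
      ≤-trans (≤-reflexive (eq τ)) (+-monoˡ-≤ 4 time) ,
      arranged (kept ks nV refl) (kept ks mV refl) perm sorted
      where
      eq : ∀ a → 1 + (1 + (1 + (a + 1))) ≡ a + 4
      eq = solve-∀

  module Sized (X : ℕ) (X≥2 : 2 ≤ X) (X^8≤V : X ^ 8 ≤ V) where
    open Powers X V X≥2 X^8≤V

    -- The lines of an early set

    module Columns (s : Store) (bd : Bounded s) (j≡0 : reg s jV ≡ 0) where
      sz : ℕ
      sz = reg s szV
      t col : ℕ → ℕ
      t j = arr s LST (reg s uV * reg s NV + j)
      col j = arr s HH (reg s obV + (reg s uV ∸ t j + reg s xV)) + arr s HH (t j)

      columns-correct : (∀ {j} → j < sz → col j ≤ V) →
        Run (while (var szV ⊖ var jV) columnStep) s (λ d s′ → d ≤ 5 * sz + 1 ×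
          (∀ {j} → j < sz → arr s′ COL j ≡ col j × arr s′ SL j ≡ arr s PS (t j)))
      columns-correct fit = run-while I sz bd (inv z≤n j≡0 λ ()) body end
        where
        record I (i d : ℕ) (s′ : Store) : Set where
          pattern
          constructor inv
          field
            time   : d ≤ 5 * i
            j≡     : reg s′ jV ≡ i
            filled : ∀ {j} → j < i → arr s′ COL j ≡ col j × arr s′ SL j ≡ arr s PS (t j)
        body : ∀ {i d s′} → Keeps columnStep s s′ → i < sz → I i d s′ →
          eval (var szV ⊖ var jV) s′ ≢ 0 × Run columnStep s′ (λ d′ → I (suc i) (d + suc d′))
        body {i} {d} {s′} ks i<sz (inv time j≡ filled) =
          (λ eq → m>n⇒m∸n≢0 i<sz (trans (sym (cong₂ _∸_ (kept ks szV refl) j≡)) eq)) ,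
          run-⨾ (run-:= (arr≤ bd′ LST _) (run-⨾ (run-put (≤-trans (≤-reflexive v≡) (fit i<sz))
            (run-⨾ (run-put (arr≤ bd′ PS _) (run-:= (subst (_≤ V) (trans (+-comm 1 i) (cong (_+ 1) (sym j≡))) (≤-trans i<sz (reg≤ bd szV)))
              (inv (≤-trans (+-monoˡ-≤ 5 time) (≤-reflexive (trans (+-comm (5 * i) 5) (sym (*-suc 5 i)))))
                (trans (cong (_+ 1) j≡) (+-comm i 1)) filled′)))))))
          where
          bd′ : Bounded s′
          bd′ = isBounded ks
          t′ v : ℕ
          t′ = arr s′ LST (reg s′ uV * reg s′ NV + reg s′ jV)
          v  = arr s′ HH (reg s′ obV + (reg s′ uV ∸ t′ + reg s′ xV)) + arr s′ HH t′
          t≡ : t′ ≡ t i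
          t≡ = trans (keptArr ks LST refl _) (cong (arr s LST) (cong₂ _+_ (cong₂ _*_ (kept ks uV refl) (kept ks NV refl)) j≡))
          v≡ : v ≡ col i
          v≡ = cong₂ _+_
            (trans (keptArr ks HH refl _) (cong (arr s HH) (cong₂ _+_ (kept ks obV refl)
              (cong₂ _+_ (cong₂ _∸_ (kept ks uV refl) t≡) (kept ks xV refl)))))
            (trans (keptArr ks HH refl _) (cong (arr s HH) t≡))
          filled′ : ∀ {j} → j < suc i →
            (arr s′ COL [ reg s′ jV ≔ v ]) j ≡ col j ×
            (arr s′ SL [ reg s′ jV ≔ arr s′ PS t′ ]) j ≡ arr s PS (t j)
          filled′ {j} j< with reg s′ jV ≟ j
          ... | yes eq with trans (sym j≡) eq
          ...   | refl = trans (≔-same (arr s′ COL) (reg s′ jV) v eq) v≡ ,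
                  trans (≔-same (arr s′ SL) (reg s′ jV) _ eq) (trans (keptArr ks PS refl t′) (cong (arr s PS) t≡))
          filled′ {j} j< | no neq with filled (≤∧≢⇒< (≤-pred j<) (λ eq → neq (trans j≡ (sym eq))))
          ... | c , sl = trans (≔-other (arr s′ COL) (reg s′ jV) v neq) c , trans (≔-other (arr s′ SL) (reg s′ jV) _ neq) sl
        end : ∀ {d s′} → Keeps columnStep s s′ → I sz d s′ → eval (var szV ⊖ var jV) s′ ≡ 0 ×
          (d + 1 ≤ 5 * sz + 1 × (∀ {j} → j < sz → arr s′ COL j ≡ col j × arr s′ SL j ≡ arr s PS (t j)))
        end ks (inv time j≡ filled) =
          trans (cong₂ _∸_ (kept ks szV refl) j≡) (n∸n≡0 sz) , +-monoˡ-≤ 1 time , filled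

    -- Tables of processing times, weights and costs

    module Tables (n : ℕ) (p w : ℕ → ℕ) (2^n≤X : 2 ^ n ≤ X)
                  (p≤X : sumBelow n p ≤ X) (w≤X : sumBelow n w ≤ X) where
      open Costs p w

      record Tabulated (b : ℕ) (s : Store) : Set where
        pattern
        constructor tabulated
        field
          ps : ∀ (v : Mask b) → arr s PS (val v) ≡ weigh p v
          ws : ∀ (v : Mask b) → arr s WS (val v) ≡ weigh w v
          cs : ∀ (v : Mask b) → arr s HH (val v) ≡ cost v

      row-correct : ∀ {s b} → Bounded s → b < n → (∀ i → arr s PA i ≡ p i) → (∀ i → arr s WA i ≡ w i) →
        reg s NV ≡ 2 ^ b → reg s bV ≡ b → reg s sV ≡ 0 → Tabulated b s →
        Run (while (var NV ⊖ var sV) tableStep) s (λ τ s′ → τ ≤ 5 * 2 ^ b + 1 × Tabulated (suc b) s′)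
      row-correct {s} {b} bd b<n p≡ w≡ N≡ b≡ s≡ (tabulated ps ws cs) = run-while I (2 ^ b) bd
        (inv z≤n s≡ ps ws cs (λ _ ()) (λ _ ()) (λ _ ())) body end
        where
        record I (i τ : ℕ) (s′ : Store) : Set where
          pattern
          constructor inv
          field
            time : τ ≤ 5 * i
            s≡′  : reg s′ sV ≡ i
            ps′  : ∀ (v : Mask b) → arr s′ PS (val v) ≡ weigh p v
            ws′  : ∀ (v : Mask b) → arr s′ WS (val v) ≡ weigh w v
            cs′  : ∀ (v : Mask b) → arr s′ HH (val v) ≡ cost v
            ps″  : ∀ (v : Mask b) → val v < i → arr s′ PS (2 ^ b + val v) ≡ weigh p (true ∷ v)
            ws″  : ∀ (v : Mask b) → val v < i → arr s′ WS (2 ^ b + val v) ≡ weigh w (true ∷ v)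
            cs″  : ∀ (v : Mask b) → val v < i → arr s′ HH (2 ^ b + val v) ≡ cost (true ∷ v)
        weigh≤X : ∀ κ → sumBelow n κ ≤ X → (v : Mask (suc b)) → weigh κ v ≤ X
        weigh≤X κ κ≤ v = ≤-trans (weigh≤ κ v) (≤-trans (sumBelow-mono κ b<n) κ≤)
        body : ∀ {i τ s′} → Keeps tableStep s s′ → i < 2 ^ b → I i τ s′ →
          eval (var NV ⊖ var sV) s′ ≢ 0 × Run tableStep s′ (λ τ′ → I (suc i) (τ + suc τ′))
        body {i} {τ} {s′} ks i< (inv time s≡′ ps′ ws′ cs′ ps″ ws″ cs″) =
          (λ eq → m>n⇒m∸n≢0 i< (trans (sym (cong₂ _∸_ (trans (kept ks NV refl) N≡) s≡′)) eq)) ,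
          run-⨾ (run-put (≤-trans (≤-reflexive c≡) c≤V) (run-⨾ (run-put (≤-trans (≤-reflexive pv≡) (≤V 1 (^-1 (weigh≤X p p≤X (true ∷ v)))))
            (run-⨾ (run-put (≤-trans (≤-reflexive wv≡) (≤V 1 (^-1 (weigh≤X w w≤X (true ∷ v)))))
              (run-:= (≤-trans (≤-reflexive s+1) (≤V 1 (^-1 (≤-trans i< (≤-trans (^-monoʳ-≤ 2 (<⇒≤ b<n)) 2^n≤X)))))
                (inv (≤-trans (+-monoˡ-≤ 5 time) (≤-reflexive (trans (+-comm (5 * i) 5) (sym (*-suc 5 i))))) s+1
                  (λ y → trans (old (arr s′ PS) y) (ps′ y)) (λ y → trans (old (arr s′ WS) y) (ws′ y)) (λ y → trans (old (arr s′ HH) y) (cs′ y))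
                  (new (arr s′ PS) pv≡ ps″) (new (arr s′ WS) wv≡ ws″) (new (arr s′ HH) c≡ cs″))))))))
          where
          v : Mask b
          v = toMask b i
          val-v : val v ≡ i
          val-v = val-toMask b i i<
          sv : reg s′ sV ≡ val v
          sv = trans s≡′ (sym val-v)
          bv : reg s′ bV ≡ b
          bv = trans (kept ks bV refl) b≡
          pb : arr s′ PA (reg s′ bV) ≡ p b
          pb = trans (keptArr ks PA refl _) (trans (p≡ _) (cong p bv))
          wb : arr s′ WA (reg s′ bV) ≡ w b
          wb = trans (keptArr ks WA refl _) (trans (w≡ _) (cong w bv))
          psv : arr s′ PS (reg s′ sV) ≡ weigh p v
          psv = trans (cong (arr s′ PS) sv) (ps′ v)
          c₀ : ℕ
          c₀ = arr s′ HH (reg s′ sV) + arr s′ WA (reg s′ bV) * (arr s′ PS (reg s′ sV) + arr s′ PA (reg s′ bV))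
          c≡ : c₀ ≡ cost (true ∷ v)
          c≡ = cong₂ _+_ (trans (cong (arr s′ HH) sv) (cs′ v)) (cong₂ _*_ wb (cong₂ _+_ psv pb))
          c≤V : cost (true ∷ v) ≤ V
          c≤V = ≤-trans (cost≤ (true ∷ v)) (≤V 2 (^-* 1 1 (^-1 (≤-trans (sumBelow-mono p b<n) p≤X)) (^-1 (≤-trans (sumBelow-mono w b<n) w≤X))))
          pv≡ : arr s′ PA (reg s′ bV) + arr s′ PS (reg s′ sV) ≡ weigh p (true ∷ v)
          pv≡ = cong₂ _+_ pb psv
          wv≡ : arr s′ WA (reg s′ bV) + arr s′ WS (reg s′ sV) ≡ weigh w (true ∷ v)
          wv≡ = cong₂ _+_ wb (trans (cong (arr s′ WS) sv) (ws′ v))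
          s+1 : reg s′ sV + 1 ≡ suc i
          s+1 = trans (cong (_+ 1) s≡′) (+-comm i 1)
          a₀ : ℕ
          a₀ = reg s′ NV + reg s′ sV
          a≡ : a₀ ≡ 2 ^ b + i
          a≡ = cong₂ _+_ (trans (kept ks NV refl) N≡) s≡′
          old : ∀ (g : ℕ → ℕ) {c} (y : Mask b) → (g [ a₀ ≔ c ]) (val y) ≡ g (val y)
          old g y = ≔-other g a₀ _ (λ eq → <⇒≱ (val<2^ y) (subst (2 ^ b ≤_) (trans (sym a≡) eq) (m≤m+n (2 ^ b) i)))
          new : ∀ (g : ℕ → ℕ) {c} {φ : Mask b → ℕ} → c ≡ φ v → (∀ y → val y < i → g (2 ^ b + val y) ≡ φ y) →
            ∀ y → val y < suc i → (g [ a₀ ≔ c ]) (2 ^ b + val y) ≡ φ y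
          new g {c} {φ} c≡ done y y< with val y ≟ i
          ... | yes eq = trans (≔-same g a₀ c (trans a≡ (cong (2 ^ b +_) (sym eq)))) (trans c≡ (cong φ (val-injective (trans val-v (sym eq)))))
          ... | no neq = trans (≔-other g a₀ c (λ eq → neq (sym (+-cancelˡ-≡ (2 ^ b) i (val y) (trans (sym a≡) eq))))) (done y (≤∧≢⇒< (≤-pred y<) neq))
        end : ∀ {τ s′} → Keeps tableStep s s′ → I (2 ^ b) τ s′ → eval (var NV ⊖ var sV) s′ ≡ 0 ×
          (τ + 1 ≤ 5 * 2 ^ b + 1 × Tabulated (suc b) s′)
        end ks (inv time s≡′ ps′ ws′ cs′ ps″ ws″ cs″) =
          trans (cong₂ _∸_ (trans (kept ks NV refl) N≡) s≡′) (n∸n≡0 (2 ^ b)) , +-monoˡ-≤ 1 time ,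
          tabulated (λ { (true ∷ v) → ps″ v (val<2^ v) ; (false ∷ v) → ps′ v })
                    (λ { (true ∷ v) → ws″ v (val<2^ v) ; (false ∷ v) → ws′ v })
                    (λ { (true ∷ v) → cs″ v (val<2^ v) ; (false ∷ v) → cs′ v })

      tables-correct : ∀ {s} → Bounded s → reg s nV ≡ n → (∀ i → arr s PA i ≡ p i) → (∀ i → arr s WA i ≡ w i) →
        arr s PS 0 ≡ 0 → arr s WS 0 ≡ 0 → arr s HH 0 ≡ 0 →
        Run tables s (λ τ s′ → τ ≤ 5 * 2 ^ n + 5 * n + 3 × reg s′ NV ≡ 2 ^ n × Tabulated n s′)
      tables-correct {s} bd n≡ p≡ w≡ ps0 ws0 cs0 =
        run-⨾ (run-:= 1≤V (run-⨾ (run-:= z≤n (run-while I n b₁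
          (inv z≤n refl refl (tabulated (λ { [] → ps0 }) (λ { [] → ws0 }) (λ { [] → cs0 }))) body end))))
        where
        1≤V : 1 ≤ V
        1≤V = ≤V 1 (^-1 (≤-trans (s≤s z≤n) X≥2))
        s₁ : Store
        s₁ = setReg (setReg s NV 1) bV 0
        b₁ : Bounded s₁
        b₁ = bounded-setReg bV (bounded-setReg NV bd 1≤V) z≤n
        record I (i τ : ℕ) (s′ : Store) : Set where
          pattern
          constructor inv
          field
            time : τ ≤ 5 * 2 ^ i + 5 * i
            N≡   : reg s′ NV ≡ 2 ^ i
            b≡   : reg s′ bV ≡ i
            tab  : Tabulated i s′
        body : ∀ {i τ s′} → Keeps tableRow s₁ s′ → i < n → I i τ s′ →
          eval (var nV ⊖ var bV) s′ ≢ 0 × Run tableRow s′ (λ τ′ → I (suc i) (τ + suc τ′))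
        body {i} {τ} {s′} ks i<n (inv time N≡ b≡ (tabulated a b c)) =
          (λ eq → m>n⇒m∸n≢0 i<n (trans (sym (cong₂ _∸_ (trans (kept ks nV refl) n≡) b≡)) eq)) ,
          run-⨾ (run-:= z≤n (run-⨾ (run-keeps b₂
            (row-correct b₂ i<n (λ j → trans (keptArr ks PA refl j) (p≡ j)) (λ j → trans (keptArr ks WA refl j) (w≡ j)) N≡ b≡ refl (tabulated a b c))
            (λ {τ₃} {s₃} k₃ (time₃ , tab₃) → finish τ₃ k₃ time₃ tab₃))))
          where
          b₂ : Bounded (setReg s′ sV 0)
          b₂ = bounded-setReg sV (isBounded ks) z≤n
          finish : ∀ {s₃} τ₃ → Keeps (while (var NV ⊖ var sV) tableStep) (setReg s′ sV 0) s₃ → τ₃ ≤ 5 * 2 ^ i + 1 → Tabulated (suc i) s₃ →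
            Run (NV := var NV ⊕ var NV ⨾ bV := var bV ⊕ lit 1) s₃ (λ τ′ → I (suc i) (τ + suc (1 + (τ₃ + τ′))))
          finish {s₃} τ₃ k₃ time₃ (tabulated a b c) =
            run-⨾ (run-:= (≤-trans (≤-reflexive N+N) (≤V 1 (^-1 (≤-trans (^-monoʳ-≤ 2 i<n) 2^n≤X))))
              (run-:= (≤-trans (≤-reflexive b+1) (≤-trans (≤-trans i<n (≤-reflexive (sym n≡))) (reg≤ bd nV)))
                (inv tick N+N b+1 (tabulated a b c))))
            where
            N+N : reg s₃ NV + reg s₃ NV ≡ 2 ^ suc i
            N+N = trans (cong (λ z → z + z) (trans (kept k₃ NV refl) N≡)) (sym (2^suc i))
            b+1 : reg s₃ bV + 1 ≡ suc i
            b+1 = trans (cong (_+ 1) (trans (kept k₃ bV refl) b≡)) (+-comm i 1)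
            tick : τ + suc (1 + (τ₃ + (1 + 1))) ≤ 5 * 2 ^ suc i + 5 * suc i
            tick = ≤-trans (+-mono-≤ time (s≤s (s≤s (+-monoˡ-≤ 2 time₃)))) (≤-reflexive (eq (2 ^ i) i))
              where
              eq : ∀ a i → 5 * a + 5 * i + suc (suc (5 * a + 1 + 2)) ≡ 5 * (2 * a) + 5 * (1 + i)
              eq = solve-∀
        end : ∀ {τ s′} → Keeps tableRow s₁ s′ → I n τ s′ → eval (var nV ⊖ var bV) s′ ≡ 0 ×
          (1 + (1 + (τ + 1)) ≤ 5 * 2 ^ n + 5 * n + 3 × reg s′ NV ≡ 2 ^ n × Tabulated n s′)
        end {τ} ks (inv time N≡ b≡ tab) =
          trans (cong₂ _∸_ (trans (kept ks nV refl) n≡) b≡) (n∸n≡0 n) ,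
          ≤-trans (≤-reflexive (eq τ)) (+-monoˡ-≤ 3 time) , N≡ , tab
          where
          eq : ∀ a → 1 + (1 + (a + 1)) ≡ a + 3
          eq = solve-∀

    -- Construction of the sorted lists of subsets

    module Build (K : Array) (K-kept : writesArr K (buildRow K) ≡ false) (κ : ℕ → ℕ)
                 (N U : ℕ) (1≤U : 1 ≤ U) (N≤X : N ≤ X) where
      open Submasks κ

      instance
        U≢0 : NonZero U
        U≢0 = >-nonZero 1≤U

      -- the list and the block sizes of v are stored under the number val v * U
      record IsList (s : Store) {b} (v : Mask b) : Set where
        pattern
        constructor isList
        field
          lst : ∀ {i} → i < 2 ^ count v → arr s LST (val v * U * N + i) ≡ val (nth (submasks v) i) * U
          ga  : arr s GA (val v * U) ≡ gOf v
          ha  : arr s HA (val v * U) ≡ hOf v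

      -- The list of number `i` occupies cells from `i * N` to below `suc i * N`, so one bound on
      -- the numbers frames all three arrays.
      record Same (b : ℕ) (s s′ : Store) : Set where
        pattern
        constructor same
        field
          lst : ∀ {i} → i < b * N → arr s′ LST i ≡ arr s LST i
          ga  : ∀ {i} → i < b → arr s′ GA i ≡ arr s GA i
          ha  : ∀ {i} → i < b → arr s′ HA i ≡ arr s HA i

      same-≤ : ∀ {a b s s′} → a ≤ b → Same b s s′ → Same a s s′
      same-≤ a≤b (same x y z) = same (λ i< → x (<-≤-trans i< (*-monoˡ-≤ N a≤b))) (λ i< → y (<-≤-trans i< a≤b)) (λ i< → z (<-≤-trans i< a≤b))

      same-trans : ∀ {b s s′ s″} → Same b s s′ → Same b s′ s″ → Same b s s″
      same-trans (same x y z) (same x′ y′ z′) =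
        same (λ i< → trans (x′ i<) (x i<)) (λ i< → trans (y′ i<) (y i<)) (λ i< → trans (z′ i<) (z i<))

      same-list : ∀ {m b s s′} {v : Mask b} → val v * U < m → 2 ^ b ≤ N → Same m s s′ → IsList s v → IsList s′ v
      same-list {m} {v = v} v< 2^b≤N (same x y z) (isList a g h) = isList
        (λ {i} i< → trans (x (<-≤-trans (+-monoʳ-< (val v * U * N) (<-≤-trans i< (≤-trans (2^count≤ v) 2^b≤N)))
          (≤-trans (≤-reflexive (+-comm (val v * U * N) N)) (*-monoˡ-≤ N v<)))) (a i<))
        (trans (y v<) g) (trans (z v<) h)

      -- A leading `false` changes neither the number of a set nor its list. Hence a row has to
      -- write only the lists of the sets that contain the new job.
      false-list : ∀ {s b} {v : Mask b} → IsList s v → IsList s (false ∷ v)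
      false-list {s} {v = v} (isList a g h) = isList
        (λ {i} i< → trans (a i<) (cong (λ y → val y * U)
          (sym (nth-map (false ∷_) (submasks v) (subst (i <_) (sym (length-submasks v)) i<))))) g h

      module Merge {b : ℕ} (v : Mask b) {s : Store} (bd : Bounded s)
        (u≡ : reg s uV ≡ val v * U) (E≡ : reg s EV ≡ 2 ^ b * U) (N≡ : reg s NV ≡ N)
        (2^b≤N : 2 ^ b ≤ N) (fits : 2 ^ suc b * U ≤ X)
        (table : ∀ (y : Mask (suc b)) → arr s K (val y * U) ≡ weigh κ y) where

        sz goal₀ : ℕ
        sz = 2 ^ count v
        goal₀ = (val v * U + 2 ^ b * U) * N
        A A′ B′ M : List _
        A  = submasks v
        A′ = List.map (false ∷_) A
        B′ = List.map (true ∷_) A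
        M  = submasks (true ∷ v)
        len : length A ≡ sz
        len = length-submasks v
        len-A′ : length A′ ≡ sz
        len-A′ = trans (length-map (false ∷_) A) len
        len-B′ : length B′ ≡ sz
        len-B′ = trans (length-map (true ∷_) A) len

        mergeStep-kept : writesArr K (mergeStep K) ≡ false
        mergeStep-kept = writesArr-⊑ (mergeStep⊑ {K}) K K-kept

        val<E : val v * U + 1 ≤ val v * U + 2 ^ b * U
        val<E = +-monoʳ-≤ (val v * U) (*-mono-≤ (1≤2^ b) 1≤U)

        merge-correct : reg s szV ≡ sz → reg s aV ≡ 0 → reg s cV ≡ 0 → reg s kV ≡ 0 →
          (∀ {i} → i < sz → arr s LST (val v * U * N + i) ≡ val (nth A i) * U) →
          Run (while (var szV ⊕ var szV ⊖ var kV) (mergeStep K)) s (λ τ s′ → τ ≤ 5 * (sz + sz) + 1 ×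
            (∀ {i} → i < goal₀ → arr s′ LST i ≡ arr s LST i) ×
            (∀ {i} → i < sz + sz → arr s′ LST (goal₀ + i) ≡ val (nth M i) * U))
        merge-correct sz≡ a≡0 c≡0 k≡0 listed = run-while I (sz + sz) bd
          (inv z≤n k≡0 (subst (_≤ sz) (sym a≡0) z≤n) (subst (_≤ sz) (sym c≡0) z≤n) (cong₂ _+_ a≡0 c≡0)
            (cong₂ (λ x y → merge _≤κ?_ (drop x A′) (drop y B′)) (sym a≡0) (sym c≡0)) (λ _ → refl) (λ ())) body end
          where
          record I (k τ : ℕ) (s′ : Store) : Set where
            pattern
            constructor inv
            field
              time : τ ≤ 5 * k
              k≡   : reg s′ kV ≡ k
              a≤   : reg s′ aV ≤ sz
              c≤   : reg s′ cV ≤ sz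
              a+c≡ : reg s′ aV + reg s′ cV ≡ k
              -- What is still to be written is the merge of the two remainders, so each round is
              -- one `MergeStep`.
              rest : drop k M ≡ merge _≤κ?_ (drop (reg s′ aV) A′) (drop (reg s′ cV) B′)
              old  : ∀ {i} → i < goal₀ → arr s′ LST i ≡ arr s LST i
              new  : ∀ {i} → i < k → arr s′ LST (goal₀ + i) ≡ val (nth M i) * U
          body : ∀ {k τ s′} → Keeps (mergeStep K) s s′ → k < sz + sz → I k τ s′ →
            eval (var szV ⊕ var szV ⊖ var kV) s′ ≢ 0 × Run (mergeStep K) s′ (λ τ′ → I (suc k) (τ + suc τ′))
          body {k} {τ} {s′} ks k< (inv time k≡ a≤ c≤ a+c≡ rest old new) =
            (λ eq → m>n⇒m∸n≢0 k< (trans (sym (cong₂ _∸_ (cong (λ z → z + z) sz′) k≡)) eq)) ,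
            run-⨾ (run-cond
              (λ right → run-⨾ (run-put (≤-trans (≤-reflexive (B≡ (c< right))) (bound (true ∷ nth A c)))
                (run-:= (≤-trans (≤-reflexive (+-comm c 1)) (≤-trans (c< right) sz≤V))
                  (run-:= k≤V (inv tick k+1 a≤ (subst (_≤ sz) (+-comm 1 c) (c< right))
                    (trans (sym (+-assoc a c 1)) (trans (cong (_+ 1) a+c≡) (+-comm k 1)))
                    (trans (proj₂ (stepʳ right)) (cong (λ z → merge _≤κ?_ (drop a A′) (drop z B′)) (+-comm 1 c)))
                    (λ i< → trans (≔-other (arr s′ LST) g₀ _ (λ eq → <⇒≱ i< (subst (goal₀ ≤_) (trans (sym g≡) eq) (m≤m+n goal₀ k)))) (old i<))
                    (extend (trans (B≡ (c< right)) (cong (λ z → val z * U) (trans (sym (nth-B (c< right))) (sym (proj₁ (stepʳ right))))))))))))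
              (λ left → run-⨾ (run-put (≤-trans (≤-reflexive (A≡ (a< left))) (bound (false ∷ nth A a)))
                (run-:= (≤-trans (≤-reflexive (+-comm a 1)) (≤-trans (a< left) sz≤V))
                  (run-:= k≤V (inv tick k+1 (subst (_≤ sz) (+-comm 1 a) (a< left)) c≤
                    (trans (cong (_+ c) (+-comm a 1)) (trans (cong suc a+c≡) refl))
                    (trans (proj₂ (stepˡ left)) (cong (λ z → merge _≤κ?_ (drop z A′) (drop c B′)) (+-comm 1 a)))
                    (λ i< → trans (≔-other (arr s′ LST) g₀ _ (λ eq → <⇒≱ i< (subst (goal₀ ≤_) (trans (sym g≡) eq) (m≤m+n goal₀ k)))) (old i<))
                    (extend (trans (A≡ (a< left)) (cong (λ z → val z * U) (trans (sym (nth-A (a< left))) (sym (proj₁ (stepˡ left)))))))))))))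
            where
            a c g₀ test : ℕ
            a = reg s′ aV
            c = reg s′ cV
            g₀ = (reg s′ uV + reg s′ EV) * reg s′ NV + reg s′ kV
            a₀ c₀ : ℕ
            a₀ = arr s′ LST (reg s′ uV * reg s′ NV + a)
            c₀ = arr s′ LST (reg s′ uV * reg s′ NV + c) + reg s′ EV
            test = 1 ∸ (reg s′ szV ∸ a) + (reg s′ szV ∸ c) * (arr s′ K a₀ ∸ arr s′ K c₀)
            sz′ : reg s′ szV ≡ sz
            sz′ = trans (kept ks szV refl) sz≡
            E′ : reg s′ EV ≡ 2 ^ b * U
            E′ = trans (kept ks EV refl) E≡
            base′ : reg s′ uV * reg s′ NV ≡ val v * U * N
            base′ = cong₂ _*_ (trans (kept ks uV refl) u≡) (trans (kept ks NV refl) N≡)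
            g≡ : g₀ ≡ goal₀ + k
            g≡ = cong₂ _+_ (cong₂ _*_ (cong₂ _+_ (trans (kept ks uV refl) u≡) E′) (trans (kept ks NV refl) N≡)) k≡
            source< : ∀ {i} → i < sz → val v * U * N + i < goal₀
            source< {i} i< = <-≤-trans (+-monoʳ-< (val v * U * N) (<-≤-trans i< (≤-trans (2^count≤ v) 2^b≤N)))
              (≤-trans (≤-reflexive (eq (val v * U) N)) (*-monoˡ-≤ N val<E))
              where
              eq : ∀ x n → x * n + n ≡ (x + 1) * n
              eq = solve-∀
            source : ∀ {i} → i < sz → arr s′ LST (reg s′ uV * reg s′ NV + i) ≡ val (nth A i) * U
            source {i} i< = trans (cong (λ z → arr s′ LST (z + i)) base′) (trans (old (source< i<)) (listed i<))
            A≡ : a < sz → a₀ ≡ val (nth A a) * U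
            A≡ = source
            B≡ : c < sz → c₀ ≡ val (true ∷ nth A c) * U
            B≡ c< = trans (cong₂ _+_ (source c<) E′) (trans (+-comm _ (2 ^ b * U)) (sym (*-distribʳ-+ U (2 ^ b) (val (nth A c)))))
            nth-A : a < sz → nth A′ a ≡ false ∷ nth A a
            nth-A a< = nth-map (false ∷_) A (subst (a <_) (sym len) a<)
            nth-B : c < sz → nth B′ c ≡ true ∷ nth A c
            nth-B c< = nth-map (true ∷_) A (subst (c <_) (sym len) c<)
            KA : a < sz → arr s′ K a₀ ≡ weigh κ (nth A′ a)
            KA a< = trans (keptArr ks K mergeStep-kept _) (trans (cong (arr s K) (A≡ a<)) (trans (table (false ∷ nth A a)) (cong (weigh κ) (sym (nth-A a<)))))
            KB : c < sz → arr s′ K c₀ ≡ weigh κ (nth B′ c)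
            KB c< = trans (keptArr ks K mergeStep-kept _) (trans (cong (arr s K) (B≡ c<)) (trans (table (true ∷ nth A c)) (cong (weigh κ) (sym (nth-B c<)))))
            -- As many sets have been written as were taken, and `k < sz + sz`; so the two lists are
            -- not both exhausted.
            other : sz ≤ a → c < sz
            other sz≤a = +-cancelˡ-< sz c sz (≤-<-trans (≤-trans (+-monoˡ-≤ c sz≤a) (≤-reflexive a+c≡)) k<)
            test-a< : a < sz → test ≡ (sz ∸ c) * (arr s′ K a₀ ∸ arr s′ K c₀)
            test-a< a< = trans (cong (λ z → 1 ∸ (z ∸ a) + (z ∸ c) * (arr s′ K a₀ ∸ arr s′ K c₀)) sz′)
              (cong (_+ (sz ∸ c) * (arr s′ K a₀ ∸ arr s′ K c₀)) (m≤n⇒m∸n≡0 (m<n⇒0<n∸m a<)))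
            c< : test ≢ 0 → c < sz
            c< nonzero with a <? sz
            ... | no a≮  = other (≮⇒≥ a≮)
            ... | yes a< with c <? sz
            ...   | yes c< = c<
            ...   | no c≮  = ⊥-elim (nonzero (trans (test-a< a<) (cong (_* (arr s′ K a₀ ∸ arr s′ K c₀)) (m≤n⇒m∸n≡0 (≮⇒≥ c≮)))))
            a< : test ≡ 0 → a < sz
            a< zero′ with a <? sz
            ... | yes a< = a<
            ... | no a≮  = ⊥-elim (1+n≢0 {0} (trans (sym (cong (1 ∸_) (m≤n⇒m∸n≡0 (≤-trans (≤-reflexive sz′) (≮⇒≥ a≮))))) (m+n≡0⇒m≡0 _ zero′)))
            stepʳ : test ≢ 0 → MergeStep.Next A′ B′ {a} {c} rest a (suc c) (nth B′ c)
            stepʳ nonzero = MergeStep.takeʳ A′ B′ {a} {c} rest (subst (c <_) (sym len-B′) (c< nonzero))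
              (λ a<′ → let a< = subst (a <_) len-A′ a<′ in subst₂ _<_ (KB (c< nonzero)) (KA a<)
                (m∸n≢0⇒n<m (λ eq → nonzero (trans (test-a< a<) (trans (cong ((sz ∸ c) *_) eq) (*-zeroʳ (sz ∸ c)))))))
            stepˡ : test ≡ 0 → MergeStep.Next A′ B′ {a} {c} rest (suc a) c (nth A′ a)
            stepˡ zero′ = MergeStep.takeˡ A′ B′ {a} {c} rest (subst (a <_) (sym len-A′) (a< zero′))
              (λ c<′ → let c< = subst (c <_) len-B′ c<′ in subst₂ _≤_ (KA (a< zero′)) (KB c<)
                (m∸n≡0⇒m≤n (m*n≡0⇒n≡0 c< (trans (sym (test-a< (a< zero′))) zero′))))
              where
              m*n≡0⇒n≡0 : ∀ {x} → c < sz → (sz ∸ c) * x ≡ 0 → x ≡ 0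
              m*n≡0⇒n≡0 {x} c< eq with m*n≡0⇒m≡0∨n≡0 (sz ∸ c) eq
              ... | inj₁ z = ⊥-elim (m>n⇒m∸n≢0 c< z)
              ... | inj₂ z = z
            bound : ∀ (y : Mask (suc b)) → val y * U ≤ V
            bound y = ≤V 1 (^-1 (≤-trans (*-monoˡ-≤ U (<⇒≤ (val<2^ y))) fits))
            sz≤V : sz ≤ V
            sz≤V = ≤V 1 (^-1 (≤-trans (2^count≤ v) (≤-trans 2^b≤N N≤X)))
            k+1 : reg s′ kV + 1 ≡ suc k
            k+1 = trans (cong (_+ 1) k≡) (+-comm k 1)
            k≤V : reg s′ kV + 1 ≤ V
            k≤V = ≤-trans (≤-reflexive k+1) (≤-trans k< (≤V 2 (^-+ 1 sz≤ sz≤)))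
              where
              sz≤ : sz ≤ X ^ 1
              sz≤ = ^-1 (≤-trans (2^count≤ v) (≤-trans 2^b≤N N≤X))
            tick : τ + 5 ≤ 5 * suc k
            tick = ≤-trans (+-monoˡ-≤ 5 time) (≤-reflexive (trans (+-comm (5 * k) 5) (sym (*-suc 5 k))))
            extend : ∀ {x} → x ≡ val (nth M k) * U → ∀ {i} → i < suc k → (arr s′ LST [ g₀ ≔ x ]) (goal₀ + i) ≡ val (nth M i) * U
            extend {x} x≡ {i} i< with k ≟ i
            ... | yes refl = trans (≔-same (arr s′ LST) g₀ x g≡) x≡
            ... | no neq   = trans (≔-other (arr s′ LST) g₀ x (λ eq → neq (+-cancelˡ-≡ goal₀ k i (trans (sym g≡) eq)))) (new (≤∧≢⇒< (≤-pred i<) (λ eq → neq (sym eq))))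
          end : ∀ {τ s′} → Keeps (mergeStep K) s s′ → I (sz + sz) τ s′ → eval (var szV ⊕ var szV ⊖ var kV) s′ ≡ 0 × (τ + 1 ≤ 5 * (sz + sz) + 1 ×
            (∀ {i} → i < goal₀ → arr s′ LST i ≡ arr s LST i) × (∀ {i} → i < sz + sz → arr s′ LST (goal₀ + i) ≡ val (nth M i) * U))
          end ks (inv time k≡ _ _ _ _ old new) =
            trans (cong₂ _∸_ (cong (λ z → z + z) (trans (kept ks szV refl) sz≡)) k≡) (n∸n≡0 (sz + sz)) , +-monoˡ-≤ 1 time , old , new

      record Ready (b : ℕ) (s : Store) : Set where
        pattern
        constructor ready
        field
          E≡    : reg s EV ≡ 2 ^ b * U
          N≡    : reg s NV ≡ N
          unit≡ : reg s unitV ≡ U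
          2^sb≤N : 2 ^ suc b ≤ N
          fits  : 2 ^ suc b * U ≤ X
          table : ∀ (y : Mask (suc b)) → arr s K (val y * U) ≡ weigh κ y

      listTime : ∀ {b} → Mask b → ℕ
      listTime v = 20 * 2 ^ count v

      list-correct : ∀ {s b} (v : Mask b) → Bounded s → Ready b s → reg s uV ≡ val v * U → IsList s v →
        Run (listStep K) s (λ τ s′ → suc τ ≤ listTime v × IsList s′ (true ∷ v) ×
          Same (val v * U + 2 ^ b * U) s s′ × reg s′ uV ≡ val v * U + U)
      list-correct {s} {b} v bd (ready E≡ N≡ unit≡ 2^sb≤N fits table) u≡ (isList lst ga ha) =
        run-⨾ (run-:= (arr≤ bd GA _) (run-⨾ (run-:= sz≤V (run-⨾ (run-put (arr≤ bd HA _) (run-⨾ (run-put 2g≤V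
          (run-⨾ (run-:= z≤n (run-⨾ (run-:= z≤n (run-⨾ (run-:= z≤n (run-⨾ (run-keeps b₇
            (merge-correct sz≡ refl refl refl (λ {i} i< → lst i<))
            (λ {τ₈} {s₈} k₈ (time₈ , old , new) → run-:=
              (≤-trans (≤-reflexive (u+U k₈)) (≤V 1 (^-1 u+U≤X)))
              (tick τ₈ time₈ , done k₈ new , unchanged k₈ old , u+U k₈)))))))))))))))))
        where
        2^b≤N : 2 ^ b ≤ N
        2^b≤N = ≤-trans (^-monoʳ-≤ 2 (n≤1+n b)) 2^sb≤N
        g₀ sz₀ h₀ g₁ i₀ : ℕ
        g₀ = arr s GA (reg s uV)
        sz₀ = g₀ * arr s HA (reg s uV)
        h₀ = arr s HA (reg s uV)
        g₁ = 2 * g₀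
        i₀ = reg s uV + reg s EV
        g≡ : g₀ ≡ gOf v
        g≡ = trans (cong (arr s GA) u≡) ga
        h≡ : h₀ ≡ hOf v
        h≡ = trans (cong (arr s HA) u≡) ha
        sz≡ : sz₀ ≡ 2 ^ count v
        sz≡ = trans (cong₂ _*_ g≡ h≡) (trans (*-comm (gOf v) (hOf v)) (hOf*gOf v))
        count≤X : 2 ^ count v ≤ X
        count≤X = ≤-trans (2^count≤ v) (≤-trans 2^b≤N N≤X)
        sz≤V : sz₀ ≤ V
        sz≤V = ≤V 1 (^-1 (≤-trans (≤-reflexive sz≡) count≤X))
        g≤X : g₀ ≤ X
        g≤X = ≤-trans (≤-trans (≤-reflexive g≡) (≤-trans (m≤n*m (gOf v) (hOf v) {{>-nonZero (hOf≥1 v)}}) (≤-reflexive (hOf*gOf v)))) count≤X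
        2g≤V : g₁ ≤ V
        2g≤V = ≤V 2 (^-* 1 1 (^-1 X≥2) (^-1 g≤X))
        s₇ : Store
        s₇ = setReg (setReg (setReg (setArr (setArr (setReg (setReg s tV g₀) szV sz₀) GA i₀ h₀) HA i₀ g₁) aV 0) cV 0) kV 0
        b₇ : Bounded s₇
        b₇ = bounded-setReg kV (bounded-setReg cV (bounded-setReg aV (bounded-setArr HA i₀ (bounded-setArr GA i₀
               (bounded-setReg szV (bounded-setReg tV bd (arr≤ bd GA _)) sz≤V) (arr≤ bd HA _)) 2g≤V) z≤n) z≤n) z≤n
        i₀≡ : i₀ ≡ val v * U + 2 ^ b * U
        i₀≡ = cong₂ _+_ u≡ E≡
        i₀≡′ : i₀ ≡ val (true ∷ v) * U
        i₀≡′ = trans i₀≡ (trans (+-comm (val v * U) _) (sym (*-distribʳ-+ U (2 ^ b) (val v))))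
        K-table : ∀ (y : Mask (suc b)) → arr s₇ K (val y * U) ≡ weigh κ y
        K-table y = trans (setArr-other (setArr s₂ GA i₀ h₀) HA i₀ g₁ (val y * U) (writesArr-⊑ (⊑-listStep here₄) K K-kept))
          (trans (setArr-other s₂ GA i₀ h₀ (val y * U) (writesArr-⊑ (⊑-listStep here₃) K K-kept)) (table y))
          where
          here₃ : (GA ⟦ var uV ⊕ var EV ⟧:= HA at var uV) ⊑ listStep K
          here₃ = inSecond (inSecond (inFirst self))
          here₄ : (HA ⟦ var uV ⊕ var EV ⟧:= lit 2 ⊗ var tV) ⊑ listStep K
          here₄ = inSecond (inSecond (inSecond (inFirst self)))
          ⊑-listStep : ∀ {c} → c ⊑ listStep K → c ⊑ buildRow K
          ⊑-listStep p = inSecond (inFirst (inLoop p))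
          s₂ : Store
          s₂ = setReg (setReg s tV g₀) szV sz₀
          setArr-other : ∀ s A i v j → writesArr K (A ⟦ lit 0 ⟧:= lit 0) ≡ false → arr (setArr s A i v) K j ≡ arr s K j
          setArr-other s A i v j h = cong (λ b → (if b then arr s K [ i ≔ v ] else arr s K) j) h
        open Merge v {s₇} b₇ u≡ E≡ N≡ 2^b≤N fits K-table
        u+U≤X : val v * U + U ≤ X
        u+U≤X = ≤-trans (≤-reflexive (+-comm (val v * U) U)) (≤-trans (*-monoˡ-≤ U (val<2^ v))
          (≤-trans (*-monoˡ-≤ U (^-monoʳ-≤ 2 (n≤1+n b))) fits))
        u+U : ∀ {s₈} → Keeps (while (var szV ⊕ var szV ⊖ var kV) (mergeStep K)) s₇ s₈ → reg s₈ uV + reg s₈ unitV ≡ val v * U + U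
        u+U k₈ = cong₂ _+_ (trans (kept k₈ uV refl) u≡) (trans (kept k₈ unitV refl) unit≡)
        tick : ∀ τ₈ → τ₈ ≤ 5 * (2 ^ count v + 2 ^ count v) + 1 → suc (7 + (τ₈ + 1)) ≤ 20 * 2 ^ count v
        tick τ₈ time₈ = ≤-trans (s≤s (+-monoʳ-≤ 7 (+-monoˡ-≤ 1 time₈))) (≤-trans (≤-reflexive (eq₁ (2 ^ count v)))
          (≤-trans (+-monoʳ-≤ (10 * 2 ^ count v) (*-monoʳ-≤ 10 (1≤2^ (count v)))) (≤-reflexive (eq₂ (2 ^ count v)))))
          where
          eq₁ : ∀ a → suc (7 + (5 * (a + a) + 1 + 1)) ≡ 10 * a + 10 * 1
          eq₁ = solve-∀
          eq₂ : ∀ a → 10 * a + 10 * a ≡ 20 * a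
          eq₂ = solve-∀
        done : ∀ {s₈} → Keeps (while (var szV ⊕ var szV ⊖ var kV) (mergeStep K)) s₇ s₈ →
          (∀ {i} → i < 2 ^ count v + 2 ^ count v → arr s₈ LST (goal₀ + i) ≡ val (nth (submasks (true ∷ v)) i) * U) →
          IsList (setReg s₈ uV (reg s₈ uV + reg s₈ unitV)) (true ∷ v)
        done {s₈} k₈ new = isList
          (λ {i} i< → trans (cong (λ z → arr s₈ LST (z * N + i)) (trans (sym i₀≡′) i₀≡)) (new (subst (i <_) (2^suc (count v)) i<)))
          (trans (keptArr k₈ GA refl _) (trans (≔-same (arr s GA) i₀ h₀ i₀≡′) h≡))
          (trans (keptArr k₈ HA refl _) (trans (≔-same (arr s HA) i₀ g₁ i₀≡′) (cong (2 *_) g≡)))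
        unchanged : ∀ {s₈} → Keeps (while (var szV ⊕ var szV ⊖ var kV) (mergeStep K)) s₇ s₈ →
          (∀ {i} → i < goal₀ → arr s₈ LST i ≡ arr s LST i) →
          Same (val v * U + 2 ^ b * U) s (setReg s₈ uV (reg s₈ uV + reg s₈ unitV))
        unchanged k₈ old = same old
          (λ i< → trans (keptArr k₈ GA refl _) (≔-other (arr s GA) i₀ h₀ (λ eq → <⇒≢ i< (trans (sym eq) i₀≡))))
          (λ i< → trans (keptArr k₈ HA refl _) (≔-other (arr s HA) i₀ g₁ (λ eq → <⇒≢ i< (trans (sym eq) i₀≡))))

      row-correct : ∀ {s b} → Bounded s → Ready b s → reg s uV ≡ 0 → (∀ (v : Mask b) → IsList s v) →
        Run (while (var EV ⊖ var uV) (listStep K)) s (λ τ s′ → τ ≤ 20 * 3 ^ b + 1 × (∀ (v : Mask (suc b)) → IsList s′ v) × Same (2 ^ b * U) s s′)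
      row-correct {s} {b} bd rd@(ready E≡ N≡ unit≡ 2^sb≤N fits table) u≡ listed = run-while I (2 ^ b) bd
        (inv z≤n u≡ (same (λ _ → refl) (λ _ → refl) (λ _ → refl)) (λ _ ())) body end
        where
        2^b≤N : 2 ^ b ≤ N
        2^b≤N = ≤-trans (^-monoʳ-≤ 2 (n≤1+n b)) 2^sb≤N
        κ′ : ℕ → ℕ
        κ′ y = listTime (toMask b y)
        record I (i τ : ℕ) (s′ : Store) : Set where
          pattern
          constructor inv
          field
            time : τ ≤ sumBelow i κ′
            u≡′  : reg s′ uV ≡ i * U
            old  : Same (2 ^ b * U) s s′
            new  : ∀ (v : Mask b) → val v < i → IsList s′ (true ∷ v)
        val*U< : ∀ (v : Mask b) → val v * U < 2 ^ b * U
        val*U< v = *-monoˡ-< U (val<2^ v)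
        body : ∀ {i τ s′} → Keeps (listStep K) s s′ → i < 2 ^ b → I i τ s′ →
          eval (var EV ⊖ var uV) s′ ≢ 0 × Run (listStep K) s′ (λ τ′ → I (suc i) (τ + suc τ′))
        body {i} {τ} {s′} ks i< (inv time u≡′ old new) =
          (λ eq → m>n⇒m∸n≢0 (*-monoˡ-< U i<) (trans (sym (cong₂ _∸_ (trans (kept ks EV refl) E≡) u≡′)) eq)) ,
          run-mono (λ {τ₁} {s₁} (time₁ , isl , sm , u₁) → inv (+-mono-≤ time time₁)
              (trans u₁ (trans (cong (λ z → z * U + U) val-v) (+-comm (i * U) U)))
              (same-trans old (same-≤ (m≤n+m _ (val v * U)) sm)) (extend isl sm))
            (list-correct v (isBounded ks)
              (ready (trans (kept ks EV refl) E≡) (trans (kept ks NV refl) N≡) (trans (kept ks unitV refl) unit≡) 2^sb≤N fits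
                (λ y → trans (keptArr ks K (writesArr-⊑ (listStep⊑ {K}) K K-kept) _) (table y)))
              (trans u≡′ (cong (_* U) (sym val-v))) (same-list (val*U< v) 2^b≤N old (listed v)))
          where
          v : Mask b
          v = toMask b i
          val-v : val v ≡ i
          val-v = val-toMask b i i<
          extend : ∀ {s₁} → IsList s₁ (true ∷ v) → Same (val v * U + 2 ^ b * U) s′ s₁ → ∀ (y : Mask b) → val y < suc i → IsList s₁ (true ∷ y)
          extend {s₁} isl sm y y< with val y ≟ i
          ... | yes eq = subst (λ z → IsList s₁ (true ∷ z)) (val-injective (trans val-v (sym eq))) isl
          ... | no neq = same-list {v = true ∷ y}
                (≤-trans (≤-reflexive (cong suc (*-distribʳ-+ U (2 ^ b) (val y)))) (≤-trans (≤-reflexive (cong suc (+-comm (2 ^ b * U) (val y * U))))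
                  (+-monoˡ-< (2 ^ b * U) (*-monoˡ-< U (≤-trans y<i (≤-reflexive (sym val-v)))))))
                2^sb≤N sm (new y y<i)
            where
            y<i : val y < i
            y<i = ≤∧≢⇒< (≤-pred y<) neq
        end : ∀ {τ s′} → Keeps (listStep K) s s′ → I (2 ^ b) τ s′ → eval (var EV ⊖ var uV) s′ ≡ 0 ×
          (τ + 1 ≤ 20 * 3 ^ b + 1 × (∀ (v : Mask (suc b)) → IsList s′ v) × Same (2 ^ b * U) s s′)
        end {s′ = s′} ks (inv time u≡′ old new) =
          trans (cong₂ _∸_ (trans (kept ks EV refl) E≡) u≡′) (n∸n≡0 (2 ^ b * U)) ,
          +-monoˡ-≤ 1 (≤-trans time (≤-reflexive (trans (sumBelow-toMask b listTime)
            (trans (sumMask-* {b} 20 (λ v → 2 ^ count v)) (cong (20 *_) (sumMask-^ 2 b)))))) ,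
          (λ { (true ∷ v) → new v (val<2^ v) ; (false ∷ v) → false-list (same-list (val*U< v) 2^b≤N old (listed v)) }) , old

      build-correct : ∀ {s} cnt → Bounded s → reg s cntV ≡ cnt → reg s EV ≡ U → reg s NV ≡ N → reg s unitV ≡ U →
        2 ^ cnt ≤ N → 2 ^ cnt * U ≤ X → (∀ {c} → c ≤ cnt → (y : Mask c) → arr s K (val y * U) ≡ weigh κ y) → IsList s [] →
        Run (build K) s (λ τ s′ → τ ≤ 20 * 3 ^ cnt + 5 * cnt + 2 × (∀ (v : Mask cnt) → IsList s′ v) × Same U s s′ × reg s′ EV ≡ 2 ^ cnt * U)
      build-correct {s} cnt bd c≡ E≡₀ N≡ unit≡ 2^cnt≤N fits table nil = run-⨾ (run-:= z≤n (run-while I cnt b₁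
        (inv z≤n refl (trans E≡₀ (sym (*-identityˡ U))) (λ { [] → list₀ nil }) (same (λ _ → refl) (λ _ → refl) (λ _ → refl))) body end))
        where
        s₁ : Store
        s₁ = setReg s bV 0
        b₁ : Bounded s₁
        b₁ = bounded-setReg bV bd z≤n
        list₀ : IsList s [] → IsList s₁ []
        list₀ (isList a b c) = isList a b c
        record I (i τ : ℕ) (s′ : Store) : Set where
          pattern
          constructor inv
          field
            time   : τ ≤ 20 * 3 ^ i + 5 * i
            b≡     : reg s′ bV ≡ i
            E≡     : reg s′ EV ≡ 2 ^ i * U
            listed : ∀ (v : Mask i) → IsList s′ v
            old    : Same U s s′
        body : ∀ {i τ s′} → Keeps (buildRow K) s₁ s′ → i < cnt → I i τ s′ →
          eval (var cntV ⊖ var bV) s′ ≢ 0 × Run (buildRow K) s′ (λ τ′ → I (suc i) (τ + suc τ′))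
        body {i} {τ} {s′} ks i< (inv time b≡ E≡ listed old) =
          (λ eq → m>n⇒m∸n≢0 i< (trans (sym (cong₂ _∸_ (trans (kept ks cntV refl) c≡) b≡)) eq)) ,
          run-⨾ (run-:= z≤n (run-⨾ (run-keeps b₂ (row-correct b₂ rd refl (λ v → list′ (listed v)))
            (λ {τ₃} {s₃} k₃ (time₃ , listed₃ , same₃) → finish τ₃ k₃ time₃ listed₃ same₃))))
          where
          b₂ : Bounded (setReg s′ uV 0)
          b₂ = bounded-setReg uV (isBounded ks) z≤n
          list′ : ∀ {b} {v : Mask b} → IsList s′ v → IsList (setReg s′ uV 0) v
          list′ (isList a b c) = isList a b c
          double≤ : 2 ^ suc i * U ≤ X
          double≤ = ≤-trans (*-monoˡ-≤ U (^-monoʳ-≤ 2 i<)) fits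
          rd : Ready i (setReg s′ uV 0)
          rd = ready E≡ (trans (kept ks NV refl) N≡) (trans (kept ks unitV refl) unit≡) (≤-trans (^-monoʳ-≤ 2 i<) 2^cnt≤N) double≤
            (λ y → trans (keptArr ks K K-kept _) (table i< y))
          finish : ∀ {s₃} τ₃ → Keeps (while (var EV ⊖ var uV) (listStep K)) (setReg s′ uV 0) s₃ → τ₃ ≤ 20 * 3 ^ i + 1 →
            (∀ (v : Mask (suc i)) → IsList s₃ v) → Same (2 ^ i * U) (setReg s′ uV 0) s₃ →
            Run (EV := var EV ⊕ var EV ⨾ bV := var bV ⊕ lit 1) s₃ (λ τ′ → I (suc i) (τ + suc (1 + (τ₃ + τ′))))
          finish {s₃} τ₃ k₃ time₃ listed₃ (same x y z) =
            run-⨾ (run-:= (≤-trans (≤-reflexive E+E) (≤V 1 (^-1 double≤)))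
              (run-:= (≤-trans (≤-reflexive b+1) (≤-trans i< (≤-trans (≤-reflexive (sym c≡)) (reg≤ bd cntV))))
                (inv tick b+1 E+E (λ v → list″ (listed₃ v)) (same-trans old (same-≤ U≤ (same x y z))))))
            where
            E+E : reg s₃ EV + reg s₃ EV ≡ 2 ^ suc i * U
            E+E = trans (cong (λ z → z + z) (trans (kept k₃ EV refl) E≡)) (trans (sym (*-distribʳ-+ U (2 ^ i) (2 ^ i))) (cong (_* U) (sym (2^suc i))))
            b+1 : reg s₃ bV + 1 ≡ suc i
            b+1 = trans (cong (_+ 1) (trans (kept k₃ bV refl) b≡)) (+-comm i 1)
            U≤ : U ≤ 2 ^ i * U
            U≤ = m≤n*m U (2 ^ i) {{m^n≢0 2 i}}
            list″ : ∀ {b} {v : Mask b} → IsList s₃ v → IsList (setReg (setReg s₃ EV (reg s₃ EV + reg s₃ EV)) bV (reg s₃ bV + 1)) v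
            list″ (isList a b c) = isList a b c
            -- A geometric sum: the earlier rows and the present one cost `20 * 3 ^ i` each, and the
            -- third such summand of `20 * 3 ^ suc i` is left over.
            tick : τ + suc (1 + (τ₃ + (1 + 1))) ≤ 20 * 3 ^ suc i + 5 * suc i
            tick = ≤-trans (+-mono-≤ time (s≤s (s≤s (+-monoˡ-≤ 2 time₃)))) (≤-trans (m≤m+n _ (20 * 3 ^ i)) (≤-reflexive (eq (3 ^ i) i)))
              where
              eq : ∀ a i → 20 * a + 5 * i + suc (suc (20 * a + 1 + 2)) + 20 * a ≡ 20 * (3 * a) + 5 * (1 + i)
              eq = solve-∀
        end : ∀ {τ s′} → Keeps (buildRow K) s₁ s′ → I cnt τ s′ → eval (var cntV ⊖ var bV) s′ ≡ 0 ×
          (1 + (τ + 1) ≤ 20 * 3 ^ cnt + 5 * cnt + 2 × (∀ (v : Mask cnt) → IsList s′ v) × Same U s s′ × reg s′ EV ≡ 2 ^ cnt * U)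
        end {τ} ks (inv time b≡ E≡ listed old) =
          trans (cong₂ _∸_ (trans (kept ks cntV refl) c≡) b≡) (n∸n≡0 cnt) ,
          ≤-trans (≤-reflexive (+-comm 1 (τ + 1))) (≤-trans (≤-reflexive (+-assoc τ 1 1)) (+-monoˡ-≤ 2 time)) , listed , old , E≡

    -- Adding a machine

    module Layer (l f : ℕ) (p w : ℕ → ℕ) (2^n≤X : 2 ^ (l + f) ≤ X)
                 (p≤X : sumBelow (l + f) p ≤ X) (w≤X : sumBelow (l + f) w ≤ X) where
      open Costs p w
      module Low  = Submasks p
      module High = Submasks (λ i → w (i + f))

      n N F : ℕ
      n = l + f
      N = 2 ^ n
      F = 2 ^ f

      record Lists (s : Store) : Set where
        pattern
        constructor lists
        field
          N≡    : reg s NV ≡ N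
          F≡    : reg s FV ≡ F
          ps≡   : ∀ (v : Mask n) → arr s PS (val v) ≡ weigh p v
          ws≡   : ∀ (v : Mask n) → arr s WS (val v) ≡ weigh w v
          low   : ∀ (u : Mask f) {k} → k < 2 ^ count u → arr s LST (val u * N + k) ≡ val (nth (Low.submasks u) k)
          low-g : ∀ (u : Mask f) → arr s GA (val u) ≡ gOf u
          low-h : ∀ (u : Mask f) → arr s HA (val u) ≡ hOf u
          high   : ∀ (d : Mask l) {k} → k < 2 ^ count d → arr s LST (val d * F * N + k) ≡ val (nth (High.submasks d) k) * F
          high-g : ∀ (d : Mask l) → arr s GA (val d * F) ≡ gOf d
          high-h : ∀ (d : Mask l) → arr s HA (val d * F) ≡ hOf d
      open Lists public

      val-low : ∀ (u : Mask f) → val (∅ {l} ⧺ u) ≡ val u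
      val-low u = trans (val-++ (∅ {l}) u) (cong (λ x → x * F + val u) (val-∅ l))

      val-high : ∀ (d : Mask l) → val (d ⧺ ∅ {f}) ≡ val d * F
      val-high d = trans (val-++ d (∅ {f})) (trans (cong (val d * F +_) (val-∅ f)) (+-identityʳ _))

      cost≤X² : ∀ (v : Mask n) → cost v ≤ X ^ 2
      cost≤X² v = ≤-trans (cost≤ v) (^-* 1 1 (^-1 p≤X) (^-1 w≤X))

      record LayerState (h : Mask n → ℕ) (ob nb : ℕ) (s : Store) : Set where
        pattern
        constructor layerState
        field
          ob≡   : reg s obV ≡ ob
          nb≡   : reg s nbV ≡ nb
          ob+N≤ : ob + N ≤ nb
          old≡  : ∀ x → arr s HH (ob + val x) ≡ h x
          cost≡ : ∀ (v : Mask n) → arr s HH (val v) ≡ cost v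
      open LayerState public

      Attained : (Mask n → ℕ) → Mask n → ℕ → Set
      Attained h v a = ∃₂ λ t x → Split v t x × a ≡ cost t + h x

      -- The pair of `u` and `d` accounts for exactly those splits in which the early part is `u`
      -- and the previous machines keep the late jobs outside `d`. By `decrease`, what one pair has
      -- achieved survives the others.
      record Improved (h : Mask n → ℕ) (nb : ℕ) (u : Mask f) (d : Mask l) (s s′ : Store) : Set where
        pattern
        constructor improved
        field
          decrease : ∀ i → arr s′ HH i ≤ arr s HH i
          origin   : ∀ i → arr s′ HH i ≡ arr s HH i ⊎ (∃[ v ] (i ≡ nb + val v × Attained h v (arr s′ HH i)))
          complete : ∀ {v₂ t₂ t₁ x₁} → Split v₂ t₂ (complement d) → Split u t₁ x₁ →
            arr s′ HH (nb + val (v₂ ⧺ u)) ≤ cost (t₂ ⧺ t₁) + h (complement d ⧺ x₁)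

      -- There is a scan over the 2^|u| lines for each of the `hOf d` blocks, the windows amount to
      -- `gOf d` further passes, and each query takes constant extra work.
      innerTime : Mask f → Mask l → ℕ
      innerTime u d = 2 ^ count u * (gOf d + hOf d) + 2 ^ count d

      module _ {h : Mask n → ℕ} (h≤ : ∀ x → h x ≤ X ^ 2) {ob nb : ℕ} where

        inner-correct : ∀ {s} (u : Mask f) (d : Mask l) → Bounded s → Lists s → LayerState h ob nb s →
          reg s uV ≡ val u → reg s dV ≡ val d * F →
          Run inner s (λ τ s′ → τ ≤ 40 * innerTime u d × Improved h nb u d s s′)
        inner-correct {s} u d bd ls st u≡ d≡ =
          run-⨾ (run-:= sz≤V (run-⨾ (run-:= x≤V (run-⨾ (run-:= z≤n (run-⨾ (run-keeps b₁
            (Columns.columns-correct s₁ b₁ refl col≤V) λ {τ} k₂ (time , filled) → after τ k₂ time filled)))))))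
          where
          x₂ : Mask l
          x₂ = complement d
          sz₀ x₀ : ℕ
          sz₀ = arr s GA (reg s uV) * arr s HA (reg s uV)
          x₀  = reg s NV ∸ reg s FV ∸ reg s dV
          C : ℕ
          C = 2 ^ count u
          C≤X : C ≤ X
          C≤X = ≤-trans (2^count≤ u) (≤-trans (^-monoʳ-≤ 2 (m≤n+m f l)) 2^n≤X)
          sz≡ : sz₀ ≡ C
          sz≡ = trans (cong₂ _*_ (trans (cong (arr s GA) u≡) (low-g ls u)) (trans (cong (arr s HA) u≡) (low-h ls u)))
                  (trans (*-comm (gOf u) (hOf u)) (hOf*gOf u))
          sz≤V : sz₀ ≤ V
          sz≤V = ≤V 1 (^-1 (≤-trans (≤-reflexive sz≡) C≤X))
          x≤V : x₀ ≤ V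
          x≤V = ≤-trans (m∸n≤m _ (reg s dV)) (≤-trans (m∸n≤m _ (reg s FV)) (reg≤ bd NV))
          x≡ : x₀ ≡ val x₂ * F
          x≡ = trans (cong₂ _∸_ (cong₂ _∸_ (N≡ ls) (F≡ ls)) d≡) (trans (cong (λ y → y ∸ F ∸ val d * F) N≡′)
                 (trans (cong (_∸ val d * F) (m+n∸n≡m ((val d + val x₂) * F) F))
                   (trans (cong (_∸ val d * F) (*-distribʳ-+ F (val d) (val x₂))) (m+n∸m≡n (val d * F) _))))
            where
            N≡′ : N ≡ (val d + val x₂) * F + F
            N≡′ = trans (^-distribˡ-+-* 2 l f) (trans (cong (_* F) (sym (val-complement d)))
                    (trans (*-distribʳ-+ F (val d + val x₂) 1) (cong ((val d + val x₂) * F +_) (*-identityˡ F))))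
          s₁ : Store
          s₁ = setReg (setReg (setReg s szV sz₀) xV x₀) jV 0
          b₁ : Bounded s₁
          b₁ = bounded-setReg jV (bounded-setReg xV (bounded-setReg szV bd sz≤V) x≤V) z≤n
          t₁ x₁ : ℕ → Mask f
          t₁ j = nth (Low.submasks u) j
          -- The remainder of `u` is defined by the same subtraction that the program performs; it
          -- thereby becomes a function of `j`, and `split₁` identifies it.
          x₁ j = toMask f (val u ∸ val (t₁ j))
          split₁ : ∀ {j} → j < C → Split u (t₁ j) (x₁ j)
          split₁ {j} j< with Low.∈-split u (nth-∈ (Low.submasks u) (subst (j <_) (sym (Low.length-submasks u)) j<))
          ... | y , sp = subst (Split u (t₁ j)) (trans (sym (toMask-val y)) (cong (toMask f) (sym (split-val∸ sp)))) sp
          t≡ : ∀ {j} → j < C → Columns.t s₁ b₁ refl j ≡ val (t₁ j)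
          t≡ {j} j< = trans (cong (λ y → arr s LST (y + j)) (cong₂ _*_ u≡ (N≡ ls))) (low ls u j<)
          colValue : ℕ → ℕ
          colValue j = h (x₂ ⧺ x₁ j) + cost (t₁ j)
          cost-t₁ : ∀ t → arr s HH (val t) ≡ cost t
          cost-t₁ t = trans (cong (arr s HH) (sym (val-low t))) (trans (cost≡ st (∅ {l} ⧺ t)) (cost-low l t))
          col≡ : ∀ {j} → j < C → Columns.col s₁ b₁ refl j ≡ colValue j
          col≡ {j} j< = cong₂ _+_
            (trans (cong (arr s HH) (cong₂ _+_ (ob≡ st) (trans (cong₂ _+_ (trans (cong₂ _∸_ u≡ (t≡ j<)) (split-val∸ (split₁ j<))) x≡)
              (trans (+-comm (val (x₁ j)) _) (sym (val-++ x₂ (x₁ j))))))) (old≡ st (x₂ ⧺ x₁ j)))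
            (trans (cong (arr s HH) (t≡ j<)) (cost-t₁ (t₁ j)))
          cost₁≤ : ∀ (t : Mask f) → cost t ≤ X ^ 2
          cost₁≤ t = ≤-trans (≤-reflexive (sym (cost-low l t))) (cost≤X² (∅ {l} ⧺ t))
          col≤V : ∀ {j} → j < sz₀ → Columns.col s₁ b₁ refl j ≤ V
          col≤V {j} j< = ≤-trans (≤-reflexive (col≡ j<C)) (≤V 3 (^-+ 2 (h≤ (x₂ ⧺ x₁ j)) (cost₁≤ (t₁ j))))
            where
            j<C : j < C
            j<C = subst (j <_) sz≡ j<
          ps-t₁ : ∀ t → arr s PS (val t) ≡ weigh p t
          ps-t₁ t = trans (cong (arr s PS) (sym (val-low t))) (trans (ps≡ ls (∅ {l} ⧺ t)) (weigh-low p l t))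

          after : ∀ {s₂} τ → Keeps (while (var szV ⊖ var jV) columnStep) s₁ s₂ → τ ≤ 5 * sz₀ + 1 →
            (∀ {j} → j < sz₀ → arr s₂ COL j ≡ Columns.col s₁ b₁ refl j × arr s₂ SL j ≡ arr s PS (Columns.t s₁ b₁ refl j)) →
            Run (gV := GA at var dV ⨾ rV := HA at var dV ⊗ var gV ⨾ loV := lit 0 ⨾ while (var rV) block) s₂
              (λ τ′ s′ → 1 + (1 + (1 + (τ + τ′))) ≤ 40 * innerTime u d × Improved h nb u d s s′)
          after {s₂} τ k₂ time filled =
            run-⨾ (run-:= g≤V (run-⨾ (run-:= r≤V (run-⨾ (run-:= z≤n (run-mono
              (λ {τ′} {s′} (time′ , pr) → total τ′ time′ , improve s′ pr)
              (rows-correct R sz≥1 t< slopes weights fit (hOf d) g≥1 R≡ r₀≡R refl)))))))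
            where
            g₀ r₀ : ℕ
            g₀ = arr s₂ GA (reg s₂ dV)
            r₀ = arr s₂ HA (reg s₂ dV) * g₀
            d₂≡ : reg s₂ dV ≡ val d * F
            d₂≡ = trans (kept k₂ dV refl) d≡
            g≡ : g₀ ≡ gOf d
            g≡ = trans (keptArr k₂ GA refl _) (trans (cong (arr s GA) d₂≡) (high-g ls d))
            h≡ : arr s₂ HA (reg s₂ dV) ≡ hOf d
            h≡ = trans (keptArr k₂ HA refl _) (trans (cong (arr s HA) d₂≡) (high-h ls d))
            R : ℕ
            R = 2 ^ count d
            r₀≡R : r₀ ≡ R
            r₀≡R = trans (cong₂ _*_ h≡ g≡) (hOf*gOf d)
            R≤X : R ≤ X
            R≤X = ≤-trans (2^count≤ d) (≤-trans (^-monoʳ-≤ 2 (m≤m+n l f)) 2^n≤X)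
            g≤V : g₀ ≤ V
            g≤V = arr≤ (isBounded k₂) GA _
            r≤V : r₀ ≤ V
            r≤V = ≤V 1 (^-1 (≤-trans (≤-reflexive r₀≡R) R≤X))
            s₃ : Store
            s₃ = setReg (setReg (setReg s₂ gV g₀) rV r₀) loV 0
            b₃ : Bounded s₃
            b₃ = bounded-setReg loV (bounded-setReg rV (bounded-setReg gV (isBounded k₂) g≤V) r≤V) z≤n
            open Rows s₃ b₃ using (rows-correct; Progress; goal; cand; q; e; M) renaming (t to tᵣ)
            sz₃ : reg s₃ szV ≡ C
            sz₃ = trans (kept k₂ szV refl) sz≡
            toC : ∀ {j} → j < reg s₃ szV → j < C
            toC {j} = subst (j <_) sz₃
            sz≥1 : 1 ≤ reg s₃ szV
            sz≥1 = ≤-trans (1≤2^ (count u)) (≤-reflexive (sym sz₃))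
            g≥1 : 1 ≤ g₀
            g≥1 = ≤-trans (gOf≥1 d) (≤-reflexive (sym g≡))
            R≡ : R ≡ hOf d * g₀
            R≡ = trans (sym (hOf*gOf d)) (cong (hOf d *_) (sym g≡))
            t₂ : ℕ → Mask l
            t₂ ρ = nth (High.submasks d) ρ
            tᵣ≡ : ∀ {ρ} → ρ < R → tᵣ ρ ≡ val (t₂ ρ) * F
            tᵣ≡ {ρ} ρ< = trans (keptArr k₂ LST refl _) (trans (cong (λ y → arr s LST (y + ρ)) (cong₂ _*_ d₂≡ (trans (kept k₂ NV refl) (N≡ ls)))) (high ls d ρ<))
            tᵣ-val : ∀ {ρ} → ρ < R → tᵣ ρ ≡ val (t₂ ρ ⧺ ∅ {f})
            tᵣ-val {ρ} ρ< = trans (tᵣ≡ ρ<) (sym (val-high (t₂ ρ)))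
            q≡ : ∀ {ρ} → ρ < R → q ρ ≡ weigh w (t₂ ρ ⧺ ∅ {f})
            q≡ {ρ} ρ< = trans (keptArr k₂ WS refl _) (trans (cong (arr s WS) (tᵣ-val ρ<)) (ws≡ ls (t₂ ρ ⧺ ∅ {f})))
            e≡ : ∀ {ρ} → ρ < R → e ρ ≡ cost (t₂ ρ ⧺ ∅ {f})
            e≡ {ρ} ρ< = trans (keptArr k₂ HH refl _) (trans (cong (arr s HH) (tᵣ-val ρ<)) (cost≡ st (t₂ ρ ⧺ ∅ {f})))
            C≡ : ∀ {j} → j < C → arr s₃ COL j ≡ colValue j
            C≡ {j} j< = trans (proj₁ (filled (subst (j <_) (sym sz≡) j<))) (col≡ j<)
            S≡ : ∀ {j} → j < C → arr s₃ SL j ≡ weigh p (t₁ j)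
            S≡ {j} j< = trans (proj₂ (filled (subst (j <_) (sym sz≡) j<))) (trans (cong (arr s PS) (t≡ j<)) (ps-t₁ (t₁ j)))
            -- The line `j` at query `ρ` contributes all but the cost of the late part alone;
            -- `cost-++` assembles the cost of the joint set.
            candValue : ∀ {ρ j} → ρ < R → j < C → cand ρ j ≡ cost (t₂ ρ ⧺ t₁ j) + h (x₂ ⧺ x₁ j)
            candValue {ρ} {j} ρ< j< = trans (cong₂ _+_ (cong₂ _+_ (C≡ j<) (cong₂ _*_ (S≡ j<) (q≡ ρ<))) (e≡ ρ<))
              (trans (eq (h (x₂ ⧺ x₁ j)) (cost (t₁ j)) (weigh p (t₁ j) * weigh w (t₂ ρ ⧺ ∅ {f})) (cost (t₂ ρ ⧺ ∅ {f})))
                (cong (_+ h (x₂ ⧺ x₁ j)) (sym (cost-++ (t₂ ρ) (t₁ j)))))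
              where
              eq : ∀ a b c d → a + b + c + d ≡ b + c + d + a
              eq = solve-∀
            N≤nb : N ≤ nb
            N≤nb = ≤-trans (m≤n+m N ob) (ob+N≤ st)
            nb₃ : reg s₃ nbV ≡ nb
            nb₃ = trans (kept k₂ nbV refl) (nb≡ st)
            t< : ∀ {ρ} → ρ < R → tᵣ ρ < reg s₃ nbV
            t< {ρ} ρ< = subst₂ _<_ (sym (tᵣ-val ρ<)) (sym nb₃) (<-≤-trans (val<2^ (t₂ ρ ⧺ ∅ {f})) N≤nb)
            slopes : ∀ {i j} → i ≤ j → j < reg s₃ szV → arr s₃ SL i ≤ arr s₃ SL j
            slopes {i} {j} i≤j j< = subst₂ _≤_ (sym (S≡ (≤-<-trans i≤j (toC j<)))) (sym (S≡ (toC j<)))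
              (Low.nth-ordered (Low.ordered-submasks u) i≤j (subst (j <_) (sym (Low.length-submasks u)) (toC j<)))
            weights : ∀ {i j} → i ≤ j → j < R → q i ≤ q j
            weights {i} {j} i≤j j< = subst₂ _≤_
              (sym (trans (q≡ (≤-<-trans i≤j j<)) (weigh-high w (t₂ i)))) (sym (trans (q≡ j<) (weigh-high w (t₂ j))))
              (High.nth-ordered (High.ordered-submasks d) i≤j (subst (j <_) (sym (High.length-submasks d)) j<))
            fit : ∀ {ρ j} → ρ < R → j < reg s₃ szV → cand ρ j ≤ V
            fit {ρ} {j} ρ< j< = ≤-trans (≤-reflexive (candValue ρ< (toC j<))) (≤V 3 (^-+ 2 (cost≤X² (t₂ ρ ⧺ t₁ j)) (h≤ (x₂ ⧺ x₁ j))))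
            split₂ : ∀ {ρ} → ρ < R → ∃[ v₂ ] Split v₂ (t₂ ρ) x₂
            split₂ {ρ} ρ< with High.∈-split d (nth-∈ (High.submasks d) (subst (ρ <_) (sym (High.length-submasks d)) ρ<))
            ... | y , sp = union x₂ (complement-involutive d) sp
            goal≡ : ∀ {ρ v₂} → ρ < R → Split v₂ (t₂ ρ) x₂ → goal ρ ≡ nb + val (v₂ ⧺ u)
            goal≡ {ρ} {v₂} ρ< sp = trans (cong₂ _+_ (cong₂ _+_ (cong₂ _+_ nb₃ (trans (kept k₂ uV refl) u≡)) (trans (kept k₂ xV refl) x≡)) (tᵣ≡ ρ<))
              (trans (eq nb (val u) (val x₂) (val (t₂ ρ)) F)
                (cong (nb +_) (trans (cong (λ y → y * F + val u) (sym (split-val sp))) (sym (val-++ v₂ u)))))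
              where
              eq : ∀ a b c d e → a + b + c * e + d * e ≡ a + ((d + c) * e + b)
              eq = solve-∀
            improve : ∀ s′ → Progress R sz≥1 t< slopes weights fit 0 s′ → Improved h nb u d s s′
            improve s′ pr = improved
              (λ i → ≤-trans (decr i) (≤-reflexive (keptArr k₂ HH refl i))) from complete
              where
              open Rows.Progress pr renaming (decrease to decr)
              from : ∀ i → arr s′ HH i ≡ arr s HH i ⊎ (∃[ v ] (i ≡ nb + val v × Attained h v (arr s′ HH i)))
              from i with origin i
              ... | inj₁ eq = inj₁ (trans eq (keptArr k₂ HH refl i))
              ... | inj₂ (ρ , j , ρ< , j< , i≡ , v≡) with split₂ ρ<
              ...   | v₂ , sp = inj₂ (v₂ ⧺ u , trans i≡ (goal≡ ρ< sp) ,
                      t₂ ρ ⧺ t₁ j , x₂ ⧺ x₁ j , split-++ sp (split₁ (toC j<)) , trans v≡ (candValue ρ< (toC j<)))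
              complete : ∀ {v₂ t₂ t₁ x₁} → Split v₂ t₂ x₂ → Split u t₁ x₁ →
                arr s′ HH (nb + val (v₂ ⧺ u)) ≤ cost (t₂ ⧺ t₁) + h (x₂ ⧺ x₁)
              complete {v₂} {y₂} {y₁} {z₁} sp₂ sp₁
                with ∈-nth (High.split-∈ (subst (λ c → Split c y₂ (proj₁ (split-complement sp₂))) (complement-involutive d) (proj₂ (split-complement sp₂))))
                   | ∈-nth (Low.split-∈ sp₁)
              ... | ρ , ρ< , refl | j , j< , refl = begin
                arr s′ HH (nb + val (v₂ ⧺ u))           ≡⟨ cong (arr s′ HH) (goal≡ ρ<R sp₂) ⟨
                arr s′ HH (goal ρ)                       ≤⟨ done z≤n ρ<R (subst (j <_) (sym sz₃) j<C) ⟩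
                cand ρ j                                 ≡⟨ candValue ρ<R j<C ⟩
                cost (t₂ ρ ⧺ t₁ j) + h (x₂ ⧺ x₁ j)     ≡⟨ cong (λ y → cost (t₂ ρ ⧺ t₁ j) + h (x₂ ⧺ y)) (trans (cong (toMask f) (split-val∸ sp₁)) (toMask-val z₁)) ⟩
                cost (t₂ ρ ⧺ t₁ j) + h (x₂ ⧺ z₁)       ∎
                where
                open ≤-Reasoning
                ρ<R : ρ < R
                ρ<R = subst (ρ <_) (High.length-submasks d) ρ<
                j<C : j < C
                j<C = subst (j <_) (Low.length-submasks u) j<
            total : ∀ τ′ → τ′ ≤ hOf d * (13 + 6 * reg s₃ szV + 12 * g₀) + 6 * (g₀ * reg s₃ szV) + 1 →
              1 + (1 + (1 + (τ + (1 + (1 + (1 + τ′)))))) ≤ 40 * innerTime u d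
            total τ′ time′ = begin
              3 + (τ + (3 + τ′))                                                      ≤⟨ +-monoʳ-≤ 3 (+-mono-≤ (subst (λ y → τ ≤ 5 * y + 1) sz≡ time) (+-monoʳ-≤ 3 (subst₂ (λ y z → τ′ ≤ hOf d * (13 + 6 * y + 12 * z) + 6 * (z * y) + 1) sz₃ g≡ time′))) ⟩
              3 + (5 * C + 1 + (3 + (hOf d * (13 + 6 * C + 12 * gOf d) + 6 * (gOf d * C) + 1))) ≤⟨ bound C (gOf d) (hOf d) (1≤2^ (count u)) (gOf≥1 d) ⟩
              40 * (C * (gOf d + hOf d) + hOf d * gOf d)                              ≡⟨ cong (λ y → 40 * (C * (gOf d + hOf d) + y)) (hOf*gOf d) ⟩
              40 * innerTime u d                                                      ∎
              where
              open ≤-Reasoning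
              bound : ∀ c g h → 1 ≤ c → 1 ≤ g →
                3 + (5 * c + 1 + (3 + (h * (13 + 6 * c + 12 * g) + 6 * (g * c) + 1))) ≤ 40 * (c * (g + h) + h * g)
              -- Once `c` and `g` are written as successors, the difference of the two sides is a
              -- polynomial with positive coefficients; the constant 40 is large enough for this.
              bound (suc c) (suc g) h _ _ = ≤-trans (m≤m+n _ (21 + 34 * g + 49 * h + 29 * c + 34 * (c * g) + 34 * (c * h) + 28 * (h * g)))
                (≤-reflexive (eq c g h))
                where
                eq : ∀ c g h → 3 + (5 * (1 + c) + 1 + (3 + (h * (13 + 6 * (1 + c) + 12 * (1 + g)) + 6 * ((1 + g) * (1 + c)) + 1))) +
                  (21 + 34 * g + 49 * h + 29 * c + 34 * (c * g) + 34 * (c * h) + 28 * (h * g)) ≡ 40 * ((1 + c) * ((1 + g) + h) + h * (1 + g))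
                eq = solve-∀

      lists-kept : ∀ {s s′} → Keeps layerStep s s′ → Lists s → Lists s′
      lists-kept k ls = lists (trans (kept k NV refl) (N≡ ls)) (trans (kept k FV refl) (F≡ ls))
        (λ v → trans (keptArr k PS refl _) (ps≡ ls v)) (λ v → trans (keptArr k WS refl _) (ws≡ ls v))
        (λ u k< → trans (keptArr k LST refl _) (low ls u k<))
        (λ u → trans (keptArr k GA refl _) (low-g ls u)) (λ u → trans (keptArr k HA refl _) (low-h ls u))
        (λ d k< → trans (keptArr k LST refl _) (high ls d k<))
        (λ d → trans (keptArr k GA refl _) (high-g ls d)) (λ d → trans (keptArr k HA refl _) (high-h ls d))

      N≤X : N ≤ X
      N≤X = 2^n≤X

      F≤N : F ≤ N
      F≤N = ^-monoʳ-≤ 2 (m≤n+m f l)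

      2^l*F≡N : 2 ^ l * F ≡ N
      2^l*F≡N = sym (^-distribˡ-+-* 2 l f)

      -- The factor 42 is the 40 of `inner-correct` plus 2 for the loop test and the step of `dV`,
      -- which are absorbed since `innerTime` is at least 1.
      lowTime : Mask f → ℕ
      lowTime u = sumBelow (2 ^ l) (λ y → 42 * innerTime u (toMask l y)) + 5

      layerTime : ℕ
      layerTime = sumBelow (2 ^ f) (λ x → lowTime (toMask f x)) + 3 * N + 10

      innerTime≥1 : ∀ u d → 1 ≤ innerTime u d
      innerTime≥1 u d = ≤-trans (1≤2^ (count d)) (m≤n+m _ _)

      module _ (h : Mask n → ℕ) (h≤ : ∀ x → h x ≤ X ^ 2) (ob : ℕ) where

        nb : ℕ
        nb = ob + N

        Complete : Store → Mask f → Mask l → Set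
        Complete s u d = ∀ {v₂ t₂ t₁ x₁} → Split v₂ t₂ (complement d) → Split u t₁ x₁ →
          arr s HH (nb + val (v₂ ⧺ u)) ≤ cost (t₂ ⧺ t₁) + h (complement d ⧺ x₁)

        -- `P` records the pairs that have been processed. Entries are at all times costs of actual
        -- splits; once `P` covers all pairs, they are also lower bounds and hence minima.
        record Filling (P : Mask f → Mask l → Set) (s : Store) : Set where
          pattern
          constructor filling
          field
            sound    : ∀ v → Attained h v (arr s HH (nb + val v))
            state    : LayerState h ob nb s
            complete : ∀ {u d} → P u d → Complete s u d
        open Filling

        filling-store : ∀ {P s s′} → (∀ i → arr s′ HH i ≡ arr s HH i) → reg s′ obV ≡ reg s obV → reg s′ nbV ≡ reg s nbV →
          Filling P s → Filling P s′
        filling-store same o≡ n≡ (filling sound (layerState a b c d e) complete) = filling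
          (λ v → subst (Attained h v) (sym (same _)) (sound v))
          (layerState (trans o≡ a) (trans n≡ b) c (λ x → trans (same _) (d x)) (λ x → trans (same _) (e x)))
          (λ pud s₂ s₁ → ≤-trans (≤-reflexive (same _)) (complete pud s₂ s₁))

        filling-weaken : ∀ {P Q s} → (∀ {u d} → Q u d → P u d) → Filling P s → Filling Q s
        filling-weaken f (filling a b c) = filling a b (λ q → c (f q))

        improve : ∀ {P s s′ u d} → Keeps inner s s′ → Filling P s → Improved h nb u d s s′ →
          Filling (λ u′ d′ → P u′ d′ ⊎ (u′ ≡ u × d′ ≡ d)) s′
        improve {P} {s} {s′} {u} {d} ks (filling sound (layerState a b c old cst) complete) (improved decrease origin complete′) =
          filling sound′
            (layerState (trans (kept ks obV refl) a) (trans (kept ks nbV refl) b) c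
              (λ x → trans (same (<-≤-trans (+-monoʳ-< ob (val<2^ x)) c)) (old x))
              (λ x → trans (same (<-≤-trans (val<2^ x) (≤-trans (m≤n+m N ob) c))) (cst x)))
            (λ { (inj₁ pud) s₂ s₁ → ≤-trans (decrease _) (complete pud s₂ s₁)
               ; (inj₂ (refl , refl)) s₂ s₁ → complete′ s₂ s₁ })
          where
          same : ∀ {i} → i < nb → arr s′ HH i ≡ arr s HH i
          same {i} i< with origin i
          ... | inj₁ eq = eq
          ... | inj₂ (v , refl , _) = ⊥-elim (<⇒≱ i< (m≤m+n nb (val v)))
          sound′ : ∀ v → Attained h v (arr s′ HH (nb + val v))
          sound′ v with origin (nb + val v)
          ... | inj₁ eq = subst (Attained h v) (sym eq) (sound v)
          ... | inj₂ (v′ , eq , att) with val-injective {v = v} {v′} (+-cancelˡ-≡ nb _ _ eq)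
          ...   | refl = att

        high-correct : ∀ {s} (u : Mask f) {P : Mask f → Mask l → Set} → Bounded s → Lists s → Filling P s →
          reg s uV ≡ val u → reg s dV ≡ 0 →
          Run (while (var NV ⊖ var dV) highStep) s (λ τ s′ →
            τ ≤ sumBelow (2 ^ l) (λ y → 42 * innerTime u (toMask l y)) + 1 × Filling (λ u′ d′ → P u′ d′ ⊎ u′ ≡ u) s′)
        high-correct {s} u {P} bd ls fl u≡ d≡ = run-while I (2 ^ l) bd
          (inv z≤n d≡ (filling-weaken (λ { (inj₁ x) → x ; (inj₂ (_ , ())) }) fl)) body end
          where
          κ : ℕ → ℕ
          κ y = 42 * innerTime u (toMask l y)
          record I (i τ : ℕ) (s′ : Store) : Set where
            pattern
            constructor inv
            field
              time : τ ≤ sumBelow i κ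
              d≡′  : reg s′ dV ≡ i * F
              fill : Filling (λ u′ d′ → P u′ d′ ⊎ (u′ ≡ u × val d′ < i)) s′
          body : ∀ {i τ s′} → Keeps highStep s s′ → i < 2 ^ l → I i τ s′ →
            eval (var NV ⊖ var dV) s′ ≢ 0 × Run highStep s′ (λ τ′ → I (suc i) (τ + suc τ′))
          body {i} {τ} {s′} ks i< (inv time d≡′ fill) =
            (λ eq → m>n⇒m∸n≢0 iF<N (trans (sym (cong₂ _∸_ (N≡ ls′) d≡′)) eq)) ,
            run-⨾ (run-keeps (isBounded ks)
              (inner-correct h≤ u d (isBounded ks) ls′ (state fill) (trans (kept ks uV refl) u≡) (trans d≡′ (cong (_* F) (sym val-d))))
              (λ {τ₁} {s₁} k₁ (time₁ , imp) → run-:=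
                (≤-trans (≤-reflexive (d+F k₁)) (≤V 1 (^-1 (≤-trans (≤-trans (*-monoˡ-≤ F i<) (≤-reflexive 2^l*F≡N)) N≤X))))
                (inv (tick τ₁ time₁) (d+F k₁)
                  (filling-store (λ _ → refl) refl refl (filling-weaken extend (improve k₁ fill imp))))))
            where
            ls′ : Lists s′
            ls′ = lists-kept (keeps-⊑ (⊑-trans highStep⊑lowStep lowStep⊑layerStep) ks) ls
            d : Mask l
            d = toMask l i
            val-d : val d ≡ i
            val-d = val-toMask l i i<
            iF<N : i * F < N
            iF<N = <-≤-trans (*-monoˡ-< F {{>-nonZero (1≤2^ f)}} i<) (≤-reflexive 2^l*F≡N)
            d+F : ∀ {s₁} → Keeps inner s′ s₁ → reg s₁ dV + reg s₁ FV ≡ suc i * F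
            d+F k₁ = trans (cong₂ _+_ (trans (kept k₁ dV refl) d≡′) (trans (kept k₁ FV refl) (F≡ ls′))) (+-comm (i * F) F)
            extend : ∀ {u′ d′} → P u′ d′ ⊎ (u′ ≡ u × val d′ < suc i) → (P u′ d′ ⊎ (u′ ≡ u × val d′ < i)) ⊎ (u′ ≡ u × d′ ≡ d)
            extend (inj₁ x) = inj₁ (inj₁ x)
            extend {d′ = d′} (inj₂ (refl , lt)) with val d′ ≟ i
            ... | yes eq = inj₂ (refl , val-injective (trans eq (sym val-d)))
            ... | no neq = inj₁ (inj₂ (refl , ≤∧≢⇒< (≤-pred lt) neq))
            tick : ∀ τ₁ → τ₁ ≤ 40 * innerTime u d → τ + suc (τ₁ + 1) ≤ sumBelow i κ + κ i
            tick τ₁ time₁ = +-mono-≤ time (begin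
              suc (τ₁ + 1)                                 ≡⟨ eq τ₁ ⟩
              τ₁ + 2 * 1                                   ≤⟨ +-mono-≤ time₁ (*-monoʳ-≤ 2 (innerTime≥1 u d)) ⟩
              40 * innerTime u d + 2 * innerTime u d       ≡⟨ *-distribʳ-+ (innerTime u d) 40 2 ⟨
              42 * innerTime u d                           ∎)
              where
              open ≤-Reasoning
              eq : ∀ a → suc (a + 1) ≡ a + 2 * 1
              eq = solve-∀
          end : ∀ {τ s′} → Keeps highStep s s′ → I (2 ^ l) τ s′ → eval (var NV ⊖ var dV) s′ ≡ 0 ×
            (τ + 1 ≤ sumBelow (2 ^ l) κ + 1 × Filling (λ u′ d′ → P u′ d′ ⊎ u′ ≡ u) s′)
          end ks (inv time d≡′ fill) =
            trans (cong₂ _∸_ (N≡ (lists-kept (keeps-⊑ (⊑-trans highStep⊑lowStep lowStep⊑layerStep) ks) ls)) (trans d≡′ 2^l*F≡N)) (n∸n≡0 N) ,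
            +-monoˡ-≤ 1 time ,
            filling-weaken (λ { (inj₁ x) → inj₁ x ; {d = d} (inj₂ refl) → inj₂ (refl , val<2^ d) }) fill

        low-correct : ∀ {s} → Bounded s → Lists s → (∀ v → arr s HH (nb + val v) ≡ h v) → LayerState h ob nb s → reg s uV ≡ 0 →
          Run (while (var FV ⊖ var uV) lowStep) s (λ τ s′ →
            τ ≤ sumBelow (2 ^ f) (λ x → lowTime (toMask f x)) + 1 × Filling (λ _ _ → ⊤) s′)
        low-correct {s} bd ls copied st u≡ = run-while I (2 ^ f) bd
          -- The copied entries are attained by the split that gives the empty set to the new
          -- machine.
          (inv z≤n u≡ (filling (λ v → ∅ , v , split-sym (split-∅ v) , trans (copied v) (cong (_+ h v) (sym (cost-∅ n)))) st (λ ()))) body end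
          where
          κ : ℕ → ℕ
          κ x = lowTime (toMask f x)
          record I (i τ : ℕ) (s′ : Store) : Set where
            pattern
            constructor inv
            field
              time : τ ≤ sumBelow i κ
              u≡′  : reg s′ uV ≡ i
              fill : Filling (λ u′ _ → val u′ < i) s′
          body : ∀ {i τ s′} → Keeps lowStep s s′ → i < 2 ^ f → I i τ s′ →
            eval (var FV ⊖ var uV) s′ ≢ 0 × Run lowStep s′ (λ τ′ → I (suc i) (τ + suc τ′))
          body {i} {τ} {s′} ks i< (inv time u≡′ fill) =
            (λ eq → m>n⇒m∸n≢0 i< (trans (sym (cong₂ _∸_ (F≡ ls′) u≡′)) eq)) ,
            run-⨾ (run-:= z≤n (run-⨾ (run-keeps b₀
              (high-correct u b₀ (lists-kept (keeps-trans (keeps-⊑ lowStep⊑layerStep k₀) (keeps-setReg dV 0 refl bd′ z≤n)) ls)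
                (filling-store (λ _ → refl) refl refl fill) (trans u≡′ (sym val-u)) refl)
              (λ {τ₁} {s₁} k₁ (time₁ , fill₁) → run-:=
                (≤-trans (≤-reflexive (u+1 k₁)) (≤V 1 (^-1 (≤-trans (≤-trans i< F≤N) N≤X))))
                (inv (tick τ₁ time₁) (u+1 k₁) (filling-store (λ _ → refl) refl refl (filling-weaken (λ {u′} {d′} → extend {u′} {d′}) fill₁)))))))
            where
            bd′ = isBounded ks
            k₀ = keeps-⊑ self ks
            ls′ : Lists s′
            ls′ = lists-kept (keeps-⊑ lowStep⊑layerStep ks) ls
            b₀ : Bounded (setReg s′ dV 0)
            b₀ = bounded-setReg dV bd′ z≤n
            u : Mask f
            u = toMask f i
            val-u : val u ≡ i
            val-u = val-toMask f i i<
            u+1 : ∀ {s₁} → Keeps (while (var NV ⊖ var dV) highStep) (setReg s′ dV 0) s₁ → reg s₁ uV + 1 ≡ suc i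
            u+1 k₁ = trans (cong (_+ 1) (trans (kept k₁ uV refl) u≡′)) (+-comm i 1)
            extend : ∀ {u′ : Mask f} {d′ : Mask l} → val u′ < suc i → val u′ < i ⊎ u′ ≡ u
            extend {u′} lt with val u′ ≟ i
            ... | yes eq = inj₂ (val-injective (trans eq (sym val-u)))
            ... | no neq = inj₁ (≤∧≢⇒< (≤-pred lt) neq)
            tick : ∀ τ₁ → τ₁ ≤ sumBelow (2 ^ l) (λ y → 42 * innerTime u (toMask l y)) + 1 → τ + suc (1 + (τ₁ + 1)) ≤ sumBelow i κ + κ i
            tick τ₁ time₁ = +-mono-≤ time (≤-trans (s≤s (s≤s (+-monoˡ-≤ 1 time₁)))
              (≤-trans (≤-reflexive (eq (sumBelow (2 ^ l) (λ y → 42 * innerTime u (toMask l y))))) (+-monoʳ-≤ (sumBelow (2 ^ l) (λ y → 42 * innerTime u (toMask l y))) (n≤1+n 4))))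
              where
              eq : ∀ a → suc (suc (a + 1 + 1)) ≡ a + 4
              eq = solve-∀
          end : ∀ {τ s′} → Keeps lowStep s s′ → I (2 ^ f) τ s′ → eval (var FV ⊖ var uV) s′ ≡ 0 ×
            (τ + 1 ≤ sumBelow (2 ^ f) κ + 1 × Filling (λ _ _ → ⊤) s′)
          end ks (inv time u≡′ fill) =
            trans (cong₂ _∸_ (F≡ (lists-kept (keeps-⊑ lowStep⊑layerStep ks) ls)) u≡′) (n∸n≡0 F) ,
            +-monoˡ-≤ 1 time , filling-weaken (λ {u} {d} _ → val<2^ u) fill

        -- A split of `v` falls into a late and an early part. It was considered for the pair
        -- consisting of the early part `v₁` of `v` and the complement of the late jobs `x₂` that
        -- stay on the previous machines.
        filled-best : ∀ {k s} → (∀ x → Best k x (h x)) → Filling (λ _ _ → ⊤) s → ∀ v → Best (suc k) v (arr s HH (nb + val v))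
        filled-best {k} {s} best (filling sound state complete) v with sound v
        ... | t , x , sp , eq = best-suc best sp eq below
          where
          below : ∀ {t x} → Split v t x → arr s HH (nb + val v) ≤ cost t + h x
          below sp with splitAt l v
          ... | v₂ , v₁ , refl with split-++⁻ v₂ v₁ sp
          ...   | splitParts t₂ x₂ t₁ x₁ refl refl s₂ s₁ = subst (λ y → arr s HH (nb + val v) ≤ cost (t₂ ⧺ t₁) + h (y ⧺ x₁))
                  (complement-involutive x₂) (complete _ (subst (Split v₂ t₂) (sym (complement-involutive x₂)) s₂) s₁)

      copy-correct : ∀ {s} → Bounded s → reg s NV ≡ N → reg s obV + N ≤ reg s nbV → reg s sV ≡ 0 →
        Run (while (var NV ⊖ var sV) copyStep) s (λ τ s′ → τ ≤ 3 * N + 1 ×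
          (∀ i → i < reg s nbV → arr s′ HH i ≡ arr s HH i) ×
          (∀ i → i < N → arr s′ HH (reg s nbV + i) ≡ arr s HH (reg s obV + i)))
      copy-correct {s} bd N≡ ob+N≤ s≡ = run-while I N bd (inv z≤n s≡ (λ _ _ → refl) (λ _ ())) body end
        where
        record I (i τ : ℕ) (s′ : Store) : Set where
          pattern
          constructor inv
          field
            time : τ ≤ 3 * i
            s≡′  : reg s′ sV ≡ i
            old  : ∀ j → j < reg s nbV → arr s′ HH j ≡ arr s HH j
            new  : ∀ j → j < i → arr s′ HH (reg s nbV + j) ≡ arr s HH (reg s obV + j)
        body : ∀ {i τ s′} → Keeps copyStep s s′ → i < N → I i τ s′ →
          eval (var NV ⊖ var sV) s′ ≢ 0 × Run copyStep s′ (λ τ′ → I (suc i) (τ + suc τ′))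
        body {i} {τ} {s′} ks i< (inv time s≡′ old new) =
          (λ eq → m>n⇒m∸n≢0 i< (trans (sym (cong₂ _∸_ (trans (kept ks NV refl) N≡) s≡′)) eq)) ,
          run-⨾ (run-put (arr≤ (isBounded ks) HH _) (run-:= (≤-trans (≤-reflexive s+1) (≤-trans i< (≤-trans (≤-reflexive (sym N≡)) (reg≤ bd NV))))
            (inv (≤-trans (+-monoˡ-≤ 3 time) (≤-reflexive (trans (+-comm (3 * i) 3) (sym (*-suc 3 i))))) s+1 old′ new′)))
          where
          s+1 : reg s′ sV + 1 ≡ suc i
          s+1 = trans (cong (_+ 1) s≡′) (+-comm i 1)
          a v : ℕ
          a = reg s′ nbV + reg s′ sV
          v = arr s′ HH (reg s′ obV + reg s′ sV)
          a≡ : a ≡ reg s nbV + i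
          a≡ = cong₂ _+_ (kept ks nbV refl) s≡′
          v≡ : v ≡ arr s HH (reg s obV + i)
          v≡ = trans (cong (arr s′ HH) (cong₂ _+_ (kept ks obV refl) s≡′)) (old _ (<-≤-trans (+-monoʳ-< (reg s obV) i<) ob+N≤))
          old′ : ∀ j → j < reg s nbV → (arr s′ HH [ a ≔ v ]) j ≡ arr s HH j
          old′ j j< = trans (≔-other (arr s′ HH) a v λ eq → <⇒≱ j< (subst (reg s nbV ≤_) (trans (sym a≡) eq) (m≤m+n _ i))) (old j j<)
          new′ : ∀ j → j < suc i → (arr s′ HH [ a ≔ v ]) (reg s nbV + j) ≡ arr s HH (reg s obV + j)
          new′ j j< with i ≟ j
          ... | yes refl = trans (≔-same (arr s′ HH) a v a≡) v≡
          ... | no neq = trans (≔-other (arr s′ HH) a v λ eq → neq (+-cancelˡ-≡ (reg s nbV) i j (trans (sym a≡) eq)))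
                           (new j (≤∧≢⇒< (≤-pred j<) (λ eq → neq (sym eq))))
        end : ∀ {τ s′} → Keeps copyStep s s′ → I N τ s′ → eval (var NV ⊖ var sV) s′ ≡ 0 × (τ + 1 ≤ 3 * N + 1 ×
          (∀ i → i < reg s nbV → arr s′ HH i ≡ arr s HH i) × (∀ i → i < N → arr s′ HH (reg s nbV + i) ≡ arr s HH (reg s obV + i)))
        end ks (inv time s≡′ old new) =
          trans (cong₂ _∸_ (trans (kept ks NV refl) N≡) s≡′) (n∸n≡0 N) , +-monoˡ-≤ 1 time , old , new

      n≤X : n ≤ X
      n≤X = ≤-trans (≤2^ n) N≤X
        where
        ≤2^ : ∀ b → b ≤ 2 ^ b
        ≤2^ zero    = z≤n
        ≤2^ (suc b) = subst (suc b ≤_) (sym (2^suc b)) (+-mono-≤ (1≤2^ b) (≤2^ b))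

      record AtLayer (k : ℕ) (s : Store) : Set where
        pattern
        constructor atLayer
        field
          obₖ   : reg s obV ≡ k * N
          lyₖ   : reg s lyV ≡ k
          best  : ∀ (x : Mask n) → Best (suc k) x (arr s HH (k * N + val x))
          costs : ∀ (v : Mask n) → arr s HH (val v) ≡ cost v

      layer-correct : ∀ {s k} → Bounded s → Lists s → k < n → AtLayer k s →
        Run layerStep s (λ τ s′ → τ ≤ layerTime × AtLayer (suc k) s′)
      layer-correct {s} {k} bd ls k<n (atLayer obₖ lyₖ best costs) =
        run-⨾ (run-:= nb≤V (run-⨾ (run-:= z≤n (run-⨾ (run-keeps b₁
          (copy-correct b₁ (N≡ ls) (≤-reflexive (cong (reg s obV +_) (sym (N≡ ls)))) refl)
          (λ {τ₂} {s₂} k₂ (time₂ , old , new) → fill k₂ time₂ old new))))))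
        where
        h : Mask n → ℕ
        h x = arr s HH (k * N + val x)
        h≤ : ∀ x → h x ≤ X ^ 2
        h≤ x = ≤-trans (best≤cost (best x)) (cost≤X² x)
        nb₀ : ℕ
        nb₀ = reg s obV + reg s NV
        nb₀≡ : nb₀ ≡ k * N + N
        nb₀≡ = cong₂ _+_ obₖ (N≡ ls)
        nb≤V : nb₀ ≤ V
        nb≤V = ≤-trans (≤-reflexive nb₀≡) (≤V 3 (^-+ 2 (^-* 1 1 (^-1 (≤-trans (<⇒≤ k<n) n≤X)) (^-1 N≤X)) (^-up 1 2 (^-1 N≤X))))
        s₁ : Store
        s₁ = setReg (setReg s nbV nb₀) sV 0
        b₁ : Bounded s₁
        b₁ = bounded-setReg sV (bounded-setReg nbV bd nb≤V) z≤n
        ks₁ : Keeps layerStep s s₁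
        ks₁ = keeps-trans (keeps-setReg nbV nb₀ refl bd nb≤V) (keeps-setReg sV 0 refl (bounded-setReg nbV bd nb≤V) z≤n)
        fill : ∀ {τ₂ s₂} → Keeps (while (var NV ⊖ var sV) copyStep) s₁ s₂ → τ₂ ≤ 3 * N + 1 →
          (∀ i → i < nb₀ → arr s₂ HH i ≡ arr s HH i) →
          (∀ i → i < N → arr s₂ HH (nb₀ + i) ≡ arr s HH (reg s obV + i)) →
          Run (uV := lit 0 ⨾ while (var FV ⊖ var uV) lowStep ⨾ obV := var nbV ⨾ lyV := var lyV ⊕ lit 1) s₂
            (λ τ s′ → 1 + (1 + (τ₂ + τ)) ≤ layerTime × AtLayer (suc k) s′)
        fill {τ₂} {s₂} k₂ time₂ old new = run-⨾ (run-:= z≤n (run-⨾ (run-keeps b₃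
            (low-correct h h≤ (k * N) b₃ (lists-kept k₃ ls) copied state refl)
            (λ {τ₄} {s₄} k₄ (time₄ , fl) → finish k₄ time₄ fl))))
          where
          s₃ : Store
          s₃ = setReg s₂ uV 0
          b₃ : Bounded s₃
          b₃ = bounded-setReg uV (isBounded k₂) z≤n
          k₃ : Keeps layerStep s s₃
          k₃ = keeps-trans (keeps-trans ks₁ (keeps-⊑ {c′ = layerStep} (inSecond (inSecond (inFirst self))) k₂)) (keeps-setReg uV 0 refl (isBounded k₂) z≤n)
          nb₂ : reg s₂ nbV ≡ k * N + N
          nb₂ = trans (kept k₂ nbV refl) nb₀≡
          copied : ∀ (v : Mask n) → arr s₂ HH (k * N + N + val v) ≡ h v
          copied v = trans (cong (λ y → arr s₂ HH (y + val v)) (sym nb₀≡))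
            (trans (new (val v) (val<2^ v)) (cong (λ y → arr s HH (y + val v)) obₖ))
          state : LayerState h (k * N) (k * N + N) s₃
          state = layerState (trans (kept k₂ obV refl) obₖ) nb₂ ≤-refl
            (λ x → old _ (<-≤-trans (+-monoʳ-< (k * N) (val<2^ x)) (≤-reflexive (sym nb₀≡))))
            (λ v → trans (old _ (<-≤-trans (val<2^ v) (≤-trans (m≤n+m N (k * N)) (≤-reflexive (sym nb₀≡))))) (costs v))
          finish : ∀ {τ₄ s₄} → Keeps (while (var FV ⊖ var uV) lowStep) s₃ s₄ →
            τ₄ ≤ sumBelow (2 ^ f) (λ x → lowTime (toMask f x)) + 1 → Filling h h≤ (k * N) (λ _ _ → ⊤) s₄ →
            Run (obV := var nbV ⨾ lyV := var lyV ⊕ lit 1) s₄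
              (λ τ s′ → 1 + (1 + (τ₂ + (1 + (τ₄ + τ)))) ≤ layerTime × AtLayer (suc k) s′)
          finish {τ₄} {s₄} k₄ time₄ fl = run-⨾ (run-:= (reg≤ (isBounded k₄) nbV) (run-:=
              (≤-trans (≤-reflexive ly≡) (≤V 1 (^-1 (≤-trans k<n n≤X))))
              (total , atLayer ob≡′ ly≡
                (λ v → subst (λ y → Best (suc (suc k)) v (arr s₄ HH (y + val v))) (+-comm (k * N) N) (filled-best h h≤ (k * N) best fl v))
                (λ v → LayerState.cost≡ (Filling.state fl) v))))
            where
            ly≡ : reg s₄ lyV + 1 ≡ suc k
            ly≡ = trans (cong (_+ 1) (trans (kept k₄ lyV refl) (trans (kept k₂ lyV refl) lyₖ))) (+-comm k 1)
            ob≡′ : reg s₄ nbV ≡ suc k * N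
            ob≡′ = trans (kept k₄ nbV refl) (trans nb₂ (+-comm (k * N) N))
            total : 1 + (1 + (τ₂ + (1 + (τ₄ + (1 + 1))))) ≤ layerTime
            total = ≤-trans (+-monoʳ-≤ 2 (+-mono-≤ time₂ (s≤s (+-monoˡ-≤ 2 time₄))))
              (≤-trans (≤-reflexive (eq (3 * N) L)) (+-monoʳ-≤ (L + 3 * N) (m≤m+n 7 3)))
              where
              L = sumBelow (2 ^ f) (λ x → lowTime (toMask f x))
              eq : ∀ a b → 2 + (a + 1 + suc (b + 1 + 2)) ≡ b + a + 7
              eq = solve-∀

      full : Mask n
      full = replicate n true

      val-full : N ∸ 1 ≡ val full
      val-full = trans (cong (_∸ 1) (sym (suc-full n))) refl
        where
        suc-full : ∀ b → suc (val (replicate b true)) ≡ 2 ^ b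
        suc-full zero    = refl
        suc-full (suc b) = trans (sym (+-suc (2 ^ b) _)) (trans (cong (2 ^ b +_) (suc-full b)) (sym (2^suc b)))

      layers-correct : ∀ {s} → Bounded s → Lists s → (∀ (v : Mask n) → arr s HH (val v) ≡ cost v) → reg s nV ≡ n →
        Run layers s (λ τ s′ → τ ≤ n * (layerTime + 1) + 5 × Best (suc (n ∸ (n ∸ reg s mV) ∸ 1)) full (reg s′ rV))
      layers-correct {s} bd ls costs n≡ =
        run-⨾ (run-:= z≤n (run-⨾ (run-:= z≤n (run-⨾ (run-:= c≤V (run-⨾ (run-while I K b₁
          (inv z≤n (atLayer refl refl (λ x → subst (Best 1 x) (sym (costs x)) (best-1 x)) costs)) body end)))))))
        where
        c₀ K : ℕ
        c₀ = reg s nV ∸ (reg s nV ∸ reg s mV) ∸ 1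
        K  = n ∸ (n ∸ reg s mV) ∸ 1
        c≡ : c₀ ≡ K
        c≡ = cong (λ y → y ∸ (y ∸ reg s mV) ∸ 1) n≡
        c≤V : c₀ ≤ V
        c≤V = ≤-trans (m∸n≤m (reg s nV ∸ (reg s nV ∸ reg s mV)) 1) (≤-trans (m∸n≤m (reg s nV) (reg s nV ∸ reg s mV)) (reg≤ bd nV))
        K≤n : K ≤ n
        K≤n = ≤-trans (m∸n≤m (n ∸ (n ∸ reg s mV)) 1) (m∸n≤m n (n ∸ reg s mV))
        s₁ : Store
        s₁ = setReg (setReg (setReg s obV 0) lyV 0) cntV c₀
        b₁ : Bounded s₁
        b₁ = bounded-setReg cntV (bounded-setReg lyV (bounded-setReg obV bd z≤n) z≤n) c≤V
        ls₁ : Lists s₁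
        ls₁ = ls-same ls
          where
          ls-same : Lists s → Lists s₁
          ls-same (lists a b c d e f g h i j) = lists a b c d e f g h i j
        record I (i τ : ℕ) (s′ : Store) : Set where
          pattern
          constructor inv
          field
            time : τ ≤ i * (layerTime + 1)
            at   : AtLayer i s′
        body : ∀ {i τ s′} → Keeps layerStep s₁ s′ → i < K → I i τ s′ →
          eval (var cntV ⊖ var lyV) s′ ≢ 0 × Run layerStep s′ (λ τ′ → I (suc i) (τ + suc τ′))
        body {i} {τ} {s′} ks i<K (inv time at@(atLayer _ lyᵢ _ _)) =
          (λ eq → m>n⇒m∸n≢0 i<K (trans (sym (cong₂ _∸_ (trans (kept ks cntV refl) c≡) lyᵢ)) eq)) ,
          run-mono (λ {τ′} (time′ , at′) → inv (≤-trans (+-mono-≤ time (s≤s time′))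
              (≤-reflexive (trans (+-comm (i * (layerTime + 1)) _) (cong (_+ i * (layerTime + 1)) (+-comm 1 layerTime))))) at′)
            (layer-correct (isBounded ks) (lists-kept ks ls₁) (<-≤-trans i<K K≤n) at)
        end : ∀ {τ s′} → Keeps layerStep s₁ s′ → I K τ s′ → eval (var cntV ⊖ var lyV) s′ ≡ 0 ×
          Run (rV := HH at (var obV ⊕ (var NV ⊖ lit 1))) s′ (λ τ′ s″ →
            1 + (1 + (1 + (τ + 1 + τ′))) ≤ n * (layerTime + 1) + 5 × Best (suc K) full (reg s″ rV))
        end {τ} {s′} ks (inv time (atLayer ob′ ly′ best′ _)) =
          trans (cong₂ _∸_ (trans (kept ks cntV refl) c≡) ly′) (n∸n≡0 K) ,
          run-:= (arr≤ (isBounded ks) HH _)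
            (≤-trans (≤-reflexive (eq τ)) (+-monoˡ-≤ 5 (≤-trans time (*-monoˡ-≤ (layerTime + 1) K≤n))) ,
             subst (Best (suc K) full) (cong (arr s′ HH) (sym (cong₂ _+_ ob′
               (trans (cong (_∸ 1) (N≡ (lists-kept ks ls₁))) val-full)))) (best′ full))
          where
          eq : ∀ a → 1 + (1 + (1 + (a + 1 + 1))) ≡ a + 5
          eq = solve-∀

      open Tables n p w 2^n≤X p≤X w≤X using (Tabulated; tabulated; module Tabulated)

      tabulated-≤ : ∀ {b s} → b ≤ n → Tabulated n s → Tabulated b s
      tabulated-≤ {b} {s} b≤n tab = go (n ∸ b) (m+[n∸m]≡n b≤n) tab
        where
        pred-tab : ∀ {b} → Tabulated (suc b) s → Tabulated b s
        pred-tab (tabulated x y z) = tabulated (λ v → x (false ∷ v)) (λ v → y (false ∷ v)) (λ v → z (false ∷ v))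
        go : ∀ {m} k → b + k ≡ m → Tabulated m s → Tabulated b s
        go zero refl t    = subst (λ m → Tabulated m s) (+-identityʳ b) t
        go (suc k) refl t = go k refl (pred-tab (subst (λ m → Tabulated m s) (+-suc b k) t))

      1≤F : 1 ≤ F
      1≤F = 1≤2^ f

      module BuildLow  = Build PS refl p N 1 ≤-refl 2^n≤X
      module BuildHigh = Build WS refl (λ i → w (i + f)) N F 1≤F 2^n≤X

      lists-correct : ∀ {s} → Bounded s → reg s nV ≡ n → n / 2 ≡ f → reg s NV ≡ N → Tabulated n s →
        Run sublists s (λ τ s′ → τ ≤ 20 * 3 ^ f + 20 * 3 ^ l + 5 * n + 13 × Lists s′)
      lists-correct {s} bd n≡ half N≡ tab =
        run-⨾ (run-put z≤n (run-⨾ (run-put 1≤V (run-⨾ (run-put 1≤V (run-⨾ (run-:= 1≤V (run-⨾ (run-:= 1≤V (run-⨾ (run-:= c≤V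
          (run-⨾ (run-keeps b₆ (BuildLow.build-correct f b₆ c≡f refl N≡ refl (^-monoʳ-≤ 2 (m≤n+m f l)) low≤X lowTable lowNil)
            (λ {τ₇} {s₇} k₇ (time₇ , low₇ , same₇ , E₇) → second-half τ₇ k₇ time₇ low₇ same₇ E₇))))))))))))))
        where
        1≤V : 1 ≤ V
        1≤V = ≤V 1 (^-1 (≤-trans (s≤s z≤n) X≥2))
        c₀ : ℕ
        c₀ = reg s nV / 2
        c≡f : c₀ ≡ f
        c≡f = trans (cong (_/ 2) n≡) half
        c≤V : c₀ ≤ V
        c≤V = ≤-trans (m/n≤m (reg s nV) 2) (reg≤ bd nV)
        low≤X : 2 ^ f * 1 ≤ X
        low≤X = ≤-trans (≤-reflexive (*-identityʳ (2 ^ f))) (≤-trans (^-monoʳ-≤ 2 (m≤n+m f l)) 2^n≤X)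
        s₆ : Store
        s₆ = setReg (setReg (setReg (setArr (setArr (setArr s LST 0 0) GA 0 1) HA 0 1) unitV 1) EV 1) cntV c₀
        b₆ : Bounded s₆
        b₆ = bounded-setReg cntV (bounded-setReg EV (bounded-setReg unitV (bounded-setArr HA 0 (bounded-setArr GA 0 (bounded-setArr LST 0 bd z≤n) 1≤V) 1≤V) 1≤V) 1≤V) c≤V
        lowTable : ∀ {c} → c ≤ f → (y : Mask c) → arr s PS (val y * 1) ≡ weigh p y
        lowTable c≤f y = trans (cong (arr s PS) (*-identityʳ (val y))) (Tabulated.ps (tabulated-≤ (≤-trans c≤f (m≤n+m f l)) tab) y)
        lowNil : BuildLow.IsList s₆ []
        lowNil = BuildLow.isList (λ { {zero} _ → refl ; {suc i} (s≤s ()) }) refl refl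
        second-half : ∀ {s₇} τ₇ → Keeps (build PS) s₆ s₇ → τ₇ ≤ 20 * 3 ^ f + 5 * f + 2 → (∀ (v : Mask f) → BuildLow.IsList s₇ v) →
          BuildLow.Same 1 s₆ s₇ → reg s₇ EV ≡ 2 ^ f * 1 →
          Run (unitV := var EV ⨾ FV := var EV ⨾ cntV := var nV ⊖ var cntV ⨾ build WS) s₇ (λ τ s′ →
            1 + (1 + (1 + (1 + (1 + (1 + (τ₇ + τ)))))) ≤ 20 * 3 ^ f + 20 * 3 ^ l + 5 * n + 13 × Lists s′)
        second-half {s₇} τ₇ k₇ time₇ low₇ (BuildLow.same x₇ y₇ z₇) E₇ =
          run-⨾ (run-:= (reg≤ b₇ EV) (run-⨾ (run-:= (reg≤ b₇ EV) (run-⨾ (run-:= l≤V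
            (run-keeps b₁₀ (BuildHigh.build-correct l b₁₀ l≡ E≡F (trans (kept k₇ NV refl) N≡) E≡F (^-monoʳ-≤ 2 (m≤m+n l f)) high≤X highTable highNil)
              (λ {τ₁₁} {s₁₁} k₁₁ (time₁₁ , high₁₁ , same₁₁ , _) → total τ₁₁ time₁₁ , collect k₁₁ high₁₁ same₁₁)))))))
          where
          b₇ = isBounded k₇
          l₀ : ℕ
          l₀ = reg s₇ nV ∸ reg s₇ cntV
          E≡F : reg s₇ EV ≡ F
          E≡F = trans E₇ (*-identityʳ (2 ^ f))
          l≡ : l₀ ≡ l
          l≡ = trans (cong₂ _∸_ (trans (kept k₇ nV refl) n≡) (trans (kept k₇ cntV refl) c≡f)) (m+n∸n≡m l f)
          l≤V : l₀ ≤ V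
          l≤V = ≤-trans (m∸n≤m _ (reg s₇ cntV)) (reg≤ b₇ nV)
          high≤X : 2 ^ l * F ≤ X
          high≤X = ≤-trans (≤-reflexive (sym (^-distribˡ-+-* 2 l f))) 2^n≤X
          s₁₀ : Store
          s₁₀ = setReg (setReg (setReg s₇ unitV (reg s₇ EV)) FV (reg s₇ EV)) cntV l₀
          b₁₀ : Bounded s₁₀
          b₁₀ = bounded-setReg cntV (bounded-setReg FV (bounded-setReg unitV b₇ (reg≤ b₇ EV)) (reg≤ b₇ EV)) l≤V
          highTable : ∀ {c} → c ≤ l → (y : Mask c) → arr s₇ WS (val y * F) ≡ weigh (λ i → w (i + f)) y
          highTable c≤l y = trans (keptArr k₇ WS refl _) (trans (cong (arr s WS) (sym (trans (val-++ y (∅ {f})) (trans (cong (val y * F +_) (val-∅ f)) (+-identityʳ _)))))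
            (trans (Tabulated.ws (tabulated-≤ (+-monoˡ-≤ f c≤l) tab) (y ⧺ ∅ {f})) (weigh-high w y)))
          N≥1 : 0 < 1 * N
          N≥1 = ≤-trans (1≤2^ n) (≤-reflexive (sym (*-identityˡ N)))
          highNil : BuildHigh.IsList s₁₀ []
          -- The empty set has the number 0 in both halves, so what was written for the early lists
          -- serves as the start of the late ones.
          highNil = BuildHigh.isList (λ { {zero} _ → x₇ N≥1 ; {suc i} (s≤s ()) }) (y₇ (s≤s z≤n)) (z₇ (s≤s z≤n))
          collect : ∀ {s₁₁} → Keeps (build WS) s₁₀ s₁₁ → (∀ (v : Mask l) → BuildHigh.IsList s₁₁ v) → BuildHigh.Same F s₁₀ s₁₁ → Lists s₁₁
          collect {s₁₁} k₁₁ high₁₁ (BuildHigh.same x y z) = lists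
            (trans (kept k₁₁ NV refl) (trans (kept k₇ NV refl) N≡)) (trans (kept k₁₁ FV refl) E≡F)
            (λ v → trans (keptArr k₁₁ PS refl _) (trans (keptArr k₇ PS refl _) (Tabulated.ps tab v)))
            (λ v → trans (keptArr k₁₁ WS refl _) (trans (keptArr k₇ WS refl _) (Tabulated.ws tab v)))
            (λ u {k} k< → trans (cong (λ a → arr s₁₁ LST (a * N + k)) (sym (*-identityʳ (val u))))
              (trans (BuildLow.IsList.lst (low₁₁ u) k<) (*-identityʳ _)))
            (λ u → trans (cong (arr s₁₁ GA) (sym (*-identityʳ (val u)))) (BuildLow.IsList.ga (low₁₁ u)))
            (λ u → trans (cong (arr s₁₁ HA) (sym (*-identityʳ (val u)))) (BuildLow.IsList.ha (low₁₁ u)))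
            (λ d k< → BuildHigh.IsList.lst (high₁₁ d) k<) (λ d → BuildHigh.IsList.ga (high₁₁ d)) (λ d → BuildHigh.IsList.ha (high₁₁ d))
            where
            -- The second construction leaves the entries of all numbers below `F` alone, and the
            -- early sets have just these numbers.
            low₁₁ : ∀ (u : Mask f) → BuildLow.IsList s₁₁ u
            low₁₁ u = BuildLow.same-list (≤-trans (s≤s (≤-reflexive (*-identityʳ (val u)))) (val<2^ u)) (^-monoʳ-≤ 2 (m≤n+m f l))
              (BuildLow.same {s = s₁₀} x y z) (shift (low₇ u))
              where
              shift : ∀ {u : Mask f} → BuildLow.IsList s₇ u → BuildLow.IsList s₁₀ u
              shift (BuildLow.isList a b c) = BuildLow.isList a b c
          total : ∀ τ₁₁ → τ₁₁ ≤ 20 * 3 ^ l + 5 * l + 2 →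
            1 + (1 + (1 + (1 + (1 + (1 + (τ₇ + (1 + (1 + (1 + τ₁₁))))))))) ≤ 20 * 3 ^ f + 20 * 3 ^ l + 5 * n + 13
          total τ₁₁ time₁₁ = ≤-trans (+-monoʳ-≤ 6 (+-mono-≤ time₇ (+-monoʳ-≤ 3 time₁₁))) (≤-reflexive (eq (20 * 3 ^ f) (20 * 3 ^ l) l f))
            where
            eq : ∀ a b l f → 6 + (a + 5 * f + 2 + (3 + (b + 5 * l + 2))) ≡ a + b + 5 * (l + f) + 13
            eq = solve-∀

-- The sums of gOf and hOf grow by a factor of 1 + √2 < 5 / 2 per job.
blocks≤ : ∀ l → 2 ^ l * sumMask {l} gOf ≤ 2 * 5 ^ l × 2 ^ l * sumMask {l} hOf ≤ 3 * 5 ^ l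
blocks≤ zero = s≤s z≤n , s≤s z≤n
blocks≤ (suc l) with blocks≤ l
... | g≤ , h≤ = (begin
    2 * 2 ^ l * (G + H)              ≡⟨ eq₁ (2 ^ l) G H ⟩
    2 * (2 ^ l * G + 2 ^ l * H)      ≤⟨ *-monoʳ-≤ 2 (+-mono-≤ g≤ h≤) ⟩
    2 * (2 * 5 ^ l + 3 * 5 ^ l)      ≡⟨ eq₂ (5 ^ l) ⟩
    2 * (5 * 5 ^ l)                  ∎) , (begin
    2 * 2 ^ l * (H + sumMask {l} (λ v → 2 * gOf v)) ≡⟨ cong (λ x → 2 * 2 ^ l * (H + x)) (sumMask-* {l} 2 gOf) ⟩
    2 * 2 ^ l * (H + 2 * G)          ≡⟨ eq₃ (2 ^ l) G H ⟩
    2 * (2 ^ l * H) + 4 * (2 ^ l * G) ≤⟨ +-mono-≤ (*-monoʳ-≤ 2 h≤) (*-monoʳ-≤ 4 g≤) ⟩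
    2 * (3 * 5 ^ l) + 4 * (2 * 5 ^ l) ≤⟨ m≤m+n _ (5 ^ l) ⟩
    2 * (3 * 5 ^ l) + 4 * (2 * 5 ^ l) + 5 ^ l ≡⟨ eq₄ (5 ^ l) ⟩
    3 * (5 * 5 ^ l)                  ∎)
  where
  open ≤-Reasoning
  G H : ℕ
  G = sumMask {l} gOf
  H = sumMask {l} hOf
  eq₁ : ∀ a g h → 2 * a * (g + h) ≡ 2 * (a * g + a * h)
  eq₁ = solve-∀
  eq₂ : ∀ a → 2 * (2 * a + 3 * a) ≡ 2 * (5 * a)
  eq₂ = solve-∀
  eq₃ : ∀ a g h → 2 * a * (h + 2 * g) ≡ 2 * (a * h) + 4 * (a * g)
  eq₃ = solve-∀
  eq₄ : ∀ a → 2 * (3 * a) + 4 * (2 * a) + a ≡ 3 * (5 * a)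
  eq₄ = solve-∀

-- Growth rates

Γ : ℕ → ℕ
Γ l = sumMask {l} gOf + sumMask {l} hOf

Γ≤ : ∀ l → 2 ^ l * Γ l ≤ 5 * 5 ^ l
Γ≤ l = begin
  2 ^ l * Γ l                                           ≡⟨ *-distribˡ-+ (2 ^ l) (sumMask {l} gOf) _ ⟩
  2 ^ l * sumMask {l} gOf + 2 ^ l * sumMask {l} hOf     ≤⟨ +-mono-≤ (proj₁ (blocks≤ l)) (proj₂ (blocks≤ l)) ⟩
  2 * 5 ^ l + 3 * 5 ^ l                                 ≡⟨ *-distribʳ-+ (5 ^ l) 2 3 ⟨
  5 * 5 ^ l                                             ∎
  where open ≤-Reasoning

1≤sumMask : ∀ {b} {φ : Mask b → ℕ} → (∀ v → 1 ≤ φ v) → 1 ≤ sumMask φ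
1≤sumMask {zero} h  = h []
1≤sumMask {suc b} h = ≤-trans (1≤sumMask (h ∘ (false ∷_))) (m≤m+n _ _)

Γ≥1 : ∀ l → 1 ≤ Γ l
Γ≥1 l = ≤-trans (1≤sumMask {l} gOf≥1) (m≤m+n _ _)

work : ℕ → ℕ → ℕ
work l f = 3 ^ f * Γ l + 2 ^ f * 3 ^ l + 2 ^ (l + f)

Balanced : ℕ → ℕ → Set
Balanced l f = l ≡ f ⊎ l ≡ suc f

^-distrib-* : ∀ a b k → (a * b) ^ k ≡ a ^ k * b ^ k
^-distrib-* a b zero    = refl
^-distrib-* a b (suc k) = trans (cong (a * b *_) (^-distrib-* a b k)) (eq a b (a ^ k) (b ^ k))
  where
  eq : ∀ a b x y → a * b * (x * y) ≡ a * x * (b * y)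
  eq = solve-∀

-- Multiplication by `2 ^ l` clears the denominators of (5/2)^l. Compared with the leading term, the
-- second summand grows by 12 instead of 15 for each pair of an early and a late job, and the third
-- is estimated by 2 ≤ 3 per early and 4 ≤ 5 per late job. An additional late job costs the second
-- summand a factor of at most 2.
2^l*work≤ : ∀ l f → Balanced l f → 2 ^ l * work l f ≤ 8 * (3 ^ f * 5 ^ l)
2^l*work≤ l f bal = begin
  2 ^ l * (3 ^ f * Γ l + 2 ^ f * 3 ^ l + 2 ^ (l + f))              ≡⟨ cong (λ x → 2 ^ l * (3 ^ f * Γ l + 2 ^ f * 3 ^ l + x)) (^-distribˡ-+-* 2 l f) ⟩
  2 ^ l * (3 ^ f * Γ l + 2 ^ f * 3 ^ l + 2 ^ l * 2 ^ f)            ≡⟨ eq (2 ^ l) (3 ^ f) (Γ l) (2 ^ f) (3 ^ l) ⟩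
  3 ^ f * (2 ^ l * Γ l) + 2 ^ f * (2 ^ l * 3 ^ l) + 2 ^ f * (2 ^ l * 2 ^ l)
    ≤⟨ +-mono-≤ (+-mono-≤ (*-monoʳ-≤ (3 ^ f) (Γ≤ l)) (sixes bal)) fours ⟩
  3 ^ f * (5 * 5 ^ l) + 2 * (3 ^ f * 5 ^ l) + 3 ^ f * 5 ^ l        ≡⟨ eq′ (3 ^ f) (5 ^ l) ⟩
  8 * (3 ^ f * 5 ^ l)                                              ∎
  where
  open ≤-Reasoning
  eq : ∀ a b g c d → a * (b * g + c * d + a * c) ≡ b * (a * g) + c * (a * d) + c * (a * a)
  eq = solve-∀
  eq′ : ∀ a b → a * (5 * b) + 2 * (a * b) + a * b ≡ 8 * (a * b)
  eq′ = solve-∀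
  fours : 2 ^ f * (2 ^ l * 2 ^ l) ≤ 3 ^ f * 5 ^ l
  fours = *-mono-≤ (^-monoˡ-≤ f (n≤1+n 2)) (≤-trans (≤-reflexive (sym (^-distrib-* 2 2 l))) (^-monoˡ-≤ l (n≤1+n 4)))
  square : ∀ k → 2 ^ k * (2 ^ k * 3 ^ k) ≤ 3 ^ k * 5 ^ k
  square k = ≤-trans (≤-reflexive (trans (cong (2 ^ k *_) (sym (^-distrib-* 2 3 k))) (sym (^-distrib-* 2 6 k))))
    (≤-trans (^-monoˡ-≤ k (m≤m+n 12 3)) (≤-reflexive (^-distrib-* 3 5 k)))
  sixes : ∀ {l} → Balanced l f → 2 ^ f * (2 ^ l * 3 ^ l) ≤ 2 * (3 ^ f * 5 ^ l)
  sixes (inj₁ refl) = ≤-trans (square f) (m≤m+n _ _)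
  sixes (inj₂ refl) = begin
    2 ^ f * (2 * 2 ^ f * (3 * 3 ^ f))      ≡⟨ eq₁ (2 ^ f) (3 ^ f) ⟩
    6 * (2 ^ f * (2 ^ f * 3 ^ f))          ≤⟨ *-mono-≤ (m≤m+n 6 4) (square f) ⟩
    10 * (3 ^ f * 5 ^ f)                   ≡⟨ eq₂ (3 ^ f) (5 ^ f) ⟩
    2 * (3 ^ f * (5 * 5 ^ f))              ∎
    where
    eq₁ : ∀ a b → a * (2 * a * (3 * b)) ≡ 6 * (a * (a * b))
    eq₁ = solve-∀
    eq₂ : ∀ a b → 10 * (a * b) ≡ 2 * (a * (5 * b))
    eq₂ = solve-∀

-- Bernoulli's inequality: b / a is at least 1 + 1 / (D + 1), so its k-th power is at least 1 + k /
-- (D + 1).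
absorb-linear : ∀ D a b → suc (suc D) * a ≤ suc D * b → ∀ k → (suc D + k) * a ^ k ≤ suc D * b ^ k
absorb-linear D a b h zero    = ≤-reflexive (cong (_* 1) (+-identityʳ (suc D)))
absorb-linear D a b h (suc k) = *-cancelˡ-≤ (suc D) (begin
  suc D * ((suc D + suc k) * (a * a ^ k))       ≡⟨ eq₁ (suc D) (suc D + suc k) a (a ^ k) ⟩
  suc D * (suc D + suc k) * (a * a ^ k)         ≤⟨ *-monoˡ-≤ (a * a ^ k) (≤-trans (m≤m+n _ k) (≤-reflexive (eq₂ D k))) ⟩
  suc (suc D) * (suc D + k) * (a * a ^ k)       ≡⟨ eq₃ (suc (suc D)) (suc D + k) a (a ^ k) ⟩
  suc (suc D) * a * ((suc D + k) * a ^ k)       ≤⟨ *-mono-≤ h (absorb-linear D a b h k) ⟩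
  suc D * b * (suc D * b ^ k)                   ≡⟨ eq₄ (suc D) b (b ^ k) ⟩
  suc D * (suc D * (b * b ^ k))                 ∎)
  where
  open ≤-Reasoning
  eq₁ : ∀ d e a x → d * (e * (a * x)) ≡ d * e * (a * x)
  eq₁ = solve-∀
  eq₂ : ∀ D k → (1 + D) * ((1 + D) + (1 + k)) + k ≡ (2 + D) * ((1 + D) + k)
  eq₂ = solve-∀
  eq₃ : ∀ d e a x → d * e * (a * x) ≡ d * a * (e * x)
  eq₃ = solve-∀
  eq₄ : ∀ d b x → d * b * (d * x) ≡ d * (d * (b * x))
  eq₄ = solve-∀

-- Used with r / q = 2.755, where 2 (r / q)² exceeds 15 by a factor of more
-- than 85 / 84; this slack absorbs the linear factor.
module Growth (q r : ℕ) (even : 85 * (15 * (q * q)) ≤ 84 * (2 * (r * r))) (odd : 5 * q ≤ 2 * r) where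

  double : ∀ x f → x ^ (f + f) ≡ (x * x) ^ f
  double x f = trans (^-distribˡ-+-* x f f) (sym (^-distrib-* x x f))

  pairs : ∀ f → (84 + f) * (15 * (q * q)) ^ f ≤ 84 * (2 * (r * r)) ^ f
  pairs = absorb-linear 83 (15 * (q * q)) (2 * (r * r)) even

  growth-even : ∀ f → (2 * (84 + f)) * (3 ^ f * 5 ^ f) * q ^ (f + f) ≤ 168 * (2 ^ f * r ^ (f + f))
  growth-even f = begin
    (2 * (84 + f)) * (3 ^ f * 5 ^ f) * q ^ (f + f)   ≡⟨ cong₂ (λ x y → (2 * (84 + f)) * x * y) (sym (^-distrib-* 3 5 f)) (double q f) ⟩
    (2 * (84 + f)) * 15 ^ f * (q * q) ^ f            ≡⟨ eq (84 + f) (15 ^ f) ((q * q) ^ f) ⟩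
    2 * ((84 + f) * (15 ^ f * (q * q) ^ f))          ≡⟨ cong (λ x → 2 * ((84 + f) * x)) (^-distrib-* 15 (q * q) f) ⟨
    2 * ((84 + f) * (15 * (q * q)) ^ f)              ≤⟨ *-monoʳ-≤ 2 (pairs f) ⟩
    2 * (84 * (2 * (r * r)) ^ f)                     ≡⟨ *-assoc 2 84 ((2 * (r * r)) ^ f) ⟨
    168 * (2 * (r * r)) ^ f                          ≡⟨ cong (168 *_) (trans (^-distrib-* 2 (r * r) f) (cong (2 ^ f *_) (sym (double r f)))) ⟩
    168 * (2 ^ f * r ^ (f + f))                      ∎
    where
    open ≤-Reasoning
    eq : ∀ a b c → (2 * a) * b * c ≡ 2 * (a * (b * c))
    eq = solve-∀

  growth : ∀ l f → Balanced l f → (l + f + 1) * (3 ^ f * 5 ^ l) * q ^ (l + f) ≤ 168 * (2 ^ l * r ^ (l + f))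
  growth l f (inj₁ refl) = ≤-trans
    (*-monoˡ-≤ (q ^ (f + f)) (*-monoˡ-≤ (3 ^ f * 5 ^ f) (≤-trans (m≤m+n (f + f + 1) 167) (≤-reflexive (eq f))))) (growth-even f)
    where
    eq : ∀ f → f + f + 1 + 167 ≡ 2 * (84 + f)
    eq = solve-∀
  -- The additional late job contributes the factor 5/2, which is at most r / q by `odd`.
  growth l f (inj₂ refl) = begin
    (suc f + f + 1) * (3 ^ f * (5 * 5 ^ f)) * (q * q ^ (f + f))   ≡⟨ eq₁ (suc f + f + 1) (3 ^ f) (5 ^ f) q (q ^ (f + f)) ⟩
    (suc f + f + 1) * (3 ^ f * 5 ^ f) * q ^ (f + f) * (5 * q)     ≤⟨ *-mono-≤ (≤-trans (*-monoˡ-≤ (q ^ (f + f)) (*-monoˡ-≤ (3 ^ f * 5 ^ f)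
                                                                     (≤-trans (m≤m+n (suc f + f + 1) 166) (≤-reflexive (eq₀ f))))) (growth-even f)) odd ⟩
    168 * (2 ^ f * r ^ (f + f)) * (2 * r)                         ≡⟨ eq₂ 168 (2 ^ f) (r ^ (f + f)) r ⟩
    168 * (2 * 2 ^ f * (r * r ^ (f + f)))                         ∎
    where
    open ≤-Reasoning
    eq₀ : ∀ f → (1 + f) + f + 1 + 166 ≡ 2 * (84 + f)
    eq₀ = solve-∀
    eq₁ : ∀ a b c q x → a * (b * (5 * c)) * (q * x) ≡ a * (b * c) * x * (5 * q)
    eq₁ = solve-∀
    eq₂ : ∀ a b c r → a * (b * c) * (2 * r) ≡ a * (2 * b * (r * c))
    eq₂ = solve-∀

-- 1344 is the product of the constants 8 of `2^l*work≤` and 168 of `growth`. The base is kept as a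
-- variable fraction r / q until the end; the numbers 1000 and 2755 enter only through two numerical
-- inequalities.
time-bound : ∀ l f c t → Balanced l f → t ≤ c * ((l + f + 1) * work l f) → t * 1000 ^ (l + f) ≤ (c * 1344) * 2755 ^ (l + f)
time-bound l f c t bal t≤ = general 1000 2755 (≤ᵇ⇒≤ _ _ tt) (≤ᵇ⇒≤ _ _ tt)
  where
  general : ∀ q r → 85 * (15 * (q * q)) ≤ 84 * (2 * (r * r)) → 5 * q ≤ 2 * r → t * q ^ (l + f) ≤ (c * 1344) * r ^ (l + f)
  general q r even odd = *-cancelˡ-≤ (2 ^ l) {{m^n≢0 2 l}} (begin
    2 ^ l * (t * q ^ (l + f))                                           ≤⟨ *-monoʳ-≤ (2 ^ l) (*-monoˡ-≤ (q ^ (l + f)) t≤) ⟩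
    2 ^ l * (c * ((l + f + 1) * work l f) * q ^ (l + f))                ≡⟨ eq₁ (2 ^ l) c (l + f + 1) (work l f) (q ^ (l + f)) ⟩
    c * ((l + f + 1) * (2 ^ l * work l f) * q ^ (l + f))                ≤⟨ *-monoʳ-≤ c (*-monoˡ-≤ (q ^ (l + f)) (*-monoʳ-≤ (l + f + 1) (2^l*work≤ l f bal))) ⟩
    c * ((l + f + 1) * (8 * (3 ^ f * 5 ^ l)) * q ^ (l + f))             ≡⟨ eq₂ c (l + f + 1) (3 ^ f * 5 ^ l) (q ^ (l + f)) ⟩
    c * 8 * ((l + f + 1) * (3 ^ f * 5 ^ l) * q ^ (l + f))               ≤⟨ *-monoʳ-≤ (c * 8) (Growth.growth q r even odd l f bal) ⟩
    c * 8 * (168 * (2 ^ l * r ^ (l + f)))                               ≡⟨ eq₃ c (2 ^ l) (r ^ (l + f)) ⟩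
    2 ^ l * (c * 1344 * r ^ (l + f))                                    ∎)
    where
    open ≤-Reasoning
    eq₁ : ∀ a c m w x → a * (c * (m * w) * x) ≡ c * (m * (a * w) * x)
    eq₁ = solve-∀
    eq₂ : ∀ c m z x → c * (m * (8 * z) * x) ≡ c * 8 * (m * z * x)
    eq₂ = solve-∀
    eq₃ : ∀ c a x → c * 8 * (168 * (a * x)) ≡ a * (c * 1344 * x)
    eq₃ = solve-∀

-- The total number of ticks

sumMask-const : ∀ b c → sumMask {b} (λ _ → c) ≡ 2 ^ b * c
sumMask-const zero c    = sym (+-identityʳ c)
sumMask-const (suc b) c = trans (cong₂ _+_ (sumMask-const b c) (sumMask-const b c))
  (trans (sym (*-distribʳ-+ c (2 ^ b) (2 ^ b))) (cong (_* c) (sym (2^suc b))))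

layer-sum : ∀ l f → sumBelow (2 ^ f) (λ x → sumBelow (2 ^ l) (λ y → 42 * (2 ^ count (toMask f x) * (gOf (toMask l y) + hOf (toMask l y)) + 2 ^ count (toMask l y))) + 5)
  ≡ 42 * (3 ^ f * Γ l + 2 ^ f * 3 ^ l) + 5 * 2 ^ f
layer-sum l f = begin
  sumBelow (2 ^ f) (λ x → sumBelow (2 ^ l) (λ y → κ (toMask f x) (toMask l y)) + 5)
    ≡⟨ sumBelow-toMask f (λ u → sumBelow (2 ^ l) (λ y → κ u (toMask l y)) + 5) ⟩
  sumMask {f} (λ u → sumBelow (2 ^ l) (λ y → κ u (toMask l y)) + 5)
    ≡⟨ sumMask-cong (λ u → cong (_+ 5) (trans (sumBelow-toMask l (κ u)) (row-sum u))) ⟩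
  sumMask {f} (λ u → 42 * (Γ l * 2 ^ count u + 3 ^ l) + 5)
    ≡⟨ sumMask-+ {f} (λ u → 42 * (Γ l * 2 ^ count u + 3 ^ l)) (λ _ → 5) ⟩
  sumMask {f} (λ u → 42 * (Γ l * 2 ^ count u + 3 ^ l)) + sumMask {f} (λ _ → 5)
    ≡⟨ cong₂ _+_ (trans (sumMask-* {f} 42 (λ u → Γ l * 2 ^ count u + 3 ^ l)) (cong (42 *_) (trans (sumMask-+ {f} (λ u → Γ l * 2 ^ count u) (λ _ → 3 ^ l))
         (cong₂ _+_ (trans (sumMask-* {f} (Γ l) (λ u → 2 ^ count u)) (trans (cong (Γ l *_) (sumMask-^ 2 f)) (*-comm (Γ l) (3 ^ f)))) (sumMask-const f (3 ^ l))))))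
         (trans (sumMask-const f 5) (*-comm (2 ^ f) 5)) ⟩
  42 * (3 ^ f * Γ l + 2 ^ f * 3 ^ l) + 5 * 2 ^ f  ∎
  where
  open ≡-Reasoning
  κ : Mask f → Mask l → ℕ
  κ u d = 42 * (2 ^ count u * (gOf d + hOf d) + 2 ^ count d)
  row-sum : ∀ u → sumMask {l} (κ u) ≡ 42 * (Γ l * 2 ^ count u + 3 ^ l)
  row-sum u = trans (sumMask-* {l} 42 (λ d → 2 ^ count u * (gOf d + hOf d) + 2 ^ count d)) (cong (42 *_)
    (trans (sumMask-+ {l} (λ d → 2 ^ count u * (gOf d + hOf d)) (λ d → 2 ^ count d)) (cong₂ _+_
      (trans (sumMask-* {l} (2 ^ count u) (λ d → gOf d + hOf d)) (trans (cong (2 ^ count u *_) (sumMask-+ {l} gOf hOf)) (*-comm (2 ^ count u) (Γ l))))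
      (sumMask-^ 2 l))))

-- Every term is compared with `work`, whose summand `2 ^ (l + f)` is there to dominate the number
-- of jobs and the constants. The terms with a factor n add up to 18 for sorting and 61 for the
-- layers, the others to 80.
total-ticks : ∀ l f → let n = l + f in ∀ {a b c d} →
  a ≤ n * (9 * n + 9) + 4 → b ≤ 5 * 2 ^ n + 5 * n + 3 → c ≤ 20 * 3 ^ f + 20 * 3 ^ l + 5 * n + 13 →
  d ≤ n * (42 * (3 ^ f * Γ l + 2 ^ f * 3 ^ l) + 5 * 2 ^ f + 3 * 2 ^ n + 10 + 1) + 5 →
  a + (b + (c + d)) ≤ 80 * ((n + 1) * work l f)
total-ticks l f {a} {b} {c} {d} a≤ b≤ c≤ d≤ = begin
  a + (b + (c + d)) ≤⟨ +-mono-≤ a≤ (+-mono-≤ b≤ (+-mono-≤ c≤ d≤)) ⟩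
  n * (9 * n + 9) + 4 + (5 * 2 ^ n + 5 * n + 3 + (20 * 3 ^ f + 20 * 3 ^ l + 5 * n + 13 +
    (n * (42 * (3 ^ f * Γ l + 2 ^ f * 3 ^ l) + 5 * 2 ^ f + 3 * 2 ^ n + 10 + 1) + 5)))
    ≤⟨ +-mono-≤ (+-mono-≤ (*-monoʳ-≤ n (+-mono-≤ (*-monoʳ-≤ 9 n≤Y) (*-monoʳ-≤ 9 1≤Y))) (*-monoʳ-≤ 4 1≤Y))
         (+-mono-≤ (+-mono-≤ (+-mono-≤ (*-monoʳ-≤ 5 N≤Y) (*-monoʳ-≤ 5 n≤Y)) (*-monoʳ-≤ 3 1≤Y))
         (+-mono-≤ (+-mono-≤ (+-mono-≤ (+-mono-≤ (*-monoʳ-≤ 20 3^f≤Y) (*-monoʳ-≤ 20 3^l≤Y)) (*-monoʳ-≤ 5 n≤Y)) (*-monoʳ-≤ 13 1≤Y))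
         (+-mono-≤ (*-monoʳ-≤ n (+-mono-≤ (+-mono-≤ (+-mono-≤ (+-mono-≤ (*-monoʳ-≤ 42 (m≤m+n (3 ^ f * Γ l + 2 ^ f * 3 ^ l) (2 ^ n))) (*-monoʳ-≤ 5 2^f≤Y)) (*-monoʳ-≤ 3 N≤Y)) (*-monoʳ-≤ 10 1≤Y)) 1≤Y))
                   (*-monoʳ-≤ 5 1≤Y)))) ⟩
  n * (9 * Y + 9 * Y) + 4 * Y + (5 * Y + 5 * Y + 3 * Y + (20 * Y + 20 * Y + 5 * Y + 13 * Y + (n * (42 * Y + 5 * Y + 3 * Y + 10 * Y + Y) + 5 * Y)))
    ≡⟨ eq₁ n Y ⟩
  79 * (n * Y) + 80 * Y          ≤⟨ +-monoˡ-≤ (80 * Y) (*-monoˡ-≤ (n * Y) (n≤1+n 79)) ⟩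
  80 * (n * Y) + 80 * Y          ≡⟨ eq₂ n Y ⟩
  80 * ((n + 1) * Y)             ∎
  where
  open ≤-Reasoning
  n Y : ℕ
  n = l + f
  Y = work l f
  N≤Y : 2 ^ n ≤ Y
  N≤Y = m≤n+m _ _
  1≤Y : 1 ≤ Y
  1≤Y = ≤-trans (1≤2^ n) N≤Y
  ≤2^ : ∀ b → b ≤ 2 ^ b
  ≤2^ zero    = z≤n
  ≤2^ (suc b) = subst (suc b ≤_) (sym (2^suc b)) (+-mono-≤ (1≤2^ b) (≤2^ b))
  n≤Y : n ≤ Y
  n≤Y = ≤-trans (≤2^ n) N≤Y
  2^f≤Y : 2 ^ f ≤ Y
  2^f≤Y = ≤-trans (^-monoʳ-≤ 2 (m≤n+m f l)) N≤Y
  3^f≤Y : 3 ^ f ≤ Y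
  3^f≤Y = ≤-trans (≤-trans (≤-reflexive (sym (*-identityʳ (3 ^ f)))) (*-monoʳ-≤ (3 ^ f) (Γ≥1 l))) (≤-trans (m≤m+n _ (2 ^ f * 3 ^ l)) (m≤m+n _ _))
  3^l≤Y : 3 ^ l ≤ Y
  3^l≤Y = ≤-trans (≤-trans (≤-reflexive (sym (*-identityˡ (3 ^ l)))) (*-monoˡ-≤ (3 ^ l) (1≤2^ f))) (≤-trans (m≤n+m _ (3 ^ f * Γ l)) (m≤m+n _ _))
  eq₁ : ∀ n y → n * (9 * y + 9 * y) + 4 * y + (5 * y + 5 * y + 3 * y + (20 * y + 20 * y + 5 * y + 13 * y + (n * (42 * y + 5 * y + 3 * y + 10 * y + y) + 5 * y))) ≡ 79 * (n * y) + 80 * y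
  eq₁ = solve-∀
  eq₂ : ∀ n y → 80 * (n * y) + 80 * y ≡ 80 * ((n + 1) * y)
  eq₂ = solve-∀

-- The input and its encoding length

get : List ℕ → ℕ → ℕ
get xs a = fromMaybe 0 (head (drop a xs))

get-++ʳ : ∀ xs {ys} a → get (xs ++ ys) (length xs + a) ≡ get ys a
get-++ʳ [] a       = refl
get-++ʳ (x ∷ xs) a = get-++ʳ xs a

get-tabulate : ∀ {n} (g : Fin n → ℕ) ys j → get (tabulate g ++ ys) (toℕ j) ≡ g j
get-tabulate g ys zero    = refl
get-tabulate g ys (suc j) = get-tabulate (g ∘ suc) ys j

get-beyond : ∀ xs {a} → length xs ≤ a → get xs a ≡ 0
get-beyond [] {zero}  _         = refl
get-beyond [] {suc a} _         = refl
get-beyond (x ∷ xs) {suc a} (s≤s h) = get-beyond xs h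

<2^bits : ∀ x → x < 2 ^ bits x
<2^bits x with x <? 2 ^ bits x
... | yes x< = x<
... | no x≮  = contradict (subst (_≤ ⌊log₂ x ⌋) (⌊log₂[2^n]⌋≡n (bits x)) (⌊log₂⌋-mono-≤ (≮⇒≥ x≮)))
  where
  contradict : suc ⌊log₂ x ⌋ ≤ ⌊log₂ x ⌋ → x < 2 ^ bits x
  contradict h with () ← n≮n ⌊log₂ x ⌋ h

bitLength : List ℕ → ℕ
bitLength xs = sum (List.map bits xs)

-- With S for the bound on the rest, x + S is at most (x + 1) S, since S ≥ 1. So 2^L bounds every
-- number and every total in an input of length L.
sum≤2^ : ∀ xs → sum xs ≤ 2 ^ bitLength xs
sum≤2^ []       = z≤n
sum≤2^ (x ∷ xs) = begin
  x + sum xs                              ≤⟨ +-monoʳ-≤ x (sum≤2^ xs) ⟩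
  x + S                                   ≤⟨ +-monoˡ-≤ S (≤-trans (≤-reflexive (sym (*-identityʳ x))) (*-monoʳ-≤ x (1≤2^ (bitLength xs)))) ⟩
  x * S + S                               ≡⟨ +-comm (x * S) S ⟩
  suc x * S                               ≤⟨ *-monoˡ-≤ S (<2^bits x) ⟩
  2 ^ bits x * S                          ≡⟨ ^-distribˡ-+-* 2 (bits x) (bitLength xs) ⟨
  2 ^ (bits x + bitLength xs)             ∎
  where
  open ≤-Reasoning
  S = 2 ^ bitLength xs

-- Every number has at least one digit. This makes the encoding length exceed the number of jobs, so
-- 2^L also bounds the number of sets of jobs.
length≤bitLength : ∀ xs → length xs ≤ bitLength xs
length≤bitLength []       = z≤n
length≤bitLength (x ∷ xs) = s≤s (≤-trans (length≤bitLength xs) (m≤n+m _ ⌊log₂ x ⌋))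

get≤sum : ∀ xs a → get xs a ≤ sum xs
get≤sum [] zero          = z≤n
get≤sum [] (suc a)       = z≤n
get≤sum (x ∷ xs) zero    = m≤m+n x _
get≤sum (x ∷ xs) (suc a) = ≤-trans (get≤sum xs a) (m≤n+m _ x)

sumBelow≡sum : ∀ {A : Set} (g : A → ℕ) e n → sumBelow n (g ∘ e) ≡ sum (List.map g (applyDownFrom e n))
sumBelow≡sum g e zero    = refl
sumBelow≡sum g e (suc n) = trans (+-comm (sumBelow n (g ∘ e)) _) (cong (g (e n) +_) (sumBelow≡sum g e n))

applyDownFrom-↭ : ∀ {A : Set} (e : ℕ → A) n → applyDownFrom e (suc n) ↭ e 0 ∷ applyDownFrom (e ∘ suc) n
applyDownFrom-↭ e zero    = ↭-refl
applyDownFrom-↭ e (suc n) = ↭-trans (↭-prep (e (suc n)) (applyDownFrom-↭ e n)) (↭-swap (e (suc n)) (e 0) ↭-refl)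

applyDownFrom-tabulate : ∀ {A : Set} (e : ℕ → A) n → applyDownFrom e n ↭ tabulate {n = n} (e ∘ toℕ)
applyDownFrom-tabulate e zero    = ↭-refl
applyDownFrom-tabulate e (suc n) = ↭-trans (applyDownFrom-↭ e n) (↭-prep (e 0) (applyDownFrom-tabulate (e ∘ suc) n))

tabulate-cong : ∀ {A : Set} {n} {g h : Fin n → A} → (∀ j → g j ≡ h j) → tabulate g ≡ tabulate h
tabulate-cong {n = zero} eq  = refl
tabulate-cong {n = suc n} eq = cong₂ _∷_ (eq zero) (tabulate-cong (eq ∘ suc))

-- The complete program, its word size and its running time

body : Cmd
body = sort ⨾ tables ⨾ sublists ⨾ layers

-- From n in cell 0 it computes 2n + 2, the length of the input, and leaves it in register 0 as the
-- base of the arrays.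
prologue : List Instruction
prologue = load 0 0 ∷ const 2 2 ∷ arith mul 0 0 2 ∷ arith add 0 0 2 ∷ []

epilogue : ℕ → List Instruction
epilogue x = const (stackReg 0) 0 ∷ arith add 0 (varReg x) (stackReg 0) ∷ []

programOf : Cmd → ℕ → Program
programOf c x = prologue ++ (compile 4 c ++ epilogue x)

s₀ : Store
s₀ = store (λ _ → 0) (λ _ _ → 0)

module Execute (c : Cmd) (x : ℕ) (xs : List ℕ) (W B V : ℕ)
  (B≡ : B ≡ 2 + (get xs 0 + get xs 0)) (length-xs : length xs ≡ B)
  (V≥16 : 16 ≤ V) (B≤V : B ≤ V) (input≤V : ∀ a → get xs a ≤ V) (c-fits : V ^ degreeᶜ c < 2 ^ W) (V-fits : V < 2 ^ W) where

  open Logic B V (get xs) input≤V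
  open Correctness W B V (get xs) V≥16 B≤V input≤V
  open Simulation (programOf c x)

  b₀ : Bounded s₀
  b₀ = bounded (λ _ → z≤n) (λ _ _ → z≤n)

  ≤V⇒truncate≡ : ∀ {y} → y ≤ V → truncate W y ≡ y
  ≤V⇒truncate≡ y≤ = truncate≡ (≤-<-trans y≤ V-fits)

  at-program : ∀ ys zs {Pg} → ys ++ zs ≡ Pg → Simulation.At Pg (length ys) zs
  at-program ys []       eq = _
  at-program ys (z ∷ zs) {Pg} eq = here-at ys eq , subst (λ k → Simulation.At Pg k zs) (trans (length-++ ys) (+-comm (length ys) 1))
    (at-program (ys ++ z ∷ []) zs (trans (++-assoc ys (z ∷ []) zs) eq))
    where
    here-at : ∀ ys {Pg} → ys ++ z ∷ zs ≡ Pg → head (drop (length ys) Pg) ≡ just z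
    here-at [] refl       = refl
    here-at (y ∷ ys) refl = here-at ys refl

  n : ℕ
  n = get xs 0

  R₁ : ℕ → ℕ
  R₁ = proj₁ (line prologue ((λ _ → 0) , get xs))

  represents₁ : Represents R₁ (get xs) s₀
  -- Memory beyond the input is 0, hence the arrays are 0 at the start. The tables rely on this for
  -- their entries at the empty set.
  represents₁ = represents base≡ vars≡ (λ A i → get-beyond xs (≤-trans (≤-reflexive length-xs) (address≥ A i))) (λ _ _ → refl)
    where
    step₂ : truncate W 2 ≡ 2
    step₂ = ≤V⇒truncate≡ (≤-trans (s≤s (s≤s z≤n)) V≥16)
    double : n * truncate W 2 ≡ n + n
    double = trans (cong (n *_) step₂) (eq n)
      where
      eq : ∀ n → n * 2 ≡ n + n
      eq = solve-∀
    double≡ : truncate W (n * truncate W 2) ≡ n + n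
    double≡ = trans (cong (truncate W) double) (≤V⇒truncate≡ (≤-trans (≤-trans (m≤n+m _ 2) (≤-reflexive (sym B≡))) B≤V))
    base≡ : truncate W (truncate W (n * truncate W 2) + truncate W 2) ≡ B
    base≡ = trans (cong (truncate W) (trans (cong₂ _+_ double≡ step₂) (trans (+-comm (n + n) 2) (sym B≡)))) (≤V⇒truncate≡ B≤V)
    vars≡ : ∀ y → R₁ (varReg y) ≡ 0
    vars≡ y = ≔-other (λ _ → 0) 2 (truncate W 2) {varReg y} (λ eq → stackReg≢varReg 0 y (sym eq))

  record Output (Q : ℕ → Store → Set) : Set where
    constructor outputs
    field
      {τ time} : ℕ
      {final}  : Store
      after    : OutputsAfter W (programOf c x) xs (reg final x) time
      post     : Q τ final
      time≤    : time ≤ 4 + size c * τ + 2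

  execute-correct : ∀ {Q} → Run c s₀ Q → Output Q
  execute-correct (run {τ} {s′} exec post) =
    outputs (_ , _⟶⟨_⟩_.extend all (halted end) , output) post
      (≤-trans (≤-reflexive (+-identityʳ _)) (_⟶⟨_⟩_.time≤ all))
    where
    codes = at-++ prologue (at-program [] (programOf c x) refl)
    codes′ = at-++ (compile 4 c) (proj₂ codes)
    sim : Simulates 4 (size c * τ) (4 + size c) R₁ (get xs) s′
    sim = simulate {size c} ≤-refl (fits c-fits) exec b₀ represents₁ (proj₁ codes′)
    open Simulates sim renaming (run to steps)
    R₃ : ℕ → ℕ
    R₃ = proj₁ (line (epilogue x) (R′ , M′))
    start : ⟨ 0 , (λ _ → 0) , get xs ⟩ ⟶⟨ 4 ⟩ ⟨ 4 , R₁ , get xs ⟩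
    start = reach-line (proj₁ codes) (load ∷ const ∷ arith ∷ arith ∷ []) refl
    stop′ : ⟨ 4 + size c , R′ , M′ ⟩ ⟶⟨ 2 ⟩ ⟨ 4 + size c + 2 , R₃ , M′ ⟩
    stop′ = reach-line (at-≡ (cong (4 +_) (length-compile 4 c)) (proj₂ codes′)) (const ∷ arith ∷ []) refl
    all : ⟨ 0 , (λ _ → 0) , get xs ⟩ ⟶⟨ 4 + size c * τ + 2 ⟩ ⟨ 4 + size c + 2 , R₃ , M′ ⟩
    all = reach-trans (reach-trans start steps) stop′
    output : R₃ 0 ≡ reg s′ x
    output = trans (cong (truncate W) (trans (cong₂ _+_
        (trans (≔-other R′ (stackReg 0) (truncate W 0) {varReg x} (λ eq → stackReg≢varReg 0 x (sym eq))) (Represents.vars≡ rep x))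
        (≤V⇒truncate≡ z≤n)) (+-identityʳ _))) (≤V⇒truncate≡ (Bounded.reg≤ bnd x))
    beyond : ∀ (ys : Program) k → length ys ≤ k → head (drop k ys) ≡ nothing
    beyond [] zero _          = refl
    beyond [] (suc k) _       = refl
    beyond (y ∷ ys) (suc k) (s≤s h) = beyond ys k h
    end : head (drop (4 + size c + 2) (programOf c x)) ≡ nothing
    end = beyond (programOf c x) (4 + size c + 2) (≤-reflexive (trans (length-++ prologue {compile 4 c ++ epilogue x})
      (cong (4 +_) (trans (length-++ (compile 4 c) {epilogue x}) (cong (_+ 2) (length-compile 4 c))))))

-- For encoding length L the program is run with X = 2^L and V = X^8. Intermediate values are at
-- most V to the degree of the command and need about 8 L bits per degree. The inner `suc` makes the
-- bound apply to V itself too, the outer one makes it strict.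
wordFactor timeFactor : Cmd → ℕ
wordFactor c = suc (8 * suc (degreeᶜ c))
timeFactor c = (6 + 80 * size c) * 1344

time-factor : ∀ k τ y → 1 ≤ y → τ ≤ 80 * y → 4 + k * τ + 2 ≤ (6 + 80 * k) * y
time-factor k τ y 1≤y τ≤ = begin
  4 + k * τ + 2               ≤⟨ +-monoˡ-≤ 2 (+-monoʳ-≤ 4 (*-monoʳ-≤ k τ≤)) ⟩
  4 + k * (80 * y) + 2        ≡⟨ eq k y ⟩
  6 * 1 + 80 * k * y          ≤⟨ +-monoˡ-≤ (80 * k * y) (*-monoʳ-≤ 6 1≤y) ⟩
  6 * y + 80 * k * y          ≡⟨ *-distribʳ-+ y 6 (80 * k) ⟨
  (6 + 80 * k) * y            ∎
  where
  open ≤-Reasoning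
  eq : ∀ k y → 4 + k * (80 * y) + 2 ≡ 6 * 1 + 80 * k * y
  eq = solve-∀

module Solve (I : Instance) (X V W : ℕ) (X≥2 : 2 ≤ X) (X^8≤V : X ^ 8 ≤ V)
  (2^n≤X : 2 ^ Instance.jobs I ≤ X) (sum≤X : sum (encode I) ≤ X) where
  open Instance I renaming (jobs to N₀; machines to m₀)

  xs : List ℕ
  xs = encode I

  B : ℕ
  B = 2 + (N₀ + N₀)

  input : ℕ → ℕ
  input = get xs

  open Powers X V X≥2 X^8≤V

  length-xs : length xs ≡ B
  length-xs = cong (2 +_) (trans (length-++ (tabulate processing)) (cong₂ _+_ (length-tabulate processing) (length-tabulate weight)))

  input≤X : ∀ a → input a ≤ X
  input≤X a = ≤-trans (get≤sum xs a) sum≤X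

  input≤V : ∀ a → input a ≤ V
  input≤V a = ≤V 1 (^-1 (input≤X a))

  input-processing : ∀ j → input (2 + toℕ j) ≡ processing j
  input-processing j = get-tabulate processing (tabulate weight) j

  input-weight : ∀ j → input (2 + N₀ + toℕ j) ≡ weight j
  input-weight j = trans (cong (λ k → get (tabulate processing ++ tabulate weight) (k + toℕ j)) (sym (length-tabulate processing)))
    (trans (get-++ʳ (tabulate processing) (toℕ j))
      (trans (cong (λ ys → get ys (toℕ j)) (sym (++-[] (tabulate weight)))) (get-tabulate weight [] j)))
    where
    ++-[] : ∀ (ys : List ℕ) → ys ++ [] ≡ ys
    ++-[] []       = refl
    ++-[] (y ∷ ys) = cong (y ∷_) (++-[] ys)

  open Logic B V input input≤V
  open Verification B V input input≤V using (Arranged; arranged; job)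

  b₀ : Bounded s₀
  b₀ = bounded (λ _ → z≤n) (λ _ _ → z≤n)

  f l : ℕ
  f = N₀ / 2
  l = N₀ ∸ f

  n≡ : N₀ ≡ N₀ % 2 + f * 2
  n≡ = m≡m%n+[m/n]*n N₀ 2

  l≡ : l ≡ N₀ % 2 + f
  l≡ = trans (cong (_∸ f) (trans n≡ (eq (N₀ % 2) f))) (m+n∸n≡m (N₀ % 2 + f) f)
    where
    eq : ∀ r f → r + f * 2 ≡ r + f + f
    eq = solve-∀

  l+f≡ : l + f ≡ N₀
  l+f≡ = trans (cong (_+ f) l≡) (trans (eq (N₀ % 2) f) (sym n≡))
    where
    eq : ∀ r f → r + f + f ≡ r + f * 2
    eq = solve-∀

  balanced : Balanced l f
  balanced with N₀ % 2 | m%n<n N₀ 2 | l≡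
  ... | zero        | _               | eq = inj₁ eq
  ... | suc zero    | _               | eq = inj₂ eq
  ... | suc (suc _) | s≤s (s≤s ())    | _

  jobs-↭ : applyDownFrom job (input 0) ↭ tabulate (λ j → processing j , weight j)
  jobs-↭ = ↭-trans (applyDownFrom-tabulate job N₀) (↭-reflexive (tabulate-cong λ j → cong₂ _,_ (input-processing j) (input-weight j)))

  K : ℕ
  K = suc (N₀ ∸ (N₀ ∸ m₀) ∸ 1)

  body-correct : Run body s₀ (λ τ s′ → τ ≤ 80 * ((l + f + 1) * work l f) × IsOptimalValue I (reg s′ rV))
  body-correct = run-⨾ (run-keeps b₀ (Verification.sort-correct B V input input≤V b₀ refl) λ k₁ (time₁ , ar) → sorted k₁ time₁ ar)
    where
    sorted : ∀ {τ₁ s₁} → Keeps sort s₀ s₁ → τ₁ ≤ N₀ * (9 * N₀ + 9) + 4 → Arranged s₁ →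
      Run (tables ⨾ sublists ⨾ layers) s₁ (λ τ s′ → τ₁ + τ ≤ 80 * ((l + f + 1) * work l f) × IsOptimalValue I (reg s′ rV))
    sorted {τ₁} {s₁} k₁ time₁ (arranged n₁ m₁ perm ordered) =
      run-⨾ (run-keeps (isBounded k₁)
        (tables-correct (isBounded k₁) nV≡ (λ _ → refl) (λ _ → refl) (keptArr k₁ PS refl 0) (keptArr k₁ WS refl 0) (keptArr k₁ HH refl 0))
        λ k₂ (time₂ , N₂ , tab) → tabled k₂ time₂ N₂ tab)
      where
      p w : ℕ → ℕ
      p = arr s₁ PA
      w = arr s₁ WA
      nV≡ : reg s₁ nV ≡ l + f
      nV≡ = trans n₁ (sym l+f≡)
      arrangement : applyDownFrom (λ k → p k , w k) N₀ ↭ tabulate (λ j → processing j , weight j)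
      arrangement = ↭-trans perm jobs-↭
      sum≤ : ∀ (g : ℕ × ℕ → ℕ) → sum (List.map g (tabulate (λ j → processing j , weight j))) ≤ X → sumBelow (l + f) (λ k → g (p k , w k)) ≤ X
      sum≤ g h = ≤-trans (≤-reflexive (trans (cong (λ n → sumBelow n (λ k → g (p k , w k))) l+f≡)
        (trans (sumBelow≡sum g (λ k → p k , w k) N₀) (sum-↭ (↭-map⁺ g arrangement))))) h
      sum-xs≤ : sum (tabulate processing) + sum (tabulate weight) ≤ X
      sum-xs≤ = ≤-trans (≤-reflexive (sym (sum-++ (tabulate processing) (tabulate weight))))
        (≤-trans (≤-trans (m≤n+m _ m₀) (m≤n+m _ N₀)) sum≤X)
      p≤X : sumBelow (l + f) p ≤ X
      p≤X = sum≤ proj₁ (≤-trans (≤-reflexive (cong sum (map-tabulate (λ j → processing j , weight j) proj₁))) (≤-trans (m≤m+n _ _) sum-xs≤))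
      w≤X : sumBelow (l + f) w ≤ X
      w≤X = sum≤ proj₂ (≤-trans (≤-reflexive (cong sum (map-tabulate (λ j → processing j , weight j) proj₂))) (≤-trans (m≤n+m _ (sum (tabulate processing))) sum-xs≤))
      2^≤X : 2 ^ (l + f) ≤ X
      2^≤X = subst (λ n → 2 ^ n ≤ X) (sym l+f≡) 2^n≤X
      open Verification.Sized B V input input≤V X X≥2 X^8≤V using (module Tables; module Layer)
      open Tables (l + f) p w 2^≤X p≤X w≤X using (tables-correct; Tabulated; module Tabulated)
      open Layer l f p w 2^≤X p≤X w≤X using (Lists; lists-correct; layers-correct; layerTime)
      open Costs p w
      smith : ∀ {i j} → i < j → j < N₀ → p i * w j ≤ p j * w i
      smith {i} {j} i<j j<n = ≼⇒smith {p i} {w i} {p j} {w j} (ordered i<j j<n)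
      K≤m : K ≤ m₀
      K≤m with N₀ ∸ (N₀ ∸ m₀) | ≤-trans (m∸[m∸n]≤n N₀ m₀) ≤-refl
        where
        m∸[m∸n]≤n : ∀ a b → a ∸ (a ∸ b) ≤ b
        m∸[m∸n]≤n a b with a ≤? b
        ... | yes a≤b = ≤-trans (m∸n≤m a (a ∸ b)) a≤b
        ... | no a≰b  = ≤-reflexive (m∸[m∸n]≡n (<⇒≤ (≰⇒> a≰b)))
      -- Without jobs `K` is still 1, so a machine has to exist.
      ... | zero  | _  = machines≥1
      ... | suc k | k< = k<
      enough : m₀ ≤ K ⊎ N₀ ≤ K
      enough with m₀ ≤? N₀
      ... | yes m≤n = inj₁ (subst (λ k → m₀ ≤ suc (k ∸ 1)) (sym (m∸[m∸n]≡n m≤n)) (m≤n+m∸n m₀ 1))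
      ... | no m≰n  = inj₂ (subst (λ k → N₀ ≤ suc (N₀ ∸ k ∸ 1)) (sym (m≤n⇒m∸n≡0 (<⇒≤ (≰⇒> m≰n)))) (m≤n+m∸n N₀ 1))
      optimal : ∀ {a} → Best (suc (l + f ∸ (l + f ∸ m₀) ∸ 1)) (replicate (l + f) true) a → IsOptimalValue I a
      optimal {a} best = Scheduling.best-optimal I p w arrangement smith enough K≤m
        (subst (λ n → Best (suc (n ∸ (n ∸ m₀) ∸ 1)) (replicate n true) a) l+f≡ best)
      tabled : ∀ {τ₂ s₂} → Keeps tables s₁ s₂ → τ₂ ≤ 5 * 2 ^ (l + f) + 5 * (l + f) + 3 → reg s₂ NV ≡ 2 ^ (l + f) → Tabulated (l + f) s₂ →
        Run (sublists ⨾ layers) s₂ (λ τ s′ → τ₁ + (τ₂ + τ) ≤ 80 * ((l + f + 1) * work l f) × IsOptimalValue I (reg s′ rV))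
      tabled {τ₂} {s₂} k₂ time₂ N₂ tab =
        run-⨾ (run-keeps (isBounded k₂)
          (lists-correct (isBounded k₂) nV₂ (cong (_/ 2) l+f≡) N₂ tab)
          λ {τ₃} {s₃} k₃ (time₃ , ls) → run-mono
            (λ {τ₄} {s₄} (time₄ , best) → total {τ₃} {τ₄} time₃ time₄ ,
              optimal (subst (λ m → Best (suc (l + f ∸ (l + f ∸ m) ∸ 1)) (replicate (l + f) true) (reg s₄ rV))
                (trans (kept k₃ mV refl) (trans (kept k₂ mV refl) m₁)) best))
            (layers-correct (isBounded k₃) ls (λ v → trans (keptArr k₃ HH refl _) (Tabulated.cs tab v)) (trans (kept k₃ nV refl) nV₂)))
        where
        nV₂ : reg s₂ nV ≡ l + f
        nV₂ = trans (kept k₂ nV refl) nV≡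
        total : ∀ {τ₃ τ₄} → τ₃ ≤ 20 * 3 ^ f + 20 * 3 ^ l + 5 * (l + f) + 13 → τ₄ ≤ (l + f) * (layerTime + 1) + 5 →
          τ₁ + (τ₂ + (τ₃ + τ₄)) ≤ 80 * ((l + f + 1) * work l f)
        total time₃ time₄ = total-ticks l f (subst (λ n → τ₁ ≤ n * (9 * n + 9) + 4) (sym l+f≡) time₁) time₂ time₃
          (subst (λ S → _ ≤ (l + f) * (S + 3 * 2 ^ (l + f) + 10 + 1) + 5) (layer-sum l f) time₄)

  V≥16 : 16 ≤ V
  V≥16 = ≤-trans (≤-trans (m≤m+n 16 240) (^-monoˡ-≤ 8 X≥2)) X^8≤V

  B≤V : B ≤ V
  B≤V = ≤V 3 (^-+ 2 (^-up 1 2 (^-1 X≥2)) (^-+ 1 (^-1 N₀≤X) (^-1 N₀≤X)))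
    where
    N₀≤X : N₀ ≤ X
    N₀≤X = input≤X 0

  Solves : Cmd → Set
  Solves c = Run c s₀ (λ τ s′ → τ ≤ 80 * ((l + f + 1) * work l f) × IsOptimalValue I (reg s′ rV))

  solution : ∀ c → Solves c → V ^ degreeᶜ c < 2 ^ W → V < 2 ^ W → Σ[ v ∈ ℕ ] Σ[ t ∈ ℕ ]
    (OutputsAfter W (programOf c rV) (encode I) v t × IsOptimalValue I v ×
     t * 1000 ^ N₀ ≤ timeFactor c * 2755 ^ N₀)
  solution c c-correct c-fits V-fits = reg final rV , time , after , proj₂ post ,
      subst (λ n → time * 1000 ^ n ≤ timeFactor c * 2755 ^ n) l+f≡
        (time-bound l f (6 + 80 * size c) time balanced (≤-trans time≤ (time-factor (size c) τ ((l + f + 1) * work l f)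
          (*-mono-≤ (m≤n+m 1 (l + f)) (≤-trans (1≤2^ (l + f)) (m≤n+m _ (3 ^ f * Γ l + 2 ^ f * 3 ^ l)))) (proj₁ post))))
    where
    open Execute c rV (encode I) W B V refl length-xs V≥16 B≤V input≤V c-fits V-fits
    open Output (execute-correct c-correct)

power-fits : ∀ L d D → 1 ≤ L → d ≤ D → (((2 ^ L) ^ 8) ^ d) < 2 ^ (suc (8 * D) * L)
power-fits L d D L≥1 d≤D = subst (_< 2 ^ (suc (8 * D) * L)) (sym power≡) (^-monoʳ-< 2 (n<1+n 1)
  (≤-<-trans (*-monoˡ-≤ L (*-monoʳ-≤ 8 d≤D)) (m<n+m (8 * D * L) L≥1)))
  where
  power≡ : ((2 ^ L) ^ 8) ^ d ≡ 2 ^ (8 * d * L)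
  power≡ = trans (^-*-assoc (2 ^ L) 8 d) (trans (^-*-assoc 2 L (8 * d)) (cong (2 ^_) (*-comm L (8 * d))))

-- Stated for any command that solves all instances, so that the size and the degree of the actual
-- program stay symbolic.
solve-instance : ∀ c →
  (∀ I X V W X≥2 X^8≤V 2^n≤X sum≤X → Solve.Solves I X V W X≥2 X^8≤V 2^n≤X sum≤X c) →
  (I : Instance) → Σ[ v ∈ ℕ ] Σ[ t ∈ ℕ ]
  (OutputsAfter (wordFactor c * encodingLength I) (programOf c rV) (encode I) v t × IsOptimalValue I v ×
   t * 1000 ^ Instance.jobs I ≤ timeFactor c * 2755 ^ Instance.jobs I)
solve-instance c c-correct I = solveWith (encodingLength I) (length≤bitLength (encode I)) (sum≤2^ (encode I))
  where
  n : ℕ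
  n = Instance.jobs I
  length≡ : length (encode I) ≡ 2 + (n + n)
  length≡ = cong (2 +_) (trans (length-++ (tabulate (Instance.processing I)))
    (cong₂ _+_ (length-tabulate (Instance.processing I)) (length-tabulate (Instance.weight I))))
  solveWith : ∀ L → length (encode I) ≤ L → sum (encode I) ≤ 2 ^ L → Σ[ v ∈ ℕ ] Σ[ t ∈ ℕ ]
    (OutputsAfter (wordFactor c * L) (programOf c rV) (encode I) v t × IsOptimalValue I v ×
     t * 1000 ^ n ≤ timeFactor c * 2755 ^ n)
  solveWith L length≤L sum≤ =
    Solve.solution I (2 ^ L) ((2 ^ L) ^ 8) (wordFactor c * L) X≥2 ≤-refl 2^n≤X sum≤ c
      (c-correct I (2 ^ L) ((2 ^ L) ^ 8) (wordFactor c * L) X≥2 ≤-refl 2^n≤X sum≤)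
      (power-fits L (degreeᶜ c) (suc (degreeᶜ c)) L≥1 (n≤1+n _))
      (subst (_< 2 ^ (wordFactor c * L)) (*-identityʳ ((2 ^ L) ^ 8)) (power-fits L 1 (suc (degreeᶜ c)) L≥1 (s≤s z≤n)))
    where
    length≤L′ : 2 + (n + n) ≤ L
    length≤L′ = ≤-trans (≤-reflexive (sym length≡)) length≤L
    L≥1 : 1 ≤ L
    L≥1 = ≤-trans (s≤s z≤n) length≤L′
    X≥2 : 2 ≤ 2 ^ L
    X≥2 = ≤-trans (≤-reflexive (sym (*-identityʳ 2))) (^-monoʳ-≤ 2 L≥1)
    2^n≤X : 2 ^ n ≤ 2 ^ L
    2^n≤X = ^-monoʳ-≤ 2 (≤-trans (m≤m+n n n) (≤-trans (m≤n+m (n + n) 2) length≤L′))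

theorem1 : Σ[ P ∈ Program ] Σ[ k ∈ ℕ ] Σ[ c ∈ ℕ ] (1 ≤ k × ((I : Instance) →
    Σ[ v ∈ ℕ ] Σ[ t ∈ ℕ ]
    (OutputsAfter (k * encodingLength I) P (encode I) v t
    × IsOptimalValue I v
    × t * 1000 ^ Instance.jobs I ≤ c * 2755 ^ Instance.jobs I)))
theorem1 = programOf body rV , wordFactor body , timeFactor body , s≤s z≤n , solve-instance body Solve.body-correct
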